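{- Let $n>0$ be an integer. (1) $N_\sigma(n)$ is odd if and only if $12n-1=p^{4a+1}m^2$, where $p$ is prime and $m,a$ are integers with $(m,p)=1$ and $a\ge 0$. (2) $N_\sigma(n)\equiv 2\pmod 4$ if and only if $12n-1=p_1^{4a+1}p_2^{4b+1}m^2$, where $p_1,p_2$ are primes with $\left(\frac{p_1}{p_2}\right)=-1$, $(m,p_1p_2)=1$ and $a,b\ge 0$ are integers.
   Context: Let $(a;q)_n=\prod_{j=0}^{n-1}(1-aq^j)$. Ramanujan's sixth order mock theta function $\sigma(q)=\sum_{n\ge0}N_\sigma(n)q^n=\sum_{n\ge0}\frac{q^{(n+1)(n+2)/2}(-q;q)_n}{(q;q^2)_{n+1}}$. $\left(\frac{\cdot}{\cdot}\right)$ is the Kronecker symbol. -}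

module Defs where

open import Data.Nat using (ℕ; zero; suc; _+_; _*_; _∸_; _≤?_; _≡ᵇ_; _%_; _/_)
open import Data.Nat.Divisibility using (_∣?_)
open import Data.Bool using (Bool; true; false; if_then_else_)
open import Data.List using (List; upTo; map)
open import Data.Nat.ListAction using (sum)
open import Data.Bool.ListAction using (any)
open import Data.Integer using (ℤ; +_; -[1+_])
open import Relation.Nullary.Decidable using (⌊_⌋)

Series : Set
Series = ℕ → ℕ

_·_ : Series → Series → Series
(f · g) n = sum (map (λ i → f i * g (n ∸ i)) (upTo (suc n)))

one : Series
one zero    = 1
one (suc _) = 0

onePlusQ^ : ℕ → Series
onePlusQ^ j n = (if ⌊ n ≟' 0 ⌋ then 1 else 0) + (if ⌊ n ≟' j ⌋ then 1 else 0)
  where open import Data.Nat using () renaming (_≟_ to _≟'_)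

-- 1/(1 - q^(2j+1)) = Σ_{t≥0} q^{(2j+1)t}
geomOdd : ℕ → Series
geomOdd j n = if ⌊ suc (2 * j) ∣? n ⌋ then 1 else 0

negQPoch : ℕ → Series
negQPoch zero    = one
negQPoch (suc k) = negQPoch k · onePlusQ^ (suc k)

invQQ2Poch : ℕ → Series
invQQ2Poch zero    = geomOdd 0
invQQ2Poch (suc k) = invQQ2Poch k · geomOdd (suc k)

shift : ℕ → Series → Series
shift T f n = if ⌊ T ≤? n ⌋ then f (n ∸ T) else 0

tri : ℕ → ℕ
tri k = ((suc k) * (suc (suc k))) / 2

σterm : ℕ → Series
σterm k = shift (tri k) (negQPoch k · invQQ2Poch k)

-- N_σ(n): coefficient of q^n in σ(q). Only k < n can contribute,
-- since (k+1)(k+2)/2 ≥ k+1 > n for k ≥ n.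
Nσ : ℕ → ℕ
Nσ n = sum (map (λ k → σterm k n) (upTo (suc n)))

isSquareMod : ℕ → ℕ → Bool
isSquareMod a zero    = false
isSquareMod a (suc p) = any (λ x → (x * x) % suc p ≡ᵇ a % suc p) (upTo (suc p))

kroneckerPrime : ℕ → ℕ → ℤ
kroneckerPrime a zero = + 0   -- p = 0 is not prime; never used
kroneckerPrime a (suc p) =
  if suc p ≡ᵇ 2
  then (if (a % 8) ≡ᵇ 1 then + 1 else if (a % 8) ≡ᵇ 7 then + 1
        else if (a % 8) ≡ᵇ 3 then -[1+ 0 ] else if (a % 8) ≡ᵇ 5 then -[1+ 0 ] else + 0)
  else (if a % suc p ≡ᵇ 0 then + 0 else if isSquareMod a (suc p) then + 1 else -[1+ 0 ])

{-# OPTIONS --safe #-}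
module Submission where


-- The proof turns `Nσ n` modulo 4 into a class number of binary quadratic forms and then finds that
-- class number modulo 4 from group actions on classes.
--
-- Modulo 2 the factor (-q;q)_n agrees with (q;q)_n. Let s_n be the n-th term of σ(q) and u_n the
-- same term with (q;q)_n in place of (-q;q)_n. Then (1 - (-1)^n)(s_n - u_n) is divisible by 4, so
-- modulo 4 the series σ is Σ (-1)^n s_n + Σ u_n - Σ (-1)^n u_n (`alternate`). Two Bailey pairs
-- (`Pair1.identity`, `Pair2.identity`), proved by telescoping certificates, together with
-- summations of q-Gauss type turn these three series into explicit sums of powers of q. Their
-- coefficients count lattice points in cones: triples with 12 n + b² = 12 a c + 1, and solutions of
-- x² - 3 y² = 2 (12 n - 1). Multiplication by 1 + √3 identifies the latter with the diagonal
-- triples a = c. The result is `Nσ-class-number`: `Nσ n` has the parity of the number of triples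
-- with b < 3 min(a, c), and is 2 modulo 4 exactly when that number is.
--
-- Put D = 12 n - 1. The discriminant -D is 1 modulo 3, so a form of discriminant -D has exactly two
-- zeros on the projective line over the field of three elements. This makes the number of triples
-- equal to the number H(D) of reduced positive forms of discriminant -D, imprimitive ones included
-- (`rep'-card`).
--
-- It remains to find H(D) modulo 4. If p divides D exactly once, then H(p^(2k) D) = (1 + p + ... +
-- p^k) H(D) (`odd-power-card`), which reduces prime powers of odd exponent to exponent 1. As D is 3
-- modulo 4 it is not a square; the cases are the number of primes of odd exponent.
--
-- One prime: H(D) has the parity of the number of ambiguous forms, which are factorisations D = x y
-- with x < y, and that number is odd (`one-prime`). An exponent 4a + 3 contributes a factor
-- divisible by p + 1, hence by 4.
--
-- Two primes, D = p q m²: the number of ambiguous forms is twice an odd number. If p is not a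
-- square modulo q, composition with the ambiguous class of norm p and inversion generate a free
-- action of the Klein four-group on the remaining forms (`nonresidue-four`), so H(D) is 2 modulo 4.
-- If both primes are residues of each other, Legendre's theorem gives a point on p u² + q y² = w²,
-- and this point gives a square root of the class of norm p. The square root acts freely with order
-- 4 on the forms of discriminant -pq (`four-divides`), while the classes of norms p and q act
-- freely on the forms not divisible by m.
--
-- Three or more primes: the classes of norms p and q generate a free four-group on all forms
-- (`three-primes`).

module Exponents where

 open import Data.Nat.Base using (ℕ; zero; suc; _+_; _*_; _∸_)

 dbl tri pron : ℕ → ℕ
 dbl zero     = zero
 dbl (suc j)  = suc (suc (dbl j))
 tri zero     = zero
 tri (suc n)  = tri n + suc n
 pron zero    = zero
 pron (suc j) = pron j + dbl j

 -- 2 (r + 1) + 2 (r + 2) + … + 2 (r + d)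
 gapExp : ℕ → ℕ → ℕ
 gapExp r zero    = zero
 gapExp r (suc d) = gapExp r d + (suc (r + d) + suc (r + d))

 -- (t + d)(t + d + 1) - t (t + 1)/2
 dExp : ℕ → ℕ → ℕ
 dExp t zero    = tri t
 dExp t (suc d) = (suc (t + d) + suc (t + d)) + dExp t d

 idx : ℕ → ℕ → ℕ
 idx j δ = dbl j + δ

 -- The term of index r = 2j + δ of the first Bailey pair contributes j(j + 1), d steps of the
 -- recurrence in `unroll` contribute `gapExp r d`, and the closed form reached there contributes r
 -- + d + 1.
 exponent : ℕ → ℕ → ℕ → ℕ
 exponent j δ d = pron (suc j) + (gapExp (idx j δ) d + suc (idx j δ + d))

 -- An exponent in the expansion of Σ (-1)^n u_n. The index t expands `D r`, and ε in {0, 1} expands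
 -- a factor 1 + q^(r+1).
 conjExponent : ℕ → ℕ → ℕ → ℕ
 conjExponent r t ε = dExp t (r ∸ t) + tri (suc r) + ε * suc r

-- q-series algebra in a commutative ring

module QSeries where

 open import Algebra.Bundles using (CommutativeRing)
 open import Algebra.Solver.Ring.AlmostCommutativeRing using (fromCommutativeRing; _-Raw-AlmostCommutative⟶_)
 open import Level using (0ℓ)
 import Data.Integer.Properties as ℤP
 open import Data.Nat.Base as ℕ using (ℕ; zero; suc; s≤s; z≤n; s≤s⁻¹)
 open Exponents

 -- The ring is abstract here and becomes the ring of integer power series in `Coefficients`; the
 -- homomorphism from the integers supplies coefficients to the ring solver.
 module QAlgebra
  (R : CommutativeRing 0ℓ 0ℓ)
  (ℤ⟶R : CommutativeRing.rawRing ℤP.+-*-commutativeRing -Raw-AlmostCommutative⟶ fromCommutativeRing R)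
  (q : CommutativeRing.Carrier R)
  where

  open import Data.Integer.Base as ℤ using (1ℤ)
  open import Data.Maybe.Base using (just; nothing)
  import Data.Nat.Properties as ℕP
  open import Data.Nat.Solver using (module +-*-Solver)
  open import Relation.Binary.Definitions using (WeaklyDecidable)
  import Relation.Binary.PropositionalEquality as ≡
  open ≡ using (_≡_)
  open import Relation.Nullary.Decidable using (yes; no)
  open CommutativeRing R
  open _-Raw-AlmostCommutative⟶_ ℤ⟶R using (⟦_⟧; 0-homo; 1-homo)
  open import Relation.Binary.Reasoning.Setoid setoid
  open import Algebra.Properties.Ring ring using (-0#≈0#)

  private
   coeff≟ : WeaklyDecidable (λ a b → ⟦ a ⟧ ≈ ⟦ b ⟧)
   coeff≟ a b with a ℤP.≟ b
   ... | yes a≡b = just (reflexive (≡.cong ⟦_⟧ a≡b))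
   ... | no  _   = nothing

  open import Algebra.Solver.Ring (CommutativeRing.rawRing ℤP.+-*-commutativeRing) (fromCommutativeRing R) ℤ⟶R coeff≟
   public using (solve; _:=_; _:+_; _:*_; _:-_; :-_; con; Polynomial)

  -- The solver's own copy of 1#.
  o : Carrier
  o = ⟦ 1ℤ ⟧

  c1 : ∀ {n} → Polynomial n
  c1 = con 1ℤ

  o*_ : ∀ x → o * x ≈ x
  o*_ = solve 1 (λ x → c1 :* x := x) refl

  x-x : ∀ x → x - x ≈ 0#
  x-x = -‿inverseʳ

  zero-sub : ∀ {x y} → x ≈ y → x - y ≈ 0#
  zero-sub {x} {y} e = trans (+-congʳ e) (x-x y)

  sub-zero : ∀ {x y} → x - y ≈ 0# → x ≈ y
  sub-zero {x} {y} e = begin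
   x             ≈⟨ solve 2 (λ x y → x := (x :- y) :+ y) refl x y ⟩
   (x - y) + y   ≈⟨ +-congʳ e ⟩
   0# + y        ≈⟨ +-identityˡ y ⟩
   y             ∎

  -- p ≈ r follows from p ≈ r + k (x - y) and x ≈ y.
  using1 : ∀ {p r k x y} → x ≈ y → p ≈ r + k * (x - y) → p ≈ r
  using1 {p} {r} {k} e h = trans h (trans (+-congˡ (trans (*-congˡ (zero-sub e)) (zeroʳ k))) (+-identityʳ r))

  using2 : ∀ {p r k x y k' x' y'} → x ≈ y → x' ≈ y' → p ≈ r + k * (x - y) + k' * (x' - y') → p ≈ r
  using2 e e' h = using1 e (using1 e' h)

  qp : ℕ → Carrier
  qp zero    = o
  qp (suc n) = q * qp n

  qp-+ : ∀ m n → qp (m ℕ.+ n) ≈ qp m * qp n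
  qp-+ zero    n = sym (o* qp n)
  qp-+ (suc m) n = trans (*-congˡ (qp-+ m n)) (sym (*-assoc q (qp m) (qp n)))

  qp-≡ : ∀ {m n} → m ≡ n → qp m ≈ qp n
  qp-≡ ≡.refl = refl

  sg : ℕ → Carrier
  sg zero    = o
  sg (suc n) = - sg n

  sum : ℕ → (ℕ → Carrier) → Carrier
  sum zero    f = 0#
  sum (suc L) f = sum L f + f L

  sum-cong : ∀ L {f g : ℕ → Carrier} → (∀ n → n ℕ.< L → f n ≈ g n) → sum L f ≈ sum L g
  sum-cong zero    p = refl
  sum-cong (suc L) p = +-cong (sum-cong L (λ n n<L → p n (ℕP.m≤n⇒m≤1+n n<L))) (p L ℕP.≤-refl)

  sum-0 : ∀ L → sum L (λ _ → 0#) ≈ 0#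
  sum-0 zero    = refl
  sum-0 (suc L) = trans (+-identityʳ _) (sum-0 L)

  sum-*ˡ : ∀ L h (f : ℕ → Carrier) → h * sum L f ≈ sum L (λ n → h * f n)
  sum-*ˡ zero    h f = zeroʳ h
  sum-*ˡ (suc L) h f = trans (distribˡ h _ _) (+-congʳ (sum-*ˡ L h f))

  sum-+ : ∀ L (f : ℕ → Carrier) (g : ℕ → Carrier) → sum L (λ n → f n + g n) ≈ sum L f + sum L g
  sum-+ zero    f g = sym (+-identityˡ 0#)
  sum-+ (suc L) f g = trans (+-congʳ (sum-+ L f g))
   (solve 4 (λ a b c d → (a :+ b) :+ (c :+ d) := (a :+ c) :+ (b :+ d)) refl (sum L f) (sum L g) (f L) (g L))

  sum-neg : ∀ L (f : ℕ → Carrier) → sum L (λ n → - f n) ≈ - sum L f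
  sum-neg zero    f = sym -0#≈0#
  sum-neg (suc L) f = trans (+-congʳ (sum-neg L f)) (solve 2 (λ a b → :- a :+ :- b := :- (a :+ b)) refl (sum L f) (f L))

  sum-sub : ∀ L (f : ℕ → Carrier) (g : ℕ → Carrier) → sum L (λ n → f n - g n) ≈ sum L f - sum L g
  sum-sub L f g = trans (sum-+ L f (λ n → - g n)) (+-congˡ (sum-neg L g))

  sum-swap : ∀ L M (f : ℕ → ℕ → Carrier) → sum L (λ a → sum M (f a)) ≈ sum M (λ b → sum L (λ a → f a b))
  sum-swap zero    M f = sym (sum-0 M)
  sum-swap (suc L) M f = trans (+-congʳ (sum-swap L M f)) (sym (sum-+ M (λ b → sum L (λ a → f a b)) (f L)))

  sum-telescope : ∀ L (g : ℕ → Carrier) → sum L (λ n → g (suc n) - g n) ≈ g L - g 0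
  sum-telescope zero    g = sym (x-x (g 0))
  sum-telescope (suc L) g = trans (+-congʳ (sum-telescope L g))
   (solve 3 (λ a b c → (a :- b) :+ (c :- a) := c :- b) refl (g L) (g 0) (g (suc L)))

  sum-split : ∀ k L (f : ℕ → Carrier) → sum (k ℕ.+ L) f ≈ sum k f + sum L (λ n → f (k ℕ.+ n))
  sum-split k zero    f = trans (reflexive (≡.cong (λ m → sum m f) (ℕP.+-identityʳ k))) (sym (+-identityʳ _))
  sum-split k (suc L) f = trans (reflexive (≡.cong (λ m → sum m f) (ℕP.+-suc k L)))
   (trans (+-congʳ (sum-split k L f)) (+-assoc _ _ _))

  infixr 4 _,_
  infix 4 _≡[_]_
  -- Congruence modulo q^L with its quotient. Identities between infinite series are stated below as
  -- congruences modulo q^L between sums of length about L.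
  record _≡[_]_ (x : Carrier) (L : ℕ) (y : Carrier) : Set where
   constructor _,_
   field
    quotient : Carrier
    equality : x ≈ y + qp L * quotient

  ≈⇒≡[] : ∀ {L x y} → x ≈ y → x ≡[ L ] y
  ≈⇒≡[] {L} {x} {y} e = 0# , trans e (sym (trans (+-congˡ (zeroʳ (qp L))) (+-identityʳ y)))

  ≡[]-trans : ∀ {L x y z} → x ≡[ L ] y → y ≡[ L ] z → x ≡[ L ] z
  ≡[]-trans {L} {x} {y} {z} (h , e) (k , e') = h + k , trans e (trans (+-congʳ e')
   (solve 4 (λ z Q h k → (z :+ Q :* k) :+ Q :* h := z :+ Q :* (h :+ k)) refl z (qp L) h k))

  ≡[]-sym : ∀ {L x y} → x ≡[ L ] y → y ≡[ L ] x
  ≡[]-sym {L} {x} {y} (h , e) = - h , using1 e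
   (solve 4 (λ x y Q h → y := (x :+ Q :* (:- h)) :+ (:- c1) :* (x :- (y :+ Q :* h))) refl x y (qp L) h)

  ≡[]-+ : ∀ {L x y x' y'} → x ≡[ L ] y → x' ≡[ L ] y' → x + x' ≡[ L ] y + y'
  ≡[]-+ {L} {x} {y} {x'} {y'} (h , e) (k , e') = h + k , trans (+-cong e e')
   (solve 5 (λ y y' Q h k → (y :+ Q :* h) :+ (y' :+ Q :* k) := (y :+ y') :+ Q :* (h :+ k)) refl y y' (qp L) h k)

  ≡[]-*ˡ : ∀ {L x y} a → x ≡[ L ] y → a * x ≡[ L ] a * y
  ≡[]-*ˡ {L} {x} {y} a (h , e) = a * h , trans (*-congˡ e)
   (solve 4 (λ a y Q h → a :* (y :+ Q :* h) := a :* y :+ Q :* (a :* h)) refl a y (qp L) h)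

  ≡[]-neg : ∀ {L x y} → x ≡[ L ] y → - x ≡[ L ] - y
  ≡[]-neg {L} {x} {y} (h , e) = - h , trans (-‿cong e)
   (solve 3 (λ y Q h → :- (y :+ Q :* h) := :- y :+ Q :* (:- h)) refl y (qp L) h)

  ≡[]-sub : ∀ {L x y x' y'} → x ≡[ L ] y → x' ≡[ L ] y' → x - x' ≡[ L ] y - y'
  ≡[]-sub p r = ≡[]-+ p (≡[]-neg r)

  ≡[]-* : ∀ {L x y x' y'} → x ≡[ L ] y → x' ≡[ L ] y' → x * x' ≡[ L ] y * y'
  ≡[]-* {x' = x'} {y'} p r = ≡[]-trans (≡[]-trans (≈⇒≡[] (*-comm _ x')) (≡[]-trans (≡[]-*ˡ x' p) (≈⇒≡[] (*-comm x' _))))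
   (≡[]-*ˡ _ r)

  ≡[]-resp : ∀ {L x x' y y'} → x ≈ x' → y ≈ y' → x ≡[ L ] y → x' ≡[ L ] y'
  ≡[]-resp e e' (h , p) = h , trans (sym e) (trans p (+-congʳ e'))

  ≡[]-sum : ∀ {K} L {f g : ℕ → Carrier} → (∀ n → n ℕ.< L → f n ≡[ K ] g n) → sum L f ≡[ K ] sum L g
  ≡[]-sum zero    p = ≈⇒≡[] refl
  ≡[]-sum (suc L) p = ≡[]-+ (≡[]-sum L (λ n n<L → p n (ℕP.m≤n⇒m≤1+n n<L))) (p L ℕP.≤-refl)

  qp-small : ∀ {L} m a → L ℕ.≤ m → qp m * a ≡[ L ] 0#
  qp-small {L} m a L≤m = qp (m ℕ.∸ L) * a , (begin
   qp m * a                          ≈⟨ *-congʳ (trans (qp-≡ (≡.sym (ℕP.m+[n∸m]≡n L≤m))) (qp-+ L (m ℕ.∸ L))) ⟩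
   qp L * qp (m ℕ.∸ L) * a           ≈⟨ trans (*-assoc _ _ _) (sym (+-identityˡ _)) ⟩
   0# + qp L * (qp (m ℕ.∸ L) * a)    ∎)

  -- Congruences may be cancelled by a unit u with inverse v.
  ≡[]-cancel : ∀ {L x y} u v → v * u ≈ o → u * x ≡[ L ] u * y → x ≡[ L ] y
  ≡[]-cancel {L} {x} {y} u v e p = ≡[]-resp (lem x) (lem y) (≡[]-*ˡ v p)
   where
   lem : ∀ z → v * (u * z) ≈ z
   lem z = trans (sym (*-assoc v u z)) (trans (*-congʳ e) (o* z))

  ≈-cancel : ∀ {x y} u v → v * u ≈ o → u * x ≈ u * y → x ≈ y
  ≈-cancel {x} {y} u v e p = trans (sym (lem x)) (trans (*-congˡ p) (lem y))
   where
   lem : ∀ z → v * (u * z) ≈ z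
   lem z = trans (sym (*-assoc v u z)) (trans (*-congʳ e) (o* z))

 -- Two Bailey pairs with telescoping certificates

 module QIdentities
  (R : CommutativeRing 0ℓ 0ℓ)
  (ℤ⟶R : CommutativeRing.rawRing ℤP.+-*-commutativeRing -Raw-AlmostCommutative⟶ fromCommutativeRing R)
  (q : CommutativeRing.Carrier R)
  (geo : ℕ → CommutativeRing.Carrier R)
  (geo-inv : ∀ k → CommutativeRing._≈_ R (CommutativeRing._*_ R (geo k) (CommutativeRing._-_ R (QAlgebra.o R ℤ⟶R q)
   (QAlgebra.qp R ℤ⟶R q (suc k)))) (QAlgebra.o R ℤ⟶R q))
  where

  open import Data.Sum.Base using (inj₁; inj₂)
  import Data.Nat.Properties as ℕP
  import Relation.Binary.PropositionalEquality as ≡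
  open ≡ using (_≡_)
  open CommutativeRing R hiding (zero)
  open QAlgebra R ℤ⟶R q
  open import Relation.Binary.Reasoning.Setoid setoid
  open import Algebra.Properties.Ring ring using (-0#≈0#)

  -- In the usual notation: (q;q)_n, (-q;q)_n, 1/(q;q)_n, q^(n(n+1)/2), 1/(q;q²)_{n+1}, and the
  -- partial theta-like sum described below.
  poch npoch ip tq b D : ℕ → Carrier
  poch zero     = o
  poch (suc n)  = poch n * (o - qp (suc n))
  npoch zero    = o
  npoch (suc n) = npoch n * (o + qp (suc n))
  ip zero       = o
  ip (suc n)    = ip n * geo n
  tq zero       = o
  tq (suc n)    = tq n * qp (suc n)
  b zero        = geo 0
  b (suc n)     = b n * geo (2 ℕ.* suc n)
  -- D r = Σ_{t ≤ r} q^(r(r+1) - t(t+1)/2)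
  D zero        = o
  D (suc r)     = qp (suc r) * qp (suc r) * D r + tq (suc r)

  -- 1/(q)_{n-r}, read as 0 when r > n
  ipm : ℕ → ℕ → Carrier
  ipm n       zero    = ip n
  ipm zero    (suc r) = 0#
  ipm (suc n) (suc r) = ipm n r

  ip-suc : ∀ n → (o - qp (suc n)) * ip (suc n) ≈ ip n
  ip-suc n = using1 (geo-inv n) (solve 3 (λ Q i g → (c1 :- Q) :* (i :* g) := i :+ i :* (g :* (c1 :- Q) :- c1)) refl
   (qp (suc n)) (ip n) (geo n))

  poch-ip : ∀ n → poch n * ip n ≈ o
  poch-ip zero    = o* o
  poch-ip (suc n) = trans (solve 4 (λ p Q i g → (p :* (c1 :- Q)) :* (i :* g) := (p :* i) :* (g :* (c1 :- Q))) refl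
   (poch n) (qp (suc n)) (ip n) (geo n)) (trans (*-cong (poch-ip n) (geo-inv n)) (o* o))

  ipm-> : ∀ n r → n ℕ.< r → ipm n r ≈ 0#
  ipm-> zero    (suc r) _   = refl
  ipm-> (suc n) (suc r) n<r = ipm-> n r (s≤s⁻¹ n<r)

  ipm-+ : ∀ r d → ipm (r ℕ.+ d) r ≡ ip d
  ipm-+ zero    d = ≡.refl
  ipm-+ (suc r) d = ipm-+ r d

  ipm-+0 : ∀ r → ipm (r ℕ.+ 0) (suc r) ≈ 0#
  ipm-+0 r = ipm-> (r ℕ.+ 0) (suc r) (s≤s (ℕP.≤-reflexive (ℕP.+-identityʳ r)))

  ipm-+1 : ∀ r d → ipm (r ℕ.+ suc d) (suc r) ≡ ip d
  ipm-+1 r d = ≡.trans (≡.cong (λ n → ipm n (suc r)) (ℕP.+-suc r d)) (ipm-+ r d)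

  -- ip (n - r - 1) = (1 - q^(n-r)) ip (n - r), also when n = r
  ipm-suc : ∀ r d → ipm (r ℕ.+ d) (suc r) ≈ (o - qp d) * ip d
  ipm-suc r zero    = trans (ipm-+0 r) (sym (trans (*-congʳ (x-x o)) (zeroˡ _)))
  ipm-suc r (suc d) = trans (reflexive (ipm-+1 r d)) (sym (ip-suc d))

  data Gap (n r : ℕ) : Set where
   below : n ℕ.< r → Gap n r
   above : ∀ d → n ≡ r ℕ.+ d → Gap n r

  gap : ∀ n r → Gap n r
  gap n r with ℕP.≤-total (suc n) r
  ... | inj₁ n<r = below n<r
  ... | inj₂ r≤1+n with ℕP.m≤n⇒m<n∨m≡n r≤1+n
  ...   | inj₁ r<1+n = above (n ℕ.∸ r) (≡.sym (ℕP.m+[n∸m]≡n (s≤s⁻¹ r<1+n)))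
  ...   | inj₂ r≡1+n = below (ℕP.≤-reflexive (≡.sym r≡1+n))

  sub-cong : ∀ {x x' y y'} → x ≈ x' → y ≈ y' → x - y ≈ x' - y'
  sub-cong e e' = +-cong e (-‿cong e')

  ip-down : ∀ n x → qp n ≈ x → ip n ≈ (o - q * x) * ip (suc n)
  ip-down n x e = trans (sym (ip-suc n)) (*-congʳ (sub-cong refl (*-congˡ e)))

  sum-last : ∀ L (g : ℕ → Carrier) → g 0 ≈ 0# → g L ≈ 0# → sum L (λ n → g (suc n) - g n) ≈ 0#
  sum-last L g e e' = trans (sum-telescope L g) (trans (sub-cong e' e) (x-x 0#))

  module Pair1 where
   w : ℕ → Carrier
   w zero    = o
   w (suc j) = w j * qp (dbl j)

   -- A Bailey pair relative to q, up to a factor 1 - q: α_{2j} = (-1)^j q^(j(j+1)) and α_{2j+1} =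
   -- -α_{2j}. `ℓ n j` is the joint contribution of these two to β_n, `ℓ⁻ n j` is the same for n -
   -- 1, and `G` is the certificate of the recurrence in n.
   ℓ ℓ⁻ G : ℕ → ℕ → Carrier
   ℓ n j = sg j * w (suc j) * (ipm n (dbl j) * ip (suc (dbl j ℕ.+ n)) - ipm n (suc (dbl j)) * ip (suc (suc (dbl j ℕ.+ n))))
   ℓ⁻ n j = sg j * w (suc j) * (ipm n (suc (dbl j)) * ip (dbl j ℕ.+ n) - ipm n (suc (suc (dbl j))) * ip (suc (dbl j ℕ.+ n)))
   G n j = (qp (dbl j) - o) * (sg j * w j) * (ipm n (dbl j) * ip (dbl j ℕ.+ n))

   ℓ⁻-suc : ∀ m j → ℓ⁻ (suc m) j ≈ ℓ m j
   ℓ⁻-suc m j rewrite ℕP.+-suc (dbl j) m = refl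

   private
    -- Rewrites everything in z = q^(2j), Q = q^n and the inverse factorials, so that the relation
    -- becomes the single ring identity `alg`. The three positions of n relative to 2j differ only
    -- in the values of α, a1, a2.
    certificate : ∀ n j {z Q α a1 a2} (let β = ip (suc (suc (dbl j ℕ.+ n))); i1 = (o - q * (q * (z * Q))) * β; i0 = (o - q * (z * Q)) * i1) →
     qp (dbl j) ≈ z → qp n ≈ Q → ipm n (dbl j) ≈ α → ipm n (suc (dbl j)) ≈ a1 → ipm n (suc (suc (dbl j))) ≈ a2 →
     (o - Q) * (o - q * Q * Q) * (sg j * (w j * z) * (α * i1 - a1 * β)) - Q * (sg j * (w j * z) * (a1 * i0 - a2 * i1))
      ≈ Q * ((q * (q * z) - o) * ((- sg j) * (w j * z)) * (a2 * β) - (z - o) * (sg j * w j) * (α * i0)) →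
     (o - qp n) * (o - q * qp n * qp n) * ℓ n j - qp n * ℓ⁻ n j ≈ qp n * (G n (suc j) - G n j)
    certificate n j {z} {Q} {α} {a1} {a2} ez eQ ea e1 e2 alg = begin
     (o - qp n) * (o - q * qp n * qp n) * ℓ n j - qp n * ℓ⁻ n j
      ≈⟨ sub-cong (*-cong (*-cong (sub-cong refl eQ) (sub-cong refl (*-cong (*-congˡ eQ) eQ)))
            (*-cong (*-congˡ (*-congˡ ez)) (sub-cong (*-cong ea ei1) (*-congʳ e1))))
           (*-cong eQ (*-cong (*-congˡ (*-congˡ ez)) (sub-cong (*-cong e1 ei0) (*-cong e2 ei1)))) ⟩
     _ ≈⟨ alg ⟩
     _ ≈⟨ *-cong eQ (sub-cong (*-cong (*-cong (sub-cong (*-congˡ (*-congˡ ez)) refl) (*-congˡ (*-congˡ ez))) (*-congʳ e2))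
                 (*-cong (*-congʳ (sub-cong ez refl)) (*-cong ea ei0))) ⟨
     qp n * (G n (suc j) - G n j) ∎
     where
     eN : qp (dbl j ℕ.+ n) ≈ z * Q
     eN = trans (qp-+ (dbl j) n) (*-cong ez eQ)
     ei1 : ip (suc (dbl j ℕ.+ n)) ≈ (o - q * (q * (z * Q))) * ip (suc (suc (dbl j ℕ.+ n)))
     ei1 = ip-down (suc (dbl j ℕ.+ n)) _ (*-congˡ eN)
     ei0 : ip (dbl j ℕ.+ n) ≈ (o - q * (z * Q)) * ((o - q * (q * (z * Q))) * ip (suc (suc (dbl j ℕ.+ n))))
     ei0 = trans (ip-down (dbl j ℕ.+ n) _ eN) (*-congˡ ei1)

   -- `G` vanishes at j = 0 and for 2j > n, so summing over j gives a first-order recurrence in n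
   -- for Σ_j ℓ n j.
   step : ∀ n j → (o - qp n) * (o - q * qp n * qp n) * ℓ n j - qp n * ℓ⁻ n j ≈ qp n * (G n (suc j) - G n j)
   step n j with gap n (dbl j)
   ... | below n<2j = certificate n j refl refl (ipm-> n _ n<2j) (ipm-> n _ (ℕP.m≤n⇒m≤1+n n<2j)) (ipm-> n _ (ℕP.m≤n⇒m≤1+n (ℕP.m≤n⇒m≤1+n n<2j)))
    (trans (sub-cong (trans (*-congˡ (trans (*-congˡ zero-diff) (zeroʳ _))) (zeroʳ _)) (trans (*-congˡ (trans (*-congˡ zero-diff) (zeroʳ _))) (zeroʳ _)))
     (trans (x-x 0#) (sym (trans (*-congˡ (trans (sub-cong (trans (*-congˡ (zeroˡ _)) (zeroʳ _)) (trans (*-congˡ (zeroˡ _)) (zeroʳ _))) (x-x 0#))) (zeroʳ _)))))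
    where
    zero-diff : ∀ {x y} → 0# * x - 0# * y ≈ 0#
    zero-diff = trans (sub-cong (zeroˡ _) (zeroˡ _)) (x-x 0#)
   -- At n = 2j the next two inverse factorials are zero; writing this zero as `o - o` makes it an
   -- expression of the ring solver.
   ... | above zero ≡.refl = certificate n j {Q = qp (dbl j) * o} refl (qp-+ (dbl j) 0) (reflexive (ipm-+ (dbl j) 0))
    (trans (ipm-+0 (dbl j)) (sym 0h)) (trans (ipm-> n _ (ℕP.m≤n⇒m≤1+n (s≤s (ℕP.≤-reflexive (ℕP.+-identityʳ (dbl j)))))) (sym 0h))
    (solve 6 (λ s w z α β q → let Q = z :* c1 ; i1 = (c1 :- q :* (q :* (z :* Q))) :* β ; i0 = (c1 :- q :* (z :* Q)) :* i1 ; a = c1 :- c1 in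
     (c1 :- Q) :* (c1 :- q :* Q :* Q) :* (s :* (w :* z) :* (α :* i1 :- a :* β)) :- Q :* (s :* (w :* z) :* (a :* i0 :- a :* i1))
      := Q :* ((q :* (q :* z) :- c1) :* ((:- s) :* (w :* z)) :* (a :* β) :- (z :- c1) :* (s :* w) :* (α :* i0)))
     refl (sg j) (w j) (qp (dbl j)) (ip 0) (ip (suc (suc (dbl j ℕ.+ n)))) q)
    where
    0h : o - o ≈ 0#
    0h = x-x o
   ... | above (suc d) ≡.refl = certificate n j {Q = qp (dbl j) * (q * qp d)} refl (qp-+ (dbl j) (suc d)) (reflexive (ipm-+ (dbl j) (suc d)))
    (ipm-suc (dbl j) (suc d))
    (trans (reflexive (≡.cong (λ m → ipm m (suc (suc (dbl j)))) (ℕP.+-suc (dbl j) d))) (trans (ipm-suc (dbl j) d) (*-congˡ (sym (ip-suc d)))))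
    (solve 7 (λ s w z α β q y → let Q = z :* (q :* y) ; i1 = (c1 :- q :* (q :* (z :* Q))) :* β ; i0 = (c1 :- q :* (z :* Q)) :* i1 ; a1 = (c1 :- q :* y) :* α ; a2 = (c1 :- y) :* a1 in
     (c1 :- Q) :* (c1 :- q :* Q :* Q) :* (s :* (w :* z) :* (α :* i1 :- a1 :* β)) :- Q :* (s :* (w :* z) :* (a1 :* i0 :- a2 :* i1))
      := Q :* ((q :* (q :* z) :- c1) :* ((:- s) :* (w :* z)) :* (a2 :* β) :- (z :- c1) :* (s :* w) :* (α :* i0)))
     refl (sg j) (w j) (qp (dbl j)) (ip (suc d)) (ip (suc (suc (dbl j ℕ.+ n)))) q (qp d))

   private
    base : ∀ M → sum (suc M) (ℓ 0) ≈ geo 0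
    base zero = trans (+-identityˡ _) (trans (*-congˡ (sub-cong refl (zeroˡ _)))
     (trans (*-congˡ (trans (+-congˡ -0#≈0#) (+-identityʳ _))) (solve 1 (λ g → (c1 :* (c1 :* c1)) :* (c1 :* (c1 :* g)) := g) refl (geo 0))))
    base (suc M) = trans (+-cong (base M) (trans (*-congˡ (trans (sub-cong (zeroˡ _) (zeroˡ _)) (x-x 0#))) (zeroʳ _))) (+-identityʳ _)

   geo-b : ∀ n → geo (2 ℕ.* n) * (o - q * qp n * qp n) ≈ o
   geo-b n = trans (*-congˡ (sub-cong refl (sym (trans (*-congˡ (trans (qp-≡ {2 ℕ.* n} {n ℕ.+ n} (≡.cong (n ℕ.+_) (ℕP.+-identityʳ n))) (qp-+ n n))) (sym (*-assoc q _ _))))))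
    (geo-inv (2 ℕ.* n))

   -- Both sides satisfy the recurrence obtained by summing `step`; the bound n < 2M kills the upper
   -- end of the telescoping sum.
   identity : ∀ n M → n ℕ.< dbl M → tq n * b n ≈ poch n * sum M (ℓ n)
   identity zero    (suc M) _   = *-congˡ (sym (base M))
   identity (suc n) M       n<M = sym (begin
    poch n * (o - Q) * S
     ≈⟨ using1 (geo-b (suc n)) (solve 5 (λ p Q S g q → p :* (c1 :- Q) :* S
        := p :* g :* ((c1 :- Q) :* (c1 :- q :* Q :* Q) :* S) :+ (:- (p :* (c1 :- Q) :* S)) :* (g :* (c1 :- q :* Q :* Q) :- c1)) refl (poch n) Q S g q) ⟩
    poch n * g * ((o - Q) * (o - q * Q * Q) * S)
     ≈⟨ *-congˡ key ⟩
    poch n * g * (Q * sum M (ℓ n))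
     ≈⟨ using1 (identity n M (ℕP.<-trans (ℕP.n<1+n n) n<M)) (solve 6 (λ p g Q S' t b → p :* g :* (Q :* S')
        := t :* Q :* (b :* g) :+ (:- (g :* Q)) :* (t :* b :- p :* S')) refl (poch n) g Q (sum M (ℓ n)) (tq n) (b n)) ⟩
    tq n * Q * (b n * g) ∎)
    where
    Q = qp (suc n)
    g = geo (2 ℕ.* suc n)
    S = sum M (ℓ (suc n))
    G-0 : G (suc n) 0 ≈ 0#
    G-0 = trans (*-congʳ (trans (*-congʳ (x-x o)) (zeroˡ _))) (zeroˡ _)
    G-M : G (suc n) M ≈ 0#
    G-M = trans (*-congˡ (trans (*-congʳ (ipm-> (suc n) (dbl M) n<M)) (zeroˡ _))) (zeroʳ _)
    key : (o - Q) * (o - q * Q * Q) * S ≈ Q * sum M (ℓ n)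
    key = sub-zero (begin
     (o - Q) * (o - q * Q * Q) * S - Q * sum M (ℓ n)
      ≈⟨ sub-cong (sum-*ˡ M _ _) (sum-*ˡ M Q (ℓ n)) ⟩
     sum M (λ j → (o - Q) * (o - q * Q * Q) * ℓ (suc n) j) - sum M (λ j → Q * ℓ n j)
      ≈⟨ sum-sub M _ _ ⟨
     sum M (λ j → (o - Q) * (o - q * Q * Q) * ℓ (suc n) j - Q * ℓ n j)
      ≈⟨ sum-cong M (λ j _ → trans (sub-cong refl (*-congˡ (sym (ℓ⁻-suc n j)))) (step (suc n) j)) ⟩
     sum M (λ j → Q * (G (suc n) (suc j) - G (suc n) j))
      ≈⟨ sum-*ˡ M Q _ ⟨
     Q * sum M (λ j → G (suc n) (suc j) - G (suc n) j)
      ≈⟨ trans (*-congˡ (sum-last M (G (suc n)) G-0 G-M)) (zeroʳ Q) ⟩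
     0# ∎)

  module Pair2 where
   -- A Bailey pair relative to q², with α_r = (-1)^r D_r (1 - q^(2r+2)) up to a constant factor.
   -- `c⁻ n r` is the term for n - 1 and `H` is the certificate. The truncated n ∸ r in `H` only
   -- occurs next to `ipm n r`, which is zero when r > n.
   c c⁻ H : ℕ → ℕ → Carrier
   c n r = sg r * D r * (o - qp (suc r) * qp (suc r)) * (ipm n r * ip (suc (suc (r ℕ.+ n))))
   c⁻ n r = sg r * D r * (o - qp (suc r) * qp (suc r)) * (ipm n (suc r) * ip (suc (r ℕ.+ n)))
   H n r = sg r * ((o - qp n) * (D r * qp (n ℕ.∸ r) * (o - q * (qp r * qp r)) * (ipm n r * ip (suc (r ℕ.+ n))))
           + qp n * ((qp (suc r) - o) * tq r * (ipm n (suc r) * ip (suc (r ℕ.+ n)))))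

   c⁻-suc : ∀ m r → c⁻ (suc m) r ≈ c m r
   c⁻-suc m r rewrite ℕP.+-suc r m = refl

   private
    certificate : ∀ n r {z Q y y' α a1 a2} (let β = ip (suc (suc (r ℕ.+ n))); i1 = (o - q * (q * (z * Q))) * β) →
     qp r ≈ z → qp n ≈ Q → qp (n ℕ.∸ r) ≈ y → qp (n ℕ.∸ suc r) * a1 ≈ y' * a1 →
     ipm n r ≈ α → ipm n (suc r) ≈ a1 → ipm n (suc (suc r)) ≈ a2 →
     (o - Q) * ((o - q * Q * Q) * (sg r * D r * (o - (q * z) * (q * z)) * (α * β)) - sg r * D r * (o - (q * z) * (q * z)) * (a1 * i1))
      ≈ sg r * ((o - Q) * (D r * y * (o - q * (z * z)) * (α * i1)) + Q * ((q * z - o) * tq r * (a1 * i1)))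
      - (- sg r) * ((o - Q) * (((q * z) * (q * z) * D r + tq r * (q * z)) * (o - q * ((q * z) * (q * z))) * (y' * a1 * β))
             + Q * ((q * (q * z) - o) * (tq r * (q * z)) * (a2 * β))) →
     (o - qp n) * ((o - q * qp n * qp n) * c n r - c⁻ n r) ≈ H n r - H n (suc r)
    certificate n r {z} {Q} {y} {y'} {α} {a1} {a2} ez eQ ey ey' ea e1 e2 alg = begin
     (o - qp n) * ((o - q * qp n * qp n) * c n r - c⁻ n r)
      ≈⟨ *-cong (sub-cong refl eQ) (sub-cong (*-cong (sub-cong refl (*-cong (*-congˡ eQ) eQ)) (*-cong (*-congˡ ezz) (*-congʳ ea)))
                         (*-cong (*-congˡ ezz) (*-cong e1 ei1))) ⟩
     _ ≈⟨ alg ⟩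
     _ ≈⟨ sub-cong (*-congˡ (+-cong (*-cong (sub-cong refl eQ) (*-cong (*-cong (*-congˡ ey) (sub-cong refl (*-congˡ (*-cong ez ez)))) (*-cong ea ei1)))
                    (*-cong eQ (*-cong (*-congʳ (sub-cong (*-congˡ ez) refl)) (*-cong e1 ei1)))))
            (*-congˡ (+-cong (*-cong (sub-cong refl eQ) lem)
                    (*-cong eQ (*-cong (*-cong (sub-cong (*-congˡ (*-congˡ ez)) refl) (*-congˡ (*-congˡ ez))) (*-congʳ e2))))) ⟨
     H n r - H n (suc r) ∎
     where
     ezz : o - qp (suc r) * qp (suc r) ≈ o - (q * z) * (q * z)
     ezz = sub-cong refl (*-cong (*-congˡ ez) (*-congˡ ez))
     ei1 : ip (suc (r ℕ.+ n)) ≈ (o - q * (q * (z * Q))) * ip (suc (suc (r ℕ.+ n)))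
     ei1 = ip-down (suc (r ℕ.+ n)) _ (*-congˡ (trans (qp-+ r n) (*-cong ez eQ)))
     lem : D (suc r) * qp (n ℕ.∸ suc r) * (o - q * (qp (suc r) * qp (suc r))) * (ipm n (suc r) * ip (suc (suc (r ℕ.+ n))))
       ≈ ((q * z) * (q * z) * D r + tq r * (q * z)) * (o - q * ((q * z) * (q * z))) * (y' * a1 * ip (suc (suc (r ℕ.+ n))))
     lem = trans (solve 5 (λ D y f a i → D :* y :* f :* (a :* i) := D :* f :* (y :* a :* i)) refl _ _ _ _ _)
      (*-cong (*-cong (+-cong (*-congʳ (*-cong (*-congˡ ez) (*-congˡ ez))) (*-congˡ (*-congˡ ez)))
              (sub-cong refl (*-congˡ (*-cong (*-congˡ ez) (*-congˡ ez)))))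
          (*-congʳ (trans (*-congˡ e1) ey')))

   step : ∀ n r → (o - qp n) * ((o - q * qp n * qp n) * c n r - c⁻ n r) ≈ H n r - H n (suc r)
   step n r with gap n r
   ... | below n<r = certificate n r {y' = 0#} refl refl refl (trans (zeroʳ _) (sym (zeroʳ 0#))) (ipm-> n _ n<r) (ipm-> n _ (ℕP.m≤n⇒m≤1+n n<r)) (ipm-> n _ (ℕP.m≤n⇒m≤1+n (ℕP.m≤n⇒m≤1+n n<r)))
    (trans (zeros (o - q * qp n * qp n) _ _ _ _ _) (sym (trans (sub-cong (zeros' _ _ _ _ _ _) (zeros″ _ _ _ _ _ _ _)) (x-x 0#))))
    where
    z0 : ∀ {x y} → x * (0# * y) ≈ 0#
    z0 = trans (*-congˡ (zeroˡ _)) (zeroʳ _)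
    zeros : ∀ k a x y i j → (o - qp n) * (k * (a * x * (0# * i)) - a * y * (0# * j)) ≈ 0#
    zeros k a x y i j = trans (*-congˡ (trans (sub-cong (trans (*-congˡ z0) (zeroʳ _)) z0) (x-x 0#))) (zeroʳ _)
    zeros' : ∀ s k a b i j → s * (k * (a * (0# * i)) + b * (j * (0# * i))) ≈ 0#
    zeros' s k a b i j = trans (*-congˡ (trans (+-cong (trans (*-congˡ z0) (zeroʳ _)) (trans (*-congˡ z0) (zeroʳ _))) (+-identityˡ 0#))) (zeroʳ s)
    zeros″ : ∀ s k a b i j x → s * (k * (a * (0# * 0# * i)) + b * (j * (0# * x))) ≈ 0#
    zeros″ s k a b i j x = trans (*-congˡ (trans (+-cong (trans (*-congˡ (trans (*-congˡ (*-congʳ (zeroˡ 0#))) z0)) (zeroʳ _)) (trans (*-congˡ z0) (zeroʳ _))) (+-identityˡ 0#))) (zeroʳ s)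
   ... | above zero ≡.refl = certificate n r {Q = qp r * o} {y = o} {y' = o} {a1 = o - o} refl (qp-+ r 0) (qp-≡ (ℕP.m+n∸m≡n r 0))
    (trans (*-congˡ 0h) (trans (zeroʳ _) (sym (trans (*-congˡ 0h) (zeroʳ _))))) (reflexive (ipm-+ r 0))
    (trans (ipm-+0 r) (sym 0h)) (trans (ipm-> n _ (ℕP.m≤n⇒m≤1+n (s≤s (ℕP.≤-reflexive (ℕP.+-identityʳ r))))) (sym 0h))
    (solve 7 (λ s D t z α β q → let Q = z :* c1 ; i1 = (c1 :- q :* (q :* (z :* Q))) :* β ; y = c1 ; y' = c1 ; a1 = c1 :- c1 ; a2 = c1 :- c1 in
     (c1 :- Q) :* ((c1 :- q :* Q :* Q) :* (s :* D :* (c1 :- (q :* z) :* (q :* z)) :* (α :* β)) :- s :* D :* (c1 :- (q :* z) :* (q :* z)) :* (a1 :* i1))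
      := s :* ((c1 :- Q) :* (D :* y :* (c1 :- q :* (z :* z)) :* (α :* i1)) :+ Q :* ((q :* z :- c1) :* t :* (a1 :* i1)))
      :- (:- s) :* ((c1 :- Q) :* (((q :* z) :* (q :* z) :* D :+ t :* (q :* z)) :* (c1 :- q :* ((q :* z) :* (q :* z))) :* (y' :* a1 :* β))
             :+ Q :* ((q :* (q :* z) :- c1) :* (t :* (q :* z)) :* (a2 :* β))))
     refl (sg r) (D r) (tq r) (qp r) (ip 0) (ip (suc (suc (r ℕ.+ n)))) q)
    where
    0h : o - o ≈ 0#
    0h = x-x o
   ... | above (suc d) ≡.refl = certificate n r {Q = qp r * (q * qp d)} {y = q * qp d} {y' = qp d} refl (qp-+ r (suc d)) (qp-≡ (ℕP.m+n∸m≡n r (suc d)))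
    (*-congʳ (qp-≡ (≡.trans (≡.cong (ℕ._∸ suc r) (ℕP.+-suc r d)) (ℕP.m+n∸m≡n r d)))) (reflexive (ipm-+ r (suc d)))
    (ipm-suc r (suc d))
    (trans (reflexive (≡.cong (λ m → ipm m (suc (suc r))) (ℕP.+-suc r d))) (trans (ipm-suc r d) (*-congˡ (sym (ip-suc d)))))
    (solve 8 (λ s D t z α β q y' → let y = q :* y' ; Q = z :* y ; i1 = (c1 :- q :* (q :* (z :* Q))) :* β ; a1 = (c1 :- y) :* α ; a2 = (c1 :- y') :* a1 in
     (c1 :- Q) :* ((c1 :- q :* Q :* Q) :* (s :* D :* (c1 :- (q :* z) :* (q :* z)) :* (α :* β)) :- s :* D :* (c1 :- (q :* z) :* (q :* z)) :* (a1 :* i1))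
      := s :* ((c1 :- Q) :* (D :* y :* (c1 :- q :* (z :* z)) :* (α :* i1)) :+ Q :* ((q :* z :- c1) :* t :* (a1 :* i1)))
      :- (:- s) :* ((c1 :- Q) :* (((q :* z) :* (q :* z) :* D :+ t :* (q :* z)) :* (c1 :- q :* ((q :* z) :* (q :* z))) :* (y' :* a1 :* β))
             :+ Q :* ((q :* (q :* z) :- c1) :* (t :* (q :* z)) :* (a2 :* β))))
     refl (sg r) (D r) (tq r) (qp r) (ip (suc d)) (ip (suc (suc (r ℕ.+ n)))) q (qp d))

   -- Induction on n through the summed `step`; its additional factor 1 - q^n is a unit and is
   -- cancelled.
   identity : ∀ n M → n ℕ.< M → b n ≈ sum M (c n)
   identity zero    M n<M = sym (base M n<M)
    where
    base : ∀ M → 0 ℕ.< M → sum M (c 0) ≈ geo 0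
    base (suc zero) _ = trans (+-identityˡ _) (using1 (geo-inv 1) (trans
     (solve 3 (λ g0 g1 q → c1 :* c1 :* (c1 :- (q :* c1) :* (q :* c1)) :* (c1 :* (c1 :* g0 :* g1))
      := g0 :+ g0 :* (g1 :* (c1 :- q :* (q :* c1)) :- c1)) refl (geo 0) (geo 1) q) refl))
    base (suc (suc M)) _ = trans (+-cong (base (suc M) (s≤s z≤n)) (trans (*-congˡ (zeroˡ _)) (zeroʳ _))) (+-identityʳ _)
   identity (suc n) M n<M = sym (begin
    S           ≈⟨ using1 (Pair1.geo-b (suc n)) (solve 4 (λ S g Q q → S := g :* ((c1 :- q :* Q :* Q) :* S) :+ (:- S) :* (g :* (c1 :- q :* Q :* Q) :- c1)) refl S g Q q) ⟩
    g * ((o - q * Q * Q) * S) ≈⟨ *-congˡ key ⟩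
    g * S⁻      ≈⟨ trans (*-congˡ (sym (identity n M (ℕP.<-trans (ℕP.n<1+n n) n<M)))) (*-comm _ _) ⟩
    b n * g     ∎)
    where
    Q = qp (suc n)
    g = geo (2 ℕ.* suc n)
    S = sum M (c (suc n))
    S⁻ = sum M (c n)
    -- The two parts of `H` cancel at r = 0 because (1 - q^(n+1))/(q;q)_{n+1} = 1/(q;q)_n.
    H-0 : H (suc n) 0 ≈ 0#
    H-0 = using1 (geo-inv n) (trans (solve 5 (λ Q q i j g → c1 :* ((c1 :- Q) :* (c1 :* Q :* (c1 :- q :* (c1 :* c1)) :* ((i :* g) :* j)) :+ Q :* ((q :* c1 :- c1) :* c1 :* (i :* j)))
     := (c1 :- c1) :+ (Q :* (c1 :- q) :* i :* j) :* (g :* (c1 :- Q) :- c1)) refl Q q (ip n) (ip (suc (suc n))) (geo n)) (+-congʳ (x-x o)))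
    H-M : H (suc n) M ≈ 0#
    H-M = trans (*-congˡ (trans (+-cong (trans (*-congˡ (z0 (ipm-> (suc n) M n<M))) (zeroʳ _)) (trans (*-congˡ (z0 (ipm-> (suc n) (suc M) (ℕP.m≤n⇒m≤1+n n<M)))) (zeroʳ _))) (+-identityˡ 0#))) (zeroʳ _)
     where
     z0 : ∀ {x y u} → x ≈ 0# → u * (x * y) ≈ 0#
     z0 e = trans (*-congˡ (trans (*-congʳ e) (zeroˡ _))) (zeroʳ _)
    key : (o - q * Q * Q) * S ≈ S⁻
    key = sub-zero (≈-cancel (o - Q) (geo n) (geo-inv n) (begin
     (o - Q) * ((o - q * Q * Q) * S - S⁻)
      ≈⟨ *-congˡ (trans (sub-cong (sum-*ˡ M _ _) refl) (sym (sum-sub M _ _))) ⟩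
     (o - Q) * sum M (λ r → (o - q * Q * Q) * c (suc n) r - c n r)
      ≈⟨ sum-*ˡ M _ _ ⟩
     sum M (λ r → (o - Q) * ((o - q * Q * Q) * c (suc n) r - c n r))
      ≈⟨ sum-cong M (λ r _ → trans (*-congˡ (sub-cong refl (sym (c⁻-suc n r)))) (trans (step (suc n) r)
         (solve 2 (λ x y → x :- y := (:- y) :- (:- x)) refl _ _))) ⟩
     sum M (λ r → - H (suc n) (suc r) - (- H (suc n) r))
      ≈⟨ sum-last M (λ r → - H (suc n) r) (trans (-‿cong H-0) -0#≈0#) (trans (-‿cong H-M) -0#≈0#) ⟩
     0# ≈⟨ zeroʳ _ ⟨
     (o - Q) * 0# ∎))

  module KSums (L : ℕ) where
   -- The sums conjugate to the two Bailey pairs: exchanging the order of summation in Σ_n v_n β_n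
   -- leaves `K v r` as the factor of α_r for the first pair and `M v r` for the second.
   K M : (ℕ → Carrier) → ℕ → Carrier
   K v r = sum L (λ n → v n * (ipm n r * ip (suc (r ℕ.+ n))))
   M v r = sum L (λ n → v n * (ipm n r * ip (suc (suc (r ℕ.+ n)))))

   -- From 1 - q^(n+r+2) = (1 - q^(2r+2)) + q^(2r+2) (1 - q^(n-r)). A closed form for `M` thus
   -- determines `K` by iteration.
   K-rec : ∀ v r → K v r ≈ (o - qp (suc r) * qp (suc r)) * M v r + qp (suc r) * qp (suc r) * K v (suc r)
   K-rec v r = sym (trans (+-cong (sum-*ˡ L _ _) (sum-*ˡ L _ _)) (trans (sym (sum-+ L _ _)) (sum-cong L (λ n _ → sym (term n)))))
    where
    term : ∀ n → v n * (ipm n r * ip (suc (r ℕ.+ n))) ≈ (o - qp (suc r) * qp (suc r)) * (v n * (ipm n r * ip (suc (suc (r ℕ.+ n)))))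
                              + qp (suc r) * qp (suc r) * (v n * (ipm n (suc r) * ip (suc (suc (r ℕ.+ n)))))
    term n with gap n r
    ... | below n<r = trans (z0 (ipm-> n r n<r)) (sym (trans (+-cong (trans (*-congˡ (z0 (ipm-> n r n<r))) (zeroʳ _))
              (trans (*-congˡ (z0 (ipm-> n (suc r) (ℕP.m≤n⇒m≤1+n n<r)))) (zeroʳ _))) (+-identityˡ 0#)))
     where
     z0 : ∀ {x y u} → x ≈ 0# → u * (x * y) ≈ 0#
     z0 e = trans (*-congˡ (trans (*-congʳ e) (zeroˡ _))) (zeroʳ _)
    ... | above d ≡.refl = begin
     v n * (ipm n r * ip (suc (r ℕ.+ n)))
      ≈⟨ *-congˡ (*-cong (reflexive (ipm-+ r d)) (ip-down (suc (r ℕ.+ n)) _ (*-congˡ (trans (qp-+ r n) (*-congˡ (qp-+ r d)))))) ⟩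
     v n * (ip d * ((o - q * (q * (z * (z * y)))) * β))
      ≈⟨ solve 6 (λ v α z y β q → v :* (α :* ((c1 :- q :* (q :* (z :* (z :* y)))) :* β))
         := (c1 :- q :* z :* (q :* z)) :* (v :* (α :* β)) :+ q :* z :* (q :* z) :* (v :* ((c1 :- y) :* α :* β))) refl (v n) (ip d) z y β q ⟩
     (o - q * z * (q * z)) * (v n * (ip d * β)) + q * z * (q * z) * (v n * ((o - y) * ip d * β))
      ≈⟨ +-cong (*-congˡ (*-congˡ (*-congʳ (reflexive (ipm-+ r d))))) (*-congˡ (*-congˡ (*-congʳ (ipm-suc r d)))) ⟨
     _ ∎
     where
     z = qp r
     y = qp d
     β = ip (suc (suc (r ℕ.+ n)))

   poch-ip-below : ∀ d i → poch (d ℕ.+ i) * ip d ≡[ suc d ] o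
   poch-ip-below d zero    = ≈⇒≡[] (trans (*-congʳ (reflexive (≡.cong poch (ℕP.+-identityʳ d)))) (poch-ip d))
   poch-ip-below d (suc i) = ≡[]-resp (trans (solve 3 (λ p x i → p :* i :* (c1 :- x) := p :* (c1 :- x) :* i) refl _ _ _) (*-congʳ (reflexive (≡.cong poch (≡.sym (ℕP.+-suc d i)))))) (o* o)
    (≡[]-* (poch-ip-below d i) (≡[]-resp refl (trans (+-congˡ -0#≈0#) (+-identityʳ o)) (≡[]-sub (≈⇒≡[] refl) small)))
    where
    small : qp (suc (d ℕ.+ i)) ≡[ suc d ] 0#
    small = ≡[]-resp (trans (*-comm _ o) (o* _)) refl (qp-small (suc (d ℕ.+ i)) o (s≤s (ℕP.m≤m+n d i)))

   geo-small : ∀ k {K} → K ℕ.≤ suc k → geo k ≡[ K ] o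
   geo-small k K≤ = ≡[]-resp (using1 (geo-inv k) (solve 2 (λ g x → c1 :+ x :* g := g :+ (:- c1) :* (g :* (c1 :- x) :- c1)) refl (geo k) (qp (suc k))))
    (+-identityʳ o) (≡[]-+ (≈⇒≡[] refl) (qp-small (suc k) (geo k) K≤))

   ip-above : ∀ N i → ip (N ℕ.+ i) ≡[ suc N ] ip N
   ip-above N zero    = ≈⇒≡[] (reflexive (≡.cong ip (ℕP.+-identityʳ N)))
   ip-above N (suc i) = ≡[]-resp (reflexive (≡.cong ip (≡.sym (ℕP.+-suc N i)))) (trans (*-comm _ o) (o* _))
    (≡[]-* (ip-above N i) (geo-small (N ℕ.+ i) (s≤s (ℕP.m≤m+n N i))))

   ≡[]-weaken : ∀ {K K' x y} → K' ℕ.≤ K → x ≡[ K ] y → x ≡[ K' ] y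
   ≡[]-weaken {K} {K'} {x} {y} K'≤K (h QAlgebra., e) = ≡[]-trans (≈⇒≡[] e)
    (≡[]-resp refl (+-identityʳ y) (≡[]-+ (≈⇒≡[] refl) (qp-small K h K'≤K)))

   v2 : ℕ → Carrier
   v2 n = qp (suc n) * poch n * poch n

   -- The summand is a difference of consecutive values of q^(r+1) `W`, and the boundary value at n
   -- = L is q^(r+1) modulo q^L.
   M-v2 : ∀ r → (o - qp (suc r)) * (o - qp (suc r)) * M v2 r ≡[ L ] qp (suc r)
   M-v2 r = ≡[]-trans (≈⇒≡[] (begin
    (o - qz) * (o - qz) * M v2 r                    ≈⟨ sum-*ˡ L _ _ ⟩
    sum L (λ n → (o - qz) * (o - qz) * (v2 n * (ipm n r * ip (suc (suc (r ℕ.+ n))))))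
                            ≈⟨ sum-cong L (λ n _ → term n) ⟩
    sum L (λ n → qz * W (suc n) - qz * W n)         ≈⟨ sum-telescope L (λ n → qz * W n) ⟩
    qz * W L - qz * W 0                             ≈⟨ sub-cong refl (trans (*-congˡ (trans (*-congˡ (zeroˡ _)) (zeroʳ _))) (zeroʳ qz)) ⟩
    qz * W L - 0#                                   ≈⟨ trans (+-congˡ -0#≈0#) (+-identityʳ _) ⟩
    qz * W L                                        ∎)) limit
    where
    qz = qp (suc r)
    W : ℕ → Carrier
    W n = poch n * poch n * (ipm n (suc r) * ip (suc r ℕ.+ n))
    term : ∀ n → (o - qz) * (o - qz) * (v2 n * (ipm n r * ip (suc (suc (r ℕ.+ n))))) ≈ qz * W (suc n) - qz * W n
    term n with gap n r
    ... | below n<r = trans (z0 (ipm-> n r n<r)) (sym (trans (sub-cong (z1 (ipm-> n r n<r)) (z1 (ipm-> n (suc r) (ℕP.m≤n⇒m≤1+n n<r)))) (x-x 0#)))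
     where
     z1 : ∀ {x y u v} → x ≈ 0# → v * (u * (x * y)) ≈ 0#
     z1 e = trans (*-congˡ (trans (*-congˡ (trans (*-congʳ e) (zeroˡ _))) (zeroʳ _))) (zeroʳ _)
     z0 : ∀ {x y u v} → x ≈ 0# → v * (u * (x * y)) ≈ 0#
     z0 = z1
    ... | above d ≡.refl = begin
     (o - qz) * (o - qz) * (v2 n * (ipm n r * β))
      ≈⟨ *-congˡ (*-cong (*-congʳ (*-congʳ (*-congˡ (qp-+ r d)))) (*-congʳ (reflexive (ipm-+ r d)))) ⟩
     (o - qz) * (o - qz) * (q * (z * y) * p * p * (α * β))
      ≈⟨ solve 6 (λ z y p α β q → (c1 :- q :* z) :* (c1 :- q :* z) :* (q :* (z :* y) :* p :* p :* (α :* β))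
         := q :* z :* (p :* (c1 :- q :* (z :* y)) :* (p :* (c1 :- q :* (z :* y))) :* (α :* β))
          :- q :* z :* (p :* p :* ((c1 :- y) :* α :* ((c1 :- q :* (q :* (z :* (z :* y)))) :* β)))) refl z y p α β q ⟩
     qz * (p * (o - q * (z * y)) * (p * (o - q * (z * y))) * (α * β)) - qz * (p * p * ((o - y) * α * ((o - q * (q * (z * (z * y)))) * β)))
      ≈⟨ sub-cong (*-congˡ (*-cong (*-cong (*-congˡ (sub-cong refl (*-congˡ (qp-+ r d)))) (*-congˡ (sub-cong refl (*-congˡ (qp-+ r d)))))
              (*-cong (reflexive (ipm-+ r d)) (reflexive (≡.cong (λ m → ip (suc m)) (ℕP.+-suc r n))))))
            (*-congˡ (*-congˡ (*-cong (ipm-suc r d) (ip-down (suc (r ℕ.+ n)) _ (*-congˡ (trans (qp-+ r n) (*-congˡ (qp-+ r d)))))))) ⟨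
     qz * W (suc n) - qz * W n ∎
     where
     z = qp r
     y = qp d
     p = poch n
     α = ip d
     β = ip (suc (suc (r ℕ.+ n)))
    limit : qz * W L ≡[ L ] qz
    limit with gap L (suc r)
    ... | below L<r = ≡[]-trans (qp-small (suc r) (W L) (ℕP.<⇒≤ L<r)) (≡[]-sym (≡[]-resp (trans (*-comm _ o) (o* qz)) refl (qp-small (suc r) o (ℕP.<⇒≤ L<r))))
    ... | above d e = ≡[]-resp (sym (begin
     qz * (poch L * poch L * (ipm L (suc r) * ip (suc r ℕ.+ L)))
      ≈⟨ *-congˡ (*-congˡ (*-cong (reflexive (≡.trans (≡.cong (λ m → ipm m (suc r)) e) (ipm-+ (suc r) d))) (reflexive (≡.cong ip (ℕP.+-comm (suc r) L))))) ⟩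
     qz * (poch L * poch L * (ip d * ip (L ℕ.+ suc r)))
      ≈⟨ solve 4 (λ z p a c → z :* (p :* p :* (a :* c)) := z :* (p :* a) :* (p :* c)) refl _ _ _ _ ⟩
     qz * (poch L * ip d) * (poch L * ip (L ℕ.+ suc r)) ∎)) (trans (*-comm qz o) (o* qz))
     (≡[]-* first second)
     where
     -- With d = L - r - 1 the quotient (q;q)_L/(q;q)_d is 1 only modulo q^(d+1); the factor q^(r+1)
     -- supplies the missing powers of q.
     first : qz * (poch L * ip d) ≡[ L ] qz
     first with poch-ip-below d (suc r)
     ... | h QAlgebra., e' = ≡[]-resp refl (trans (+-congˡ refl) (+-identityʳ qz)) (≡[]-trans (≈⇒≡[] (begin
      qz * (poch L * ip d)            ≈⟨ *-congˡ (trans (*-congʳ (reflexive (≡.cong poch (≡.trans e (ℕP.+-comm (suc r) d))))) e') ⟩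
      qz * (o + qp (suc d) * h)       ≈⟨ solve 3 (λ z x h → z :* (c1 :+ x :* h) := z :+ z :* x :* h) refl qz (qp (suc d)) h ⟩
      qz + qz * qp (suc d) * h        ≈⟨ +-congˡ (*-congʳ (qp-+ (suc r) (suc d))) ⟨
      qz + qp (suc r ℕ.+ suc d) * h   ∎)) (≡[]-+ (≈⇒≡[] refl) (qp-small (suc r ℕ.+ suc d) h (ℕP.≤-trans (ℕP.≤-reflexive e) (ℕP.+-monoʳ-≤ (suc r) (ℕP.n≤1+n d))))))
     second : poch L * ip (L ℕ.+ suc r) ≡[ L ] o
     second = ≡[]-resp refl (poch-ip L) (≡[]-*ˡ (poch L) (≡[]-weaken (ℕP.n≤1+n L) (ip-above L (suc r))))

   K-v2 : ∀ r → K v2 r ≡[ L ] qp (suc r) * (o + qp (suc r)) * geo r + qp (suc r) * qp (suc r) * K v2 (suc r)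
   K-v2 r = ≡[]-trans (≈⇒≡[] (K-rec v2 r)) (≡[]-+ (≡[]-cancel (o - x) (geo r) (geo-inv r)
    (≡[]-resp (solve 2 (λ x m → (c1 :+ x) :* ((c1 :- x) :* (c1 :- x) :* m) := (c1 :- x) :* ((c1 :- x :* x) :* m)) refl x (M v2 r))
     (using1 (geo-inv r) (solve 2 (λ x g → (c1 :+ x) :* x := (c1 :- x) :* (x :* (c1 :+ x) :* g) :+ (:- (x :* (c1 :+ x))) :* (g :* (c1 :- x) :- c1)) refl x (geo r)))
     (≡[]-*ˡ (o + x) (M-v2 r)))) (≈⇒≡[] refl))
    where
    x = qp (suc r)

 -- Summations of q-Gauss type

 module QLimits
  (R : CommutativeRing 0ℓ 0ℓ)
  (ℤ⟶R : CommutativeRing.rawRing ℤP.+-*-commutativeRing -Raw-AlmostCommutative⟶ fromCommutativeRing R)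
  (q : CommutativeRing.Carrier R)
  (geo : ℕ → CommutativeRing.Carrier R)
  (geo-inv : ∀ k → CommutativeRing._≈_ R (CommutativeRing._*_ R (geo k) (CommutativeRing._-_ R (QAlgebra.o R ℤ⟶R q)
   (QAlgebra.qp R ℤ⟶R q (suc k)))) (QAlgebra.o R ℤ⟶R q))
  where

  import Data.Nat.Properties as ℕP
  open import Data.Nat.Tactic.RingSolver using (solve-∀)
  import Relation.Binary.PropositionalEquality as ≡
  open ≡ using (_≡_)
  open CommutativeRing R hiding (zero)
  open QAlgebra R ℤ⟶R q
  open QIdentities R ℤ⟶R q geo geo-inv
  open import Relation.Binary.Reasoning.Setoid setoid
  open import Algebra.Properties.Ring ring using (-0#≈0#)

  zero-term : ∀ {x y u} → x ≈ 0# → u * (x * y) ≈ 0#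
  zero-term e = trans (*-congˡ (trans (*-congʳ e) (zeroˡ _))) (zeroʳ _)

  ≡[]-0ˡ : ∀ {L x} a → x ≡[ L ] 0# → a * x ≡[ L ] 0#
  ≡[]-0ˡ a e = ≡[]-resp refl (zeroʳ a) (≡[]-*ˡ a e)

  ≡[]-0ʳ : ∀ {L x} a → x ≡[ L ] 0# → x * a ≡[ L ] 0#
  ≡[]-0ʳ a e = ≡[]-resp (*-comm a _) refl (≡[]-0ˡ a e)

  sg-+ : ∀ m n → sg (m ℕ.+ n) ≈ sg m * sg n
  sg-+ zero    n = sym (o* sg n)
  sg-+ (suc m) n = trans (-‿cong (sg-+ m n)) (solve 2 (λ a b → :- (a :* b) := (:- a) :* b) refl (sg m) (sg n))

  -- The inverse of 1 + q^(k+1), obtained as (1 - q^(k+1))/(1 - q^(2k+2)) from the given inverses.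
  geo⁺ : ℕ → Carrier
  geo⁺ k = (o - qp (suc k)) * geo (suc (k ℕ.+ k))

  geo⁺-inv : ∀ k → geo⁺ k * (o + qp (suc k)) ≈ o
  geo⁺-inv k = using1 (geo-inv (suc (k ℕ.+ k))) (trans
   (solve 3 (λ g x q → (c1 :- q :* x) :* g :* (c1 :+ q :* x) := c1 :+ c1 :* (g :* (c1 :- q :* (q :* (x :* x))) :- c1)) refl (geo (suc (k ℕ.+ k))) (qp k) q)
   (+-congˡ (*-congˡ (sub-cong (*-congˡ (sub-cong refl (*-congˡ (*-congˡ (sym (qp-+ k k)))))) refl))))

  npoch-unit : ℕ → Carrier
  npoch-unit zero    = o
  npoch-unit (suc n) = npoch-unit n * geo⁺ n

  npoch-inv : ∀ n → npoch-unit n * npoch n ≈ o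
  npoch-inv zero    = o* o
  npoch-inv (suc n) = trans (solve 4 (λ a g p x → a :* g :* (p :* x) := (a :* p) :* (g :* x)) refl _ _ _ _)
   (trans (*-cong (npoch-inv n) (geo⁺-inv n)) (o* o))

  module Limits (L r : ℕ) where
   open KSums L using (K; M; ip-above; ≡[]-weaken; poch-ip-below)

   i : ℕ
   i = suc r

   -- Takes the place of a limit m → ∞: both sequences obey one recurrence in m and agree modulo q^L
   -- at m = L, so they agree at m = 0.
   descend : ∀ {S C f : ℕ → Carrier} → (∀ m → S m ≡[ L ] f m * S (suc m)) → (∀ m → C m ≈ f m * C (suc m)) →
        S L ≡[ L ] C L → S 0 ≡[ L ] C 0
   descend {S} {C} {f} S-step C-step limit = go L 0 (ℕP.+-identityʳ L)
    where
    go : ∀ k m → k ℕ.+ m ≡ L → S m ≡[ L ] C m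
    go zero    m ≡.refl = limit
    go (suc k) m e      = ≡[]-trans (S-step m) (≡[]-trans (≡[]-*ˡ (f m) (go k (suc m) (≡.trans (ℕP.+-suc k m) e))) (≈⇒≡[] (sym (C-step m))))

   reindex : ∀ (f : ℕ → Carrier) → (∀ n → n ℕ.< r → f n ≈ 0#) → (∀ n → f (L ℕ.+ n) ≡[ L ] 0#) →
        sum L f ≡[ L ] sum (suc L) (λ k → f (r ℕ.+ k))
   reindex f low high = ≡[]-trans (≡[]-resp (+-identityʳ _) refl (≡[]-trans (≡[]-+ (≈⇒≡[] refl) (≡[]-sym tail))
    (≈⇒≡[] (sym (sum-split L (suc r) f))))) (≈⇒≡[] (begin
     sum (L ℕ.+ suc r) f ≡⟨ ≡.cong (λ m → sum m f) (≡.trans (ℕP.+-comm L (suc r)) (≡.sym (ℕP.+-suc r L))) ⟩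
     sum (r ℕ.+ suc L) f ≈⟨ sum-split r (suc L) f ⟩
     sum r f + sum (suc L) (λ k → f (r ℕ.+ k)) ≈⟨ trans (+-congʳ (trans (sum-cong r low) (sum-0 r))) (+-identityˡ _) ⟩
     sum (suc L) (λ k → f (r ℕ.+ k)) ∎))
    where
    tail : sum (suc r) (λ n → f (L ℕ.+ n)) ≡[ L ] 0#
    tail = ≡[]-trans (≡[]-sum (suc r) (λ n _ → high n)) (≈⇒≡[] (sum-0 (suc r)))

   -- Heine-type series with the two weights that occur, and the shift c ↦ cq of its denominator parameter.
   module Shift (V : ℕ → ℕ → Carrier) (p : ℕ → Carrier) (V-0 : ∀ m → V m 0 ≈ o) (V-suc-m : ∀ m k → V (suc m) k ≈ V m k * qp k)
          (V-small : ∀ m k → V m k ≡[ k ] 0#) (V-L : ∀ k → V L (suc k) ≡[ L ] 0#) where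
    τ : ℕ → ℕ → Carrier
    τ m k = sg k * V m k * p k * (ip k * ip (i ℕ.+ i ℕ.+ m ℕ.+ k))

    S : ℕ → Carrier
    S m = sum (suc L) (τ m)

    C : ℕ → Carrier
    C m = p 0 * ip (i ℕ.+ m)

    factor : ℕ → Carrier
    factor m = o - qp (suc (i ℕ.+ m))

    C-step : ∀ m → C m ≈ factor m * C (suc m)
    C-step m = trans (*-congˡ (trans (sym (ip-suc (i ℕ.+ m))) (*-congˡ (reflexive (≡.cong ip (≡.sym (ℕP.+-suc i m)))))))
     (solve 3 (λ p x c → p :* (x :* c) := x :* (p :* c)) refl _ _ _)

    -- A contiguous relation that holds termwise up to the difference of (1 - q^k) `τ m k`. The
    -- lower end of the telescope is zero and the upper end is zero modulo q^L.
    S-step : ∀ m (x y : Carrier) → (∀ k → y * τ (suc m) k - x * τ m k ≈ (o - qp (suc k)) * τ m (suc k) - (o - qp k) * τ m k) →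
         x * S m ≡[ L ] y * S (suc m)
    S-step m x y term = ≡[]-sym (≡[]-resp (begin
     x * S m + (o - qp (suc L)) * τ m (suc L)
      ≈⟨ +-congˡ (trans (sym (trans (+-congˡ -0#≈0#) (+-identityʳ _))) (sub-cong refl (sym (trans (*-congʳ (x-x o)) (zeroˡ _))))) ⟩
     x * S m + ((o - qp (suc L)) * τ m (suc L) - (o - qp 0) * τ m 0)
      ≈⟨ +-congˡ (sum-telescope (suc L) (λ k → (o - qp k) * τ m k)) ⟨
     x * S m + sum (suc L) (λ k → (o - qp (suc k)) * τ m (suc k) - (o - qp k) * τ m k)
      ≈⟨ +-congˡ (sum-cong (suc L) (λ k _ → sym (term k))) ⟩
     x * S m + sum (suc L) (λ k → y * τ (suc m) k - x * τ m k)
      ≈⟨ +-congˡ (trans (sum-sub (suc L) _ _) (sub-cong (sym (sum-*ˡ (suc L) y _)) (sym (sum-*ˡ (suc L) x _)))) ⟩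
     x * S m + (y * S (suc m) - x * S m)
      ≈⟨ solve 2 (λ a b → a :+ (b :- a) := b) refl _ _ ⟩
     y * S (suc m) ∎) (+-identityʳ _)
     (≡[]-+ (≈⇒≡[] refl) (≡[]-0ˡ _ (≡[]-0ʳ _ (≡[]-0ʳ _ (≡[]-0ˡ _ (≡[]-weaken (ℕP.n≤1+n L) (V-small m (suc L)))))))))

    S-L : S L ≡[ L ] C L
    S-L = ≡[]-trans (≈⇒≡[] (sum-split 1 L (τ L))) (≡[]-resp refl (+-identityʳ _) (≡[]-+ head
     (≡[]-trans (≡[]-sum L (λ k _ → ≡[]-0ʳ _ (≡[]-0ʳ _ (≡[]-0ˡ _ (V-L k))))) (≈⇒≡[] (sum-0 L)))))
     where
     ip-below : ip (i ℕ.+ i ℕ.+ L ℕ.+ 0) ≡[ L ] ip (i ℕ.+ L)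
     ip-below = ≡[]-resp (reflexive (≡.cong ip (lem r L))) refl (≡[]-weaken (ℕP.m≤n⇒m≤1+n (ℕP.m≤n+m L i)) (ip-above (i ℕ.+ L) i))
      where
      lem : ∀ r L → suc r ℕ.+ L ℕ.+ suc r ≡ suc r ℕ.+ suc r ℕ.+ L ℕ.+ 0
      lem = solve-∀
     head : 0# + τ L 0 ≡[ L ] C L
     head = ≡[]-resp (trans (using1 (V-0 L) (solve 3 (λ v p c → p :* c := (c1 :* v :* p :* (c1 :* c)) :+ (:- (p :* c)) :* (v :- c1)) refl (V L 0) (p 0) _)) (sym (+-identityˡ _)))
      refl (≡[]-*ˡ (p 0) ip-below)

    -- Under V (k+1) = V k · g and p (k+1) = p k · h the certificate for the shift is a polynomial identity.
    S-step' : ∀ m x y (g h : ℕ → Carrier) → (∀ k → V m (suc k) ≈ V m k * g k) → (∀ k → p (suc k) ≈ p k * h k) →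
     (∀ k → let z = qp k; W = qp i * qp i * qp m * z in y * z - x * (o - q * W) ≈ - (g k * h k) - (o - z) * (o - q * W)) →
     x * S m ≡[ L ] y * S (suc m)
    S-step' m x y g h V-suc p-suc alg = S-step m x y term
     where
     term : ∀ k → y * τ (suc m) k - x * τ m k ≈ (o - qp (suc k)) * τ m (suc k) - (o - qp k) * τ m k
     term k = begin
      y * τ (suc m) k - x * τ m k
       ≈⟨ sub-cong (*-congˡ e1) (*-congˡ e2) ⟩
      y * (s * (v * z) * c * (a * β)) - x * (s * v * c * (a * ((o - q * W) * β)))
       ≈⟨ using1 (alg k) (solve 12 (λ y z x q W s v c a β g h → y :* (s :* (v :* z) :* c :* (a :* β)) :- x :* (s :* v :* c :* (a :* ((c1 :- q :* W) :* β)))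
          := ((:- s) :* (v :* g) :* (c :* h) :* (a :* β) :- (c1 :- z) :* (s :* v :* c :* (a :* ((c1 :- q :* W) :* β))))
           :+ (s :* v :* c :* a :* β) :* ((y :* z :- x :* (c1 :- q :* W)) :- (:- (g :* h) :- (c1 :- z) :* (c1 :- q :* W))))
          refl y z x q W s v c a β (g k) (h k)) ⟩
      (- s) * (v * g k) * (c * h k) * (a * β) - (o - z) * (s * v * c * (a * ((o - q * W) * β)))
       ≈⟨ sub-cong e3 (*-congˡ e2) ⟨
      (o - qp (suc k)) * τ m (suc k) - (o - qp k) * τ m k ∎
      where
      s = sg k
      v = V m k
      c = p k
      a = ip k
      z = qp k
      W = qp i * qp i * qp m * z
      N = i ℕ.+ i ℕ.+ m ℕ.+ k
      β = ip (suc N)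
      eN : qp N ≈ W
      eN = trans (qp-+ (i ℕ.+ i ℕ.+ m) k) (*-congʳ (trans (qp-+ (i ℕ.+ i) m) (*-congʳ (qp-+ i i))))
      arith : ∀ r m k → suc r ℕ.+ suc r ℕ.+ suc m ℕ.+ k ≡ suc (suc r ℕ.+ suc r ℕ.+ m ℕ.+ k)
      arith = solve-∀
      e1 : τ (suc m) k ≈ s * (v * z) * c * (a * β)
      e1 = *-cong (*-congʳ (*-congˡ (V-suc-m m k))) (*-congˡ (reflexive (≡.cong ip (arith r m k))))
      e2 : τ m k ≈ s * v * c * (a * ((o - q * W) * β))
      e2 = *-congˡ (*-congˡ (ip-down N W eN))
      e3 : (o - qp (suc k)) * τ m (suc k) ≈ (- s) * (v * g k) * (c * h k) * (a * β)
      e3 = trans (*-congˡ (*-cong (*-cong (*-congˡ (V-suc k)) (p-suc k)) (*-congˡ (reflexive (≡.cong ip (ℕP.+-suc (i ℕ.+ i ℕ.+ m) k))))))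
       (trans (solve 4 (λ x t a b → x :* (t :* (a :* b)) := t :* ((x :* a) :* b)) refl _ _ _ _) (*-congˡ (*-congʳ (ip-suc k))))

   ≡[0] : ∀ x → x ≡[ 0 ] 0#
   ≡[0] x = ≡[]-resp (o* x) refl (qp-small 0 x z≤n)

   ≡[]-suc : ∀ {k x} a → x ≡[ k ] 0# → x * (q * a) ≡[ suc k ] 0#
   ≡[]-suc {k} {x} a (h QAlgebra., e) = (h * a) QAlgebra., trans (*-congʳ (trans e (+-identityˡ _)))
    (trans (solve 4 (λ Q h q a → Q :* h :* (q :* a) := q :* Q :* (h :* a)) refl (qp k) h q a) (sym (+-identityˡ _)))

   -- `S m` is the q-Gauss series with numerator parameters q^(r+1), -q^(r+1), denominator parameter
   -- q^(2r+3+m) and argument -q^(m+1), up to a constant. Its value at m = 0 evaluates `M` for the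
   -- weights of Σ (-1)^n s_n.
   module Alternating where
    V : ℕ → ℕ → Carrier
    V m zero    = o
    V m (suc k) = V m k * qp (suc m)

    p h : ℕ → Carrier
    p k = poch (r ℕ.+ k) * npoch (r ℕ.+ k)
    h k = (o - qp (suc (r ℕ.+ k))) * (o + qp (suc (r ℕ.+ k)))

    V-suc-m : ∀ m k → V (suc m) k ≈ V m k * qp k
    V-suc-m m zero    = sym (o* o)
    V-suc-m m (suc k) = trans (*-congʳ (V-suc-m m k)) (solve 4 (λ v z q x → v :* z :* (q :* x) := v :* x :* (q :* z)) refl (V m k) (qp k) q (qp (suc m)))

    V-small : ∀ m k → V m k ≡[ k ] 0#
    V-small m zero    = ≡[0] o
    V-small m (suc k) = ≡[]-suc (qp m) (V-small m k)

    V-L : ∀ k → V L (suc k) ≡[ L ] 0#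
    V-L k = ≡[]-resp (*-comm _ (V L k)) refl (qp-small (suc L) (V L k) (ℕP.n≤1+n L))

    open Shift V p (λ _ → refl) V-suc-m V-small V-L public

    p-suc : ∀ k → p (suc k) ≈ p k * h k
    p-suc k rewrite ℕP.+-suc r k = solve 3 (λ a b x → a :* (c1 :- x) :* (b :* (c1 :+ x)) := a :* b :* ((c1 :- x) :* (c1 :+ x))) refl _ _ _

    S-rec : ∀ m → (o + qp (suc m)) * S m ≡[ L ] factor m * (o + qp (suc (i ℕ.+ m))) * S (suc m)
    S-rec m = S-step' m _ _ (λ _ → qp (suc m)) h (λ _ → refl) p-suc (λ k → trans
     (sub-cong (*-congʳ (*-cong (sub-cong refl (*-congˡ (qp-+ i m))) (+-congˡ (*-congˡ (qp-+ i m))))) refl)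
     (trans (solve 4 (λ q u μ z → (c1 :- q :* (u :* μ)) :* (c1 :+ q :* (u :* μ)) :* z :- (c1 :+ q :* μ) :* (c1 :- q :* (u :* u :* μ :* z))
      := :- (q :* μ :* ((c1 :- u :* z) :* (c1 :+ u :* z))) :- (c1 :- z) :* (c1 :- q :* (u :* u :* μ :* z))) refl q (qp i) (qp m) (qp k))
     (sub-cong (-‿cong (*-congˡ (*-cong (sub-cong refl (sym (qp-+ i k))) (+-congˡ (sym (qp-+ i k)))))) refl)))

    -- This is (-q^(m+1);q)_j. Multiplying `S m` by `N m i` absorbs the factors 1 + q^(m+1) and 1 +
    -- q^(i+m+1) of `S-rec`, so that the product obeys the recurrence of `C`.
    N : ℕ → ℕ → Carrier
    N m zero    = o
    N m (suc j) = N m j * (o + qp (suc (j ℕ.+ m)))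

    N-suc : ∀ m j → (o + qp (suc m)) * N (suc m) j ≈ N m j * (o + qp (suc (j ℕ.+ m)))
    N-suc m zero    = *-comm _ _
    N-suc m (suc j) = trans (sym (*-assoc _ _ _)) (trans (*-congʳ (N-suc m j)) (*-congˡ (+-congˡ (qp-≡ (≡.cong suc (ℕP.+-suc j m))))))

    N-L : ∀ j → N L j ≡[ L ] o
    N-L zero    = ≈⇒≡[] refl
    N-L (suc j) = ≡[]-resp refl (o* o) (≡[]-* (N-L j) (≡[]-resp refl (+-identityʳ o) (≡[]-+ (≈⇒≡[] refl)
     (≡[]-resp (trans (*-comm _ o) (o* _)) refl (qp-small (suc (j ℕ.+ L)) o (ℕP.m≤n⇒m≤1+n (ℕP.m≤n+m L j)))))))

    N-0 : ∀ j → N 0 j ≈ npoch j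
    N-0 zero    = refl
    N-0 (suc j) = *-cong (N-0 j) (+-congˡ (qp-≡ (≡.cong suc (ℕP.+-identityʳ j))))

    NS : ℕ → Carrier
    NS m = N m i * S m

    NS-step : ∀ m → NS m ≡[ L ] factor m * NS (suc m)
    NS-step m = ≡[]-cancel (o + qp (suc m)) (geo⁺ m) (geo⁺-inv m) (≡[]-resp
     (solve 3 (λ a b c → a :* (b :* c) := b :* (a :* c)) refl _ _ _)
     (trans (solve 4 (λ n f c s → n :* (f :* c :* s) := n :* c :* (f :* s)) refl (N m i) (factor m) (o + qp (suc (i ℕ.+ m))) (S (suc m)))
      (trans (*-congʳ (sym (N-suc m i))) (solve 4 (λ a b f s → a :* b :* (f :* s) := a :* (f :* (b :* s))) refl _ _ _ _)))
     (≡[]-*ˡ (N m i) (S-rec m)))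

    value : (o + qp i) * S 0 ≡[ L ] geo r
    value = ≡[]-cancel (npoch r) (npoch-unit r) (npoch-inv r) (≡[]-resp
     (trans (*-congʳ (N-0 i)) (*-assoc _ _ _)) C-0 (descend {NS} {C} NS-step C-step (≡[]-resp refl (o* _) (≡[]-* (N-L i) S-L))))
     where
     C-0 : C 0 ≈ npoch r * geo r
     C-0 = trans (*-cong (*-cong (reflexive (≡.cong poch (ℕP.+-identityʳ r))) (reflexive (≡.cong npoch (ℕP.+-identityʳ r))))
               (reflexive (≡.cong ip (ℕP.+-identityʳ i))))
      (using1 (poch-ip r) (solve 4 (λ a n i g → a :* n :* (i :* g) := n :* g :+ (n :* g) :* (a :* i :- c1)) refl _ _ _ _))

    v : ℕ → Carrier
    v n = sg n * (qp (suc n) * (poch n * npoch n))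

    M-v : (o - qp i * qp i) * M v r ≡[ L ] sg r * qp i
    M-v = ≡[]-trans (≡[]-*ˡ (o - qp i * qp i) (reindex _ low high)) (≡[]-trans (≈⇒≡[] (begin
     (o - x * x) * sum (suc L) (λ k → v (r ℕ.+ k) * (ipm (r ℕ.+ k) r * ip (suc (suc (r ℕ.+ (r ℕ.+ k))))))
      ≈⟨ *-congˡ (trans (sum-cong (suc L) (λ k _ → term k)) (sym (sum-*ˡ (suc L) (sg r * x) (τ 0)))) ⟩
     (o - x * x) * (sg r * x * S 0)
      ≈⟨ solve 3 (λ s x S → (c1 :- x :* x) :* (s :* x :* S) := s :* x :* (c1 :- x) :* ((c1 :+ x) :* S)) refl (sg r) x (S 0) ⟩
     sg r * x * (o - x) * ((o + x) * S 0) ∎))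
     (≡[]-resp refl (using1 (geo-inv r) (solve 3 (λ s x g → s :* x :* (c1 :- x) :* g := s :* x :+ (s :* x) :* (g :* (c1 :- x) :- c1)) refl (sg r) x (geo r)))
      (≡[]-*ˡ (sg r * x * (o - x)) value)))
     where
     x = qp i
     low : ∀ n → n ℕ.< r → v n * (ipm n r * ip (suc (suc (r ℕ.+ n)))) ≈ 0#
     low n n<r = zero-term (ipm-> n r n<r)
     high : ∀ n → v (L ℕ.+ n) * (ipm (L ℕ.+ n) r * ip (suc (suc (r ℕ.+ (L ℕ.+ n))))) ≡[ L ] 0#
     high n = ≡[]-0ʳ _ (≡[]-0ˡ _ (qp-small (suc (L ℕ.+ n)) _ (ℕP.m≤n⇒m≤1+n (ℕP.m≤m+n L n))))
     V-0-qp : ∀ k → V 0 k ≈ qp k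
     V-0-qp zero    = refl
     V-0-qp (suc k) = trans (*-congʳ (V-0-qp k)) (solve 2 (λ z q → z :* (q :* c1) := q :* z) refl (qp k) q)
     arith : ∀ r k → suc (suc (r ℕ.+ (r ℕ.+ k))) ≡ suc r ℕ.+ suc r ℕ.+ 0 ℕ.+ k
     arith = solve-∀
     term : ∀ k → v (r ℕ.+ k) * (ipm (r ℕ.+ k) r * ip (suc (suc (r ℕ.+ (r ℕ.+ k))))) ≈ sg r * x * τ 0 k
     term k = trans (*-cong (*-cong (sg-+ r k) (*-congʳ (trans (qp-+ i k) (*-congˡ (sym (V-0-qp k)))))) (*-cong (reflexive (ipm-+ r k)) (reflexive (≡.cong ip (arith r k)))))
      (solve 6 (λ s t x v p a → s :* t :* (x :* v :* p) :* a := s :* x :* (t :* v :* p :* a)) refl _ _ _ _ _ _)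

   -- The confluent case of the same summation, in which one numerator parameter tends to infinity
   -- and the weight becomes q^(k(k+1)/2 + k(i+m)). It evaluates `M` for the weights of Σ (-1)^n
   -- u_n.
   module Confluent where
    V : ℕ → ℕ → Carrier
    V m zero    = o
    V m (suc k) = V m k * (qp (suc k) * qp (i ℕ.+ m))

    p h : ℕ → Carrier
    p k = poch (r ℕ.+ k)
    h k = o - qp (suc (r ℕ.+ k))

    V-suc-m : ∀ m k → V (suc m) k ≈ V m k * qp k
    V-suc-m m zero    = sym (o* o)
    V-suc-m m (suc k) = trans (*-cong (V-suc-m m k) (*-congˡ (qp-≡ (ℕP.+-suc i m))))
     (solve 4 (λ v z q x → v :* z :* (q :* z :* (q :* x)) := v :* (q :* z :* x) :* (q :* z)) refl (V m k) (qp k) q (qp (i ℕ.+ m)))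

    V-small : ∀ m k → V m k ≡[ k ] 0#
    V-small m zero    = ≡[0] o
    V-small m (suc k) = ≡[]-0ˡ _ (qp-small (suc k) _ ℕP.≤-refl)

    V-L : ∀ k → V L (suc k) ≡[ L ] 0#
    V-L k = ≡[]-0ˡ _ (≡[]-resp (*-comm _ _) refl (qp-small (i ℕ.+ L) (qp (suc k)) (ℕP.m≤n+m L i)))

    open Shift V p (λ _ → refl) V-suc-m V-small V-L public

    S-rec : ∀ m → S m ≡[ L ] factor m * S (suc m)
    S-rec m = ≡[]-resp (o* _) refl (S-step' m o (factor m) (λ k → qp (suc k) * qp (i ℕ.+ m)) h (λ _ → refl)
     (λ k → reflexive (≡.cong poch (ℕP.+-suc r k))) (λ k → trans
     (sub-cong (*-congʳ (sub-cong refl (*-congˡ (qp-+ i m)))) refl)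
     (trans (solve 4 (λ q u μ z → (c1 :- q :* (u :* μ)) :* z :- c1 :* (c1 :- q :* (u :* u :* μ :* z))
      := :- (q :* z :* (u :* μ) :* (c1 :- u :* z)) :- (c1 :- z) :* (c1 :- q :* (u :* u :* μ :* z))) refl q (qp i) (qp m) (qp k))
     (sub-cong (-‿cong (*-cong (*-congˡ (sym (qp-+ i m))) (sub-cong refl (sym (qp-+ i k))))) refl))))

    value : S 0 ≡[ L ] geo r
    value = ≡[]-resp refl C-0 (descend {S} {C} S-rec C-step S-L)
     where
     C-0 : C 0 ≈ geo r
     C-0 = trans (*-cong (reflexive (≡.cong poch (ℕP.+-identityʳ r))) (reflexive (≡.cong ip (ℕP.+-identityʳ i))))
      (using1 (poch-ip r) (solve 3 (λ a i g → a :* (i :* g) := g :+ g :* (a :* i :- c1)) refl _ _ _))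

    v : ℕ → Carrier
    v n = sg n * (tq (suc n) * poch n)

    M-v : M v r ≡[ L ] sg r * tq (suc r) * geo r
    M-v = ≡[]-trans (reindex _ low high) (≡[]-trans (≈⇒≡[] (trans (sum-cong (suc L) (λ k _ → term k)) (sym (sum-*ˡ (suc L) (sg r * tq (suc r)) (τ 0)))))
     (≡[]-*ˡ (sg r * tq (suc r)) value))
     where
     low : ∀ n → n ℕ.< r → v n * (ipm n r * ip (suc (suc (r ℕ.+ n)))) ≈ 0#
     low n n<r = zero-term (ipm-> n r n<r)
     high : ∀ n → v (L ℕ.+ n) * (ipm (L ℕ.+ n) r * ip (suc (suc (r ℕ.+ (L ℕ.+ n))))) ≡[ L ] 0#
     high n = ≡[]-0ʳ _ (≡[]-0ˡ _ (≡[]-0ʳ _ (≡[]-resp (*-comm _ _) refl (qp-small (suc (L ℕ.+ n)) _ (ℕP.m≤n⇒m≤1+n (ℕP.m≤m+n L n))))))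
     tq-+ : ∀ k → tq (suc (r ℕ.+ k)) ≈ tq (suc r) * V 0 k
     tq-+ zero    = trans (reflexive (≡.cong (λ m → tq (suc m)) (ℕP.+-identityʳ r))) (sym (trans (*-comm _ _) (o* _)))
     tq-+ (suc k) = trans (*-cong (trans (reflexive (≡.cong tq (ℕP.+-suc r k))) (tq-+ k))
      (trans (qp-≡ (arith r k)) (qp-+ (suc k) (i ℕ.+ 0)))) (*-assoc _ _ _)
      where
      arith : ∀ r k → suc (r ℕ.+ suc k) ≡ suc k ℕ.+ (suc r ℕ.+ 0)
      arith = solve-∀
     arith : ∀ r k → suc (suc (r ℕ.+ (r ℕ.+ k))) ≡ suc r ℕ.+ suc r ℕ.+ 0 ℕ.+ k
     arith = solve-∀
     term : ∀ k → v (r ℕ.+ k) * (ipm (r ℕ.+ k) r * ip (suc (suc (r ℕ.+ (r ℕ.+ k))))) ≈ sg r * tq (suc r) * τ 0 k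
     term k = trans (*-cong (*-cong (sg-+ r k) (*-congʳ (tq-+ k))) (*-cong (reflexive (ipm-+ r k)) (reflexive (≡.cong ip (arith r k)))))
      (solve 6 (λ s t x v p a → s :* t :* (x :* v :* p) :* a := s :* x :* (t :* v :* p :* a)) refl _ _ _ _ _ _)

 -- σ(q) modulo 4 as sums of powers of q

 module QExpansion
  (R : CommutativeRing 0ℓ 0ℓ)
  (ℤ⟶R : CommutativeRing.rawRing ℤP.+-*-commutativeRing -Raw-AlmostCommutative⟶ fromCommutativeRing R)
  (q : CommutativeRing.Carrier R)
  (geo : ℕ → CommutativeRing.Carrier R)
  (geo-inv : ∀ k → CommutativeRing._≈_ R (CommutativeRing._*_ R (geo k) (CommutativeRing._-_ R (QAlgebra.o R ℤ⟶R q)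
   (QAlgebra.qp R ℤ⟶R q (suc k)))) (QAlgebra.o R ℤ⟶R q))
  where

  open import Data.Product.Base using (∃) renaming (_,_ to _,,_)
  import Data.Nat.Properties as ℕP
  import Relation.Binary.PropositionalEquality as ≡
  open ≡ using (_≡_)
  open CommutativeRing R hiding (zero)
  open QAlgebra R ℤ⟶R q
  open QIdentities R ℤ⟶R q geo geo-inv
  open QLimits R ℤ⟶R q geo geo-inv
  open import Relation.Binary.Reasoning.Setoid setoid

  two : Carrier
  two = o + o

  -- `s n` is the n-th term of σ(q); `u n` has (q;q)_n where `s n` has (-q;q)_n.
  s u : ℕ → Carrier
  s n = tq (suc n) * npoch n * b n
  u n = tq (suc n) * poch n * b n

  sg-sq : ∀ n → sg n * sg n ≈ o
  sg-sq zero    = o* o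
  sg-sq (suc n) = trans (solve 1 (λ a → (:- a) :* (:- a) := a :* a) refl (sg n)) (sg-sq n)

  -- (1 - (-1)^n)/2 and (1 + (-1)^n)/2
  odd even : ℕ → Carrier
  odd zero    = 0#
  odd (suc n) = o - odd n
  even n      = o - odd n

  sg-odd : ∀ n → sg n ≈ o - two * odd n
  sg-odd zero    = sym (trans (sub-cong refl (zeroʳ two)) (trans (+-congˡ (trans (sym (+-identityˡ _)) (x-x 0#))) (+-identityʳ o)))
  sg-odd (suc n) = trans (-‿cong (sg-odd n)) (solve 1 (λ a → :- (c1 :- (c1 :+ c1) :* a) := c1 :- (c1 :+ c1) :* (c1 :- a)) refl (odd n))

  -- Half of (-q;q)_n - (q;q)_n, given by a recursion because 2 has no inverse in the ring.
  half : ℕ → Carrier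
  half zero    = 0#
  half (suc n) = half n * (o + qp (suc n)) + poch n * qp (suc n)

  npoch-half : ∀ n → npoch n ≈ poch n + two * half n
  npoch-half zero    = sym (trans (+-congˡ (zeroʳ two)) (+-identityʳ o))
  npoch-half (suc n) = using1 (npoch-half n) (solve 4 (λ N P h x → N :* (c1 :+ x)
   := P :* (c1 :- x) :+ (c1 :+ c1) :* (h :* (c1 :+ x) :+ P :* x) :+ (c1 :+ x) :* (N :- (P :+ (c1 :+ c1) :* h))) refl (npoch n) (poch n) (half n) (qp (suc n)))

  infix 4 _≡4_
  record _≡4_ (x y : Carrier) : Set where
   constructor four
   field
    quotient : Carrier
    equality : x ≈ y + two * two * quotient

  ≈⇒≡4 : ∀ {x y} → x ≈ y → x ≡4 y
  ≈⇒≡4 {x} {y} e = four 0# (trans e (sym (trans (+-congˡ (zeroʳ _)) (+-identityʳ y))))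

  ≡4-trans : ∀ {x y z} → x ≡4 y → y ≡4 z → x ≡4 z
  ≡4-trans {x} {y} {z} (four h e) (four k e') = four (h + k) (trans e (trans (+-congʳ e')
   (solve 3 (λ z h k → (z :+ (c1 :+ c1) :* (c1 :+ c1) :* k) :+ (c1 :+ c1) :* (c1 :+ c1) :* h := z :+ (c1 :+ c1) :* (c1 :+ c1) :* (h :+ k)) refl z h k)))

  ≡4-+ : ∀ {x y x' y'} → x ≡4 y → x' ≡4 y' → x + x' ≡4 y + y'
  ≡4-+ {x} {y} {x'} {y'} (four h e) (four k e') = four (h + k) (trans (+-cong e e')
   (solve 4 (λ y z h k → (y :+ (c1 :+ c1) :* (c1 :+ c1) :* h) :+ (z :+ (c1 :+ c1) :* (c1 :+ c1) :* k) := y :+ z :+ (c1 :+ c1) :* (c1 :+ c1) :* (h :+ k)) refl y y' h k))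

  ≡4-sum : ∀ L {f g : ℕ → Carrier} → (∀ n → f n ≡4 g n) → sum L f ≡4 sum L g
  ≡4-sum zero    p = ≈⇒≡4 refl
  ≡4-sum (suc L) p = ≡4-+ (≡4-sum L p) (p L)

  -- s n ≡ u n modulo 2, hence Σ (1 - (-1)^n) (s n - u n) ≡ 0 modulo 4.
  alternate : ∀ L → sum L s ≡4 (sum L (λ n → sg n * s n) + sum L u) - sum L (λ n → sg n * u n)
  alternate L = ≡4-trans (≡4-sum L term) (≈⇒≡4 (trans (sum-sub L _ _) (+-congʳ (sum-+ L _ _))))
   where
   term : ∀ n → s n ≡4 (sg n * s n + u n) - sg n * u n
   term n = four (tq (suc n) * b n * half n * odd n) (using2 (npoch-half n) (sg-odd n)
    (solve 7 (λ t N P b h σ d → t :* N :* b := (σ :* (t :* N :* b) :+ t :* P :* b :- σ :* (t :* P :* b)) :+ (c1 :+ c1) :* (c1 :+ c1) :* (t :* b :* h :* d)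
     :+ (t :* b :* (c1 :- σ)) :* (N :- (P :+ (c1 :+ c1) :* h)) :+ (:- (t :* b :* (c1 :+ c1) :* h)) :* (σ :- (c1 :- (c1 :+ c1) :* d)))
     refl (tq (suc n)) (npoch n) (poch n) (b n) (half n) (sg n) (odd n)))

  tq-tri : ∀ n → tq n ≈ qp (tri n)
  tq-tri zero    = refl
  tq-tri (suc n) = trans (*-congʳ (tq-tri n)) (sym (qp-+ (tri n) (suc n)))

  w-pron : ∀ j → Pair1.w j ≈ qp (pron j)
  w-pron zero    = refl
  w-pron (suc j) = trans (*-congʳ (w-pron j)) (sym (qp-+ (pron j) (dbl j)))

  gapExp-large : ∀ r d → d ℕ.≤ gapExp r d
  gapExp-large r zero    = z≤n
  gapExp-large r (suc d) = ℕP.≤-trans (ℕP.≤-reflexive (ℕP.+-comm 1 d)) (ℕP.+-mono-≤ (gapExp-large r d) (s≤s z≤n))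

  -- Iterating the recurrence d times collects the factor q^(gapExp r d); since `gapExp r L` is at
  -- least L, the remainder after L steps vanishes modulo q^L.
  unroll : ∀ {L} (K k : ℕ → Carrier) → (∀ r → K r ≡[ L ] k r + qp (suc r) * qp (suc r) * K (suc r)) →
       ∀ r → K r ≡[ L ] sum L (λ d → qp (gapExp r d) * k (r ℕ.+ d))
  unroll {L} K k rec r = ≡[]-trans (go L) (≡[]-resp refl (+-identityʳ _) (≡[]-+ (≈⇒≡[] refl) (qp-small (gapExp r L) _ (gapExp-large r L))))
   where
   go : ∀ d → K r ≡[ L ] sum d (λ d → qp (gapExp r d) * k (r ℕ.+ d)) + qp (gapExp r d) * K (r ℕ.+ d)
   go zero    = ≈⇒≡[] (sym (trans (+-identityˡ _) (trans (o* _) (reflexive (≡.cong K (ℕP.+-identityʳ r))))))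
   go (suc d) = ≡[]-trans (go d) (≡[]-resp refl (begin
    S + G * (k (r ℕ.+ d) + x * x * K (suc (r ℕ.+ d)))
     ≈⟨ solve 5 (λ S G k x K → S :+ G :* (k :+ x :* x :* K) := S :+ G :* k :+ G :* (x :* x) :* K) refl _ _ _ _ _ ⟩
    S + G * k (r ℕ.+ d) + G * (x * x) * K (suc (r ℕ.+ d))
     ≈⟨ +-congˡ (*-cong (sym (trans (qp-+ (gapExp r d) (suc (r ℕ.+ d) ℕ.+ suc (r ℕ.+ d))) (*-congˡ (qp-+ (suc (r ℕ.+ d)) (suc (r ℕ.+ d)))))) (reflexive (≡.cong K (≡.sym (ℕP.+-suc r d))))) ⟩
    S + G * k (r ℕ.+ d) + qp (gapExp r (suc d)) * K (r ℕ.+ suc d) ∎)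
    (≡[]-+ (≈⇒≡[] refl) (≡[]-*ˡ G (rec (r ℕ.+ d)))))
    where
    S = sum d (λ d → qp (gapExp r d) * k (r ℕ.+ d))
    G = qp (gapExp r d)
    x = qp (suc (r ℕ.+ d))

  geometric : ∀ L r → qp (suc r) * geo r ≡[ L ] sum L (λ l → qp (suc r ℕ.* suc l))
  geometric L r = ≡[]-trans (go L) (≡[]-resp refl (+-identityʳ _) (≡[]-+ (≈⇒≡[] refl) (qp-small _ (geo r) (ℕP.≤-trans (ℕP.n≤1+n L) (ℕP.m≤m+n (suc L) (r ℕ.* suc L))))))
   where
   step : ∀ l → qp (suc r ℕ.* suc l) * geo r ≈ qp (suc r ℕ.* suc l) + qp (suc r ℕ.* suc (suc l)) * geo r
   step l = trans (using1 (geo-inv r) (solve 3 (λ y x g → y :* g := y :+ (x :* y) :* g :+ y :* (g :* (c1 :- x) :- c1)) refl _ (qp (suc r)) (geo r)))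
    (+-congˡ (*-congʳ (trans (sym (qp-+ (suc r) (suc r ℕ.* suc l))) (qp-≡ (≡.sym (ℕP.*-suc (suc r) (suc l)))))))
   go : ∀ l → qp (suc r) * geo r ≡[ L ] sum l (λ l → qp (suc r ℕ.* suc l)) + qp (suc r ℕ.* suc l) * geo r
   go zero    = ≈⇒≡[] (sym (trans (+-identityˡ _) (*-congʳ (qp-≡ (ℕP.*-identityʳ (suc r))))))
   go (suc l) = ≡[]-trans (go l) (≈⇒≡[] (trans (+-congˡ (step l)) (sym (+-assoc _ _ _))))

  -- D r tq (r+1) as a sum of powers of q.
  D-sum : ∀ r → D r ≈ sum (suc r) (λ t → qp (dExp t (r ℕ.∸ t)))
  D-sum zero    = sym (+-identityˡ o)
  D-sum (suc r) = +-cong (trans (*-cong (sym (qp-+ (suc r) (suc r))) (D-sum r)) (trans (sum-*ˡ (suc r) _ _) (sum-cong (suc r) term)))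
   (trans (tq-tri (suc r)) (qp-≡ (≡.cong (dExp (suc r)) (≡.sym (ℕP.n∸n≡0 (suc r))))))
   where
   term : ∀ t → t ℕ.< suc r → qp (suc r ℕ.+ suc r) * qp (dExp t (r ℕ.∸ t)) ≈ qp (dExp t (suc r ℕ.∸ t))
   term t t<1+r = trans (sym (qp-+ (suc r ℕ.+ suc r) _)) (qp-≡ (≡.trans
    (≡.cong (λ m → (suc m ℕ.+ suc m) ℕ.+ dExp t (r ℕ.∸ t)) (≡.sym (ℕP.m+[n∸m]≡n t≤r)))
    (≡.cong (dExp t) (≡.sym (ℕP.+-∸-assoc 1 t≤r)))))
    where
    t≤r = s≤s⁻¹ t<1+r

  -- The length 2 of the sums over δ and ε is a variable, so these sums do not unfold during type
  -- checking.
  module Expansion (L K2 : ℕ) (K2≡2 : K2 ≡ 2) where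
   open KSums L

   sum-K2 : ∀ (f : ℕ → Carrier) → sum K2 f ≈ f 0 + f 1
   sum-K2 f = trans (reflexive (≡.cong (λ k → sum k f) K2≡2)) (+-congʳ (+-identityˡ (f 0)))

   over : (ℕ → ℕ → ℕ → Carrier) → Carrier
   over f = sum L (λ j → sum K2 (λ δ → sum L (λ d → f j δ d)))

   over-cong : ∀ {f g} → (∀ j δ d → f j δ d ≈ g j δ d) → over f ≈ over g
   over-cong p = sum-cong L (λ j _ → sum-cong K2 (λ δ _ → sum-cong L (λ d _ → p j δ d)))

   over-cong[] : ∀ {f g} → (∀ j δ d → f j δ d ≡[ L ] g j δ d) → over f ≡[ L ] over g
   over-cong[] p = ≡[]-sum L (λ j _ → ≡[]-sum K2 (λ δ _ → ≡[]-sum L (λ d _ → p j δ d)))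

   over-+ : ∀ f g → over (λ j δ d → f j δ d + g j δ d) ≈ over f + over g
   over-+ f g = trans (sum-cong L (λ j _ → trans (sum-cong K2 (λ δ _ → sum-+ L _ _)) (sum-+ K2 _ _))) (sum-+ L _ _)

   over-* : ∀ a f → over (λ j δ d → a * f j δ d) ≈ a * over f
   over-* a f = sym (trans (sum-*ˡ L a _) (sum-cong L (λ j _ → trans (sum-*ˡ K2 a _) (sum-cong K2 (λ δ _ → sum-*ˡ L a _)))))

   over-≡4 : ∀ {f g} → (∀ j δ d → f j δ d ≡4 g j δ d) → over f ≡4 over g
   over-≡4 p = ≡4-sum L (λ j → ≡4-sum K2 (λ δ → ≡4-sum L (λ d → p j δ d)))

   -- Summing a weighted Pair₁ identity over n.
   pair1-sum : ∀ (v : ℕ → Carrier) (k : ℕ → Carrier) → (∀ r → K v r ≡[ L ] k r + qp (suc r) * qp (suc r) * K v (suc r)) →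
    sum L (λ n → v n * sum L (Pair1.ℓ n)) ≡[ L ] over (λ j δ d → sg j * sg δ * (qp (pron (suc j) ℕ.+ gapExp (idx j δ) d) * k (idx j δ ℕ.+ d)))
   pair1-sum v k rec = ≡[]-trans (≈⇒≡[] (trans (sum-cong L (λ n _ → sum-*ˡ L (v n) (Pair1.ℓ n))) (trans (sum-swap L L _) (sum-cong L (λ j _ → inner j)))))
    (≡[]-sum L (λ j _ → ≡[]-sum K2 (λ δ _ → ≡[]-trans (≡[]-*ˡ _ (unroll (K v) k rec (idx j δ))) (≈⇒≡[] (trans (sum-*ˡ L _ _) (sum-cong L (λ d _ → expand j δ d)))))))
    where
    inner : ∀ j → sum L (λ n → v n * Pair1.ℓ n j) ≈ sum K2 (λ δ → sg j * sg δ * qp (pron (suc j)) * K v (idx j δ))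
    inner j = begin
     sum L (λ n → v n * Pair1.ℓ n j)
      ≈⟨ sum-cong L (λ n _ → trans (solve 7 (λ v s w a b c d → v :* (s :* w :* (a :* b :- c :* d)) := s :* w :* (v :* (a :* b)) :- s :* w :* (v :* (c :* d))) refl
         (v n) (sg j) (Pair1.w (suc j)) _ _ _ _) refl) ⟩
     sum L (λ n → sg j * Pair1.w (suc j) * (v n * (ipm n (dbl j) * ip (suc (dbl j ℕ.+ n)))) - sg j * Pair1.w (suc j) * (v n * (ipm n (suc (dbl j)) * ip (suc (suc (dbl j ℕ.+ n))))))
      ≈⟨ trans (sum-sub L _ _) (sub-cong (sym (sum-*ˡ L _ _)) (sym (sum-*ˡ L _ _))) ⟩
     sg j * Pair1.w (suc j) * K v (dbl j) - sg j * Pair1.w (suc j) * K v (suc (dbl j))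
      ≈⟨ sub-cong (*-cong (*-congˡ (w-pron (suc j))) (reflexive (≡.cong (K v) (≡.sym (ℕP.+-identityʳ (dbl j))))))
            (*-cong (*-congˡ (w-pron (suc j))) (reflexive (≡.cong (K v) (≡.sym (ℕP.+-comm (dbl j) 1))))) ⟩
     sg j * qp (pron (suc j)) * K v (idx j 0) - sg j * qp (pron (suc j)) * K v (idx j 1)
      ≈⟨ trans (solve 4 (λ s w a b → s :* w :* a :- s :* w :* b := s :* c1 :* w :* a :+ s :* (:- c1) :* w :* b) refl _ _ _ _) (sym (sum-K2 _)) ⟩
     sum K2 (λ δ → sg j * sg δ * qp (pron (suc j)) * K v (idx j δ)) ∎
    expand : ∀ j δ d → sg j * sg δ * qp (pron (suc j)) * (qp (gapExp (idx j δ) d) * k (idx j δ ℕ.+ d))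
        ≈ sg j * sg δ * (qp (pron (suc j) ℕ.+ gapExp (idx j δ) d) * k (idx j δ ℕ.+ d))
    expand j δ d = trans (solve 5 (λ s t w g k → s :* t :* w :* (g :* k) := s :* t :* (w :* g :* k)) refl _ _ _ _ _) (*-congˡ (*-congʳ (sym (qp-+ (pron (suc j)) _))))

   exponent-split : ∀ j δ d → qp (pron (suc j) ℕ.+ gapExp (idx j δ) d) * qp (suc (idx j δ ℕ.+ d)) ≈ qp (exponent j δ d)
   exponent-split j δ d = trans (sym (qp-+ (pron (suc j) ℕ.+ gapExp (idx j δ) d) _)) (qp-≡ (ℕP.+-assoc (pron (suc j)) _ _))

   weighted : ∀ (a : ℕ → Carrier) n → n ℕ.< L → tq (suc n) * a n * b n ≈ qp (suc n) * a n * poch n * sum L (Pair1.ℓ n)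
   weighted a n n<L = using1 (Pair1.identity n L (ℕP.<-≤-trans n<L (L≤dbl L)))
    (solve 6 (λ t x a b p S → t :* x :* a :* b := x :* a :* p :* S :+ (x :* a) :* (t :* b :- p :* S)) refl (tq n) (qp (suc n)) (a n) (b n) (poch n) _)
    where
    L≤dbl : ∀ L → L ℕ.≤ dbl L
    L≤dbl zero    = z≤n
    L≤dbl (suc L) = s≤s (ℕP.m≤n⇒m≤1+n (L≤dbl L))

   tail : ℕ → ℕ → ℕ → Carrier
   tail j δ d = sum L (λ l → qp (exponent j δ d ℕ.+ suc (idx j δ ℕ.+ d) ℕ.* suc l))

   -- With x = q^(r+d+1) the unrolled closed form is x (1 + x)/(1 - x) = x + 2 x · x/(1 - x): the
   -- first term gives the principal exponents and the geometric series gives `tail` with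
   -- coefficient 2.
   u-sum : sum L u ≡[ L ] over (λ j δ d → sg j * sg δ * (qp (exponent j δ d) + two * tail j δ d))
   u-sum = ≡[]-trans (≈⇒≡[] (sum-cong L (λ n n<L → weighted poch n n<L)))
    (≡[]-trans (pair1-sum v2 (λ r → qp (suc r) * (o + qp (suc r)) * geo r) K-v2) (over-cong[] (λ j δ d → ≡[]-*ˡ _ (term j δ d))))
    where
    term : ∀ j δ d → let n = idx j δ ℕ.+ d in
     qp (pron (suc j) ℕ.+ gapExp (idx j δ) d) * (qp (suc n) * (o + qp (suc n)) * geo n) ≡[ L ] qp (exponent j δ d) + two * tail j δ d
    term j δ d = ≡[]-resp (sym (trans (using1 (geo-inv n) (solve 3 (λ e x g → e :* (x :* (c1 :+ x) :* g) := e :* x :+ (c1 :+ c1) :* (e :* x :* (x :* g)) :+ (e :* x) :* (g :* (c1 :- x) :- c1)) refl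
      (qp (pron (suc j) ℕ.+ gapExp (idx j δ) d)) (qp (suc n)) (geo n)))
      (+-cong (exponent-split j δ d) (*-congˡ (*-congʳ (exponent-split j δ d))))))
     (+-congˡ (*-congˡ (trans (sum-*ˡ L _ _) (sum-cong L (λ l _ → sym (qp-+ (exponent j δ d) _))))))
     (≡[]-+ (≈⇒≡[] refl) (≡[]-*ˡ two (≡[]-*ˡ (qp (exponent j δ d)) (geometric L n))))
     where
     n = idx j δ ℕ.+ d

   -- The closed form from `Alternating` is a single signed power of q, so only the principal
   -- exponents appear.
   s-sum : sum L (λ n → sg n * s n) ≡[ L ] over (λ j δ d → sg j * sg δ * sg (idx j δ ℕ.+ d) * qp (exponent j δ d))
   s-sum = ≡[]-trans (≈⇒≡[] (sum-cong L (λ n n<L → trans (*-congˡ (weighted npoch n n<L))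
     (solve 5 (λ s x a p S → s :* (x :* a :* p :* S) := s :* (x :* (p :* a)) :* S) refl _ _ _ _ _))))
    (≡[]-trans (pair1-sum v (λ r → sg r * qp (suc r)) rec) (≈⇒≡[] (over-cong (λ j δ d → trans
     (solve 5 (λ s t e n x → s :* t :* (e :* (n :* x)) := s :* t :* n :* (e :* x)) refl _ _ _ _ _) (*-congˡ (exponent-split j δ d))))))
    where
    v : ℕ → Carrier
    v n = sg n * (qp (suc n) * (poch n * npoch n))
    rec : ∀ r → K v r ≡[ L ] sg r * qp (suc r) + qp (suc r) * qp (suc r) * K v (suc r)
    rec r = ≡[]-trans (≈⇒≡[] (K-rec v r)) (≡[]-+ (Limits.Alternating.M-v L r) (≈⇒≡[] refl))

   -- The sign (-1)^r of the second pair meets the sign (-1)^r of the confluent sum, so every power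
   -- of q occurs with coefficient +1.
   alternating-u-sum : sum L (λ n → sg n * u n) ≡[ L ] sum L (λ r → sum (suc r) (λ t → sum K2 (λ ε → qp (conjExponent r t ε))))
   alternating-u-sum = ≡[]-trans (≈⇒≡[] (begin
    sum L (λ n → sg n * u n)
     ≈⟨ sum-cong L (λ n n<L → trans (*-congˡ (*-congˡ (Pair2.identity n L n<L))) (trans (sym (*-assoc _ _ _)) (sum-*ˡ L _ _))) ⟩
    sum L (λ n → sum L (λ r → sg n * (tq (suc n) * poch n) * Pair2.c n r))
     ≈⟨ sum-swap L L _ ⟩
    sum L (λ r → sum L (λ n → sg n * (tq (suc n) * poch n) * Pair2.c n r))
     ≈⟨ sum-cong L (λ r _ → trans (sum-cong L (λ n _ → solve 5 (λ v s d f i → v :* (s :* d :* f :* i) := s :* d :* f :* (v :* i)) refl _ _ _ _ _)) (sym (sum-*ˡ L _ _))) ⟩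
    sum L (λ r → sg r * D r * (o - qp (suc r) * qp (suc r)) * M v r) ∎))
    (≡[]-sum L (λ r _ → ≡[]-trans (≡[]-*ˡ _ (Limits.Confluent.M-v L r)) (≈⇒≡[] (value r))))
    where
    v : ℕ → Carrier
    v n = sg n * (tq (suc n) * poch n)
    value : ∀ r → sg r * D r * (o - qp (suc r) * qp (suc r)) * (sg r * tq (suc r) * geo r)
       ≈ sum (suc r) (λ t → sum K2 (λ ε → qp (conjExponent r t ε)))
    value r = begin
     sg r * D r * (o - x * x) * (sg r * tq (suc r) * geo r)
      ≈⟨ using2 (sg-sq r) (geo-inv r) (solve 5 (λ s D x t g → s :* D :* (c1 :- x :* x) :* (s :* t :* g) := t :* (c1 :+ x) :* D
         :+ (D :* (c1 :- x :* x) :* t :* g) :* (s :* s :- c1) :+ (D :* (c1 :+ x) :* t) :* (g :* (c1 :- x) :- c1)) refl (sg r) (D r) x (tq (suc r)) (geo r)) ⟩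
     tq (suc r) * (o + x) * D r
      ≈⟨ trans (*-congˡ (D-sum r)) (sum-*ˡ (suc r) _ _) ⟩
     sum (suc r) (λ t → tq (suc r) * (o + x) * qp (dExp t (r ℕ.∸ t)))
      ≈⟨ sum-cong (suc r) (λ t _ → term t) ⟩
     _ ∎
     where
     x = qp (suc r)
     term : ∀ t → tq (suc r) * (o + x) * qp (dExp t (r ℕ.∸ t)) ≈ sum K2 (λ ε → qp (conjExponent r t ε))
     term t = sym (trans (trans (sum-K2 _) (+-cong (trans (qp-+ (e ℕ.+ tri (suc r)) 0) (*-congʳ (qp-+ e (tri (suc r)))))
      (trans (qp-+ (e ℕ.+ tri (suc r)) (1 ℕ.* suc r)) (*-cong (qp-+ e (tri (suc r))) (qp-≡ (ℕP.*-identityˡ (suc r)))))))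
      (trans (solve 3 (λ a t x → a :* t :* c1 :+ a :* t :* x := t :* (c1 :+ x) :* a) refl (qp e) (qp (tri (suc r))) x)
       (*-congʳ (*-congʳ (sym (tq-tri (suc r)))))))
      where
      e = dExp t (r ℕ.∸ t)

   evens tails conj : Carrier
   evens = over (λ j δ d → even (idx j δ ℕ.+ d) * qp (exponent j δ d))
   tails = over tail
   conj  = sum L (λ r → sum (suc r) (λ t → sum K2 (λ ε → qp (conjExponent r t ε))))

   -- On the principal exponents the two sums add to 1 + (-1)^(r+d), which is 0 or 2, and the tails
   -- already carry a 2. The remaining sign multiplies an even quantity and is therefore invisible
   -- modulo 4.
   signs-irrelevant : over (λ j δ d → sg j * sg δ * sg (idx j δ ℕ.+ d) * qp (exponent j δ d)) + over (λ j δ d → sg j * sg δ * (qp (exponent j δ d) + two * tail j δ d))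
            ≡4 two * (evens + tails)
   signs-irrelevant = ≡4-trans (≈⇒≡4 (sym (over-+ _ _))) (≡4-trans (over-≡4 term)
    (≈⇒≡4 (trans (over-* two _) (*-congˡ (over-+ _ _)))))
    where
    term : ∀ j δ d → sg j * sg δ * sg (idx j δ ℕ.+ d) * qp (exponent j δ d) + sg j * sg δ * (qp (exponent j δ d) + two * tail j δ d)
       ≡4 two * (even (idx j δ ℕ.+ d) * qp (exponent j δ d) + tail j δ d)
    term j δ d = four (- ((odd j + odd δ - two * odd j * odd δ) * (even n * e + T)))
     (using1 (sg-odd n) (trans (+-cong (*-congʳ (*-congʳ (*-cong (sg-odd j) (sg-odd δ)))) (*-congʳ (*-cong (sg-odd j) (sg-odd δ))))
      (solve 6 (λ a b x s e T → let t = c1 :+ c1 ; j = c1 :- t :* a ; δ = c1 :- t :* b in j :* δ :* s :* e :+ j :* δ :* (e :+ t :* T)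
       := t :* ((c1 :- x) :* e :+ T) :+ t :* t :* (:- ((a :+ b :- t :* a :* b) :* ((c1 :- x) :* e :+ T))) :+ (j :* δ :* e) :* (s :- (c1 :- t :* x)))
       refl (odd j) (odd δ) (odd n) (sg n) e T)))
     where
     n = idx j δ ℕ.+ d
     e = qp (exponent j δ d)
     T = tail j δ d

   record Expanded : Set where
    constructor expansion-of
    field
     rest h    : Carrier
     expansion : sum L s + conj ≈ two * (evens + tails) + two * two * h + qp L * rest

   private
    combine : ∀ {σ B c x} → σ ≡4 B → B ≡[ L ] x - c → ∀ {y} → x ≡4 y → ∃ λ rest → ∃ λ h → σ + c ≈ y + two * two * h + qp L * rest
    combine {σ} {B} {c} {x} (four h1 e1) (k QAlgebra., e2) {y} (four h2 e3) = k ,, h1 + h2 ,,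
     trans (+-congʳ (trans e1 (+-congʳ (trans e2 (+-congʳ (+-congʳ e3))))))
      (solve 6 (λ x h2 c Q k h1 → let f = (c1 :+ c1) :* (c1 :+ c1) in
       (((x :+ f :* h2) :- c) :+ Q :* k) :+ f :* h1 :+ c := x :+ f :* (h1 :+ h2) :+ Q :* k) refl y h2 c (qp L) k h1)

   expanded : Expanded
   expanded = let k ,, h ,, e = combine (alternate L) (≡[]-sub (≡[]-+ s-sum u-sum) alternating-u-sum) signs-irrelevant in expansion-of k h e

open QSeries

open import Data.Empty using (⊥; ⊥-elim)
open import Data.Fin.Base as Fin using (Fin; toℕ)
import Data.Fin.Properties as FinP
import Data.Integer.Properties as ℤP
import Data.Nat.Divisibility as ℕD
import Data.Nat.Properties as ℕP
open import Data.Nat.Induction using (<-wellFounded)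
open import Data.Nat.Primality using (Prime; euclidsLemma; prime?; prime[2]; ¬prime[0]; ¬prime[1]; prime⇒irreducible; prime⇒nonZero; prime⇒nonTrivial)
open import Data.Product.Base using (Σ; ∃; _×_; _,_; proj₁; proj₂)
open import Data.Sum.Base using (_⊎_; inj₁; inj₂)
open import Function.Base using (_∘_)
open import Function.Bundles using (_⇔_; mk⇔; Equivalence)
open import Induction.WellFounded using (Acc; acc)
open import Relation.Binary.Definitions using (DecidableEquality; tri<; tri≈; tri>)
open import Relation.Binary.PropositionalEquality hiding (J; [_])
open import Relation.Nullary using (¬_; Dec; yes; no)
open import Relation.Nullary.Decidable using (_×-dec_; _⊎-dec_; _→-dec_; ¬?; from-yes; from-no)
open import Relation.Unary using (Decidable)

-- Finite cardinalities and free involutions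

module Counting where

 open import Data.Nat.Base using (ℕ; zero; suc; _+_; _*_; _≤_; _<_; z≤n; s≤s; s≤s⁻¹)
 open import Data.Nat.Properties
 open import Data.Nat.Divisibility using (_∣_; divides)
 open import Data.List.Base using (List; []; _∷_; length; map; _++_; filter; upTo; [_])
 open import Data.List.Properties using (length-map; length-++; length-upTo)
 open import Data.List.Membership.Propositional using (_∈_)
 open import Data.List.Membership.Propositional.Properties
 open import Data.List.Relation.Unary.Any using (here; there)
 open import Data.List.Relation.Unary.All as All using (All; []; _∷_)
 open import Data.List.Relation.Unary.AllPairs using ([]; _∷_)
 open import Data.List.Relation.Unary.Unique.Propositional using (Unique)
 open import Data.List.Relation.Unary.Unique.Propositional.Properties using (++⁺; filter⁺; upTo⁺; Unique[x∷xs]⇒x∉xs)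
 open import Function.Base using (id)

 record Card {A : Set} (P : A → Set) (n : ℕ) : Set where
  field
   elems    : List A
   unique   : Unique elems
   size     : length elems ≡ n
   sound    : ∀ {x} → x ∈ elems → P x
   complete : ∀ {x} → P x → x ∈ elems

 open Card

 -- A list without repetitions is no longer than a list containing it.
 unique-⊆-length : ∀ {A : Set} {xs ys : List A} → Unique xs → (∀ {x} → x ∈ xs → x ∈ ys) → length xs ≤ length ys
 unique-⊆-length {xs = []}     _        _   = z≤n
 unique-⊆-length {xs = x ∷ xs} u@(_ ∷ u') sub with ∈-∃++ (sub (here refl))
 ... | as , bs , refl = subst (suc (length xs) ≤_) len (s≤s (unique-⊆-length u' sub'))
  where
  len : suc (length (as ++ bs)) ≡ length (as ++ [ x ] ++ bs)
  len = trans (cong suc (length-++ as)) (trans (sym (+-suc (length as) (length bs))) (sym (length-++ as)))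
  sub' : ∀ {y} → y ∈ xs → y ∈ as ++ bs
  sub' y∈xs with ∈-++⁻ as (sub (there y∈xs))
  ... | inj₁ y∈as          = ∈-++⁺ˡ y∈as
  ... | inj₂ (here refl)   = ⊥-elim (Unique[x∷xs]⇒x∉xs u y∈xs)
  ... | inj₂ (there y∈bs)  = ∈-++⁺ʳ as y∈bs

 private
  map-unique : ∀ {A B : Set} {P : A → Set} (f : A → B) → (∀ {x y} → P x → P y → f x ≡ f y → x ≡ y) →
         ∀ xs → (∀ {x} → x ∈ xs → P x) → Unique xs → Unique (map f xs)
  map-unique f inj []       _  _        = []
  map-unique f inj (x ∷ xs) ps (x∉ ∷ u) = fresh xs x∉ (ps ∘ there) ∷ map-unique f inj xs (ps ∘ there) u
   where
   fresh : ∀ ys → All (x ≢_) ys → (∀ {y} → y ∈ ys → _) → All (f x ≢_) (map f ys)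
   fresh []       _          _  = []
   fresh (y ∷ ys) (x≢y ∷ xs≢) qs = (λ e → x≢y (inj (ps (here refl)) (qs (here refl)) e)) ∷ fresh ys xs≢ (qs ∘ there)

 card-≤ : ∀ {A B : Set} {P : A → Set} {Q : B → Set} {m n} → Card P m → Card Q n → (f : A → B) → (∀ {x} → P x → Q (f x)) → (∀ {x y} → P x → P y → f x ≡ f y → x ≡ y) → m ≤ n
 card-≤ {P = P} c d f to inj = subst₂ _≤_ (trans (length-map f (elems c)) (size c)) (size d)
  (unique-⊆-length (map-unique {P = P} f inj (elems c) (sound c) (unique c)) sub)
  where
  sub : ∀ {y} → y ∈ map f (elems c) → y ∈ elems d
  sub y∈ with ∈-map⁻ f y∈
  ... | x , x∈ , refl = complete d (to (sound c x∈))

 card-≡ : ∀ {A B : Set} {P : A → Set} {Q : B → Set} {m n} → Card P m → Card Q n → (f : A → B) (g : B → A) → (∀ {x} → P x → Q (f x)) → (∀ {y} → Q y → P (g y)) →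
      (∀ {x} → P x → g (f x) ≡ x) → (∀ {y} → Q y → f (g y) ≡ y) → m ≡ n
 card-≡ c d f g to from gf fg = ≤-antisym
  (card-≤ c d f to (λ px py e → trans (sym (gf px)) (trans (cong g e) (gf py))))
  (card-≤ d c g from (λ px py e → trans (sym (fg px)) (trans (cong f e) (fg py))))

 card-unique : ∀ {A : Set} {P : A → Set} {m n} → Card P m → Card P n → m ≡ n
 card-unique c d = card-≡ c d id id id id (λ _ → refl) (λ _ → refl)

 -- Transport along a bijection.
 card-map : ∀ {A B : Set} {P : A → Set} {Q : B → Set} {n} → Card P n → (f : A → B) (g : B → A) → (∀ {x} → P x → Q (f x)) → (∀ {y} → Q y → P (g y)) →
       (∀ {x} → P x → g (f x) ≡ x) → (∀ {y} → Q y → f (g y) ≡ y) → Card Q n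
 card-map {P = P} {Q = Q} c f g to from gf fg = record
  { elems = map f (elems c)
  ; unique = map-unique {P = P} f (λ px py e → trans (sym (gf px)) (trans (cong g e) (gf py))) (elems c) (sound c) (unique c)
  ; size = trans (length-map f (elems c)) (size c)
  ; sound = λ y∈ → let x , x∈ , e = ∈-map⁻ f y∈ in subst Q (sym e) (to (sound c x∈))
  ; complete = λ {y} qy → subst (_∈ map f (elems c)) (fg qy) (∈-map⁺ f (complete c (from qy)))
  }

 -- A bijection given by an injective map and a choice of preimages.
 card-image : ∀ {A B : Set} {P : A → Set} {Q : B → Set} {n} → Card P n → (f : A → B) → (∀ {x} → P x → Q (f x)) →
        (∀ {x y} → P x → P y → f x ≡ f y → x ≡ y) → (∀ {y} → Q y → ∃ λ x → P x × f x ≡ y) → Card Q n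
 card-image {P = P} {Q = Q} c f to inj onto = record
  { elems = map f (elems c)
  ; unique = map-unique {P = P} f inj (elems c) (sound c) (unique c)
  ; size = trans (length-map f (elems c)) (size c)
  ; sound = λ y∈ → let x , x∈ , e = ∈-map⁻ f y∈ in subst Q (sym e) (to (sound c x∈))
  ; complete = λ qy → let x , px , e = onto qy in subst (_∈ map f (elems c)) e (∈-map⁺ f (complete c px))
  }

 card-⇔ : ∀ {A : Set} {P Q : A → Set} {n} → Card P n → (∀ {x} → P x → Q x) → (∀ {x} → Q x → P x) → Card Q n
 card-⇔ c to from = record { elems = elems c ; unique = unique c ; size = size c ; sound = to ∘ sound c ; complete = complete c ∘ from }

 card-0 : ∀ {A : Set} {P : A → Set} → (∀ {x} → ¬ P x) → Card P 0
 card-0 none = record { elems = [] ; unique = [] ; size = refl ; sound = λ () ; complete = ⊥-elim ∘ none }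

 card-1 : ∀ {A : Set} {P : A → Set} (x : A) → P x → (∀ {y} → P y → y ≡ x) → Card P 1
 card-1 {P = P} x px only = record
  { elems = x ∷ [] ; unique = [] ∷ [] ; size = refl
  ; sound = λ { (here refl) → px } ; complete = λ py → here (only py) }

 card-suc⁻ : ∀ {A : Set} {P : A → Set} {n} → Card P (suc n) → ∃ P
 card-suc⁻ c with elems c | size c | sound c
 ... | x ∷ xs | _ | s = x , s (here refl)

 card-filter : ∀ {A : Set} {P Q : A → Set} {n} → Card P n → Decidable Q → ∃ λ k → Card (λ x → P x × Q x) k
 card-filter c Q? = _ , record
  { elems = filter Q? (elems c) ; unique = filter⁺ Q? (unique c) ; size = refl
  ; sound = λ x∈ → let x∈' , q = ∈-filter⁻ Q? x∈ in sound c x∈' , q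
  ; complete = λ (p , q) → ∈-filter⁺ Q? (complete c p) q }

 card-⊎ : ∀ {A : Set} {P Q : A → Set} {m n} → Card P m → Card Q n → (∀ {x} → P x → ¬ Q x) → Card (λ x → P x ⊎ Q x) (m + n)
 card-⊎ c d disj = record
  { elems = elems c ++ elems d
  ; unique = ++⁺ (unique c) (unique d) (λ (p , q) → disj (sound c p) (sound d q))
  ; size = trans (length-++ (elems c)) (cong₂ _+_ (size c) (size d))
  ; sound = λ x∈ → case-∈ (∈-++⁻ (elems c) x∈)
  ; complete = λ { (inj₁ p) → ∈-++⁺ˡ (complete c p) ; (inj₂ q) → ∈-++⁺ʳ (elems c) (complete d q) } }
  where
  case-∈ : ∀ {x} → x ∈ elems c ⊎ x ∈ elems d → _
  case-∈ (inj₁ p) = inj₁ (sound c p)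
  case-∈ (inj₂ q) = inj₂ (sound d q)

 card-split : ∀ {A : Set} {P Q : A → Set} {n} → Card P n → Decidable Q → ∃ λ a → ∃ λ b → Card (λ x → P x × Q x) a × Card (λ x → P x × ¬ Q x) b × a + b ≡ n
 card-split {P = P} {Q = Q} c Q? with card-filter c Q? | card-filter c (¬? ∘ Q?)
 ... | a , ca | b , cb = a , b , ca , cb , card-unique
  (card-⇔ (card-⊎ ca cb (λ (_ , q) (_ , ¬q) → ¬q q)) (λ { (inj₁ (p , _)) → p ; (inj₂ (p , _)) → p }) split) c
  where
  split : ∀ {x} → P x → (P x × Q x) ⊎ (P x × ¬ Q x)
  split {x} p with Q? x
  ... | yes q = inj₁ (p , q)
  ... | no ¬q = inj₂ (p , ¬q)

 card-< : ∀ L → Card (_< L) L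
 card-< L = record { elems = upTo L ; unique = upTo⁺ L ; size = length-upTo L ; sound = ∈-upTo⁻ ; complete = ∈-upTo⁺ }

 sumℕ : ℕ → (ℕ → ℕ) → ℕ
 sumℕ zero    f = 0
 sumℕ (suc L) f = sumℕ L f + f L

 card-sum : ∀ {B : Set} L {Q : ℕ → B → Set} {k : ℕ → ℕ} → (∀ j → j < L → Card (Q j) (k j)) →
       Card (λ ((j , y) : ℕ × B) → j < L × Q j y) (sumℕ L k)
 card-sum zero    c = card-0 λ ()
 card-sum (suc L) {Q} c = card-⇔ (card-⊎ (card-sum L (λ j j<L → c j (m≤n⇒m≤1+n j<L)))
   (card-map {Q = λ (j , y) → j ≡ L × Q j y} (c L ≤-refl) (L ,_) proj₂ (refl ,_) (λ { (refl , q) → q }) (λ _ → refl) (λ { (refl , _) → refl }))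
   (λ { (j<L , _) (refl , _) → <-irrefl refl j<L }))
  (λ { (inj₁ (j<L , q)) → m≤n⇒m≤1+n j<L , q ; (inj₂ (refl , q)) → ≤-refl , q })
  (λ { {j , _} (j<1+L , q) → back j<1+L q })
  where
  back : ∀ {j y} → j < suc L → Q j y → (j < L × Q j y) ⊎ (j ≡ L × Q j y)
  back j<1+L q with m≤n⇒m<n∨m≡n (s≤s⁻¹ j<1+L)
  ... | inj₁ j<L  = inj₁ (j<L , q)
  ... | inj₂ refl = inj₂ (refl , q)

 sumℕ-const : ∀ L c → sumℕ L (λ _ → c) ≡ L * c
 sumℕ-const zero    c = refl
 sumℕ-const (suc L) c = trans (cong (_+ c) (sumℕ-const L c)) (+-comm (L * c) c)

 card-remove : ∀ {A : Set} {P : A → Set} {n} → DecidableEquality A → Card P (suc n) → ∀ {x} → P x → Card (λ y → P y × y ≢ x) n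
 card-remove {P = P} {n = n} _≟_ c {x} px with card-split c (_≟ x)
 ... | a , b , ca , cb , a+b≡n with card-unique ca (card-1 x (px , refl) proj₂)
 ... | refl = subst (Card _) (suc-injective a+b≡n) cb

 remove-many : ∀ {A : Set} {P : A → Set} {n} → DecidableEquality A → Card P n → ∀ {x} → P x → ∃ λ n' → n ≡ suc n' × Card (λ y → P y × y ≢ x) n'
 remove-many {n = zero}  _≟_ c px with elems c | size c | complete c px
 ... | [] | _ | ()
 remove-many {n = suc n} _≟_ c px = n , refl , card-remove _≟_ c px

 module Involution {A : Set} (_≟_ : DecidableEquality A) where

  -- Strong induction on the cardinality, deleting one orbit {x, τ x} at a time.
  2∣-free : ∀ {P : A → Set} {n} → Card P n → (τ : A → A) → (∀ {x} → P x → P (τ x)) → (∀ {x} → P x → τ (τ x) ≡ x) →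
       (∀ {x} → P x → τ x ≢ x) → 2 ∣ n
  2∣-free {n = n} c τ = go n (<-wellFounded n) c
   where
   go : ∀ {P : A → Set} n → Acc _<_ n → Card P n → (∀ {x} → P x → P (τ x)) → (∀ {x} → P x → τ (τ x) ≡ x) → (∀ {x} → P x → τ x ≢ x) → 2 ∣ n
   go zero    _        c cl inv free = divides 0 refl
   go (suc n) (acc rs) c cl inv free with card-suc⁻ c
   ... | x , px with remove-many _≟_ (card-remove _≟_ c px) (cl px , free px)
   ... | n' , refl , c' with go n' (rs (s≤s (n≤1+n n'))) c'
      (λ ((p , y≢x) , y≢τx) → (cl p , λ e → y≢τx (trans (sym (inv p)) (cong τ e))) , λ e → y≢x (trans (sym (inv p)) (trans (cong τ e) (inv px))))
      (inv ∘ proj₁ ∘ proj₁) (free ∘ proj₁ ∘ proj₁)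
   ...   | divides q eq = divides (suc q) (cong (suc ∘ suc) eq)

  -- τ is a free involution and σ induces a free involution on the τ-orbits.
  record FourFold (P : A → Set) (τ σ : A → A) : Set where
   field
    τ-closed : ∀ {x} → P x → P (τ x)
    σ-closed : ∀ {x} → P x → P (σ x)
    τ-inv    : ∀ {x} → P x → τ (τ x) ≡ x
    commute  : ∀ {x} → P x → σ (τ x) ≡ τ (σ x)
    σ-square : ∀ {x} → P x → σ (σ x) ≡ x ⊎ σ (σ x) ≡ τ x
    τ-free   : ∀ {x} → P x → τ x ≢ x
    σ-free   : ∀ {x} → P x → σ x ≢ x
    σ≢τ      : ∀ {x} → P x → σ x ≢ τ x

  -- Each round deletes the four distinct elements x, τ x, σ x, τ (σ x). As `σ-square` allows both
  -- σ² = 1 and σ² = τ, the argument covers the Klein group and the cyclic group of order 4.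
  4∣-free : ∀ {P : A → Set} {n τ σ} → Card P n → FourFold P τ σ → 4 ∣ n
  4∣-free {n = n} {τ} {σ} c = go n (<-wellFounded n) c
   where
   go : ∀ {P : A → Set} n → Acc _<_ n → Card P n → FourFold P τ σ → 4 ∣ n
   go zero    _        c ff = divides 0 refl
   go {P} (suc n) (acc rs) c ff with card-suc⁻ c
   ... | x , px = shrink
    where
    open FourFold ff
    x1 = τ x
    x2 = σ x
    x3 = τ (σ x)
    p2 = σ-closed px
    τx3 : τ x3 ≡ x2
    τx3 = τ-inv p2
    x2≢x : x2 ≢ x
    x2≢x = σ-free px
    x3≢x : x3 ≢ x
    x3≢x e = σ≢τ px (trans (sym τx3) (cong τ e))
    x3≢x1 : x3 ≢ x1
    x3≢x1 e = σ-free px (trans (sym τx3) (trans (cong τ e) (τ-inv px)))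
    Rest : A → Set
    Rest y = (((P y × y ≢ x) × y ≢ x1) × y ≢ x2) × y ≢ x3
    restP : ∀ {y} → Rest y → P y
    restP = proj₁ ∘ proj₁ ∘ proj₁ ∘ proj₁
    τ-flip : ∀ {y z} → P y → τ y ≡ z → y ≡ τ z
    τ-flip p e = trans (sym (τ-inv p)) (cong τ e)
    σ-flip : ∀ {y z} → P y → σ y ≡ z → y ≡ σ z ⊎ y ≡ τ (σ z)
    σ-flip p e with σ-square p
    ... | inj₁ s = inj₁ (trans (sym s) (cong σ e))
    ... | inj₂ s = inj₂ (τ-flip p (trans (sym s) (cong σ e)))
    σx1 : σ x1 ≡ x3
    σx1 = commute px
    σx2 : σ x2 ≡ x ⊎ σ x2 ≡ x1
    σx2 = σ-square px
    σx3 : σ x3 ≡ x ⊎ σ x3 ≡ x1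
    σx3 with σx2
    ... | inj₁ e = inj₂ (trans (commute p2) (cong τ e))
    ... | inj₂ e = inj₁ (trans (commute p2) (trans (cong τ e) (τ-inv px)))
    rest-τ : ∀ {y} → Rest y → Rest (τ y)
    rest-τ ((((p , n0) , n1) , n2) , n3) = (((τ-closed p , (λ e → n1 (τ-flip p e))) , (λ e → n0 (trans (τ-flip p e) (τ-inv px)))) ,
     (λ e → n3 (τ-flip p e))) , (λ e → n2 (trans (τ-flip p e) τx3))
    rest-σ : ∀ {y} → Rest y → Rest (σ y)
    rest-σ {y} ((((p , n0) , n1) , n2) , n3) = (((σ-closed p , c0) , c1) , c2) , c3
     where
     c0 : σ y ≢ x
     c0 e with σ-flip p e
     ... | inj₁ e' = n2 e'
     ... | inj₂ e' = n3 e'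
     c1 : σ y ≢ x1
     c1 e with σ-flip p e
     ... | inj₁ e' = n3 (trans e' σx1)
     ... | inj₂ e' = n2 (trans e' (trans (cong τ σx1) τx3))
     c2 : σ y ≢ x2
     c2 e with σ-flip p e | σx2
     ... | inj₁ e' | inj₁ s = n0 (trans e' s)
     ... | inj₁ e' | inj₂ s = n1 (trans e' s)
     ... | inj₂ e' | inj₁ s = n1 (trans e' (cong τ s))
     ... | inj₂ e' | inj₂ s = n0 (trans e' (trans (cong τ s) (τ-inv px)))
     c3 : σ y ≢ x3
     c3 e with σ-flip p e | σx3
     ... | inj₁ e' | inj₁ s = n0 (trans e' s)
     ... | inj₁ e' | inj₂ s = n1 (trans e' s)
     ... | inj₂ e' | inj₁ s = n1 (trans e' (cong τ s))
     ... | inj₂ e' | inj₂ s = n0 (trans e' (trans (cong τ s) (τ-inv px)))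
    rest : FourFold Rest τ σ
    rest = record
     { τ-closed = rest-τ ; σ-closed = rest-σ ; τ-inv = τ-inv ∘ restP ; commute = commute ∘ restP ; σ-square = σ-square ∘ restP
     ; τ-free = τ-free ∘ restP ; σ-free = σ-free ∘ restP ; σ≢τ = σ≢τ ∘ restP }
    shrink : 4 ∣ suc n
    shrink with remove-many _≟_ (card-remove _≟_ c px) (τ-closed px , τ-free px)
    ... | n1 , refl , c1 with remove-many _≟_ c1 ((p2 , x2≢x) , σ≢τ px)
    ... | n2 , refl , c2 with remove-many _≟_ c2 (((τ-closed p2 , x3≢x) , x3≢x1) , τ-free p2)
    ... | n3 , refl , c3 with go n3 (rs (s≤s (m≤n⇒m≤1+n (m≤n⇒m≤1+n (n≤1+n n3))))) c3 rest
    ... | divides k eq = divides (suc k) (cong (λ z → suc (suc (suc (suc z)))) eq)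

-- The ring of integer power series

module PowerSeries where

 open import Data.Nat.Base as ℕ using (ℕ; zero; suc; s≤s; z≤n; s≤s⁻¹)
 open import Data.Integer.Base as ℤ using (ℤ; 0ℤ; 1ℤ)
 open import Data.Integer.Tactic.RingSolver using (solve-∀)
 open import Data.Maybe.Base using (just; nothing)
 open import Algebra.Bundles using (CommutativeRing)
 open import Algebra.Solver.Ring.AlmostCommutativeRing using (fromCommutativeRing; _-Raw-AlmostCommutative⟶_)
 open import Level using (0ℓ)
 open import Relation.Binary.Definitions using (WeaklyDecidable)
 open import Relation.Nullary.Decidable using (yes; no)

 PS : Set
 PS = ℕ → ℤ

 infix 4 _≐_
 _≐_ : PS → PS → Set
 f ≐ g = ∀ n → f n ≡ g n

 tail : PS → PS
 tail f n = f (suc n)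

 -- The Cauchy product recurses on the tail of its first factor, which makes the ring laws
 -- inductions on the coefficient index.
 add mul : PS → PS → PS
 add f g n = f n ℤ.+ g n
 mul f g zero    = f 0 ℤ.* g 0
 mul f g (suc n) = f 0 ℤ.* g (suc n) ℤ.+ mul (tail f) g n

 const : ℤ → PS
 const c zero    = c
 const c (suc n) = 0ℤ

 private
  mul-congTo : ∀ n {f f' g g' : PS} → (∀ k → k ℕ.≤ n → f k ≡ f' k) → (∀ k → k ℕ.≤ n → g k ≡ g' k) →
         mul f g n ≡ mul f' g' n
  mul-congTo zero    p q = cong₂ ℤ._*_ (p 0 z≤n) (q 0 z≤n)
  mul-congTo (suc n) p q = cong₂ ℤ._+_ (cong₂ ℤ._*_ (p 0 z≤n) (q (suc n) ℕP.≤-refl))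
   (mul-congTo n (λ k k≤n → p (suc k) (s≤s k≤n)) (λ k k≤n → q k (ℕP.m≤n⇒m≤1+n k≤n)))

  mul-cong : ∀ {f f' g g'} → f ≐ f' → g ≐ g' → mul f g ≐ mul f' g'
  mul-cong p q n = mul-congTo n (λ k _ → p k) (λ k _ → q k)

  mul-sucʳ : ∀ f g n → mul f g (suc n) ≡ mul f (tail g) n ℤ.+ f (suc n) ℤ.* g 0
  mul-sucʳ f g zero    = refl
  mul-sucʳ f g (suc n) = trans (cong (λ z → f 0 ℤ.* g (suc (suc n)) ℤ.+ z) (mul-sucʳ (tail f) g n))
   (sym (ℤP.+-assoc (f 0 ℤ.* g (suc (suc n))) (mul (tail f) (tail g) n) (f (suc (suc n)) ℤ.* g 0)))

  mul-comm : ∀ f g → mul f g ≐ mul g f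
  mul-comm f g zero    = ℤP.*-comm (f 0) (g 0)
  mul-comm f g (suc n) = trans (mul-sucʳ f g n) (trans (ℤP.+-comm (mul f (tail g) n) (f (suc n) ℤ.* g 0))
   (cong₂ ℤ._+_ (ℤP.*-comm (f (suc n)) (g 0)) (mul-comm f (tail g) n)))

  mul-distribʳ : ∀ h f g → mul (add f g) h ≐ add (mul f h) (mul g h)
  mul-distribʳ h f g zero    = ℤP.*-distribʳ-+ (h 0) (f 0) (g 0)
  mul-distribʳ h f g (suc n) = trans (cong (λ z → (f 0 ℤ.+ g 0) ℤ.* h (suc n) ℤ.+ z) (mul-distribʳ h (tail f) (tail g) n))
   (lem (f 0) (g 0) (h (suc n)) (mul (tail f) h n) (mul (tail g) h n))
   where
   lem : ∀ a b c x y → (a ℤ.+ b) ℤ.* c ℤ.+ (x ℤ.+ y) ≡ (a ℤ.* c ℤ.+ x) ℤ.+ (b ℤ.* c ℤ.+ y)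
   lem = solve-∀

  mul-distribˡ : ∀ h f g → mul h (add f g) ≐ add (mul h f) (mul h g)
  mul-distribˡ h f g n = trans (mul-comm h (add f g) n)
   (trans (mul-distribʳ h f g n) (cong₂ ℤ._+_ (mul-comm f h n) (mul-comm g h n)))

  scale : ∀ c f g n → mul (λ k → c ℤ.* f k) g n ≡ c ℤ.* mul f g n
  scale c f g zero    = ℤP.*-assoc c (f 0) (g 0)
  scale c f g (suc n) = trans (cong (λ z → c ℤ.* f 0 ℤ.* g (suc n) ℤ.+ z) (scale c (tail f) g n)) (lem c (f 0) (g (suc n)) (mul (tail f) g n))
   where
   lem : ∀ c a b x → (c ℤ.* a) ℤ.* b ℤ.+ c ℤ.* x ≡ c ℤ.* (a ℤ.* b ℤ.+ x)
   lem = solve-∀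

  mul-assoc : ∀ f g h → mul (mul f g) h ≐ mul f (mul g h)
  mul-assoc f g h zero    = ℤP.*-assoc (f 0) (g 0) (h 0)
  mul-assoc f g h (suc n) = trans
   (cong (λ z → f 0 ℤ.* g 0 ℤ.* h (suc n) ℤ.+ z) (trans (mul-distribʳ h (λ k → f 0 ℤ.* g (suc k)) (mul (tail f) g) n)
    (cong₂ ℤ._+_ (scale (f 0) (tail g) h n) (mul-assoc (tail f) g h n))))
   (lem (f 0) (g 0) (h (suc n)) (mul (tail g) h n) (mul (tail f) (mul g h) n))
   where
   lem : ∀ a b c x y → (a ℤ.* b) ℤ.* c ℤ.+ (a ℤ.* x ℤ.+ y) ≡ a ℤ.* (b ℤ.* c ℤ.+ x) ℤ.+ y
   lem = solve-∀

  zero-mul : ∀ f → mul (λ _ → 0ℤ) f ≐ (λ _ → 0ℤ)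
  zero-mul f zero    = refl
  zero-mul f (suc n) = trans (ℤP.+-identityˡ _) (zero-mul f n)

 const-mul : ∀ c f n → mul (const c) f n ≡ c ℤ.* f n
 const-mul c f zero    = refl
 const-mul c f (suc n) = trans (cong (λ z → c ℤ.* f (suc n) ℤ.+ z) (zero-mul f n)) (ℤP.+-identityʳ _)

 private
  one-mul : ∀ f → mul (const 1ℤ) f ≐ f
  one-mul f n = trans (const-mul 1ℤ f n) (ℤP.*-identityˡ (f n))

 series : CommutativeRing 0ℓ 0ℓ
 series = record
  { Carrier = PS ; _≈_ = _≐_ ; _+_ = add ; _*_ = mul ; -_ = λ f n → ℤ.- f n
  ; 0# = λ _ → 0ℤ ; 1# = const 1ℤ
  ; isCommutativeRing = record
   { *-comm = mul-comm
   ; isRing = record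
    { *-cong = mul-cong ; *-assoc = mul-assoc
    ; *-identity = one-mul , λ f n → trans (mul-comm f (const 1ℤ) n) (one-mul f n)
    ; distrib = mul-distribˡ , mul-distribʳ
    ; +-isAbelianGroup = record
     { comm = λ f g n → ℤP.+-comm (f n) (g n)
     ; isGroup = record
      { inverse = (λ f n → ℤP.+-inverseˡ (f n)) , λ f n → ℤP.+-inverseʳ (f n)
      ; ⁻¹-cong = λ p n → cong ℤ.-_ (p n)
      ; isMonoid = record
       { identity = (λ f n → ℤP.+-identityˡ (f n)) , λ f n → ℤP.+-identityʳ (f n)
       ; isSemigroup = record
        { assoc = λ f g h n → ℤP.+-assoc (f n) (g n) (h n)
        ; isMagma = record
         { ∙-cong = λ p q n → cong₂ ℤ._+_ (p n) (q n)
         ; isEquivalence = record { refl = λ _ → refl ; sym = λ p n → sym (p n) ; trans = λ p q n → trans (p n) (q n) }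
         } } } } } } }
  }

 const-homo : CommutativeRing.rawRing ℤP.+-*-commutativeRing -Raw-AlmostCommutative⟶ fromCommutativeRing series
 const-homo = record
  { ⟦_⟧    = const
  ; +-homo = λ { a b zero → refl ; a b (suc n) → refl }
  ; *-homo = λ { a b zero → refl ; a b (suc n) → sym (trans (const-mul a (const b) (suc n)) (ℤP.*-zeroʳ a)) }
  ; -‿homo = λ { a zero → refl ; a (suc n) → refl }
  ; 0-homo = λ { zero → refl ; (suc n) → refl }
  ; 1-homo = λ n → refl
  }

 const-≟ : WeaklyDecidable (λ a b → const a ≐ const b)
 const-≟ a b with a ℤP.≟ b
 ... | yes a≡b = just (λ n → cong (λ c → const c n) a≡b)
 ... | no  _   = nothing

 X : ℕ → PS
 X zero    = const 1ℤ
 X (suc k) zero    = 0ℤ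
 X (suc k) (suc n) = X k n

 shiftBy : ℕ → PS → PS
 shiftBy zero    f n       = f n
 shiftBy (suc k) f zero    = 0ℤ
 shiftBy (suc k) f (suc n) = shiftBy k f n

 X-mul : ∀ k f → mul (X k) f ≐ shiftBy k f
 X-mul zero    f n       = one-mul f n
 X-mul (suc k) f zero    = refl
 X-mul (suc k) f (suc n) = trans (ℤP.+-identityˡ _) (X-mul k f n)

 shiftBy-< : ∀ k f n → n ℕ.< k → shiftBy k f n ≡ 0ℤ
 shiftBy-< (suc k) f zero    _   = refl
 shiftBy-< (suc k) f (suc n) n<k = shiftBy-< k f n (s≤s⁻¹ n<k)

 X-mul-small : ∀ {L} k f → L ℕ.≤ k → ∀ n → n ℕ.< L → mul (X k) f n ≡ 0ℤ
 X-mul-small k f L≤k n n<L = trans (X-mul k f n) (shiftBy-< k f n (ℕP.<-≤-trans n<L L≤k))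

 shiftBy-X : ∀ k j → shiftBy k (X j) ≐ X (k ℕ.+ j)
 shiftBy-X zero    j n       = refl
 shiftBy-X (suc k) j zero    = refl
 shiftBy-X (suc k) j (suc n) = shiftBy-X k j n

 X-+ : ∀ k j → X (k ℕ.+ j) ≐ mul (X k) (X j)
 X-+ k j n = trans (sym (shiftBy-X k j n)) (sym (X-mul k (X j) n))

 module PSRing = CommutativeRing series

 module PSSolver where
  open import Algebra.Solver.Ring (CommutativeRing.rawRing ℤP.+-*-commutativeRing) (fromCommutativeRing series)
   const-homo const-≟ public

-- Coefficients of σ(q) as cardinalities

module Coefficients where

 open import Defs
 open PowerSeries
 open Exponents using (idx; exponent; conjExponent)
 open Counting
 open import Data.Nat.Base as ℕ using (ℕ; zero; suc; z≤n; s≤s; s≤s⁻¹)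
 open import Data.Nat.DivMod using (m*n/n≡m)
 import Data.Nat.Tactic.RingSolver as ℕ-RingSolver
 open import Data.Nat.Divisibility using (_∣_; _∣?_; ∣m+n∣m⇒∣n; ∣m∣n⇒∣m+n; ∣-refl; ∣⇒≤; _∣0)
 open import Data.Nat.ListAction.Properties using (sum-++)
 import Data.Nat.ListAction as ListAction
 open import Data.Integer.Base as ℤ using (ℤ; +_; 1ℤ)
 open import Data.Integer.Tactic.RingSolver using () renaming (solve-∀ to ring)
 open import Data.Bool.Base using (if_then_else_)
 open import Data.List.Base using (upTo; map; applyUpTo; _∷_; [])
 open import Data.List.Properties using (upTo-∷ʳ; map-++; map-upTo)
 open import Data.Unit.Base using (⊤; tt)
 open import Relation.Nullary.Decidable using (⌊_⌋)

 ι : (ℕ → ℕ) → PS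
 ι f n = + f n

 module QA = QAlgebra series const-homo (X 1)

 qp-X : ∀ k → QA.qp k ≐ X k
 qp-X zero    n = refl
 qp-X (suc k) n = trans (PSRing.*-congˡ {x = X 1} (qp-X k) n) (sym (X-+ 1 k n))

 indicator : ℕ → ℕ → ℕ
 indicator e n = if ⌊ n ℕP.≟ e ⌋ then 1 else 0

 X-indicator : ∀ e n → X e n ≡ + indicator e n
 X-indicator zero    zero    = refl
 X-indicator zero    (suc n) = refl
 X-indicator (suc e) zero    = refl
 X-indicator (suc e) (suc n) = trans (X-indicator e n) (cong +_ lem)
  where
  lem : indicator e n ≡ indicator (suc e) (suc n)
  lem with n ℕP.≟ e | suc n ℕP.≟ suc e
  ... | yes _ | yes _ = refl
  ... | yes p | no ¬p = ⊥-elim (¬p (cong suc p))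
  ... | no ¬p | yes p = ⊥-elim (¬p (ℕP.suc-injective p))
  ... | no _  | no _  = refl

 geometricℕ : ℕ → ℕ → ℕ
 geometricℕ k n = if ⌊ suc k ∣? n ⌋ then 1 else 0

 geometric : ℕ → PS
 geometric k = ι (geometricℕ k)

 private
  divides-shift : ∀ k m → geometricℕ k (suc k ℕ.+ m) ≡ geometricℕ k m
  divides-shift k m with suc k ∣? suc k ℕ.+ m | suc k ∣? m
  ... | yes _ | yes _ = refl
  ... | yes p | no ¬p = ⊥-elim (¬p (∣m+n∣m⇒∣n p ∣-refl))
  ... | no ¬p | yes p = ⊥-elim (¬p (∣m∣n⇒∣m+n ∣-refl p))
  ... | no _  | no _  = refl

  divides-small : ∀ k n → n ℕ.< k → geometricℕ k (suc n) ≡ 0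
  divides-small k n n<k with suc k ∣? suc n
  ... | yes p = ⊥-elim (ℕP.<⇒≱ (s≤s n<k) (∣⇒≤ p))
  ... | no _  = refl

  shiftBy-+ : ∀ k f m → shiftBy k f (k ℕ.+ m) ≡ f m
  shiftBy-+ zero    f m = refl
  shiftBy-+ (suc k) f m = shiftBy-+ k f m

  geometric-rec : ∀ k n → geometric k n ≡ const 1ℤ n ℤ.+ shiftBy (suc k) (geometric k) n
  geometric-rec k zero with suc k ∣? 0
  ... | yes _ = refl
  ... | no ¬p = ⊥-elim (¬p (suc k ∣0))
  geometric-rec k (suc n) with ℕP.≤-total k n
  ... | inj₁ k≤n = sym (trans (ℤP.+-identityˡ _) (subst (λ n → shiftBy k (geometric k) n ≡ geometric k (suc n)) (ℕP.m+[n∸m]≡n k≤n)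
     (trans (shiftBy-+ k (geometric k) (n ℕ.∸ k)) (cong +_ (sym (divides-shift k (n ℕ.∸ k)))))))
  ... | inj₂ n≤k with ℕP.m≤n⇒m<n∨m≡n n≤k
  ...   | inj₁ n<k  = sym (trans (ℤP.+-identityˡ _) (trans (shiftBy-< k (geometric k) n n<k) (cong +_ (sym (divides-small k n n<k)))))
  ...   | inj₂ refl = sym (trans (ℤP.+-identityˡ _) (subst (λ n' → shiftBy n (geometric n) n' ≡ geometric n (suc n')) (ℕP.+-identityʳ n)
     (trans (shiftBy-+ n (geometric n) 0) (cong +_ (sym (divides-shift n 0))))))

 geometric-inverse : ∀ k → mul (geometric k) (add (const 1ℤ) (λ n → ℤ.- QA.qp (suc k) n)) ≐ const 1ℤ
 geometric-inverse k = PSRing.trans {i = mul g (add (const 1ℤ) (λ n → ℤ.- QA.qp (suc k) n))} {j = add g (λ n → ℤ.- mul (X (suc k)) g n)}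
  (PSRing.trans (PSRing.*-congˡ {x = g} (λ n → cong (λ z → const 1ℤ n ℤ.- z) (qp-X (suc k) n)))
   (PSSolver.solve 2 (λ g x → g PSSolver.:* (PSSolver.con 1ℤ PSSolver.:- x) PSSolver.:= g PSSolver.:- x PSSolver.:* g) PSRing.refl g (X (suc k))))
  (λ n → trans (cong₂ (λ a b → a ℤ.- b) (geometric-rec k n) (X-mul (suc k) g n)) (lem (const 1ℤ n) (shiftBy (suc k) g n)))
  where
  g = geometric k
  lem : ∀ a b → (a ℤ.+ b) ℤ.- b ≡ a
  lem = ring

 module QI = QIdentities series const-homo (X 1) geometric geometric-inverse
 module QE = QExpansion series const-homo (X 1) geometric geometric-inverse

 ι-· : ∀ f g → ι (f · g) ≐ mul (ι f) (ι g)
 ι-· f g n = trans (cong (λ l → + ListAction.sum l) (map-upTo (λ i → f i ℕ.* g (n ℕ.∸ i)) (suc n))) (go n f)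
  where
  go : ∀ n f → + ListAction.sum (applyUpTo (λ i → f i ℕ.* g (n ℕ.∸ i)) (suc n)) ≡ mul (ι f) (ι g) n
  go zero    f = trans (cong +_ (ℕP.+-identityʳ (f 0 ℕ.* g 0))) (ℤP.pos-* (f 0) (g 0))
  go (suc n) f = trans (ℤP.pos-+ (f 0 ℕ.* g (suc n)) _) (cong₂ ℤ._+_ (ℤP.pos-* (f 0) (g (suc n))) (go n (λ i → f (suc i))))

 ι-onePlusQ : ∀ j → ι (onePlusQ^ (suc j)) ≐ add (const 1ℤ) (QA.qp (suc j))
 ι-onePlusQ j n = trans (ℤP.pos-+ (indicator 0 n) (indicator (suc j) n)) (cong₂ ℤ._+_ (sym (X-indicator 0 n))
  (trans (sym (X-indicator (suc j) n)) (sym (qp-X (suc j) n))))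

 ι-one : ι one ≐ const 1ℤ
 ι-one zero    = refl
 ι-one (suc n) = refl

 ι-negQPoch : ∀ k → ι (negQPoch k) ≐ QI.npoch k
 ι-negQPoch zero    = ι-one
 ι-negQPoch (suc k) = PSRing.trans (ι-· (negQPoch k) (onePlusQ^ (suc k))) (PSRing.*-cong {x = ι (negQPoch k)} (ι-negQPoch k) (ι-onePlusQ k))

 ι-invQQ2Poch : ∀ k → ι (invQQ2Poch k) ≐ QI.b k
 ι-invQQ2Poch zero    n = refl
 ι-invQQ2Poch (suc k) = PSRing.trans (ι-· (invQQ2Poch k) (geomOdd (suc k))) (PSRing.*-congʳ {x = geometric (2 ℕ.* suc k)} (ι-invQQ2Poch k))

 tri-double : ∀ n → Exponents.tri n ℕ.* 2 ≡ n ℕ.* suc n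
 tri-double zero    = refl
 tri-double (suc n) = trans (ℕP.*-distribʳ-+ 2 (Exponents.tri n) (suc n)) (trans (cong (ℕ._+ suc n ℕ.* 2) (tri-double n)) (lem n))
  where
  lem : ∀ n → n ℕ.* suc n ℕ.+ suc n ℕ.* 2 ≡ suc n ℕ.* suc (suc n)
  lem = ℕ-RingSolver.solve-∀

 tri-agree : ∀ k → tri k ≡ Exponents.tri (suc k)
 tri-agree k = trans (cong (λ m → m ℕ./ 2) (sym (tri-double (suc k)))) (m*n/n≡m (Exponents.tri (suc k)) 2)

 ι-shift : ∀ T f → ι (shift T f) ≐ shiftBy T (ι f)
 ι-shift T f n with T ℕP.≤? n
 ... | yes T≤n = sym (subst (λ n' → shiftBy T (ι f) n' ≡ + f (n ℕ.∸ T)) (ℕP.m+[n∸m]≡n T≤n) (shiftBy-+ T (ι f) (n ℕ.∸ T)))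
 ... | no T≰n  = sym (shiftBy-< T (ι f) n (ℕP.≰⇒> T≰n))

 ι-σterm : ∀ k → ι (σterm k) ≐ QE.s k
 ι-σterm k = PSRing.trans {j = mul (QI.tq (suc k)) (mul (QI.npoch k) (QI.b k))}
  (PSRing.trans (ι-shift (tri k) (negQPoch k · invQQ2Poch k)) (PSRing.trans (PSRing.sym (X-mul (tri k) (ι (negQPoch k · invQQ2Poch k))))
   (PSRing.*-cong {x = X (tri k)} tq≐ (PSRing.trans (ι-· (negQPoch k) (invQQ2Poch k)) (PSRing.*-cong {x = ι (negQPoch k)} (ι-negQPoch k) (ι-invQQ2Poch k))))))
  (PSRing.sym (PSRing.*-assoc (QI.tq (suc k)) (QI.npoch k) (QI.b k)))
  where
  tq≐ : X (tri k) ≐ QI.tq (suc k)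
  tq≐ n = trans (cong (λ e → X e n) (tri-agree k)) (trans (sym (qp-X (Exponents.tri (suc k)) n)) (sym (QE.tq-tri (suc k) n)))

 sum-upTo : ∀ (f : ℕ → ℕ) L → ListAction.sum (map f (upTo L)) ≡ sumℕ L f
 sum-upTo f zero    = refl
 sum-upTo f (suc L) = trans (cong (λ l → ListAction.sum (map f l)) (sym (upTo-∷ʳ L))) (trans (cong ListAction.sum (map-++ f (upTo L) (L ∷ [])))
  (trans (sum-++ (map f (upTo L)) (f L ∷ [])) (cong₂ ℕ._+_ (sum-upTo f L) (ℕP.+-identityʳ (f L)))))

 sum-coefficient : ∀ L {f : ℕ → PS} {k : ℕ → ℕ} {m} → (∀ n → n ℕ.< L → f n m ≡ + k n) → QA.sum L f m ≡ + sumℕ L k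
 sum-coefficient zero    p = refl
 sum-coefficient (suc L) {k = k} p = trans (cong₂ ℤ._+_ (sum-coefficient L (λ n n<L → p n (ℕP.m≤n⇒m≤1+n n<L))) (p L ℕP.≤-refl)) (sym (ℤP.pos-+ (sumℕ L k) (k L)))

 two-coefficient : ∀ f n → mul QE.two f n ≡ + 2 ℤ.* f n
 two-coefficient f n = trans (PSRing.distribʳ f (const 1ℤ) (const 1ℤ) n) (trans (cong₂ ℤ._+_ (PSRing.*-identityˡ f n) (PSRing.*-identityˡ f n)) (lem (f n)))
  where
  lem : ∀ a → a ℤ.+ a ≡ + 2 ℤ.* a
  lem = ring

 parity : ℕ → ℕ
 parity zero    = 1
 parity (suc n) = 1 ℕ.∸ parity n

 parity-01 : ∀ n → parity n ≡ 0 ⊎ parity n ≡ 1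
 parity-01 zero    = inj₂ refl
 parity-01 (suc n) with parity n | parity-01 n
 ... | _ | inj₁ refl = inj₂ refl
 ... | _ | inj₂ refl = inj₁ refl

 even-parity : ∀ n → QE.even n ≐ const (+ parity n)
 odd-parity : ∀ n → QE.odd n ≐ const (+ (1 ℕ.∸ parity n))
 odd-parity zero    zero    = refl
 odd-parity zero    (suc k) = refl
 odd-parity (suc n) k = trans (even-parity n k) (cong (λ z → const (+ z) k) (lem n))
  where
  lem : ∀ n → parity n ≡ 1 ℕ.∸ (1 ℕ.∸ parity n)
  lem n with parity n | parity-01 n
  ... | _ | inj₁ refl = refl
  ... | _ | inj₂ refl = refl
 even-parity n k = trans (cong (λ z → const 1ℤ k ℤ.- z) (odd-parity n k)) (lem n k)
  where
  lem : ∀ n k → const 1ℤ k ℤ.- const (+ (1 ℕ.∸ parity n)) k ≡ const (+ parity n) k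
  lem n k with parity n | parity-01 n
  lem n zero    | _ | inj₁ refl = refl
  lem n (suc k) | _ | inj₁ refl = refl
  lem n zero    | _ | inj₂ refl = refl
  lem n (suc k) | _ | inj₂ refl = refl

 card-indicator : ∀ e m → Card (λ (_ : ⊤) → e ≡ m) (indicator e m)
 card-indicator e m with m ℕP.≟ e
 ... | yes refl = card-1 tt refl (λ _ → refl)
 ... | no m≢e   = card-0 (λ e≡m → m≢e (sym e≡m))

 qp-coefficient : ∀ e m → QA.qp e m ≡ + indicator e m
 qp-coefficient e m = trans (qp-X e m) (X-indicator e m)

 -- To read the coefficient of q^m it suffices to work modulo q^(m+1), so all sums have length m +
 -- 1.
 module At (m K2 : ℕ) (K2≡2 : K2 ≡ 2) where
  L = suc m
  open QE.Expansion L K2 K2≡2 using (evens; tails; conj; expanded; Expanded)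

  record MainSet (x : ℕ × (ℕ × (ℕ × ⊤))) : Set where
   constructor principal
   field bounds : let j , δ , d , _ = x in j ℕ.< L × δ ℕ.< K2 × d ℕ.< L × exponent j δ d ≡ m

  record TailSet (x : ℕ × (ℕ × (ℕ × (ℕ × ⊤)))) : Set where
   constructor lengthened
   field bounds : let j , δ , d , l , _ = x in j ℕ.< L × δ ℕ.< K2 × d ℕ.< L × l ℕ.< L × exponent j δ d ℕ.+ suc (idx j δ ℕ.+ d) ℕ.* suc l ≡ m

  record ConjSet (x : ℕ × (ℕ × (ℕ × ⊤))) : Set where
   constructor conjugate
   field bounds : let r , t , ε , _ = x in r ℕ.< L × t ℕ.< suc r × ε ℕ.< K2 × conjExponent r t ε ≡ m

  #main #tail #conj #even : ℕ
  #main = sumℕ L (λ j → sumℕ K2 (λ δ → sumℕ L (λ d → indicator (exponent j δ d) m)))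
  #tail = sumℕ L (λ j → sumℕ K2 (λ δ → sumℕ L (λ d → sumℕ L (λ l → indicator (exponent j δ d ℕ.+ suc (idx j δ ℕ.+ d) ℕ.* suc l) m))))
  #conj = sumℕ L (λ r → sumℕ (suc r) (λ t → sumℕ K2 (λ ε → indicator (conjExponent r t ε) m)))
  #even = sumℕ L (λ j → sumℕ K2 (λ δ → sumℕ L (λ d → parity (idx j δ ℕ.+ d) ℕ.* indicator (exponent j δ d) m)))

  main-card : Card MainSet #main
  main-card = card-⇔ (card-sum L (λ j _ → card-sum K2 (λ δ _ → card-sum L (λ d _ → card-indicator _ m)))) principal MainSet.bounds

  tail-card : Card TailSet #tail
  tail-card = card-⇔ (card-sum L (λ j _ → card-sum K2 (λ δ _ → card-sum L (λ d _ → card-sum L (λ l _ → card-indicator _ m))))) lengthened TailSet.bounds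

  conj-card : Card ConjSet #conj
  conj-card = card-⇔ (card-sum L (λ r _ → card-sum (suc r) (λ t _ → card-sum K2 (λ ε _ → card-indicator _ m)))) conjugate ConjSet.bounds

  -- The coefficient of q^m in `expansion`, where the multiple of q^L with L = m + 1 contributes
  -- nothing.
  Nσ-expansion : ∃ λ h → + Nσ m ℤ.+ + #conj ≡ + 2 ℤ.* (+ #even ℤ.+ + #tail) ℤ.+ + 2 ℤ.* (+ 2 ℤ.* h)
  Nσ-expansion = h m , trans (cong₂ ℤ._+_ (sym σ-coefficient) (sym conj-coefficient)) (trans (expansion m) (trans
   (cong₂ ℤ._+_ (cong₂ ℤ._+_ (trans (two-coefficient (add evens tails) m) (cong (λ z → + 2 ℤ.* z) (cong₂ ℤ._+_ even-coefficient tail-coefficient)))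
    (trans (PSRing.*-assoc QE.two QE.two h m) (trans (two-coefficient (mul QE.two h) m) (cong (λ z → + 2 ℤ.* z) (two-coefficient h m)))))
    (trans (PSRing.*-congʳ {x = rest} (qp-X L) m) (X-mul-small L rest ℕP.≤-refl m ℕP.≤-refl))) (ℤP.+-identityʳ _)))
   where
   open Expanded expanded
   σ-coefficient : QA.sum L QE.s m ≡ + Nσ m
   σ-coefficient = trans (sum-coefficient L (λ n _ → sym (ι-σterm n m))) (cong +_ (sym (sum-upTo (λ k → σterm k m) L)))
   conj-coefficient : conj m ≡ + #conj
   conj-coefficient = sum-coefficient L (λ r _ → sum-coefficient (suc r) (λ t _ → sum-coefficient K2 (λ ε _ → qp-coefficient (conjExponent r t ε) m)))
   even-coefficient : evens m ≡ + #even
   even-coefficient = sum-coefficient L (λ j _ → sum-coefficient K2 (λ δ _ → sum-coefficient L (λ d _ →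
    trans (PSRing.*-congʳ {x = QA.qp (exponent j δ d)} (even-parity (idx j δ ℕ.+ d)) m)
    (trans (const-mul (+ parity (idx j δ ℕ.+ d)) (QA.qp (exponent j δ d)) m)
    (trans (cong (λ z → + parity (idx j δ ℕ.+ d) ℤ.* z) (qp-coefficient (exponent j δ d) m)) (sym (ℤP.pos-* (parity (idx j δ ℕ.+ d)) _)))))))
   tail-coefficient : tails m ≡ + #tail
   tail-coefficient = sum-coefficient L (λ j _ → sum-coefficient K2 (λ δ _ → sum-coefficient L (λ d _ → sum-coefficient L (λ l _ → qp-coefficient _ m))))

-- From exponents to norm equations

module Representations where

 open import Defs using (Nσ)
 open Counting
 open Exponents
 open Coefficients using (module At; tri-double; parity; parity-01; indicator)
 open import Data.Nat.Base hiding (parity)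
 open import Data.Nat.Properties
 open import Data.Nat.DivMod
 open import Data.Nat.Divisibility using (_∣_; divides)
 open import Data.Nat.Tactic.RingSolver using () renaming (solve-∀ to ring)
 open import Data.Integer.Base as ℤ using (ℤ)
 import Data.Integer.Tactic.RingSolver as ℤ-RingSolver
 open import Data.Unit.Base using (⊤; tt)
 open import Function.Base using (case_of_)

 dbl-double : ∀ j → dbl j ≡ j + j
 dbl-double zero    = refl
 dbl-double (suc j) = cong suc (trans (cong suc (dbl-double j)) (sym (+-suc j j)))

 pron-value : ∀ j → pron (suc j) ≡ j * j + j
 pron-value zero    = refl
 pron-value (suc j) = trans (cong₂ _+_ (pron-value j) (dbl-double (suc j))) (lem j)
  where
  lem : ∀ j → j * j + j + (suc j + suc j) ≡ suc j * suc j + suc j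
  lem = ring

 gapExp-value : ∀ r d → gapExp r d ≡ d * (r + r + d + 1)
 gapExp-value r zero    = refl
 gapExp-value r (suc d) = trans (cong (_+ (suc (r + d) + suc (r + d))) (gapExp-value r d)) (lem r d)
  where
  lem : ∀ r d → d * (r + r + d + 1) + (suc (r + d) + suc (r + d)) ≡ suc d * (r + r + suc d + 1)
  lem = ring

 exponentOf : ℕ → ℕ → ℕ → ℕ
 exponentOf j δ d = j * j + j + (d * ((j + j + δ) + (j + j + δ) + d + 1) + suc (j + j + δ + d))

 -- Coordinates in which the exponent e satisfies 12 e + b² = 12 a² + 1. For δ = 0, 1 the values 6j
 -- + 1 and 6j + 5 of b run through the positive integers prime to 6.
 aOf bOf : ℕ → ℕ → ℕ → ℕ
 aOf j δ d = suc (j + j + δ + d)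
 bOf j δ d = 6 * j + 1 + 4 * δ

 exponentOf-norm : ∀ j δ d → δ < 2 → 12 * exponentOf j δ d + bOf j δ d * bOf j δ d ≡ 12 * (aOf j δ d * aOf j δ d) + 1
 exponentOf-norm j 0 d _ = lem j d
  where
  lem : ∀ j d → 12 * (j * j + j + (d * ((j + j + 0) + (j + j + 0) + d + 1) + suc (j + j + 0 + d))) + (6 * j + 1 + 0) * (6 * j + 1 + 0)
    ≡ 12 * (suc (j + j + 0 + d) * suc (j + j + 0 + d)) + 1
  lem = ring
 exponentOf-norm j 1 d _ = lem j d
  where
  lem : ∀ j d → 12 * (j * j + j + (d * ((j + j + 1) + (j + j + 1) + d + 1) + suc (j + j + 1 + d))) + (6 * j + 1 + 4) * (6 * j + 1 + 4)
    ≡ 12 * (suc (j + j + 1 + d) * suc (j + j + 1 + d)) + 1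
  lem = ring
 exponentOf-norm j (suc (suc δ)) d (s≤s (s≤s ()))

 -- A square that is 1 modulo 12 has root ±1 modulo 6.
 root-cases : ∀ b x y → 12 * y + b * b ≡ 12 * x + 1 → ∃ λ j → ∃ λ δ → δ < 2 × b ≡ 6 * j + 1 + 4 * δ
 root-cases b x y eq = cases (b % 6) (b / 6) (m%n<n b 6) (m≡m%n+[m/n]*n b 6)
  where
  square : ∀ k j → 12 * y + (k + j * 6) * (k + j * 6) ≡ k * k + (y + k * j + 3 * j * j) * 12
  square = lem y
   where
   lem : ∀ y k j → 12 * y + (k + j * 6) * (k + j * 6) ≡ k * k + (y + k * j + 3 * j * j) * 12
   lem = ring
  bad : ∀ k j → b ≡ k + j * 6 → (k * k) % 12 ≢ 1 → ⊥
  bad k j refl ≢1 = ≢1 (trans (sym ([m+kn]%n≡m%n (k * k) (y + k * j + 3 * j * j) 12))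
   (trans (cong (_% 12) (trans (sym (square k j)) (trans eq (trans (+-comm (12 * x) 1) (cong (1 +_) (*-comm 12 x)))))) ([m+kn]%n≡m%n 1 x 12)))
  form : ∀ k j δ → b ≡ k + j * 6 → k ≡ 1 + 4 * δ → b ≡ 6 * j + 1 + 4 * δ
  form k j δ e k≡ = trans e (trans (cong (_+ j * 6) k≡) (lem j δ))
   where
   lem : ∀ j δ → 1 + 4 * δ + j * 6 ≡ 6 * j + 1 + 4 * δ
   lem = ring
  cases : ∀ k j → k < 6 → b ≡ k + j * 6 → ∃ λ j → ∃ λ δ → δ < 2 × b ≡ 6 * j + 1 + 4 * δ
  cases 0 j _ e = ⊥-elim (bad 0 j e λ ())
  cases 1 j _ e = j , 0 , s≤s z≤n , form 1 j 0 e refl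
  cases 2 j _ e = ⊥-elim (bad 2 j e λ ())
  cases 3 j _ e = ⊥-elim (bad 3 j e λ ())
  cases 4 j _ e = ⊥-elim (bad 4 j e λ ())
  cases 5 j _ e = j , 1 , s≤s (s≤s z≤n) , form 5 j 1 e refl
  cases (suc (suc (suc (suc (suc (suc k)))))) j (s≤s (s≤s (s≤s (s≤s (s≤s (s≤s ())))))) _

 -- The condition d ≥ 0 on the summation index becomes the cone b < 3a; `bound-from` goes back.
 bound-to : ∀ j δ d → δ < 2 → bOf j δ d < 3 * aOf j δ d
 bound-to j δ d δ<2 = ≤-trans (≤-reflexive (lem1 j δ)) (≤-trans (+-monoʳ-≤ (6 * j + 3 * δ) (s≤s (s≤s (s≤s⁻¹ δ<2)))) (≤-trans (m≤m+n _ (3 * d)) (≤-reflexive (lem2 j δ d))))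
  where
  lem1 : ∀ j δ → suc (6 * j + 1 + 4 * δ) ≡ 6 * j + 3 * δ + suc (suc δ)
  lem1 = ring
  lem2 : ∀ j δ d → 6 * j + 3 * δ + 3 + 3 * d ≡ 3 * suc (j + j + δ + d)
  lem2 = ring

 bound-from : ∀ j δ a → 6 * j + 1 + 4 * δ < 3 * a → j + j + δ < a
 bound-from j δ a b<3a = *-cancelˡ-< 3 (j + j + δ) a (≤-trans (s≤s (≤-trans (≤-reflexive (lem1 j δ)) (≤-trans (+-monoʳ-≤ (6 * j) (≤-trans (*-monoˡ-≤ δ {3} {4} (s≤s (s≤s (s≤s z≤n)))) (n≤1+n (4 * δ)))) (≤-reflexive (lem2 j δ))))) b<3a)
  where
  lem1 : ∀ j δ → 3 * (j + j + δ) ≡ 6 * j + 3 * δ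
  lem1 = ring
  lem2 : ∀ j δ → 6 * j + suc (4 * δ) ≡ 6 * j + 1 + 4 * δ
  lem2 = ring

 bOf-injective : ∀ {j δ j' δ'} → δ < 2 → δ' < 2 → 6 * j + 1 + 4 * δ ≡ 6 * j' + 1 + 4 * δ' → j ≡ j' × δ ≡ δ'
 bOf-injective {j} {δ} {j'} {δ'} δ<2 δ'<2 e = *-cancelʳ-≡ j j' 6 (+-cancelˡ-≡ (1 + 4 * δ) _ _ (trans (trans (sym (lem j δ)) (trans e (lem j' δ'))) (cong (λ δ → 1 + 4 * δ + j' * 6) (sym δ≡)))) , δ≡
  where
  lem : ∀ j δ → 6 * j + 1 + 4 * δ ≡ 1 + 4 * δ + j * 6
  lem = ring
  residue : ∀ {δ} → δ < 2 → (1 + 4 * δ) % 6 ≡ 1 + 4 * δ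
  residue {0} _ = refl
  residue {1} _ = refl
  residue {suc (suc _)} (s≤s (s≤s ()))
  δ≡ : δ ≡ δ'
  δ≡ = *-cancelˡ-≡ δ δ' 4 (suc-injective (trans (sym (residue δ<2)) (trans (sym ([m+kn]%n≡m%n (1 + 4 * δ) j 6))
   (trans (cong (_% 6) (trans (sym (lem j δ)) (trans e (lem j' δ')))) (trans ([m+kn]%n≡m%n (1 + 4 * δ') j' 6) (residue δ'<2))))))

 module Count (m K2 : ℕ) (K2≡2 : K2 ≡ 2) where
  open At m K2 K2≡2 public

  <2 : ∀ {δ} → δ < K2 → δ < 2
  <2 = subst (_ <_) K2≡2

  <K2 : ∀ {δ} → δ < 2 → δ < K2
  <K2 = subst (_ <_) (sym K2≡2)

  -- Forms (a, b, 3c) of discriminant 1 - 12 m with 0 < b < 3 min(a, c).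
  Rep : ℕ × ℕ × ℕ → Set
  Rep (a , b , c) = 12 * m + b * b ≡ 12 * (a * c) + 1 × b < 3 * a × b < 3 * c

  Diag : ℕ × ℕ → Set
  Diag (a , b) = 12 * m + b * b ≡ 12 * (a * a) + 1 × b < 3 * a

  Above : ℕ × ℕ × ℕ → Set
  Above (a , b , c) = 12 * m + b * b ≡ 12 * (a * c) + 1 × b < 3 * a × a < c

  exponent-value : ∀ j δ d → exponent j δ d ≡ exponentOf j δ d
  exponent-value j δ d = cong₂ _+_ (pron-value j) (cong₂ _+_ (trans (gapExp-value (idx j δ) d)
   (cong (λ r → d * (r + r + d + 1)) idx-value)) (cong (λ r → suc (r + d)) idx-value))
   where
   idx-value : idx j δ ≡ j + j + δ
   idx-value = cong (_+ δ) (dbl-double j)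

  private
   a≤exponent : ∀ j δ d → aOf j δ d ≤ exponentOf j δ d
   a≤exponent j δ d = ≤-trans (m≤n+m (aOf j δ d) (d * ((j + j + δ) + (j + j + δ) + d + 1))) (m≤n+m _ (j * j + j))

   j≤a : ∀ j δ d → j < aOf j δ d
   j≤a j δ d = s≤s (≤-trans (m≤m+n j j) (≤-trans (m≤m+n (j + j) δ) (m≤m+n (j + j + δ) d)))

   d≤a : ∀ j δ d → d < aOf j δ d
   d≤a j δ d = s≤s (m≤n+m d (j + j + δ))

   split-a : ∀ j δ a → j + j + δ < a → aOf j δ (a ∸ suc (j + j + δ)) ≡ a
   split-a j δ a r<a = m+[n∸m]≡n r<a

  diag-to : ∀ {j δ d} → δ < 2 → exponentOf j δ d ≡ m → Diag (aOf j δ d , bOf j δ d)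
  diag-to {j} {δ} {d} δ<2 refl = exponentOf-norm j δ d δ<2 , bound-to j δ d δ<2

  exponent-from : ∀ {j δ d} → δ < 2 → Diag (aOf j δ d , bOf j δ d) → exponentOf j δ d ≡ m
  exponent-from {j} {δ} {d} δ<2 (eq , _) = *-cancelˡ-≡ _ _ 12 (+-cancelʳ-≡ (bOf j δ d * bOf j δ d) _ _ (trans (exponentOf-norm j δ d δ<2) (sym eq)))

  diag-card : Card Diag #main
  diag-card = card-image main-card to to-ok inj onto
   where
   to : ℕ × (ℕ × (ℕ × ⊤)) → ℕ × ℕ
   to (j , δ , d , _) = aOf j δ d , bOf j δ d
   to-ok : ∀ {x} → MainSet x → Diag (to x)
   to-ok {j , δ , d , _} (principal (_ , δ<2 , _ , e)) = diag-to {j} {δ} {d} (<2 δ<2) (trans (sym (exponent-value j δ d)) e)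
   inj : ∀ {x y} → MainSet x → MainSet y → to x ≡ to y → x ≡ y
   inj {j , δ , d , _} {j' , δ' , d' , _} (principal (_ , δ<2 , _)) (principal (_ , δ'<2 , _)) e with bOf-injective {j} {δ} {j'} {δ'} (<2 δ<2) (<2 δ'<2) (cong proj₂ e)
   ... | refl , refl with +-cancelˡ-≡ (suc (j + j + δ)) d d' (cong proj₁ e)
   ... | refl = refl
   onto : ∀ {y} → Diag y → ∃ λ x → MainSet x × to x ≡ y
   onto {a , b} (eq , b<3a) with root-cases b (a * a) m eq
   ... | j , δ , δ<2 , refl = (j , δ , d , tt) , principal (<-trans (j≤a j δ d) a<L , <K2 δ<2 , <-trans (d≤a j δ d) a<L , trans (exponent-value j δ d) e) , cong (_, bOf j δ d) a≡
    where
    d = a ∸ suc (j + j + δ)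
    a≡ : aOf j δ d ≡ a
    a≡ = split-a j δ a (bound-from j δ a b<3a)
    e : exponentOf j δ d ≡ m
    e = exponent-from {j} {δ} {d} δ<2 (subst (λ a → Diag (a , bOf j δ d)) (sym a≡) (eq , b<3a))
    a<L : aOf j δ d < L
    a<L = s≤s (subst (aOf j δ d ≤_) e (a≤exponent j δ d))

  above-card : Card Above #tail
  above-card = card-image tail-card to to-ok inj onto
   where
   to : ℕ × (ℕ × (ℕ × (ℕ × ⊤))) → ℕ × ℕ × ℕ
   to (j , δ , d , l , _) = aOf j δ d , bOf j δ d , aOf j δ d + suc l
   norm : ∀ j δ d l → δ < 2 → 12 * (exponentOf j δ d + aOf j δ d * suc l) + bOf j δ d * bOf j δ d ≡ 12 * (aOf j δ d * (aOf j δ d + suc l)) + 1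
   norm j δ d l δ<2 = trans (lem1 (exponentOf j δ d) (aOf j δ d) (suc l) (bOf j δ d)) (trans (cong (_+ 12 * (aOf j δ d * suc l)) (exponentOf-norm j δ d δ<2)) (lem2 (aOf j δ d) (suc l)))
    where
    lem1 : ∀ e a l b → 12 * (e + a * l) + b * b ≡ 12 * e + b * b + 12 * (a * l)
    lem1 = ring
    lem2 : ∀ a l → 12 * (a * a) + 1 + 12 * (a * l) ≡ 12 * (a * (a + l)) + 1
    lem2 = ring
   tailExp : ∀ j δ d l → exponent j δ d + suc (idx j δ + d) * suc l ≡ exponentOf j δ d + aOf j δ d * suc l
   tailExp j δ d l = cong₂ _+_ (exponent-value j δ d) (cong (λ r → suc (r + δ + d) * suc l) (dbl-double j))
   to-ok : ∀ {x} → TailSet x → Above (to x)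
   to-ok {j , δ , d , l , _} (lengthened (_ , δ<2 , _ , _ , e)) = trans (cong (λ m → 12 * m + bOf j δ d * bOf j δ d) (trans (sym e) (tailExp j δ d l))) (norm j δ d l (<2 δ<2))
    , bound-to j δ d (<2 δ<2) , m<m+n (aOf j δ d) (s≤s z≤n)
   inj : ∀ {x y} → TailSet x → TailSet y → to x ≡ to y → x ≡ y
   inj {j , δ , d , l , _} {j' , δ' , d' , l' , _} (lengthened (_ , δ<2 , _)) (lengthened (_ , δ'<2 , _)) e
    with bOf-injective {j} {δ} {j'} {δ'} (<2 δ<2) (<2 δ'<2) (cong (λ t → proj₁ (proj₂ t)) e)
   ... | refl , refl with +-cancelˡ-≡ (suc (j + j + δ)) d d' (cong proj₁ e)
   ... | refl with +-cancelˡ-≡ (aOf j δ d) _ _ (cong (λ t → proj₂ (proj₂ t)) e)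
   ... | refl = refl
   onto : ∀ {y} → Above y → ∃ λ x → TailSet x × to x ≡ y
   onto {a , b , c} (eq , b<3a , a<c) with root-cases b (a * c) m eq
   ... | j , δ , δ<2 , refl = (j , δ , d , l , tt) , lengthened (<-trans (j≤a j δ d) a<L , <K2 δ<2 , <-trans (d≤a j δ d) a<L , l<L , trans (tailExp j δ d l) e)
                , cong₂ (λ a c → a , bOf j δ d , c) a≡ c≡
    where
    d = a ∸ suc (j + j + δ)
    l = c ∸ suc a
    a≡ : aOf j δ d ≡ a
    a≡ = split-a j δ a (bound-from j δ a b<3a)
    c≡ : aOf j δ d + suc l ≡ c
    c≡ = trans (cong (_+ suc l) a≡) (trans (+-suc a l) (m+[n∸m]≡n a<c))
    e : exponentOf j δ d + aOf j δ d * suc l ≡ m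
    e = *-cancelˡ-≡ _ _ 12 (+-cancelʳ-≡ (bOf j δ d * bOf j δ d) _ _ (trans (norm j δ d l δ<2) (trans (cong₂ (λ a c → 12 * (a * c) + 1) a≡ c≡) (sym eq))))
    a<L : aOf j δ d < L
    a<L = s≤s (subst (aOf j δ d ≤_) e (≤-trans (a≤exponent j δ d) (m≤m+n _ _)))
    l<L : l < L
    l<L = <-≤-trans (s≤s (m≤m+n l _)) (≤-trans (subst (suc (l + (j + j + δ + d) * suc l) ≤_) e (m≤n+m _ (exponentOf j δ d))) (n≤1+n m))

  private
   parity-+ : ∀ a b → parity b ≡ 1 → parity (a + b) ≡ parity a
   parity-+ zero    b e = e
   parity-+ (suc a) b e = cong (1 ∸_) (parity-+ a b e)

   parity-double : ∀ x → parity (x + x) ≡ 1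
   parity-double zero    = refl
   parity-double (suc x) = trans (cong (λ y → 1 ∸ parity y) (+-suc x x)) (trans (cong (λ y → 1 ∸ (1 ∸ y)) (parity-double x)) refl)

   parity-pronic : ∀ x → parity (x * x + x) ≡ 1
   parity-pronic zero    = refl
   parity-pronic (suc x) = trans (cong parity (lem x)) (trans (parity-+ (x * x + x) (suc x + suc x) (parity-double (suc x))) (parity-pronic x))
    where
    lem : ∀ x → suc x * suc x + suc x ≡ (x * x + x) + (suc x + suc x)
    lem = ring

   -- The exponent has the same parity as a = r + d + 1.
   exponent-parity : ∀ j δ d → parity (exponentOf j δ d) ≡ parity (aOf j δ d)
   exponent-parity j δ d = trans (cong parity (lem j δ d))
    (trans (parity-+ (aOf j δ d + (d * d + d) + (d * (j + j + δ) + d * (j + j + δ))) (j * j + j) (parity-pronic j))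
     (trans (parity-+ (aOf j δ d + (d * d + d)) (d * (j + j + δ) + d * (j + j + δ)) (parity-double (d * (j + j + δ)))) (parity-+ (aOf j δ d) (d * d + d) (parity-pronic d))))
    where
    lem : ∀ j δ d → j * j + j + (d * ((j + j + δ) + (j + j + δ) + d + 1) + suc (j + j + δ + d))
      ≡ (suc (j + j + δ + d) + (d * d + d) + (d * (j + j + δ) + d * (j + j + δ))) + (j * j + j)
    lem = ring

   sumℕ-scale : ∀ K c (f g : ℕ → ℕ) → (∀ n → f n ≡ c * g n) → sumℕ K f ≡ c * sumℕ K g
   sumℕ-scale zero    c f g p = sym (*-zeroʳ c)
   sumℕ-scale (suc K) c f g p = trans (cong₂ _+_ (sumℕ-scale K c f g p) (p K)) (sym (*-distribˡ-+ c (sumℕ K g) (g K)))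

  -- The exponent has the parity of a = r + d + 1. When it equals m, the parity of r + d is that of
  -- m + 1, a constant factor.
  #even-value : #even ≡ parity (suc m) * #main
  #even-value = sumℕ-scale L κ _ _ λ j → sumℕ-scale K2 κ _ _ λ δ → sumℕ-scale L κ _ _ λ d → term j δ d
   where
   κ = parity (suc m)
   term : ∀ j δ d → parity (idx j δ + d) * indicator (exponent j δ d) m ≡ κ * indicator (exponent j δ d) m
   term j δ d with m ≟ exponent j δ d
   ... | no  _ = trans (*-zeroʳ (parity (idx j δ + d))) (sym (*-zeroʳ κ))
   ... | yes e = cong (_* 1) (trans (twice (idx j δ + d)) (cong (1 ∸_) (sym (trans (cong parity (trans e (exponent-value j δ d)))
     (trans (exponent-parity j δ d) (cong (λ r → parity (suc (r + δ + d))) (sym (dbl-double j))))))))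
    where
    twice : ∀ n → parity n ≡ 1 ∸ (1 ∸ parity n)
    twice n with parity n | parity-01 n
    ... | _ | inj₁ refl = refl
    ... | _ | inj₂ refl = refl

  -- Solutions of X² - 3 Y² = 2 (12 m - 1) in the cone 3 Y < X.
  Conj : ℕ × ℕ → Set
  Conj (x , y) = 24 * m + 3 * (y * y) ≡ x * x + 2 × 3 * y < x

  private
   dExp-value : ∀ t d → 2 * dExp t d + t * suc t ≡ 2 * ((t + d) * suc (t + d))
   dExp-value t zero    = trans (cong (λ z → z + t * suc t) (trans (*-comm 2 (tri t)) (tri-double t))) (lem t)
    where
    lem : ∀ t → t * suc t + t * suc t ≡ 2 * ((t + 0) * suc (t + 0))
    lem = ring
   dExp-value t (suc d) = trans (lem1 (suc (t + d)) (dExp t d) (t * suc t)) (trans (cong (λ z → z + 4 * suc (t + d)) (dExp-value t d)) (lem2 t d))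
    where
    lem1 : ∀ a e t → 2 * (a + a + e) + t ≡ 2 * e + t + 4 * a
    lem1 = ring
    lem2 : ∀ t d → 2 * ((t + d) * suc (t + d)) + 4 * suc (t + d) ≡ 2 * ((t + suc d) * suc (t + suc d))
    lem2 = ring

   conj-norm : ∀ t d ε → ε < 2 → let r = t + d in
    24 * (dExp t d + tri (suc r) + ε * suc r) + 3 * ((2 * t + 1) * (2 * t + 1)) ≡ (6 * r + 5 + 2 * ε) * (6 * r + 5 + 2 * ε) + 2
   conj-norm t d ε ε<2 = trans (lem1 (dExp t d) (tri (suc (t + d))) ε (t + d) t) (trans
    (cong₂ (λ x y → 12 * x + 12 * y + 24 * (ε * suc (t + d)) + 3) (dExp-value t d) (tri-double (suc (t + d)))) (last ε (t + d) ε<2))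
    where
    lem1 : ∀ e u ε r t → 24 * (e + u + ε * suc r) + 3 * ((2 * t + 1) * (2 * t + 1)) ≡ 12 * (2 * e + t * suc t) + 12 * (u * 2) + 24 * (ε * suc r) + 3
    lem1 = ring
    last : ∀ ε r → ε < 2 → 12 * (2 * (r * suc r)) + 12 * (suc r * suc (suc r)) + 24 * (ε * suc r) + 3 ≡ (6 * r + 5 + 2 * ε) * (6 * r + 5 + 2 * ε) + 2
    last 0 r _ = lem r
     where
     lem : ∀ r → 12 * (2 * (r * suc r)) + 12 * (suc r * suc (suc r)) + 0 + 3 ≡ (6 * r + 5 + 0) * (6 * r + 5 + 0) + 2
     lem = ring
    last 1 r _ = lem r
     where
     lem : ∀ r → 12 * (2 * (r * suc r)) + 12 * (suc r * suc (suc r)) + 24 * (1 * suc r) + 3 ≡ (6 * r + 5 + 2) * (6 * r + 5 + 2) + 2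
     lem = ring
    last (suc (suc _)) r (s≤s (s≤s ()))

   even-odd : ∀ n → ∃ λ t → ∃ λ y → y < 2 × n ≡ y + t * 2
   even-odd n = n / 2 , n % 2 , m%n<n n 2 , m≡m%n+[m/n]*n n 2

   -- Modulo 12 the equation forces y odd and x prime to 6. Then y ≥ 1 and 3y < x exclude x = 1, so
   -- x is 6r + 5 or 6r + 7.
   conj-residues : ∀ x y → 24 * m + 3 * (y * y) ≡ x * x + 2 → 3 * y < x → ∃ λ r → ∃ λ t → ∃ λ ε → ε < 2 × x ≡ 6 * r + 5 + 2 * ε × y ≡ 2 * t + 1
   conj-residues x y eq 3y<x with even-odd y
   ... | t , p , p<2 , y≡ = cases (x % 6) (x / 6) p (m%n<n x 6) p<2 (m≡m%n+[m/n]*n x 6) y≡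
    where
    squares : ∀ k s p t → (k * k + 2) + (k * s + 3 * (s * s)) * 12 ≡ (k + s * 6) * (k + s * 6) + 2
    squares = lem
     where
     lem : ∀ k s (p t : ℕ) → (k * k + 2) + (k * s + 3 * (s * s)) * 12 ≡ (k + s * 6) * (k + s * 6) + 2
     lem k s _ _ = lem' k s
      where
      lem' : ∀ k s → (k * k + 2) + (k * s + 3 * (s * s)) * 12 ≡ (k + s * 6) * (k + s * 6) + 2
      lem' = ring
    thrice : ∀ p t → 3 * (p * p) + (2 * m + p * t + t * t) * 12 ≡ 24 * m + 3 * ((p + t * 2) * (p + t * 2))
    thrice = lem m
     where
     lem : ∀ m p t → 3 * (p * p) + (2 * m + p * t + t * t) * 12 ≡ 24 * m + 3 * ((p + t * 2) * (p + t * 2))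
     lem = ring
    residues : ∀ k s p t → x ≡ k + s * 6 → y ≡ p + t * 2 → (k * k + 2) % 12 ≡ (3 * (p * p)) % 12
    residues k s p t refl refl = trans (sym ([m+kn]%n≡m%n (k * k + 2) (k * s + 3 * (s * s)) 12)) (trans (cong (_% 12) (trans (squares k s p t) (trans (sym eq) (sym (thrice p t)))))
     ([m+kn]%n≡m%n (3 * (p * p)) (2 * m + p * t + t * t) 12))
    odd-y : ∀ {t} → y ≡ 1 + t * 2 → y ≡ 2 * t + 1
    odd-y {t} e = trans e (trans (+-comm 1 (t * 2)) (cong (_+ 1) (*-comm t 2)))
    cases : ∀ k s p → k < 6 → p < 2 → x ≡ k + s * 6 → y ≡ p + t * 2 → ∃ λ r → ∃ λ t → ∃ λ ε → ε < 2 × x ≡ 6 * r + 5 + 2 * ε × y ≡ 2 * t + 1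
    cases 1 zero 1 _ _ x≡ y≡ = ⊥-elim (<⇒≱ (subst (3 * y <_) x≡ 3y<x) (≤-trans (s≤s z≤n) (≤-trans (subst (1 ≤_) (sym y≡) (s≤s z≤n)) (m≤m+n y _))))
    cases 1 (suc s) 1 _ _ x≡ y≡ = s , t , 1 , s≤s (s≤s z≤n) , trans x≡ (lem s) , odd-y {t} y≡
     where
     lem : ∀ s → 1 + suc s * 6 ≡ 6 * s + 5 + 2
     lem = ring
    cases 5 s 1 _ _ x≡ y≡ = s , t , 0 , s≤s z≤n , trans x≡ (lem s) , odd-y {t} y≡
     where
     lem : ∀ s → 5 + s * 6 ≡ 6 * s + 5 + 0
     lem = ring
    cases 0 s 0 _ _ x≡ y≡ = ⊥-elim (case residues 0 s 0 t x≡ y≡ of λ ())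
    cases 0 s 1 _ _ x≡ y≡ = ⊥-elim (case residues 0 s 1 t x≡ y≡ of λ ())
    cases 1 s 0 _ _ x≡ y≡ = ⊥-elim (case residues 1 s 0 t x≡ y≡ of λ ())
    cases 2 s 0 _ _ x≡ y≡ = ⊥-elim (case residues 2 s 0 t x≡ y≡ of λ ())
    cases 2 s 1 _ _ x≡ y≡ = ⊥-elim (case residues 2 s 1 t x≡ y≡ of λ ())
    cases 3 s 0 _ _ x≡ y≡ = ⊥-elim (case residues 3 s 0 t x≡ y≡ of λ ())
    cases 3 s 1 _ _ x≡ y≡ = ⊥-elim (case residues 3 s 1 t x≡ y≡ of λ ())
    cases 4 s 0 _ _ x≡ y≡ = ⊥-elim (case residues 4 s 0 t x≡ y≡ of λ ())
    cases 4 s 1 _ _ x≡ y≡ = ⊥-elim (case residues 4 s 1 t x≡ y≡ of λ ())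
    cases 5 s 0 _ _ x≡ y≡ = ⊥-elim (case residues 5 s 0 t x≡ y≡ of λ ())
    cases (suc (suc (suc (suc (suc (suc _)))))) s p (s≤s (s≤s (s≤s (s≤s (s≤s (s≤s ())))))) _ _ _
    cases k s (suc (suc _)) _ (s≤s (s≤s ())) _ _

  conj-card' : Card Conj #conj
  conj-card' = card-image conj-card to to-ok inj onto
   where
   to : ℕ × (ℕ × (ℕ × ⊤)) → ℕ × ℕ
   to (r , t , ε , _) = 6 * r + 5 + 2 * ε , 2 * t + 1
   norm : ∀ {r t ε} → t ≤ r → ε < 2 → 24 * conjExponent r t ε + 3 * ((2 * t + 1) * (2 * t + 1)) ≡ (6 * r + 5 + 2 * ε) * (6 * r + 5 + 2 * ε) + 2
   norm {r} {t} {ε} t≤r ε<2 = subst (λ r' → 24 * (dExp t (r ∸ t) + tri (suc r') + ε * suc r') + 3 * ((2 * t + 1) * (2 * t + 1)) ≡ (6 * r' + 5 + 2 * ε) * (6 * r' + 5 + 2 * ε) + 2)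
    (m+[n∸m]≡n t≤r) (conj-norm t (r ∸ t) ε ε<2)
   to-ok : ∀ {x} → ConjSet x → Conj (to x)
   to-ok {r , t , ε , _} (conjugate (_ , t<1+r , ε<2 , e)) = trans (cong (λ m → 24 * m + 3 * ((2 * t + 1) * (2 * t + 1))) (sym e)) (norm (s≤s⁻¹ t<1+r) (<2 ε<2))
    , ≤-trans (≤-reflexive (lem1 t)) (≤-trans (+-monoˡ-≤ 4 (*-monoʳ-≤ 6 (s≤s⁻¹ t<1+r))) (≤-trans (n≤1+n _) (≤-trans (≤-reflexive (lem2 r)) (m≤m+n (6 * r + 5) (2 * ε)))))
    where
    lem1 : ∀ t → suc (3 * (2 * t + 1)) ≡ 6 * t + 4
    lem1 = ring
    lem2 : ∀ r → suc (6 * r + 4) ≡ 6 * r + 5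
    lem2 = ring
   inj : ∀ {x y} → ConjSet x → ConjSet y → to x ≡ to y → x ≡ y
   inj {r , t , ε , _} {r' , t' , ε' , _} (conjugate (_ , _ , ε<2 , _)) (conjugate (_ , _ , ε'<2 , _)) e
    with *-cancelˡ-≡ t t' 2 (+-cancelʳ-≡ 1 _ _ (cong proj₂ e)) | ε≡ {r} {r'} {ε} {ε'} (<2 ε<2) (<2 ε'<2) (cong proj₁ e)
    where
    shape : ∀ r ε → 6 * r + 5 + 2 * ε ≡ (5 + 2 * ε) + r * 6
    shape = ring
    clash : ∀ r r' → 6 * r + 5 + 0 ≢ 6 * r' + 5 + 2
    clash r r' e = case trans (sym ([m+kn]%n≡m%n 5 r 6)) (trans (cong (_% 6) (trans (sym (shape r 0)) (trans e (shape r' 1)))) ([m+kn]%n≡m%n 7 r' 6)) of λ ()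
    ε≡ : ∀ {r r' ε ε'} → ε < 2 → ε' < 2 → 6 * r + 5 + 2 * ε ≡ 6 * r' + 5 + 2 * ε' → ε ≡ ε'
    ε≡ {ε = 0} {0} _ _ _ = refl
    ε≡ {ε = 1} {1} _ _ _ = refl
    ε≡ {r} {r'} {0} {1} _ _ e = ⊥-elim (clash r r' e)
    ε≡ {r} {r'} {1} {0} _ _ e = ⊥-elim (clash r' r (sym e))
    ε≡ {ε = suc (suc _)} (s≤s (s≤s ())) _ _
    ε≡ {ε = 0} {suc (suc _)} _ (s≤s (s≤s ())) _
    ε≡ {ε = 1} {suc (suc _)} _ (s≤s (s≤s ())) _
   ... | refl | refl with *-cancelˡ-≡ r r' 6 (+-cancelʳ-≡ 5 _ _ (+-cancelʳ-≡ (2 * ε) _ _ (cong proj₁ e)))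
   ... | refl = refl
   onto : ∀ {y} → Conj y → ∃ λ x → ConjSet x × to x ≡ y
   onto {x , y} (eq , 3y<x) with conj-residues x y eq 3y<x
   ... | r , t , ε , ε<2 , refl , refl = (r , t , ε , tt) , conjugate (r<L , s≤s t≤r , <K2 ε<2 , e) , refl
    where
    t≤r : t ≤ r
    t≤r = s≤s⁻¹ (*-cancelˡ-< 6 t (suc r) (+-cancelʳ-≤ 3 _ _ (≤-trans (≤-reflexive (lem1 t)) (≤-trans 3y<x (≤-trans (+-monoʳ-≤ (6 * r + 5) (*-monoʳ-≤ 2 (s≤s⁻¹ ε<2))) (≤-trans (≤-reflexive (lem2 r)) (+-monoʳ-≤ (6 * suc r) (s≤s (z≤n {2})))))))))
     where
     lem1 : ∀ t → suc (6 * t) + 3 ≡ suc (3 * (2 * t + 1))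
     lem1 = ring
     lem2 : ∀ r → 6 * r + 5 + 2 * 1 ≡ 6 * suc r + 1
     lem2 = ring
    e : conjExponent r t ε ≡ m
    e = *-cancelˡ-≡ _ _ 24 (+-cancelʳ-≡ (3 * ((2 * t + 1) * (2 * t + 1))) _ _ (trans (norm t≤r ε<2) (sym eq)))
    r<L : r < L
    r<L = s≤s (subst (r ≤_) e (≤-trans (≤-trans (n≤1+n r) (m≤n+m (suc r) (tri r))) (≤-trans (m≤n+m (tri (suc r)) (dExp t (r ∸ t))) (m≤m+n _ (ε * suc r)))))

  private
   -- The map is (2a√3 - b)(1 + √3) = (6a - b) + (2a - b)√3, so x = 6a - b and y = |2a - b|. `near`
   -- is the case b ≤ 2a; `far` is b > 2a (at b = 2a the two would agree), with k = 3a - b.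
   data View : ℕ → ℕ → ℕ → ℕ → Set where
    near : ∀ a b y → b + y ≡ 2 * a → View a b (2 * b + 3 * y) y
    far  : ∀ k y → 0 < k → View (y + k) (3 * y + 2 * k) (3 * y + 4 * k) y

   coords : ℕ × ℕ → ℕ × ℕ
   coords (a , b) = 6 * a ∸ b , (2 * a ∸ b) + (b ∸ 2 * a)

   coords-near : ∀ a b y → b + y ≡ 2 * a → coords (a , b) ≡ (2 * b + 3 * y , y)
   coords-near a b y e = cong₂ _,_ (trans (cong (_∸ b) (trans (lem1 a) (trans (cong (3 *_) (sym e)) (lem2 b y)))) (m+n∸m≡n b (2 * b + 3 * y)))
    (trans (cong₂ _+_ (trans (cong (_∸ b) (sym e)) (m+n∸m≡n b y)) (trans (cong (b ∸_) (sym e)) (m≤n⇒m∸n≡0 (m≤m+n b y)))) (+-identityʳ y))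
    where
    lem1 : ∀ a → 6 * a ≡ 3 * (2 * a)
    lem1 = ring
    lem2 : ∀ b y → 3 * (b + y) ≡ b + (2 * b + 3 * y)
    lem2 = ring

   coords-far : ∀ k y → coords (y + k , 3 * y + 2 * k) ≡ (3 * y + 4 * k , y)
   coords-far k y = cong₂ _,_ (trans (cong (_∸ (3 * y + 2 * k)) (lem1 k y)) (m+n∸m≡n (3 * y + 2 * k) (3 * y + 4 * k)))
    (trans (cong₂ _+_ (m≤n⇒m∸n≡0 (≤-trans (m≤m+n (2 * (y + k)) y) (≤-reflexive (sym (lem2 k y))))) (trans (cong (_∸ 2 * (y + k)) (lem2 k y)) (m+n∸m≡n (2 * (y + k)) y))) refl)
    where
    lem1 : ∀ k y → 6 * (y + k) ≡ (3 * y + 2 * k) + (3 * y + 4 * k)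
    lem1 = ring
    lem2 : ∀ k y → 3 * y + 2 * k ≡ 2 * (y + k) + y
    lem2 = ring

   view : ∀ a b → b < 3 * a → ∃ λ x → ∃ λ y → View a b x y × coords (a , b) ≡ (x , y)
   view a b b<3a with ≤-total b (2 * a)
   ... | inj₁ b≤2a = _ , _ , near a b (2 * a ∸ b) (m+[n∸m]≡n b≤2a) , coords-near a b (2 * a ∸ b) (m+[n∸m]≡n b≤2a)
   ... | inj₂ 2a≤b = go (b ∸ 2 * a) (m+[n∸m]≡n 2a≤b)
    where
    go : ∀ y → 2 * a + y ≡ b → ∃ λ x → ∃ λ y → View a b x y × coords (a , b) ≡ (x , y)
    go y refl = go' (a ∸ y) (m+[n∸m]≡n (<⇒≤ y<a)) (m<n⇒0<n∸m y<a)
     where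
     y<a : y < a
     y<a = +-cancelˡ-< (2 * a) y a (≤-trans b<3a (≤-reflexive (lem a)))
      where
      lem : ∀ a → 3 * a ≡ 2 * a + a
      lem = ring
     go' : ∀ k → y + k ≡ a → 0 < k → ∃ λ x → ∃ λ y' → View a (2 * a + y) x y' × coords (a , 2 * a + y) ≡ (x , y')
     go' k refl 0<k = _ , _ , subst (λ b → View (y + k) b (3 * y + 4 * k) y) (sym (lem k y)) (far k y 0<k) , trans (cong (λ b → coords (y + k , b)) (lem k y)) (coords-far k y)
      where
      lem : ∀ k y → 2 * (y + k) + y ≡ 3 * y + 2 * k
      lem = ring

   b-odd : ∀ a b k → 12 * m + b * b ≡ 12 * (a * a) + 1 → b ≢ 2 * k
   b-odd a b k eq b≡2k with root-cases b (a * a) m eq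
   ... | j , δ , _ , e = even≢odd k (3 * j + 2 * δ) (trans (sym b≡2k) (trans e (lem j δ)))
    where
    lem : ∀ j δ → 6 * j + 1 + 4 * δ ≡ suc (2 * (3 * j + 2 * δ))
    lem = ring

   near-norm : ∀ a b y → b + y ≡ 2 * a → (12 * m + b * b ≡ 12 * (a * a) + 1 → 24 * m + 3 * (y * y) ≡ (2 * b + 3 * y) * (2 * b + 3 * y) + 2)
                     × (24 * m + 3 * (y * y) ≡ (2 * b + 3 * y) * (2 * b + 3 * y) + 2 → 12 * m + b * b ≡ 12 * (a * a) + 1)
   near-norm a b y e = (λ eq → +-cancelʳ-≡ (2 * (b * b)) _ _ (trans (lem1 m b y) (trans (cong (λ z → 2 * z + 3 * (y * y)) eq) (trans (lem2 a y) (trans (cong (λ z → 6 * (z * z) + 3 * (y * y) + 2) (sym e)) (lem3 b y))))))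
            , (λ eq → *-cancelˡ-≡ _ _ 2 (+-cancelʳ-≡ (3 * (y * y)) _ _ (trans (sym (lem1 m b y)) (trans (cong (_+ 2 * (b * b)) eq) (sym (trans (lem2 a y) (trans (cong (λ z → 6 * (z * z) + 3 * (y * y) + 2) (sym e)) (lem3 b y))))))))
    where
    lem1 : ∀ m b y → 24 * m + 3 * (y * y) + 2 * (b * b) ≡ 2 * (12 * m + b * b) + 3 * (y * y)
    lem1 = ring
    lem2 : ∀ a y → 2 * (12 * (a * a) + 1) + 3 * (y * y) ≡ 6 * ((2 * a) * (2 * a)) + 3 * (y * y) + 2
    lem2 = ring
    lem3 : ∀ b y → 6 * ((b + y) * (b + y)) + 3 * (y * y) + 2 ≡ (2 * b + 3 * y) * (2 * b + 3 * y) + 2 + 2 * (b * b)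
    lem3 = ring

   far-norm : ∀ k y → (12 * m + (3 * y + 2 * k) * (3 * y + 2 * k) ≡ 12 * ((y + k) * (y + k)) + 1 → 24 * m + 3 * (y * y) ≡ (3 * y + 4 * k) * (3 * y + 4 * k) + 2)
            × (24 * m + 3 * (y * y) ≡ (3 * y + 4 * k) * (3 * y + 4 * k) + 2 → 12 * m + (3 * y + 2 * k) * (3 * y + 2 * k) ≡ 12 * ((y + k) * (y + k)) + 1)
   far-norm k y = (λ eq → +-cancelʳ-≡ (2 * ((3 * y + 2 * k) * (3 * y + 2 * k))) _ _ (trans (lem1 m (3 * y + 2 * k) y) (trans (cong (λ z → 2 * z + 3 * (y * y)) eq) (lem2 k y))))
          , (λ eq → *-cancelˡ-≡ _ _ 2 (+-cancelʳ-≡ (3 * (y * y)) _ _ (trans (sym (lem1 m (3 * y + 2 * k) y)) (trans (cong (_+ 2 * ((3 * y + 2 * k) * (3 * y + 2 * k))) eq) (sym (lem2 k y))))))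
    where
    lem1 : ∀ m b y → 24 * m + 3 * (y * y) + 2 * (b * b) ≡ 2 * (12 * m + b * b) + 3 * (y * y)
    lem1 = ring
    lem2 : ∀ k y → 2 * (12 * ((y + k) * (y + k)) + 1) + 3 * (y * y) ≡ (3 * y + 4 * k) * (3 * y + 4 * k) + 2 + 2 * ((3 * y + 2 * k) * (3 * y + 2 * k))
    lem2 = ring

  -- Multiplication by 1 + √3 (of norm -2) relates the two norm equations.
  diag-conj : Card Conj #main
  diag-conj = card-image diag-card coords (λ {x} → to-ok {x}) (λ {x} {y} → inj {x} {y}) onto
   where
   to-ok : ∀ {x} → Diag x → Conj (coords x)
   to-ok {a , b} (eq , b<3a) with view a b b<3a
   ... | _ , _ , near .a .b y e , c≡ = subst Conj (sym c≡) (proj₁ (near-norm a b y e) eq , m<n+m (3 * y) (pos b (b-odd a b 0 eq)))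
    where
    pos : ∀ b → b ≢ 2 * 0 → 0 < 2 * b
    pos zero    b≢0 = ⊥-elim (b≢0 refl)
    pos (suc b) _   = s≤s z≤n
   ... | _ , _ , far (suc k) y _ , c≡ = subst Conj (sym c≡) (proj₁ (far-norm (suc k) y) eq , m<m+n (3 * y) (s≤s z≤n))
   inj : ∀ {x y} → Diag x → Diag y → coords x ≡ coords y → x ≡ y
   inj {a , b} {a' , b'} (eq , b<3a) (eq' , b'<3a') e with view a b b<3a | view a' b' b'<3a'
   ... | _ , _ , v , c≡ | _ , _ , v' , c'≡ = go v v' eq eq' (cong proj₁ (trans (sym c≡) (trans e c'≡))) (cong proj₂ (trans (sym c≡) (trans e c'≡)))
    where
    go : ∀ {a b x y a' b' x' y'} → View a b x y → View a' b' x' y' → 12 * m + b * b ≡ 12 * (a * a) + 1 → 12 * m + b' * b' ≡ 12 * (a' * a') + 1 →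
       x ≡ x' → y ≡ y' → _≡_ {A = ℕ × ℕ} (a , b) (a' , b')
    go (near a b y s) (near a' b' .y s') _ _ ex refl with *-cancelˡ-≡ b b' 2 (+-cancelʳ-≡ (3 * y) _ _ ex)
    ... | refl with *-cancelˡ-≡ a a' 2 (trans (sym s) s')
    ... | refl = refl
    go (far k y _) (far k' .y _) _ _ ex refl with *-cancelˡ-≡ k k' 4 (+-cancelˡ-≡ (3 * y) _ _ ex)
    ... | refl = refl
    -- x - 3y is 2b with b odd in the near case and 4k in the far case, so the two images are
    -- disjoint.
    go (near a b y s) (far k .y _) eq _ ex refl = ⊥-elim (b-odd a b k eq (*-cancelˡ-≡ b (2 * k) 2 (+-cancelʳ-≡ (3 * y) _ _ (trans ex (lem k y)))))
     where
     lem : ∀ k y → 3 * y + 4 * k ≡ 2 * (2 * k) + 3 * y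
     lem = ring
    go (far k y _) (near a b .y s) _ eq ex refl = ⊥-elim (b-odd a b k eq (*-cancelˡ-≡ b (2 * k) 2 (+-cancelʳ-≡ (3 * y) _ _ (trans (sym ex) (lem k y)))))
     where
     lem : ∀ k y → 3 * y + 4 * k ≡ 2 * (2 * k) + 3 * y
     lem = ring
   onto : ∀ {y} → Conj y → ∃ λ x → Diag x × coords x ≡ y
   onto {x , y} (eq , 3y<x) with conj-residues x y eq 3y<x
   ... | r , t , ε , _ , x≡ , refl = go (even-odd w)
    where
    x∸ : 3 * (2 * t + 1) + (x ∸ 3 * (2 * t + 1)) ≡ x
    x∸ = m+[n∸m]≡n (<⇒≤ 3y<x)
    t≤ : t ≤ r + ε
    t≤ = s≤s⁻¹ (*-cancelˡ-< 6 t (suc (r + ε)) (≤-trans (≤-trans (m≤m+n (suc (6 * t)) 3) (≤-trans (≤-reflexive (lem1 t)) (≤-trans 3y<x (≤-reflexive x≡)))) (≤-trans (+-monoʳ-≤ (6 * r + 5) (m≤m+n (2 * ε) (4 * ε + 1))) (≤-reflexive (lem2 r ε)))))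
     where
     lem1 : ∀ t → suc (6 * t) + 3 ≡ suc (3 * (2 * t + 1))
     lem1 = ring
     lem2 : ∀ r ε → 6 * r + 5 + (2 * ε + (4 * ε + 1)) ≡ 6 * suc (r + ε)
     lem2 = ring
    -- Half of x - 3y. If w is even the preimage is a far point with k = w/2, and if w is odd it is
    -- a near point with b = w.
    w : ℕ
    w = (x ∸ 3 * (2 * t + 1)) / 2
    2w : x ≡ 3 * (2 * t + 1) + 2 * w
    2w = trans (sym x∸) (cong (3 * (2 * t + 1) +_) (trans (sym (m/n*n≡m (divides-even))) (*-comm w 2)))
     where
     divides-even : 2 ∣ x ∸ 3 * (2 * t + 1)
     divides-even = divides (3 * r + 1 + ε ∸ 3 * t) (+-cancelˡ-≡ (3 * (2 * t + 1)) _ _ (trans x∸ (trans x≡ (trans (lem1 r ε) (trans (cong (λ z → 2 * z + 3) (sym (m+[n∸m]≡n 3t≤))) (lem2 t (3 * r + 1 + ε ∸ 3 * t)))))))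
      where
      lem1 : ∀ r ε → 6 * r + 5 + 2 * ε ≡ 2 * (3 * r + 1 + ε) + 3
      lem1 = ring
      3t≤ : 3 * t ≤ 3 * r + 1 + ε
      3t≤ = *-cancelˡ-≤ 2 (+-cancelʳ-≤ 3 _ _ (≤-trans (≤-reflexive (lem3 t)) (≤-trans (<⇒≤ 3y<x) (≤-reflexive (trans x≡ (lem1 r ε))))))
       where
       lem3 : ∀ t → 2 * (3 * t) + 3 ≡ 3 * (2 * t + 1)
       lem3 = ring
      lem2 : ∀ t w → 2 * (3 * t + w) + 3 ≡ 3 * (2 * t + 1) + w * 2
      lem2 = ring
    go : (∃ λ k → ∃ λ p → p < 2 × w ≡ p + k * 2) → ∃ λ z → Diag z × coords z ≡ (x , 2 * t + 1)
    go (k , 0 , _ , w≡) = (2 * t + 1 + k , 3 * (2 * t + 1) + 2 * k) , (proj₂ (far-norm k (2 * t + 1)) (trans eq (cong (λ z → z * z + 2) (trans 2w (trans (cong (λ w → 3 * (2 * t + 1) + 2 * w) w≡) (lem t k)))))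
     , subst₂ _≤_ (+-suc (3 * (2 * t + 1)) (2 * k)) (sym (*-distribˡ-+ 3 (2 * t + 1) k)) (+-monoʳ-≤ (3 * (2 * t + 1)) (2k<3k k (k-pos k w≡))))
     , trans (coords-far k (2 * t + 1)) (cong (_, 2 * t + 1) (trans (sym (lem t k)) (trans (cong (λ w → 3 * (2 * t + 1) + 2 * w) (sym w≡)) (sym 2w))))
     where
     lem : ∀ t k → 3 * (2 * t + 1) + 2 * (k * 2) ≡ 3 * (2 * t + 1) + 4 * k
     lem = ring
     k-pos : ∀ k → w ≡ k * 2 → 0 < k
     k-pos zero    w≡0 = ⊥-elim (<-irrefl (sym (trans 2w (trans (cong (λ w → 3 * (2 * t + 1) + 2 * w) w≡0) (+-identityʳ _)))) 3y<x)
     k-pos (suc k) _   = s≤s z≤n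
     2k<3k : ∀ k → 0 < k → suc (2 * k) ≤ 3 * k
     2k<3k k 0<k = ≤-trans (≤-reflexive (+-comm 1 (2 * k))) (≤-trans (+-monoʳ-≤ (2 * k) 0<k) (≤-reflexive (lem2 k)))
      where
      lem2 : ∀ k → 2 * k + k ≡ 3 * k
      lem2 = ring
    go (k , 1 , _ , w≡) = (k + t + 1 , 1 + k * 2) , (proj₂ (near-norm (k + t + 1) (1 + k * 2) (2 * t + 1) e) (trans eq (cong (λ z → z * z + 2) x≡')) , *-cancelˡ-< 2 (1 + k * 2) (3 * (k + t + 1)) (≤-trans (m≤m+n (suc (2 * (1 + k * 2))) (2 * k + 6 * t + 3)) (≤-reflexive (lem2 k t))))
     , trans (coords-near (k + t + 1) (1 + k * 2) (2 * t + 1) e) (cong (_, 2 * t + 1) (sym x≡'))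
     where
     e : 1 + k * 2 + (2 * t + 1) ≡ 2 * (k + t + 1)
     e = lem k t
      where
      lem : ∀ k t → 1 + k * 2 + (2 * t + 1) ≡ 2 * (k + t + 1)
      lem = ring
     x≡' : x ≡ 2 * (1 + k * 2) + 3 * (2 * t + 1)
     x≡' = trans 2w (trans (cong (λ w → 3 * (2 * t + 1) + 2 * w) w≡) (+-comm (3 * (2 * t + 1)) _))
     lem2 : ∀ k t → suc (2 * (1 + k * 2)) + (2 * k + 6 * t + 3) ≡ 2 * (3 * (k + t + 1))
     lem2 = ring
    go (k , suc (suc _) , s≤s (s≤s ()) , _)

  rep-card : Card Rep (#main + (#tail + #tail))
  rep-card = card-⇔ (card-⊎ same (card-⊎ above-card below (λ { (_ , _ , a<c) (_ , _ , c<a) → <-asym a<c c<a }))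
    (λ { {a , b , c} (refl , _) (inj₁ (_ , _ , a<c)) → <-irrefl refl a<c ; {a , b , c} (refl , _) (inj₂ (_ , _ , c<a)) → <-irrefl refl c<a })) to from
   where
   Below : ℕ × ℕ × ℕ → Set
   Below (a , b , c) = 12 * m + b * b ≡ 12 * (c * a) + 1 × b < 3 * c × c < a
   Equal : ℕ × ℕ × ℕ → Set
   Equal (a , b , c) = a ≡ c × Diag (a , b)
   same : Card Equal #main
   same = card-map diag-card (λ (a , b) → a , b , a) (λ (a , b , c) → a , b) (refl ,_) proj₂ (λ _ → refl) (λ { (refl , _) → refl })
   below : Card Below #tail
   below = card-map above-card (λ (a , b , c) → c , b , a) (λ (a , b , c) → c , b , a) id id (λ _ → refl) (λ _ → refl)
    where open import Function.Base using (id)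
   to : ∀ {x} → Equal x ⊎ Above x ⊎ Below x → Rep x
   to (inj₁ (refl , eq , b<3a)) = eq , b<3a , b<3a
   to (inj₂ (inj₁ (eq , b<3a , a<c))) = eq , b<3a , <-trans b<3a (*-monoʳ-< 3 a<c)
   to {a , b , c} (inj₂ (inj₂ (eq , b<3c , c<a))) = trans eq (cong (λ z → 12 * z + 1) (*-comm c a)) , <-trans b<3c (*-monoʳ-< 3 c<a) , b<3c
   from : ∀ {x} → Rep x → Equal x ⊎ Above x ⊎ Below x
   from {a , b , c} (eq , b<3a , b<3c) with <-cmp a c
   ... | tri≈ _ refl _ = inj₁ (refl , eq , b<3a)
   ... | tri< a<c _ _  = inj₂ (inj₁ (eq , b<3a , a<c))
   ... | tri> _ _ c<a  = inj₂ (inj₂ (trans eq (cong (λ z → 12 * z + 1) (*-comm a c)) , b<3c , c<a))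

  #conj≡#main : #conj ≡ #main
  #conj≡#main = card-unique conj-card' diag-conj

 private
  congruent : ∀ x y h → ℤ.+ x ≡ ℤ.+ y ℤ.+ ℤ.+ 4 ℤ.* h → x % 4 ≡ y % 4
  congruent x y (ℤ.+ k) e = trans (cong (_% 4) (ℤP.+-injective (trans e (cong (λ z → ℤ.+ y ℤ.+ z) (sym (ℤP.pos-* 4 k)))))) (trans (cong (λ z → (y + z) % 4) (*-comm 4 k)) ([m+kn]%n≡m%n y k 4))
  congruent x y ℤ.-[1+ k ] e = sym (trans (cong (_% 4) (ℤP.+-injective {y} {x + suc k * 4} (trans (shift (ℤ.+ x) (ℤ.+ y) ℤ.-[1+ k ] e)
    (cong (λ z → ℤ.+ x ℤ.+ z) (trans (sym (ℤP.pos-* 4 (suc k))) (cong ℤ.+_ (*-comm 4 (suc k)))))))) ([m+kn]%n≡m%n x (suc k) 4))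
   where
   shift : ∀ x y h → x ≡ y ℤ.+ ℤ.+ 4 ℤ.* h → y ≡ x ℤ.+ ℤ.+ 4 ℤ.* (ℤ.- h)
   shift x y h e = trans (lem y h) (cong (ℤ._+ ℤ.+ 4 ℤ.* (ℤ.- h)) (sym e))
    where
    lem : ∀ y h → y ≡ (y ℤ.+ ℤ.+ 4 ℤ.* h) ℤ.+ ℤ.+ 4 ℤ.* (ℤ.- h)
    lem = ℤ-RingSolver.solve-∀

  halve : ∀ x y → x % 4 ≡ y % 4 → x % 2 ≡ y % 2
  halve x y e = trans (reduce x) (trans (cong (_% 2) e) (sym (reduce y)))
   where
   reduce : ∀ x → x % 2 ≡ (x % 4) % 2
   reduce x = trans (cong (_% 2) (trans (m≡m%n+[m/n]*n x 4) (cong (x % 4 +_) (lem (x / 4))))) ([m+kn]%n≡m%n (x % 4) (2 * (x / 4)) 2)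
    where
    lem : ∀ z → z * 4 ≡ 2 * z * 2
    lem = ring

 -- The expansion says that N is (2κ - 1) e + 2t modulo 4. For κ = 1 this is e + 2t. For κ = 0 it
 -- differs from e + 2t by 2e, which matters modulo 4 only if e is odd, and then neither number is 2
 -- modulo 4.
 residues-agree : ∀ N e t κ h → κ ≡ 0 ⊎ κ ≡ 1 → ℤ.+ N ℤ.+ ℤ.+ e ≡ ℤ.+ 2 ℤ.* (ℤ.+ κ ℤ.* ℤ.+ e ℤ.+ ℤ.+ t) ℤ.+ ℤ.+ 2 ℤ.* (ℤ.+ 2 ℤ.* h) →
          (N % 2 ≡ (e + (t + t)) % 2) × (N % 4 ≡ 2 ⇔ (e + (t + t)) % 4 ≡ 2)
 residues-agree N e t κ h κ-01 expansion = residues κ-01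
  where
  n = e + (t + t)
  pos-n : ℤ.+ n ≡ ℤ.+ e ℤ.+ (ℤ.+ t ℤ.+ ℤ.+ t)
  pos-n = trans (ℤP.pos-+ e _) (cong (λ z → ℤ.+ e ℤ.+ z) (ℤP.pos-+ t t))
  case-1 : κ ≡ 1 → N % 4 ≡ n % 4
  case-1 κ≡1 = congruent N n h (trans (lem (ℤ.+ N) (ℤ.+ e) (ℤ.+ κ) (ℤ.+ t) h expansion (cong ℤ.+_ κ≡1)) (cong (ℤ._+ ℤ.+ 4 ℤ.* h) (sym pos-n)))
   where
   lem : ∀ N e κ t h → N ℤ.+ e ≡ ℤ.+ 2 ℤ.* (κ ℤ.* e ℤ.+ t) ℤ.+ ℤ.+ 2 ℤ.* (ℤ.+ 2 ℤ.* h) → κ ≡ ℤ.+ 1 → N ≡ e ℤ.+ (t ℤ.+ t) ℤ.+ ℤ.+ 4 ℤ.* h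
   lem N e κ t h eq refl = trans (go1 N e) (trans (cong (ℤ._- e) eq) (go e t h))
    where
    go1 : ∀ N e → N ≡ N ℤ.+ e ℤ.- e
    go1 = ℤ-RingSolver.solve-∀
    go : ∀ e t h → ℤ.+ 2 ℤ.* (ℤ.+ 1 ℤ.* e ℤ.+ t) ℤ.+ ℤ.+ 2 ℤ.* (ℤ.+ 2 ℤ.* h) ℤ.- e ≡ e ℤ.+ (t ℤ.+ t) ℤ.+ ℤ.+ 4 ℤ.* h
    go = ℤ-RingSolver.solve-∀
  case-0 : κ ≡ 0 → (N + 2 * e) % 4 ≡ n % 4
  case-0 κ≡0 = congruent (N + 2 * e) n h (trans (trans (ℤP.pos-+ N (2 * e)) (cong (λ z → ℤ.+ N ℤ.+ z) (ℤP.pos-* 2 e)))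
   (trans (lem (ℤ.+ N) (ℤ.+ e) (ℤ.+ κ) (ℤ.+ t) h expansion (cong ℤ.+_ κ≡0)) (cong (ℤ._+ ℤ.+ 4 ℤ.* h) (sym pos-n))))
   where
   lem : ∀ N e κ t h → N ℤ.+ e ≡ ℤ.+ 2 ℤ.* (κ ℤ.* e ℤ.+ t) ℤ.+ ℤ.+ 2 ℤ.* (ℤ.+ 2 ℤ.* h) → κ ≡ ℤ.+ 0 → N ℤ.+ ℤ.+ 2 ℤ.* e ≡ e ℤ.+ (t ℤ.+ t) ℤ.+ ℤ.+ 4 ℤ.* h
   lem N e κ t h eq refl = trans (go1 N e) (trans (cong (ℤ._+ e) eq) (go e t h))
    where
    go1 : ∀ N e → N ℤ.+ ℤ.+ 2 ℤ.* e ≡ N ℤ.+ e ℤ.+ e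
    go1 = ℤ-RingSolver.solve-∀
    go : ∀ e t h → ℤ.+ 2 ℤ.* (ℤ.+ 0 ℤ.* e ℤ.+ t) ℤ.+ ℤ.+ 2 ℤ.* (ℤ.+ 2 ℤ.* h) ℤ.+ e ≡ e ℤ.+ (t ℤ.+ t) ℤ.+ ℤ.+ 4 ℤ.* h
    go = ℤ-RingSolver.solve-∀
  finish : ∀ {x y} → x % 4 ≡ y % 4 → (x % 2 ≡ y % 2) × (x % 4 ≡ 2 ⇔ y % 4 ≡ 2)
  finish {x} {y} e = halve x y e , mk⇔ (trans (sym e)) (trans e)
  odd-case : ∀ x → x % 2 ≡ 1 → x % 4 ≢ 2
  odd-case x x%2 x%4 = case trans (sym x%2) (halve x 2 x%4) of λ ()
  residues : κ ≡ 0 ⊎ κ ≡ 1 → (N % 2 ≡ n % 2) × (N % 4 ≡ 2 ⇔ n % 4 ≡ 2)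
  residues (inj₂ κ≡1) = finish {N} {n} (case-1 κ≡1)
  residues (inj₁ κ≡0) with case-0 κ≡0 | e / 2 | e % 2 | m%n<n e 2 | m≡m%n+[m/n]*n e 2
  ... | e4 | k | 0 | _ | main≡ = finish {N} {n} (trans (sym (trans (cong (λ z → (N + 2 * z) % 4) main≡) (trans (cong (λ z → (N + z) % 4) (lem k)) ([m+kn]%n≡m%n N k 4)))) e4)
   where
   lem : ∀ k → 2 * (k * 2) ≡ k * 4
   lem = ring
  ... | e4 | k | 1 | _ | main≡ = N%2 , mk⇔ (λ N%4 → ⊥-elim (odd-case N (trans N%2 n%2) N%4)) (λ n%4 → ⊥-elim (odd-case n n%2 n%4))
   where
   N%2 : N % 2 ≡ n % 2
   N%2 = trans (sym (trans (cong (λ z → (N + z) % 2) (*-comm 2 e)) ([m+kn]%n≡m%n N e 2))) (halve (N + 2 * e) n e4)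
   n%2 : n % 2 ≡ 1
   n%2 = trans (cong (_% 2) (trans (cong (_+ (t + t)) main≡) (lem k t))) ([m+kn]%n≡m%n 1 (k + t) 2)
    where
    lem : ∀ k t → 1 + k * 2 + (t + t) ≡ 1 + (k + t) * 2
    lem = ring
  ... | _ | _ | suc (suc _) | s≤s (s≤s ()) | _

 -- The terms of `Nσ-expansion` become comparable because #conj = #main and #even is 0 or #main; the
 -- triples off the diagonal come in mirrored pairs, which gives #main + 2 #tail.
 Nσ-class-number : ∀ m → ∃ λ n → Card (Count.Rep m 2 refl) n × (Nσ m % 2 ≡ n % 2) × (Nσ m % 4 ≡ 2 ⇔ n % 4 ≡ 2)
 Nσ-class-number m = #main + (#tail + #tail) , rep-card ,
  residues-agree (Nσ m) #main #tail (parity (suc m)) (proj₁ Nσ-expansion) (parity-01 (suc m))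
   (trans (cong (λ e → ℤ.+ Nσ m ℤ.+ ℤ.+ e) (sym #conj≡#main)) (trans (proj₂ Nσ-expansion)
    (cong (λ z → ℤ.+ 2 ℤ.* (z ℤ.+ ℤ.+ #tail) ℤ.+ ℤ.+ 2 ℤ.* (ℤ.+ 2 ℤ.* proj₁ Nσ-expansion)) (trans (cong ℤ.+_ #even-value) (ℤP.pos-* (parity (suc m)) #main)))))
  where open Count m 2 refl

-- Binary quadratic forms and integral substitutions

module Forms where

 open import Data.Nat.Base as ℕ using (ℕ; zero; suc)
 open import Data.Integer.Base
 open import Data.Integer.Properties
 open import Data.Integer.Tactic.RingSolver using () renaming (solve-∀ to ring)
 open import Data.Product.Properties using (≡-dec)

 -- Linear combinations of equations, checked by the ring solver.
 eq1 : ∀ {l r} k x y → l ≡ r → x - y ≡ k * (l - r) → x ≡ y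
 eq1 {l} {r} k x y e i = i-j≡0⇒i≡j x y (trans i (trans (cong (λ z → k * (z - r)) e) (trans (cong (λ z → k * z) (+-inverseʳ r)) (*-zeroʳ k))))

 eq2 : ∀ {l r l' r'} k k' x y → l ≡ r → l' ≡ r' → x - y ≡ k * (l - r) + k' * (l' - r') → x ≡ y
 eq2 {l} {r} {l'} {r'} k k' x y e e' i = eq1 k x y e (trans i (trans (cong (λ z → k * (l - r) + z)
  (trans (cong (λ z → k' * (z - r')) e') (trans (cong (λ z → k' * z) (+-inverseʳ r')) (*-zeroʳ k')))) (+-identityʳ _)))

 -- (a , b , c) stands for a x² + b x y + c y².
 Form : Set
 Form = ℤ × ℤ × ℤ

 _≟ᶠ_ : DecidableEquality Form
 _≟ᶠ_ = ≡-dec _≟_ (≡-dec _≟_ _≟_)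

 -- [[p , q] , [r , s]]
 record Matrix : Set where
  constructor mat
  field p q r s : ℤ

 det : Matrix → ℤ
 det (mat p q r s) = p * s - q * r

 _·ᵐ_ : Matrix → Matrix → Matrix
 mat p q r s ·ᵐ mat p' q' r' s' = mat (p * p' + q * r') (p * q' + q * s') (r * p' + s * r') (r * q' + s * s')

 adj : Matrix → Matrix
 adj (mat p q r s) = mat s (- q) (- r) p

 value : Form → ℤ → ℤ → ℤ
 value (a , b , c) x y = a * (x * x) + b * (x * y) + c * (y * y)

 polar : Form → ℤ → ℤ → ℤ → ℤ → ℤ
 polar (a , b , c) x y u v = + 2 * a * (x * u) + b * (x * v + y * u) + + 2 * c * (y * v)

 act : Form → Matrix → Form
 act f (mat p q r s) = value f p r , polar f p r q s , value f q s

 infixr 7 _⋆_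
 _⋆_ : ℤ → Form → Form
 n ⋆ (a , b , c) = n * a , n * b , n * c

 form-≡ : ∀ {a b c a' b' c' : ℤ} → a ≡ a' → b ≡ b' → c ≡ c' → _≡_ {A = Form} (a , b , c) (a' , b' , c')
 form-≡ refl refl refl = refl

 act-· : ∀ f M N → act (act f M) N ≡ act f (M ·ᵐ N)
 act-· (a , b , c) (mat p q r s) (mat p' q' r' s') = form-≡ (val a b c p q r s p' r') (pol a b c p q r s p' r' q' s') (val a b c p q r s q' s')
  where
  val : ∀ a b c p q r s x y → let A = a * (p * p) + b * (p * r) + c * (r * r) ; B = + 2 * a * (p * q) + b * (p * s + r * q) + + 2 * c * (r * s) ; C = a * (q * q) + b * (q * s) + c * (s * s) ; X = p * x + q * y ; Y = r * x + s * y in A * (x * x) + B * (x * y) + C * (y * y) ≡ a * (X * X) + b * (X * Y) + c * (Y * Y)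
  val = ring
  pol : ∀ a b c p q r s x y u v → let A = a * (p * p) + b * (p * r) + c * (r * r) ; B = + 2 * a * (p * q) + b * (p * s + r * q) + + 2 * c * (r * s) ; C = a * (q * q) + b * (q * s) + c * (s * s) ; X = p * x + q * y ; Y = r * x + s * y ; U = p * u + q * v ; V = r * u + s * v in + 2 * A * (x * u) + B * (x * v + y * u) + + 2 * C * (y * v) ≡ + 2 * a * (X * U) + b * (X * V + Y * U) + + 2 * c * (Y * V)
  pol = ring

 act-⋆ : ∀ n f M → act (n ⋆ f) M ≡ n ⋆ act f M
 act-⋆ n (a , b , c) (mat p q r s) = form-≡ (val n a b c p r) (pol n a b c p r q s) (val n a b c q s)
  where
  val : ∀ n a b c x y → n * a * (x * x) + n * b * (x * y) + n * c * (y * y) ≡ n * (a * (x * x) + b * (x * y) + c * (y * y))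
  val = ring
  pol : ∀ n a b c x y u v → + 2 * (n * a) * (x * u) + n * b * (x * v + y * u) + + 2 * (n * c) * (y * v)
    ≡ n * (+ 2 * a * (x * u) + b * (x * v + y * u) + + 2 * c * (y * v))
  pol = ring

 det-· : ∀ M N → det (M ·ᵐ N) ≡ det M * det N
 det-· (mat p q r s) (mat p' q' r' s') = lem p q r s p' q' r' s'
  where
  lem : ∀ p q r s p' q' r' s' → (p * p' + q * r') * (r * q' + s * s') - (p * q' + q * s') * (r * p' + s * r') ≡ (p * s - q * r) * (p' * s' - q' * r')
  lem = ring

 det-adj : ∀ M → det (adj M) ≡ det M
 det-adj (mat p q r s) = lem p q r s
  where
  lem : ∀ p q r s → s * p - - q * - r ≡ p * s - q * r
  lem = ring

 act-adj : ∀ f M → act (act f M) (adj M) ≡ (det M * det M) ⋆ f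
 act-adj (a , b , c) (mat p q r s) = trans (act-· (a , b , c) (mat p q r s) (mat s (- q) (- r) p))
  (form-≡ (lem1 a b c p q r s) (lem2 a b c p q r s) (lem3 a b c p q r s))
  where
  lem1 : ∀ a b c p q r s → let X = p * s + q * - r ; Y = r * s + s * - r in a * (X * X) + b * (X * Y) + c * (Y * Y) ≡ (p * s - q * r) * (p * s - q * r) * a
  lem1 = ring
  lem2 : ∀ a b c p q r s → let X = p * s + q * - r ; Y = r * s + s * - r ; U = p * - q + q * p ; V = r * - q + s * p in
   + 2 * a * (X * U) + b * (X * V + Y * U) + + 2 * c * (Y * V) ≡ (p * s - q * r) * (p * s - q * r) * b
  lem2 = ring
  lem3 : ∀ a b c p q r s → let X = p * - q + q * p ; Y = r * - q + s * p in a * (X * X) + b * (X * Y) + c * (Y * Y) ≡ (p * s - q * r) * (p * s - q * r) * c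
  lem3 = ring

 -- The negative of the usual discriminant, so that it is positive on definite forms.
 disc : Form → ℤ
 disc (a , b , c) = + 4 * (a * c) - b * b

 disc-act : ∀ f M → disc (act f M) ≡ det M * det M * disc f
 disc-act (a , b , c) (mat p q r s) = lem a b c p q r s
  where
  lem : ∀ a b c p q r s → let A = a * (p * p) + b * (p * r) + c * (r * r) ; B = + 2 * a * (p * q) + b * (p * s + r * q) + + 2 * c * (r * s) ; C = a * (q * q) + b * (q * s) + c * (s * s) in + 4 * (A * C) - B * B ≡ (p * s - q * r) * (p * s - q * r) * (+ 4 * (a * c) - b * b)
  lem = ring

 infix 4 _≈_ _≈⟨_⟩_
 -- f ≈⟨ n ⟩ g: some integer substitution of determinant n turns f into g.
 record _≈⟨_⟩_ (f : Form) (n : ℤ) (g : Form) : Set where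
  constructor by
  field
   matrix : Matrix
   det≡   : det matrix ≡ n
   act≡   : act f matrix ≡ g

 _≈_ : Form → Form → Set
 f ≈ g = f ≈⟨ 1ℤ ⟩ g

 1⋆ : ∀ f → 1ℤ ⋆ f ≡ f
 1⋆ (a , b , c) = form-≡ (*-identityˡ a) (*-identityˡ b) (*-identityˡ c)

 ≈-comp : ∀ {f g h m n} → f ≈⟨ m ⟩ g → g ≈⟨ n ⟩ h → f ≈⟨ m * n ⟩ h
 ≈-comp {f} (by M d e) (by N d' e') = by (M ·ᵐ N) (trans (det-· M N) (cong₂ _*_ d d')) (trans (sym (act-· f M N)) (trans (cong (λ g → act g N) e) e'))

 ≈-trans : ∀ {f g h} → f ≈ g → g ≈ h → f ≈ h
 ≈-trans p q = ≈-comp p q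

 -- The adjugate matrix undoes a substitution of determinant n up to the scalar n, which acts on
 -- forms as n².
 ≈-rev : ∀ {f g n} → f ≈⟨ n ⟩ g → g ≈⟨ n ⟩ (n * n) ⋆ f
 ≈-rev {f} (by M d e) = by (adj M) (trans (det-adj M) d) (trans (cong (λ g → act g (adj M)) (sym e)) (trans (act-adj f M) (cong (λ d → (d * d) ⋆ f) d)))

 ≈-sym : ∀ {f g} → f ≈ g → g ≈ f
 ≈-sym {f} {g} p = subst (g ≈_) (1⋆ f) (≈-rev p)

 I : Matrix
 I = mat 1ℤ 0ℤ 0ℤ 1ℤ

 act-I : ∀ f → act f I ≡ f
 act-I (a , b , c) = form-≡ (lem1 a b c) (lem2 a b c) (lem3 a b c)
  where
  lem1 : ∀ a b c → a * (1ℤ * 1ℤ) + b * (1ℤ * 0ℤ) + c * (0ℤ * 0ℤ) ≡ a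
  lem1 = ring
  lem2 : ∀ a b c → + 2 * a * (1ℤ * 0ℤ) + b * (1ℤ * 1ℤ + 0ℤ * 0ℤ) + + 2 * c * (0ℤ * 1ℤ) ≡ b
  lem2 = ring
  lem3 : ∀ a b c → a * (0ℤ * 0ℤ) + b * (0ℤ * 1ℤ) + c * (1ℤ * 1ℤ) ≡ c
  lem3 = ring

 ≈-refl : ∀ {f} → f ≈ f
 ≈-refl {f} = by I refl (act-I f)

 translate : ∀ a b c t → (a , b , c) ≈ (a , b + + 2 * a * t , a * (t * t) + b * t + c)
 translate a b c t = by (mat 1ℤ t 0ℤ 1ℤ) (lem0 t) (form-≡ (lem1 a b c) (lem2 a b c t) (lem3 a b c t))
  where
  lem0 : ∀ t → 1ℤ * 1ℤ - t * 0ℤ ≡ 1ℤ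
  lem0 = ring
  lem1 : ∀ a b c → a * (1ℤ * 1ℤ) + b * (1ℤ * 0ℤ) + c * (0ℤ * 0ℤ) ≡ a
  lem1 = ring
  lem2 : ∀ a b c t → + 2 * a * (1ℤ * t) + b * (1ℤ * 1ℤ + 0ℤ * t) + + 2 * c * (0ℤ * 1ℤ) ≡ b + + 2 * a * t
  lem2 = ring
  lem3 : ∀ a b c t → a * (t * t) + b * (t * 1ℤ) + c * (1ℤ * 1ℤ) ≡ a * (t * t) + b * t + c
  lem3 = ring

 swap : ∀ a b c → (a , b , c) ≈ (c , - b , a)
 swap a b c = by (mat 0ℤ (- 1ℤ) 1ℤ 0ℤ) refl (form-≡ (lem1 a b c) (lem2 a b c) (lem3 a b c))
  where
  lem1 : ∀ a b c → a * (0ℤ * 0ℤ) + b * (0ℤ * 1ℤ) + c * (1ℤ * 1ℤ) ≡ c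
  lem1 = ring
  lem2 : ∀ a b c → + 2 * a * (0ℤ * - 1ℤ) + b * (0ℤ * 0ℤ + 1ℤ * - 1ℤ) + + 2 * c * (1ℤ * 0ℤ) ≡ - b
  lem2 = ring
  lem3 : ∀ a b c → a * (- 1ℤ * - 1ℤ) + b * (- 1ℤ * 0ℤ) + c * (0ℤ * 0ℤ) ≡ a
  lem3 = ring

 -- Positive forms of discriminant -D.
 PosForm : ℤ → Form → Set
 PosForm D (a , b , c) = + 4 * (a * c) ≡ b * b + D × 0ℤ < a

 disc⇒ : ∀ {a b c D} → disc (a , b , c) ≡ D → + 4 * (a * c) ≡ b * b + D
 disc⇒ {a} {b} {c} refl = lem a b c
  where
  lem : ∀ a b c → + 4 * (a * c) ≡ b * b + (+ 4 * (a * c) - b * b)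
  lem = ring

 ⇒disc : ∀ {a b c D} → + 4 * (a * c) ≡ b * b + D → disc (a , b , c) ≡ D
 ⇒disc {a} {b} {c} {D} e = trans (cong (λ z → z - b * b) e) (lem b D)
  where
  lem : ∀ b D → b * b + D - b * b ≡ D
  lem = ring

 disc-≈ : ∀ {f g} → f ≈ g → disc g ≡ disc f
 disc-≈ {f} (by M d e) = trans (cong disc (sym e)) (trans (disc-act f M) (trans (cong (λ d → d * d * disc f) d) (*-identityˡ _)))

 0<sum : ∀ {x y} → 0ℤ ≤ x → 0ℤ < y → 0ℤ < x + y
 0<sum p q = +-mono-≤-< p q

 0≤square : ∀ x → 0ℤ ≤ x * x
 0≤square (+ n)    = subst (0ℤ ≤_) (pos-* n n) (+≤+ ℕ.z≤n)
 0≤square -[1+ n ] = +≤+ ℕ.z≤n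

 0≤* : ∀ {x y} → 0ℤ ≤ x → 0ℤ ≤ y → 0ℤ ≤ x * y
 0≤* {+ m} {+ n} _ _ = subst (0ℤ ≤_) (pos-* m n) (+≤+ ℕ.z≤n)

 0<* : ∀ {x y} → 0ℤ < x → 0ℤ < y → 0ℤ < x * y
 0<* {+ suc m} {+ suc n} _ _ = +<+ (ℕ.s≤s ℕ.z≤n)
 0<* {+ zero} (+<+ ())
 0<* {+ suc m} {+ zero} _ (+<+ ())

 0<⇐*ˡ : ∀ {x y} → 0ℤ < x → 0ℤ < x * y → 0ℤ < y
 0<⇐*ˡ {x} {+ suc n}    _ _ = +<+ (ℕ.s≤s ℕ.z≤n)
 0<⇐*ˡ {x} {+ zero}     p q = ⊥-elim (<-irrefl (sym (*-zeroʳ x)) q)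
 0<⇐*ˡ {+ suc m} { -[1+ n ]} p ()
 0<⇐*ˡ {+ zero} { -[1+ n ]} (+<+ ()) q

 square-pos : ∀ {x} → x ≢ 0ℤ → 0ℤ < x * x
 square-pos {+ zero}   x≢0 = ⊥-elim (x≢0 refl)
 square-pos {+ suc n}  x≢0 = +<+ (ℕ.s≤s ℕ.z≤n)
 square-pos { -[1+ n ]} x≢0 = +<+ (ℕ.s≤s ℕ.z≤n)

 ≤-from-diff : ∀ {x y} → 0ℤ ≤ y - x → x ≤ y
 ≤-from-diff = 0≤i-j⇒j≤i

 <⇒0<- : ∀ {x y} → x < y → 0ℤ < y - x
 <⇒0<- {x} {y} x<y = subst (_< y - x) (+-inverseʳ x) (+-monoˡ-< (- x) x<y)

 -- 4 a f(x,y) = (2 a x + b y)² + D y².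
 value-pos : ∀ {D a b c} → 0ℤ < D → PosForm D (a , b , c) → ∀ x y → ¬ (x ≡ 0ℤ × y ≡ 0ℤ) → 0ℤ < value (a , b , c) x y
 value-pos {D} {a} {b} {c} 0<D (e , 0<a) x y ≢0 = 0<⇐*ˡ 0<a (0<⇐*ˡ {+ 4} (+<+ (ℕ.s≤s ℕ.z≤n)) (subst (0ℤ <_) (sym key) value>0))
  where
  lem : ∀ a b c D x y → + 4 * (a * (a * (x * x) + b * (x * y) + c * (y * y))) - ((+ 2 * a * x + b * y) * (+ 2 * a * x + b * y) + D * (y * y))
    ≡ y * y * (+ 4 * (a * c) - (b * b + D))
  lem = ring
  key : + 4 * (a * value (a , b , c) x y) ≡ (+ 2 * a * x + b * y) * (+ 2 * a * x + b * y) + D * (y * y)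
  key = eq1 (y * y) _ _ e (lem a b c D x y)
  value>0 : 0ℤ < (+ 2 * a * x + b * y) * (+ 2 * a * x + b * y) + D * (y * y)
  value>0 with y ≟ 0ℤ
  ... | no y≢0  = 0<sum (0≤square (+ 2 * a * x + b * y)) (0<* 0<D (square-pos y≢0))
  ... | yes refl with x ≟ 0ℤ
  ...   | yes x≡0 = ⊥-elim (≢0 (x≡0 , refl))
  ...   | no x≢0  = subst (0ℤ <_) (sym (lem3 a b D x)) (0<* (0<* {+ 4} (+<+ (ℕ.s≤s ℕ.z≤n)) (0<* 0<a 0<a)) (square-pos x≢0))
   where
   lem3 : ∀ a b D x → (+ 2 * a * x + b * 0ℤ) * (+ 2 * a * x + b * 0ℤ) + D * (0ℤ * 0ℤ) ≡ + 4 * (a * a) * (x * x)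
   lem3 = ring

 column-nonzero : ∀ {p q r s} → det (mat p q r s) ≢ 0ℤ → ¬ (p ≡ 0ℤ × r ≡ 0ℤ)
 column-nonzero {q = q} {s = s} d≢0 (refl , refl) = d≢0 (lem q s)
  where
  lem : ∀ q s → 0ℤ * s - q * 0ℤ ≡ 0ℤ
  lem = ring

 -- Positive definiteness is preserved by substitutions of any nonzero determinant.
 pos-≈ : ∀ {D a b c g n} → 0ℤ < D → n ≢ 0ℤ → PosForm D (a , b , c) → (a , b , c) ≈⟨ n ⟩ g → 0ℤ < proj₁ g
 pos-≈ {D} {a} {b} {c} 0<D n≢0 pf (by (mat p q r s) refl refl) = value-pos {D} {a} {b} {c} 0<D pf p r (column-nonzero {p} {q} {r} {s} n≢0)

 PosForm-≈ : ∀ {D f g} → 0ℤ < D → PosForm D f → f ≈ g → PosForm D g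
 PosForm-≈ {D} {a , b , c} {a' , b' , c'} 0<D pf e =
  disc⇒ {a'} {b'} {c'} (trans (disc-≈ {a , b , c} {a' , b' , c'} e) (⇒disc {a} {b} {c} (proj₁ pf))) , pos-≈ {D} {a} {b} {c} 0<D (λ ()) pf e

 Reduced : Form → Set
 Reduced (a , b , c) = - a < b × b ≤ a × a ≤ c × (a ≡ c → 0ℤ ≤ b)

 RedForm : ℤ → Form → Set
 RedForm D f = PosForm D f × Reduced f

-- Gauss reduction: existence and uniqueness of reduced forms

module Reduction where

 open Forms
 open import Data.Nat.Base as ℕ using (ℕ; zero; suc)
 open import Data.Integer.Base hiding (suc)
 open import Data.Integer.Properties
 open import Data.Integer.DivMod using (_/ℕ_; _%ℕ_; n%ℕd<d; a≡a%ℕn+[a/ℕn]*n)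
 open import Data.Integer.Tactic.RingSolver using () renaming (solve-∀ to ring)

 reduced? : ∀ f → Dec (Reduced f)
 reduced? (a , b , c) = (- a <? b) ×-dec (b ≤? a) ×-dec (a ≤? c) ×-dec ((a ≟ c) →-dec (0ℤ ≤? b))

 redForm? : ∀ D f → Dec (RedForm D f)
 redForm? D (a , b , c) = ((+ 4 * (a * c) ≟ b * b + D) ×-dec (0ℤ <? a)) ×-dec reduced? (a , b , c)

 <-from-diff : ∀ {x y} → 0ℤ < y - x → x < y
 <-from-diff {x} {y} p = subst₂ _<_ (+-identityˡ x) (lem x y) (+-monoˡ-< x p)
  where
  lem : ∀ x y → y - x + x ≡ y
  lem = ring

 0≤- : ∀ {x y} → x ≤ y → 0ℤ ≤ y - x
 0≤- = i≤j⇒0≤j-i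

 -- Division of a - b by 2a with remainder moves the middle coefficient into the window (-a, a].
 translate-reduced : ∀ a b → 0ℤ < a → ∃ λ t → - a < b + + 2 * a * t × b + + 2 * a * t ≤ a
 translate-reduced (+ zero) b (+<+ ())
 translate-reduced (+ suc A) b _ = t , <-from-diff (subst (0ℤ <_) lower (<⇒0<- r<)) , ≤-from-diff (subst (0ℤ ≤_) upper (+≤+ ℕ.z≤n))
  where
  a : ℤ
  a = + suc A
  n r : ℕ
  n = 2 ℕ.* suc A
  r = (a - b) %ℕ n
  t : ℤ
  t = (a - b) /ℕ n
  r< : + r < + n
  r< = +<+ (n%ℕd<d (a - b) n)
  e : a - b ≡ + r + t * + n
  e = a≡a%ℕn+[a/ℕn]*n (a - b) n
  +n : + n ≡ + 2 * a
  +n = pos-* 2 (suc A)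
  lem1 : ∀ a b r t n → r - (a - (b + + 2 * a * t)) ≡ (- 1ℤ) * (a - b - (r + t * n)) + (- t) * (n - + 2 * a)
  lem1 = ring
  upper : + r ≡ a - (b + + 2 * a * t)
  upper = eq2 (- 1ℤ) (- t) _ _ e +n (lem1 a b (+ r) t (+ n))
  lem2 : ∀ a b r t n → n - r - (b + + 2 * a * t - - a) ≡ 1ℤ * (a - b - (r + t * n)) + (1ℤ + t) * (n - + 2 * a)
  lem2 = ring
  lower : + n - + r ≡ b + + 2 * a * t - - a
  lower = eq2 1ℤ (1ℤ + t) _ _ e +n (lem2 a b (+ r) t (+ n))

 -- Translation followed by a swap whenever c < a, which lowers the first coefficient. In the
 -- boundary case a = c with b < 0 one more swap makes b positive.
 exists-reduced : ∀ {D} → 0ℤ < D → ∀ f → PosForm D f → ∃ λ g → f ≈ g × RedForm D g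
 exists-reduced {D} 0<D f pf = go f pf (<-wellFounded ∣ proj₁ f ∣)
  where
  go : ∀ f → PosForm D f → Acc ℕ._<_ ∣ proj₁ f ∣ → ∃ λ g → f ≈ g × RedForm D g
  finish : ∀ f a b c → f ≈ (a , b , c) → PosForm D (a , b , c) → - a < b → b ≤ a → Acc ℕ._<_ ∣ a ∣ → ∃ λ g → f ≈ g × RedForm D g
  go f@(a , b , c) pf ac with translate-reduced a b (proj₂ pf)
  ... | t , lo , hi = finish f a (b + + 2 * a * t) (a * (t * t) + b * t + c) (translate a b c t)
             (PosForm-≈ {D} {f} 0<D pf (translate a b c t)) lo hi ac
  finish f a b c e pf lo hi (acc rs) with <-cmp a c
  ... | tri< a<c a≢c _ = (a , b , c) , e , pf , lo , hi , <⇒≤ a<c , (λ a≡c → ⊥-elim (a≢c a≡c))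
  ... | tri> _ _ c<a = next (go (c , - b , a) pf' (rs lt))
   where
   pf' : PosForm D (c , - b , a)
   pf' = PosForm-≈ {D} {a , b , c} 0<D pf (swap a b c)
   0<c : 0ℤ < c
   0<c = proj₂ pf'
   lt : ∣ c ∣ ℕ.< ∣ a ∣
   lt = drop‿+<+ (subst₂ _<_ (sym (0≤i⇒+∣i∣≡i (<⇒≤ 0<c))) (sym (0≤i⇒+∣i∣≡i (<⇒≤ (proj₂ pf)))) c<a)
   next : (∃ λ g → (c , - b , a) ≈ g × RedForm D g) → ∃ λ g → f ≈ g × RedForm D g
   next (g , e' , r) = g , ≈-trans e (≈-trans (swap a b c) e') , r
  ... | tri≈ _ refl _ with 0ℤ ≤? b
  ...   | yes 0≤b = (a , b , c) , e , pf , lo , hi , ≤-refl , (λ _ → 0≤b)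
  ...   | no b<0 = (a , - b , a) , ≈-trans e (swap a b a) , PosForm-≈ {D} {a , b , a} 0<D pf (swap a b a) ,
       <-≤-trans (neg-mono-< (proj₂ pf)) (neg-mono-≤ (<⇒≤ (≰⇒> b<0))) , <⇒≤ (subst (- b <_) (neg-involutive a) (neg-mono-< lo)) , ≤-refl ,
       (λ _ → neg-mono-≤ (<⇒≤ (≰⇒> b<0)))

 vanish : ∀ {l r} k → l ≡ r → k * (l - r) ≡ 0ℤ
 vanish {l} k refl = trans (cong (λ z → k * z) (+-inverseʳ l)) (*-zeroʳ k)

 private
  1≤ : ∀ {x} → 0ℤ < x → 0ℤ ≤ x - 1ℤ
  1≤ p = 0≤- (i<j⇒suc[i]≤j p)

  -- 4(p² ± pr + r²) = (2p ± r)² + 3r².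
  mixed-pos : ∀ p r → r ≢ 0ℤ → 0ℤ ≤ p * p + r * r + p * r - 1ℤ
  mixed-pos p r r≢0 = 1≤ (0<⇐*ˡ {+ 4} (+<+ (ℕ.s≤s ℕ.z≤n)) (subst (0ℤ <_) (lem p r) (0<sum (0≤square (+ 2 * p + r)) (0<* {+ 3} (+<+ (ℕ.s≤s ℕ.z≤n)) (square-pos r≢0)))))
   where
   lem : ∀ p r → (+ 2 * p + r) * (+ 2 * p + r) + + 3 * (r * r) ≡ + 4 * (p * p + r * r + p * r)
   lem = ring

  -- For b ≥ 0 the difference f(x, y) - c is (c - a)(y² - 1) + (a - b)(x² + y² - 1) + b (x² + xy +
  -- y² - 1), all of whose factors are nonnegative when y ≠ 0; for b ≤ 0 the signs of b and x
  -- change.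
  value-≥c : ∀ {a b c} → Reduced (a , b , c) → ∀ x y → y ≢ 0ℤ → c ≤ value (a , b , c) x y
  value-≥c {a} {b} {c} (lo , hi , a≤c , _) x y y≢0 with ≤-total 0ℤ b
  ... | inj₁ 0≤b = ≤-from-diff (subst (0ℤ ≤_) (lem a b c x y) (+-mono-≤ (+-mono-≤ (0≤* (0≤- a≤c) (1≤ (square-pos y≢0)))
      (0≤* (0≤- hi) (+-mono-≤ (0≤square x) (1≤ (square-pos y≢0))))) (0≤* 0≤b (mixed-pos x y y≢0))))
   where
   lem : ∀ a b c x y → (c - a) * (y * y - 1ℤ) + (a - b) * (x * x + (y * y - 1ℤ)) + b * (x * x + y * y + x * y - 1ℤ)
     ≡ a * (x * x) + b * (x * y) + c * (y * y) - c
   lem = ring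
  ... | inj₂ b≤0 = ≤-from-diff (subst (0ℤ ≤_) (lem a b c x y) (+-mono-≤ (+-mono-≤ (0≤* (0≤- a≤c) (1≤ (square-pos y≢0)))
      (0≤* (0≤- (<⇒≤ lo)) (+-mono-≤ (0≤square x) (1≤ (square-pos y≢0))))) (0≤* (neg-mono-≤ b≤0) (mixed-pos (- x) y y≢0))))
   where
   lem : ∀ a b c x y → (c - a) * (y * y - 1ℤ) + (b - - a) * (x * x + (y * y - 1ℤ)) + - b * (- x * - x + y * y + - x * y - 1ℤ)
     ≡ a * (x * x) + b * (x * y) + c * (y * y) - c
   lem = ring

  value-≥a : ∀ {a b c} → 0ℤ < a → Reduced (a , b , c) → ∀ x y → ¬ (x ≡ 0ℤ × y ≡ 0ℤ) → a ≤ value (a , b , c) x y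
  value-≥a {a} {b} {c} 0<a red@(_ , _ , a≤c , _) x y ≢0 with y ≟ 0ℤ
  ... | no y≢0   = ≤-trans a≤c (value-≥c {a} {b} {c} red x y y≢0)
  ... | yes refl = ≤-from-diff (subst (0ℤ ≤_) (lem a b c x) (0≤* (<⇒≤ 0<a) (1≤ (square-pos {x} λ x≡0 → ≢0 (x≡0 , refl)))))
   where
   lem : ∀ a b c x → a * (x * x - 1ℤ) ≡ a * (x * x) + b * (x * 0ℤ) + c * (0ℤ * 0ℤ) - a
   lem = ring

  first-≤ : ∀ {f g} → 0ℤ < proj₁ f → Reduced f → f ≈ g → proj₁ f ≤ proj₁ g
  first-≤ {a , b , c} 0<a red (by (mat p q r s) d refl) = value-≥a {a} {b} {c} 0<a red p r
   (column-nonzero {p} {q} {r} {s} (λ e → case-absurd (trans (sym d) e)))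
   where
   case-absurd : 1ℤ ≡ 0ℤ → ⊥
   case-absurd ()

 *-cancelˡ-pos : ∀ {a x y} → 0ℤ < a → a * x ≡ a * y → x ≡ y
 *-cancelˡ-pos {a} {x} {y} 0<a e = *-cancelˡ-≡ a x y {{≢-nonZero (λ a≡0 → <-irrefl (sym a≡0) 0<a)}} e

 square-≡-nonNeg : ∀ {x y} → 0ℤ ≤ x → 0ℤ ≤ y → x * x ≡ y * y → x ≡ y
 square-≡-nonNeg {x} {y} 0≤x 0≤y e with <-cmp x y
 ... | tri≈ _ x≡y _ = x≡y
 ... | tri< x<y _ _ = ⊥-elim (<-irrefl e (lt 0≤x 0≤y x<y))
  where
  lt : ∀ {x y} → 0ℤ ≤ x → 0ℤ ≤ y → x < y → x * x < y * y
  lt {+ m} {+ n} _ _ (+<+ m<n) = subst₂ _<_ (pos-* m m) (pos-* n n) (+<+ (ℕP.*-mono-< m<n m<n))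
 ... | tri> _ _ y<x = ⊥-elim (<-irrefl (sym e) (lt 0≤y 0≤x y<x))
  where
  lt : ∀ {x y} → 0ℤ ≤ x → 0ℤ ≤ y → x < y → x * x < y * y
  lt {+ m} {+ n} _ _ (+<+ m<n) = subst₂ _<_ (pos-* m m) (pos-* n n) (+<+ (ℕP.*-mono-< m<n m<n))

 private
  small-multiple : ∀ {a b t} → 0ℤ < a → - a < b → b ≤ a → - a < b + + 2 * a * t → b + + 2 * a * t ≤ a → t ≡ 0ℤ
  small-multiple {a} {b} {t} 0<a lo hi lo' hi' with <-cmp t 0ℤ
  ... | tri≈ _ t≡0 _ = t≡0
  ... | tri> _ _ 0<t = ⊥-elim (<-irrefl refl (<-≤-trans (0<sum {a - (b + + 2 * a * t)} (0≤- hi') (<⇒0<- lo))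
      (≤-trans (≤-reflexive (lem a b t)) (neg-mono-≤ (0≤* (<⇒≤ (0<* {+ 2} (+<+ (ℕ.s≤s ℕ.z≤n)) 0<a)) (1≤ 0<t))))))
   where
   lem : ∀ a b t → a - (b + + 2 * a * t) + (b - - a) ≡ - (+ 2 * a * (t - 1ℤ))
   lem = ring
  ... | tri< t<0 _ _ = ⊥-elim (<-irrefl refl (<-≤-trans (0<sum {a - b} (0≤- hi) (<⇒0<- lo'))
      (≤-trans (≤-reflexive (lem a b t)) (neg-mono-≤ (0≤* (<⇒≤ (0<* {+ 2} (+<+ (ℕ.s≤s ℕ.z≤n)) 0<a)) (1≤ (neg-mono-< t<0)))))))
   where
   lem : ∀ a b t → a - b + (b + + 2 * a * t - - a) ≡ - (+ 2 * a * (- t - 1ℤ))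
   lem = ring

  +-cancelʳ : ∀ x y z → x + z ≡ y + z → x ≡ y
  +-cancelʳ x y z e = eq1 1ℤ _ _ e (lem x y z)
   where
   lem : ∀ x y z → x - y ≡ 1ℤ * (x + z - (y + z))
   lem = ring

  polar-r≡0 : ∀ {a b c b' p q r s} → p * s - q * r ≡ 1ℤ → + 2 * a * (p * q) + b * (p * s + r * q) + + 2 * c * (r * s) ≡ b' → r ≡ 0ℤ → b + + 2 * a * (p * q) ≡ b'
  polar-r≡0 {a} {b} {c} {b'} {p} {q} {r} {s} d e r≡0 = i-j≡0⇒i≡j _ _ (trans (lem a b c b' p q r s)
   (cong₂ _+_ (cong₂ _+_ (vanish 1ℤ e) (vanish (- b) d)) (vanish (- (+ 2 * (b * q) + + 2 * (c * s))) r≡0)))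
   where
   lem : ∀ a b c b' p q r s → b + + 2 * a * (p * q) - b' ≡ 1ℤ * (+ 2 * a * (p * q) + b * (p * s + r * q) + + 2 * c * (r * s) - b') + (- b) * (p * s - q * r - 1ℤ)
     + (- (+ 2 * (b * q) + + 2 * (c * s))) * (r - 0ℤ)
   lem = ring

  same-b : ∀ {a b c b' c' D} → 0ℤ < a → + 4 * (a * c) ≡ b * b + D → + 4 * (a * c') ≡ b' * b' + D → b ≡ b' → _≡_ {A = Form} (a , b , c) (a , b' , c')
  same-b {a} {b} {c} {_} {c'} 0<a e e' refl = cong (λ z → (a , b , z)) (*-cancelˡ-pos 0<a (*-cancelˡ-≡ (+ 4) (a * c) (a * c') (trans e (sym e'))))

  case-r≡0 : ∀ {a b c b' c' p q r s D} → 0ℤ < a → + 4 * (a * c) ≡ b * b + D → + 4 * (a * c') ≡ b' * b' + D → Reduced (a , b , c) → Reduced (a , b' , c') →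
   p * s - q * r ≡ 1ℤ → + 2 * a * (p * q) + b * (p * s + r * q) + + 2 * c * (r * s) ≡ b' → r ≡ 0ℤ → b ≡ b'
  case-r≡0 {a} {b} {c} {b'} {c'} {p} {q} {r} {s} 0<a e e' (lo , hi , _) (lo' , hi' , _) d pol r≡0 = trans (lem a b) (trans (cong (λ t → b + + 2 * a * t) (sym t≡0)) step)
   where
   step : b + + 2 * a * (p * q) ≡ b'
   step = polar-r≡0 {a} {b} {c} {b'} {p} {q} {r} {s} d pol r≡0
   t≡0 : p * q ≡ 0ℤ
   t≡0 = small-multiple {a} {b} {p * q} 0<a lo hi (subst (- a <_) (sym step) lo') (subst (_≤ a) (sym step) hi')
   lem : ∀ a b → b ≡ b + + 2 * a * 0ℤ
   lem = ring

  last≤first : ∀ {a b c b' c'} M → Reduced (a , b , c) → act (a , b , c) M ≡ (a , b' , c') → Matrix.r M ≢ 0ℤ → a ≡ c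
  last≤first {a} {b} {c} (mat p q r s) red@(_ , _ , a≤c , _) act≡ r≢0 = ≤-antisym a≤c (≤-trans (value-≥c {a} {b} {c} red p r r≢0) (≤-reflexive (cong proj₁ act≡)))

  -- If r = 0 the substitution only shifts b by a multiple of 2a, and the window (-a, a] forces
  -- equality. If r ≠ 0 then a is a value at a point with y ≠ 0, so a = c; the same holds for the
  -- other form, and both middle coefficients are nonnegative with equal squares.
  unique-same-a : ∀ {D a b c b' c'} → RedForm D (a , b , c) → RedForm D (a , b' , c') → ∀ M → det M ≡ 1ℤ → act (a , b , c) M ≡ (a , b' , c') →
   act (a , b' , c') (adj M) ≡ (a , b , c) → Dec (Matrix.r M ≡ 0ℤ) → (a , b , c) ≡ (a , b' , c')
  unique-same-a {D} {a} {b} {c} {b'} {c'} ((e , 0<a) , red) ((e' , _) , red') (mat p q r s) d act≡ _ (yes r≡0) =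
   same-b 0<a e e' (case-r≡0 {a} {b} {c} {b'} {c'} {p} {q} {r} {s} 0<a e e' red red' d (cong (λ z → proj₁ (proj₂ z)) act≡) r≡0)
  unique-same-a {D} {a} {b} {c} {b'} {c'} ((e , 0<a) , red) ((e' , _) , red') M@(mat p q r s) d act≡ back (no r≢0) =
   same-b 0<a e e' (square-≡-nonNeg (proj₂ (proj₂ (proj₂ red)) a≡c) (proj₂ (proj₂ (proj₂ red')) a≡c')
    (+-cancelʳ (b * b) (b' * b') D (trans (sym e) (trans (cong (λ z → + 4 * (a * z)) (trans (sym a≡c) a≡c')) e'))))
   where
   a≡c : a ≡ c
   a≡c = last≤first M red act≡ r≢0
   a≡c' : a ≡ c'
   a≡c' = last≤first (adj M) red' back (λ -r≡0 → r≢0 (trans (sym (neg-involutive r)) (cong -_ -r≡0)))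

  same-a : ∀ {D f g} → (a≡a' : proj₁ f ≡ proj₁ g) → RedForm D f → RedForm D g → ∀ M → det M ≡ 1ℤ → act f M ≡ g → act g (adj M) ≡ f → f ≡ g
  same-a {D} {a , b , c} {_ , b' , c'} refl rf rg M d e e' = unique-same-a {D} {a} {b} {c} {b'} {c'} rf rg M d e e' (Matrix.r M ≟ 0ℤ)

 -- The first coefficient of a reduced form is its least nonzero value, which is an invariant of the
 -- class; `unique-same-a` settles the rest.
 reduced-unique : ∀ {D f g} → RedForm D f → RedForm D g → f ≈ g → f ≡ g
 reduced-unique {D} {f} {g} rf@((_ , 0<a) , red) rg@((_ , 0<a') , red') f≈g@(by M d e) =
  same-a {D} {f} {g} (≤-antisym (first-≤ {f} {g} 0<a red f≈g) (first-≤ {g} {f} 0<a' red' (≈-sym f≈g))) rf rg M d e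
   (trans (cong (λ g → act g (adj M)) (sym e)) (trans (act-adj f M) (trans (cong (λ d → (d * d) ⋆ f) d) (1⋆ f))))

-- Self-similarities of a form

module Commuting where

 open Forms
 open Reduction using (vanish)
 open import Data.Integer.Base hiding (suc)
 open import Data.Integer.Properties
 open import Data.Integer.Tactic.RingSolver using () renaming (solve-∀ to ring)

 -- Entries of a substitution W of determinant n with f ∘ W = n f, and their trace t; the last identity is a²(t² - 4n) = -D r².
 module Automorph {a b c D p q r s n : ℤ} (n≢0 : n ≢ 0ℤ) (e : + 4 * (a * c) ≡ b * b + D) (d : p * s - q * r ≡ n)
  (act≡ : act (a , b , c) (mat p q r s) ≡ n ⋆ (a , b , c)) where

  private
   val1 : a * (p * p) + b * (p * r) + c * (r * r) ≡ n * a
   val1 = cong proj₁ act≡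
   pol : + 2 * a * (p * q) + b * (p * s + r * q) + + 2 * c * (r * s) ≡ n * b
   pol = cong (λ z → proj₁ (proj₂ z)) act≡
   cancel : ∀ {x y} → n * x ≡ n * y → x ≡ y
   cancel {x} {y} = *-cancelˡ-≡ n x y {{≢-nonZero n≢0}}
   half : ∀ {x y} → + 2 * x ≡ + 2 * y → x ≡ y
   half {x} {y} = *-cancelˡ-≡ (+ 2) x y
   lem1 : ∀ a b c p q r s n → n * (+ 2 * (b * r)) - n * (+ 2 * (a * (s - p)))
     ≡ + 2 * s * (a * (p * p) + b * (p * r) + c * (r * r) - n * a) + (- r) * (+ 2 * a * (p * q) + b * (p * s + r * q) + + 2 * c * (r * s) - n * b)
      + (- (+ 2 * a * p + b * r)) * (p * s - q * r - n)
   lem1 = ring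
   lem2 : ∀ a b c p q r s n → n * (+ 2 * (a * q)) - n * (+ 2 * (- (c * r)))
     ≡ s * (+ 2 * a * (p * q) + b * (p * s + r * q) + + 2 * c * (r * s) - n * b) + (- (+ 2 * r)) * (a * (q * q) + b * (q * s) + c * (s * s) - n * c)
      + (- (+ 2 * a * q + b * s)) * (p * s - q * r - n)
   lem2 = ring
   lem3 : ∀ a b c D p q r s n → a * a * ((p + s) * (p + s) - + 4 * n) - - (D * (r * r))
     ≡ (- (a * (s - p) + b * r)) * (b * r - a * (s - p)) + + 4 * a * r * (a * q - - (c * r)) + (+ 4 * a * a) * (p * s - q * r - n) + (- (r * r)) * (+ 4 * (a * c) - (b * b + D))
   lem3 = ring

  val2 : a * (q * q) + b * (q * s) + c * (s * s) ≡ n * c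
  val2 = cong (λ z → proj₂ (proj₂ z)) act≡

  br≡ : b * r ≡ a * (s - p)
  br≡ = half (cancel (i-j≡0⇒i≡j _ _ (trans (lem1 a b c p q r s n) (cong₂ _+_ (cong₂ _+_ (vanish (+ 2 * s) val1) (vanish (- r) pol)) (vanish (- (+ 2 * a * p + b * r)) d)))))

  aq≡ : a * q ≡ - (c * r)
  aq≡ = half (cancel (i-j≡0⇒i≡j _ _ (trans (lem2 a b c p q r s n) (cong₂ _+_ (cong₂ _+_ (vanish s pol) (vanish (- (+ 2 * r)) val2)) (vanish (- (+ 2 * a * q + b * s)) d)))))

  trace≡ : a * a * ((p + s) * (p + s) - + 4 * n) ≡ - (D * (r * r))
  trace≡ = i-j≡0⇒i≡j _ _ (trans (lem3 a b c D p q r s n) (cong₂ _+_ (cong₂ _+_ (cong₂ _+_ (vanish (- (a * (s - p) + b * r)) br≡) (vanish (+ 4 * a * r) aq≡)) (vanish (+ 4 * a * a) d)) (vanish (- (r * r)) e)))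

-- Coprimality of integers through Bézout identities

module IntegerCoprime where

 open Forms using (eq1; eq2)
 open import Data.Nat.Base as ℕ using (ℕ; zero; suc; NonZero)
 import Data.Nat.Coprimality as ℕC
 open import Data.Nat.GCD using (module Bézout)
 open import Data.Nat.Primality.Factorisation using (factorise; PrimeFactorisation)
 open import Data.Nat.ListAction using (product)
 open import Data.List.Base using ([]; _∷_)
 open import Data.List.Relation.Unary.All using ([]; _∷_)
 open import Data.Integer.Base hiding (suc; NonZero)
 open import Data.Integer.Properties
 open import Data.Integer.Divisibility.Signed
 open import Data.Integer.Tactic.RingSolver using () renaming (solve-∀ to ring)
 open import Data.Sum.Base using (inj₂) renaming (map to map-⊎)

 -- Keeping the Bézout coefficients as data turns divisibility arguments into linear combinations of
 -- equations for the ring solver.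
 record Cop (x n : ℤ) : Set where
  constructor bezout
  field
   u v : ℤ
   eq  : x * u + n * v ≡ 1ℤ

 cop-sym : ∀ {x n} → Cop x n → Cop n x
 cop-sym {x} {n} (bezout u v e) = bezout v u (trans (+-comm (n * v) (x * u)) e)

 cop-∣ : ∀ {x n y} → Cop x n → n ∣ x * y → n ∣ y
 cop-∣ {x} {n} {y} (bezout u v e) (divides k e') = divides (k * u + v * y) (eq2 (- y) u _ _ e e' (lem x n y u v k))
  where
  lem : ∀ x n y u v k → y - (k * u + v * y) * n ≡ (- y) * (x * u + n * v - 1ℤ) + u * (x * y - k * n)
  lem = ring

 cop-* : ∀ {x y n} → Cop x n → Cop y n → Cop (x * y) n
 cop-* {x} {y} {n} (bezout u v e) (bezout u' v' e') = bezout (u * u') (x * u * v' + v * (y * u') + n * v * v')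
  (eq2 (y * u' + n * v') 1ℤ _ _ e e' (lem x y n u v u' v'))
  where
  lem : ∀ x y n u v u' v' → x * y * (u * u') + n * (x * u * v' + v * (y * u') + n * v * v') - 1ℤ
    ≡ (y * u' + n * v') * (x * u + n * v - 1ℤ) + 1ℤ * (y * u' + n * v' - 1ℤ)
  lem = ring

 cop-*ʳ : ∀ {x m n} → Cop x m → Cop x n → Cop x (m * n)
 cop-*ʳ p q = cop-sym (cop-* (cop-sym p) (cop-sym q))

 cop-∣ˡ : ∀ {x y n} → x ∣ y → Cop y n → Cop x n
 cop-∣ˡ {x} {y} {n} (divides k e') (bezout u v e) = bezout (k * u) v (eq2 1ℤ (- u) _ _ e e' (lem x y n k u v))
  where
  lem : ∀ x y n k u v → x * (k * u) + n * v - 1ℤ ≡ 1ℤ * (y * u + n * v - 1ℤ) + (- u) * (y - k * x)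
  lem = ring

 cop-∣ʳ : ∀ {x m n} → m ∣ n → Cop x n → Cop x m
 cop-∣ʳ m∣n c = cop-sym (cop-∣ˡ m∣n (cop-sym c))

 cop-+ : ∀ {x n} t → Cop x n → Cop (x + n * t) n
 cop-+ {x} {n} t (bezout u v e) = bezout u (v - t * u) (eq1 1ℤ _ _ e (lem x n t u v))
  where
  lem : ∀ x n t u v → (x + n * t) * u + n * (v - t * u) - 1ℤ ≡ 1ℤ * (x * u + n * v - 1ℤ)
  lem = ring

 cop-≡ : ∀ {x y n} → n ∣ y - x → Cop x n → Cop y n
 cop-≡ {x} {y} {n} (divides k e) c = subst (λ z → Cop z n) (sym (eq1 1ℤ _ _ e (lem x y n k))) (cop-+ k c)
  where
  lem : ∀ x y n k → y - (x + n * k) ≡ 1ℤ * (y - x - k * n)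
  lem = ring

 cop-common : ∀ {x n m} → Cop x n → m ∣ x → m ∣ n → m ∣ 1ℤ
 cop-common {x} {n} {m} (bezout u v e) p q = subst (m ∣_) e (∣m∣n⇒∣m+n (∣m⇒∣m*n u p) (∣m⇒∣m*n v q))

 +∣ : ∀ {m n} → m ℕD.∣ n → + m ∣ + n
 +∣ = ∣ᵤ⇒∣

 coprime⇒Cop : ∀ {m n} → ℕC.Coprime m n → Cop (+ m) (+ n)
 coprime⇒Cop {m} {n} c with ℕC.coprime-Bézout c
 ... | Bézout.+- x y e = bezout (+ x) (- (+ y)) (eq1 (- 1ℤ) _ _ e' (lem (+ m) (+ n) (+ x) (+ y)))
  where
  e' : 1ℤ + + y * + n ≡ + x * + m
  e' = trans (cong (λ z → 1ℤ + z) (sym (pos-* y n))) (trans (cong +_ e) (pos-* x m))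
  lem : ∀ m n x y → m * x + n * - y - 1ℤ ≡ (- 1ℤ) * (1ℤ + y * n - x * m)
  lem = ring
 ... | Bézout.-+ x y e = bezout (- (+ x)) (+ y) (eq1 (- 1ℤ) _ _ e' (lem (+ m) (+ n) (+ x) (+ y)))
  where
  e' : 1ℤ + + x * + m ≡ + y * + n
  e' = trans (cong (λ z → 1ℤ + z) (sym (pos-* x m))) (trans (cong +_ e) (pos-* y n))
  lem : ∀ m n x y → m * - x + n * y - 1ℤ ≡ (- 1ℤ) * (1ℤ + x * m - y * n)
  lem = ring

 prime-divisor : ∀ n → n ≢ 1 → ∃ λ p → Prime p × p ℕD.∣ n
 prime-divisor zero      n≢1 = 2 , prime[2] , 2 ℕD.∣0
 prime-divisor n@(suc _) n≢1 with factorise n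
 ... | record { factors = [] ; isFactorisation = e } = ⊥-elim (n≢1 e)
 ... | record { factors = p ∷ ps ; isFactorisation = e ; factorsPrime = pr ∷ _ } = p , pr , ℕD.divides (product ps) (trans e (ℕP.*-comm p (product ps)))

 no-common-prime : ∀ {m n} → (∀ {p} → Prime p → p ℕD.∣ m → p ℕD.∣ n → ⊥) → ℕC.Coprime m n
 no-common-prime none {d} (d∣m , d∣n) with d ℕP.≟ 1
 ... | yes d≡1 = d≡1
 ... | no d≢1  with prime-divisor d d≢1
 ...   | p , pr , p∣d = ⊥-elim (none pr (ℕD.∣-trans p∣d d∣m) (ℕD.∣-trans p∣d d∣n))

 no-common-prime-ℤ : ∀ {x y} → (∀ {p} → Prime p → + p ∣ x → + p ∣ y → ⊥) → Cop x y
 no-common-prime-ℤ {x} {y} none = cop-∣ˡ m∣∣m∣ (cop-∣ʳ m∣∣m∣ (coprime⇒Cop {∣ x ∣} {∣ y ∣} (no-common-prime λ pr p∣x p∣y → none pr (∣ᵤ⇒∣ p∣x) (∣ᵤ⇒∣ p∣y))))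

 prime∤1 : ∀ {p} → Prime p → ¬ + p ∣ 1ℤ
 prime∤1 {p} pr p∣1 = ¬prime[1] (subst Prime (ℕD.∣1⇒≡1 (∣⇒∣ᵤ p∣1)) pr)

 prime-∣ : ∀ {p q} → Prime p → Prime q → + p ∣ + q → p ≡ q
 prime-∣ {p} {q} pr qr p∣q with prime⇒irreducible qr (∣⇒∣ᵤ p∣q)
 ... | inj₁ refl = ⊥-elim (¬prime[1] pr)
 ... | inj₂ p≡q  = p≡q

 prime-Cop : ∀ {p x} → Prime p → ¬ + p ∣ x → Cop x (+ p)
 prime-Cop {p} {x} pr p∤x = no-common-prime-ℤ λ qr q∣x q∣p → p∤x (subst (λ q → + q ∣ x) (prime-∣ qr pr q∣p) q∣x)

 prime-∣* : ∀ {p} x y → Prime p → + p ∣ x * y → (+ p ∣ x) ⊎ (+ p ∣ y)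
 prime-∣* {p} x y pr p∣ = map-⊎ ∣ᵤ⇒∣ ∣ᵤ⇒∣ (euclidsLemma ∣ x ∣ ∣ y ∣ pr (subst (p ℕD.∣_) (abs-* x y) (∣⇒∣ᵤ p∣)))

 -- n is squarefree.
 Radical : ℤ → Set
 Radical n = ∀ x → n ∣ x * x → n ∣ x

 prime-radical : ∀ {p} → Prime p → Radical (+ p)
 prime-radical {p} pr x p∣ with prime-∣* x x pr p∣
 ... | inj₁ d = d
 ... | inj₂ d = d

 cop-*-∣ : ∀ {m n x} → Cop m n → m ∣ x → n ∣ x → m * n ∣ x
 cop-*-∣ {m} {n} {x} (bezout u v e) (divides k e1) (divides l e2) = divides (l * u + k * v) (i-j≡0⇒i≡j _ _ (trans (lem m n u v x k l)
   (trans (cong (λ z → (- x) * (z - 1ℤ) + m * u * (x - l * n) + n * v * (x - k * m)) e)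
   (trans (cong₂ (λ z w → (- x) * (1ℤ - 1ℤ) + m * u * (x - z) + n * v * (x - w)) (sym e2) (sym e1)) (lem2 m n u v x)))))
  where
  lem : ∀ m n u v x k l → x - (l * u + k * v) * (m * n) ≡ (- x) * (m * u + n * v - 1ℤ) + m * u * (x - l * n) + n * v * (x - k * m)
  lem = ring
  lem2 : ∀ m n u v x → (- x) * (1ℤ - 1ℤ) + m * u * (x - x) + n * v * (x - x) ≡ 0ℤ
  lem2 = ring

 radical-* : ∀ {m n} → Cop m n → Radical m → Radical n → Radical (m * n)
 radical-* {m} {n} c rm rn x d = cop-*-∣ c (rm x (∣-trans (divides n (*-comm m n)) d)) (rn x (∣-trans (divides m refl) d))

 residue-unique : ∀ {n i j} → i ℕ.< n → j ℕ.< n → + n ∣ + i - + j → i ≡ j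
 residue-unique {n} {i} {j} i<n j<n d = by-order (ℕP.≤-total i j)
  where
  small : ∀ x → x ℕ.< n → n ℕD.∣ x → x ≡ 0
  small zero _ _ = refl
  small x@(suc _) x<n d = ⊥-elim (ℕP.<⇒≱ x<n (ℕD.∣⇒≤ d))
  ordered : ∀ {i k} → i ℕ.≤ k → k ℕ.< n → + n ∣ + k - + i → i ≡ k
  ordered {i} {k} i≤k k<n d = ℕP.≤-antisym i≤k (ℕP.m∸n≡0⇒m≤n (small (k ℕ.∸ i) (ℕP.≤-<-trans (ℕP.m∸n≤m k i) k<n)
   (subst (n ℕD.∣_) (cong ∣_∣ (trans ([+m]-[+n]≡m⊖n k i) (⊖-≥ i≤k))) (∣⇒∣ᵤ d))))
  by-order : i ℕ.≤ j ⊎ j ℕ.≤ i → i ≡ j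
  by-order (inj₁ le) = ordered le j<n (subst (+ n ∣_) (lem (+ i) (+ j)) (∣m⇒∣-m d))
   where
   lem : ∀ x y → - (x - y) ≡ y - x
   lem = ring
  by-order (inj₂ le) = sym (ordered le i<n d)

module IntegerPrelude where

 open import Data.Nat.Base using (ℕ; zero; suc; NonZero) public
 open import Data.Integer.Base hiding (suc; NonZero; ∣_∣) public
 open import Data.Integer.Base using () renaming (∣_∣ to abs) public
 open import Data.Integer.Properties public
 open import Data.Integer.DivMod using (_/ℕ_; _%ℕ_; n%ℕd<d; a≡a%ℕn+[a/ℕn]*n) public
 open import Data.Integer.Divisibility.Signed public
 open import Data.Integer.Tactic.RingSolver using () renaming (solve-∀ to ring) public

-- Composition with an ambiguous class of norm n

module Twist where

 open Forms
 open IntegerCoprime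
 open import Data.Nat.Base as ℕ using ()
 open import Data.Nat.Primality.Factorisation using (factorise; PrimeFactorisation)
 open import Data.Nat.ListAction using (product)
 open import Data.List.Base using ([]; _∷_)
 open import Data.List.Relation.Unary.All using (All; []; _∷_)
 open IntegerPrelude

 infix 4 _∣ᶠ_ _∣ᶠ?_
 _∣ᶠ_ : ℤ → Form → Set
 n ∣ᶠ (a , b , c) = n ∣ a × n ∣ b × n ∣ c

 _∣ᶠ?_ : ∀ n f → Dec (n ∣ᶠ f)
 n ∣ᶠ? (a , b , c) = (n ∣? a) ×-dec (n ∣? b) ×-dec (n ∣? c)

 ∣ᶠ-act : ∀ {n f} M → n ∣ᶠ f → n ∣ᶠ act f M
 ∣ᶠ-act {n} {a , b , c} (mat p q r s) (na , nb , nc) =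
  ∣m∣n⇒∣m+n (∣m∣n⇒∣m+n (∣m⇒∣m*n (p * p) na) (∣m⇒∣m*n (p * r) nb)) (∣m⇒∣m*n (r * r) nc) ,
  ∣m∣n⇒∣m+n (∣m∣n⇒∣m+n (∣m⇒∣m*n (p * q) (∣n⇒∣m*n (+ 2) na)) (∣m⇒∣m*n (p * s + r * q) nb)) (∣m⇒∣m*n (r * s) (∣n⇒∣m*n (+ 2) nc)) ,
  ∣m∣n⇒∣m+n (∣m∣n⇒∣m+n (∣m⇒∣m*n (q * q) na) (∣m⇒∣m*n (q * s) nb)) (∣m⇒∣m*n (s * s) nc)

 ∣ᶠ-≈ : ∀ {n m f g} → f ≈⟨ m ⟩ g → n ∣ᶠ f → n ∣ᶠ g
 ∣ᶠ-≈ {n} (by M _ e) d = subst (n ∣ᶠ_) e (∣ᶠ-act M d)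

 Prim : ℤ → Form → Set
 Prim n f = ∀ {ℓ} → Prime ℓ → + ℓ ∣ n → ¬ + ℓ ∣ᶠ f

 shear : ∀ a b c y → (a , b , c) ≈ (a + y * (b + c * y) , b + + 2 * c * y , c)
 shear a b c y = by (mat 1ℤ 0ℤ y 1ℤ) (lem0 y) (form-≡ (lem1 a b c y) (lem2 a b c y) (lem3 a b c))
  where
  lem0 : ∀ y → 1ℤ * 1ℤ - 0ℤ * y ≡ 1ℤ
  lem0 = ring
  lem1 : ∀ a b c y → a * (1ℤ * 1ℤ) + b * (1ℤ * y) + c * (y * y) ≡ a + y * (b + c * y)
  lem1 = ring
  lem2 : ∀ a b c y → + 2 * a * (1ℤ * 0ℤ) + b * (1ℤ * 1ℤ + y * 0ℤ) + + 2 * c * (y * 1ℤ) ≡ b + + 2 * c * y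
  lem2 = ring
  lem3 : ∀ a b c → a * (0ℤ * 0ℤ) + b * (0ℤ * 1ℤ) + c * (1ℤ * 1ℤ) ≡ c
  lem3 = ring

 private
  -- If ℓ divides a, f(1, N) and f(1, -N), it divides their difference 2Nb, hence b, and then c,
  -- against primitivity. So one of the shears by N and -N makes the first coefficient prime to ℓ,
  -- and neither changes it modulo N.
  shear-one : ∀ {ℓ N a b c} → Prime ℓ → Cop (+ 2) (+ ℓ) → Cop N (+ ℓ) → Cop a N → + ℓ ∣ a → ¬ + ℓ ∣ᶠ (a , b , c) →
   ∃ λ y → Cop (a + y * (b + c * y)) N × ¬ + ℓ ∣ a + y * (b + c * y)
  shear-one {ℓ} {N} {a} {b} {c} pr c2 cN ca ℓ∣a prim = first (+ ℓ ∣? v1)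
   where
   v1 v2 : ℤ
   v1 = a + N * (b + c * N)
   v2 = a + - N * (b + c * - N)
   lem : ∀ N b c → N * - (b + c * - N) ≡ - N * (b + c * - N)
   lem = ring
   lem1 : ∀ N a b c → a + N * (b + c * N) - (a + - N * (b + c * - N)) ≡ + 2 * (N * b)
   lem1 = ring
   lem2 : ∀ N a b c → a + N * (b + c * N) - (a + N * b) ≡ N * (N * c)
   lem2 = ring
   ℓ∣b : + ℓ ∣ v1 → + ℓ ∣ v2 → + ℓ ∣ b
   ℓ∣b d1 d2 = cop-∣ cN (cop-∣ c2 (subst (+ ℓ ∣_) (lem1 N a b c) (∣m∣n⇒∣m-n d1 d2)))
   ℓ∣c : + ℓ ∣ v1 → + ℓ ∣ b → + ℓ ∣ c
   ℓ∣c d1 d = cop-∣ cN (cop-∣ cN (subst (+ ℓ ∣_) (lem2 N a b c) (∣m∣n⇒∣m-n d1 (∣m∣n⇒∣m+n ℓ∣a (∣n⇒∣m*n N d)))))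
   Goal : Set
   Goal = ∃ λ y → Cop (a + y * (b + c * y)) N × ¬ + ℓ ∣ a + y * (b + c * y)
   second : + ℓ ∣ v1 → Dec (+ ℓ ∣ v2) → Goal
   second d1 (no ∤2)  = - N , subst (λ z → Cop (a + z) N) (lem N b c) (cop-+ (- (b + c * - N)) ca) , ∤2
   second d1 (yes d2) = ⊥-elim (prim (ℓ∣a , ℓ∣b d1 d2 , ℓ∣c d1 (ℓ∣b d1 d2)))
   first : Dec (+ ℓ ∣ v1) → Goal
   first (no ∤1)  = N , cop-+ (b + c * N) ca , ∤1
   first (yes d1) = second d1 (+ ℓ ∣? v2)

  CoprimeFirst : Form → ℕ → Set
  CoprimeFirst f N = ∃ λ a → ∃ λ b → ∃ λ c → f ≈ (a , b , c) × Cop a (+ N)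

  coprime-step : ∀ {f ℓ N} → Prime ℓ → Cop (+ 2) (+ ℓ) → ¬ + ℓ ∣ᶠ f → CoprimeFirst f N → CoprimeFirst f (ℓ ℕ.* N)
  coprime-step {f} {ℓ} {N} pr c2 prim (a , b , c , e , ca) = go (+ ℓ ∣? a)
   where
   both : ∀ x → ¬ + ℓ ∣ x → Cop x (+ N) → Cop x (+ (ℓ ℕ.* N))
   both x ℓ∤x cx = subst (Cop x) (sym (pos-* ℓ N)) (cop-*ʳ (prime-Cop pr ℓ∤x) cx)
   sheared : (∃ λ y → Cop (a + y * (b + c * y)) (+ N) × ¬ + ℓ ∣ a + y * (b + c * y)) → CoprimeFirst f (ℓ ℕ.* N)
   sheared (y , cy , ℓ∤) = a + y * (b + c * y) , b + + 2 * c * y , c , ≈-trans e (shear a b c y) , both (a + y * (b + c * y)) ℓ∤ cy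
   go : Dec (+ ℓ ∣ a) → CoprimeFirst f (ℓ ℕ.* N)
   go (no ℓ∤a)  = a , b , c , e , both a ℓ∤a ca
   go (yes ℓ∣a) = sheared (shear-one {ℓ} {+ N} {a} {b} {c} pr c2 (prime-Cop pr (λ ℓ∣N → prime∤1 pr (cop-common ca ℓ∣a ℓ∣N))) ca ℓ∣a
            (λ d → prim (∣ᶠ-≈ (≈-sym e) d)))

  coprime-first' : ∀ f ps → All Prime ps → Cop (+ 2) (+ product ps) → Prim (+ product ps) f → CoprimeFirst f (product ps)
  coprime-first' (a , b , c) [] _ _ _ = a , b , c , ≈-refl , bezout 0ℤ 1ℤ (cong (λ z → z + 1ℤ) (*-zeroʳ a))
  coprime-first' f (ℓ ∷ ps) (pr ∷ prs) c2 prim = coprime-step pr (cop-∣ʳ ℓ∣ c2) (prim pr ℓ∣)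
    (coprime-first' f ps prs (cop-∣ʳ ps∣ c2) (λ qr q∣ → prim qr (∣-trans q∣ ps∣)))
   where
   ℓ∣ : + ℓ ∣ + product (ℓ ∷ ps)
   ℓ∣ = +∣ (ℕD.m∣m*n (product ps))
   ps∣ : + product ps ∣ + product (ℓ ∷ ps)
   ps∣ = +∣ (ℕD.divides ℓ refl)

 coprime-first : ∀ f N .{{_ : NonZero N}} → Cop (+ 2) (+ N) → Prim (+ N) f → ∃ λ a → ∃ λ b → ∃ λ c → f ≈ (a , b , c) × Cop a (+ N)
 coprime-first f N c2 prim with factorise N
 ... | record { factors = ps ; isFactorisation = refl ; factorsPrime = prs } = coprime-first' f ps prs c2 prim

 -- A primitive form is equivalent to one whose middle coefficient is a prescribed square root of -D modulo n.
 adapt : ∀ {D f} N .{{_ : NonZero N}} → 0ℤ < D → PosForm D f → Cop (+ 2) (+ N) → Prim (+ N) f → ∀ b0 → + N ∣ b0 * b0 + D →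
  ∃ λ a → ∃ λ b → ∃ λ c → f ≈ (a , b , c * + N) × Cop (+ 2 * a) (+ N) × + N ∣ b - b0
 adapt {D} {f} N 0<D pf c2 prim b0 b0²+D with coprime-first f N c2 prim
 ... | a , b , c , e , ca = adapt-step e pf (cop-* c2 ca) b0²+D
  where
  adapt-step : ∀ {a b c} → f ≈ (a , b , c) → PosForm D f → Cop (+ 2 * a) (+ N) → + N ∣ b0 * b0 + D → ∃ λ a → ∃ λ b → ∃ λ c → f ≈ (a , b , c * + N) × Cop (+ 2 * a) (+ N) × + N ∣ b - b0
  adapt-step {a} {b} {c} e pf c2a@(bezout u v ec) (divides k0 e0) = go (cop-∣ c2a (cop-∣ c2 N∣4ac))
   where
   -- u inverts 2a modulo N, so the translation by t moves the middle coefficient to b0 modulo N.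
   t : ℤ
   t = (b0 - b) * u
   b' c' : ℤ
   b' = b + + 2 * a * t
   c' = a * (t * t) + b * t + c
   e' : f ≈ (a , b' , c')
   e' = ≈-trans e (translate a b c t)
   lem : ∀ a b b0 u v N → b + + 2 * a * ((b0 - b) * u) - b0 - (b - b0) * v * N ≡ (b0 - b) * (+ 2 * a * u + N * v - 1ℤ)
   lem = ring
   N∣b : + N ∣ b' - b0
   N∣b = divides ((b - b0) * v) (eq1 (b0 - b) _ _ ec (lem a b b0 u v (+ N)))
   disc≡ : + 4 * (a * c') ≡ b' * b' + D
   disc≡ = proj₁ (PosForm-≈ {D} {f} 0<D pf e')
   lem2 : ∀ a b0 b c D → + 4 * (a * c) ≡ b * b + D → + 2 * (+ 2 * a * c) ≡ (b - b0) * (b + b0) + (b0 * b0 + D)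
   lem2 a b0 b c D e = eq1 1ℤ _ _ e (expand a b0 b c D)
    where
    expand : ∀ a b0 b c D → + 2 * (+ 2 * a * c) - ((b - b0) * (b + b0) + (b0 * b0 + D)) ≡ 1ℤ * (+ 4 * (a * c) - (b * b + D))
    expand = ring
   N∣4ac : + N ∣ + 2 * (+ 2 * a * c')
   N∣4ac = subst (+ N ∣_) (sym (lem2 a b0 b' c' D disc≡)) (∣m∣n⇒∣m+n (∣m⇒∣m*n (b' + b0) N∣b) (divides k0 e0))
   go : + N ∣ c' → ∃ λ a → ∃ λ b → ∃ λ c → f ≈ (a , b , c * + N) × Cop (+ 2 * a) (+ N) × + N ∣ b - b0
   go (divides c″ e″) = a , b' , c″ , subst (λ c → f ≈ (a , b' , c)) e″ e' , c2a , N∣b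

 ⋆-⋆ : ∀ m n f → m ⋆ n ⋆ f ≡ (m * n) ⋆ f
 ⋆-⋆ m n (a , b , c) = form-≡ (sym (*-assoc m n a)) (sym (*-assoc m n b)) (sym (*-assoc m n c))

 ⋆-cancel : ∀ {n f g} → n ≢ 0ℤ → n ⋆ f ≡ n ⋆ g → f ≡ g
 ⋆-cancel {n} {a , b , c} {a' , b' , c'} n≢0 e = form-≡ (cancel (cong proj₁ e)) (cancel (cong (λ z → proj₁ (proj₂ z)) e)) (cancel (cong (λ z → proj₂ (proj₂ z)) e))
  where
  cancel : ∀ {x y} → n * x ≡ n * y → x ≡ y
  cancel {x} {y} = *-cancelˡ-≡ n x y {{≢-nonZero n≢0}}

 ⋆-≈ : ∀ {k f g} n → f ≈⟨ k ⟩ g → n ⋆ f ≈⟨ k ⟩ n ⋆ g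
 ⋆-≈ {f = f} n (by M d e) = by M d (trans (act-⋆ n f M) (cong (λ g → n ⋆ g) e))

 ⋆-≈⁻ : ∀ {k n f g} → n ≢ 0ℤ → n ⋆ f ≈⟨ k ⟩ n ⋆ g → f ≈⟨ k ⟩ g
 ⋆-≈⁻ {n = n} {f} n≢0 (by M d e) = by M d (⋆-cancel n≢0 (trans (sym (act-⋆ n f M)) e))

 ≈-respˡ : ∀ {k f f' g} → f ≈ f' → f ≈⟨ k ⟩ g → f' ≈⟨ k ⟩ g
 ≈-respˡ {k} {f} {f'} {g} e p = subst (λ k → f' ≈⟨ k ⟩ g) (*-identityˡ k) (≈-comp (≈-sym e) p)

 ≈-respʳ : ∀ {k f g g'} → f ≈⟨ k ⟩ g → g ≈ g' → f ≈⟨ k ⟩ g'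
 ≈-respʳ {k} {f} {g} {g'} p e = subst (λ k → f ≈⟨ k ⟩ g') (*-identityʳ k) (≈-comp p e)

 -- The class of g is the class of f times the ambiguous class of norm n.
 T : ℤ → Form → Form → Set
 T n f g = f ≈⟨ n ⟩ n ⋆ g

 T-respˡ : ∀ {n f f' g} → f ≈ f' → T n f g → T n f' g
 T-respˡ = ≈-respˡ

 T-respʳ : ∀ {n f g g'} → T n f g → g ≈ g' → T n f g'
 T-respʳ {n} p e = ≈-respʳ p (⋆-≈ n e)

 T-sym : ∀ {n f g} → n ≢ 0ℤ → T n f g → T n g f
 T-sym {n} {f} {g} n≢0 p = ⋆-≈⁻ n≢0 (subst (λ h → n ⋆ g ≈⟨ n ⟩ h) (sym (⋆-⋆ n n f)) (≈-rev p))

 T-comp : ∀ {m n f g h} → T m f g → T n g h → T (m * n) f h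
 T-comp {m} {n} {f} {g} {h} p q = subst (λ z → f ≈⟨ m * n ⟩ z) (⋆-⋆ m n h) (≈-comp p (⋆-≈ m q))

 T-∣ᶠ : ∀ {k n f g} → Cop n k → n ≢ 0ℤ → T n f g → k ∣ᶠ f → k ∣ᶠ g
 T-∣ᶠ {k} {n} {f} {a , b , c} cop n≢0 p d with ∣ᶠ-≈ p d
 ... | da , db , dc = cop-∣ cop da , cop-∣ cop db , cop-∣ cop dc

 T-PosForm : ∀ {D n f g} → 0ℤ < D → 0ℤ < n → PosForm D f → T n f g → PosForm D g
 T-PosForm {D} {n} {a , b , c} {a' , b' , c'} 0<D 0<n pf p@(by M d e) =
  disc⇒ {a'} {b'} {c'} (*-cancelˡ-≡ (n * n) _ _ {{≢-nonZero (λ z → <-irrefl (sym z) (0<* 0<n 0<n))}}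
   (trans (lem n a' b' c') (trans (cong disc (sym e)) (trans (disc-act (a , b , c) M) (cong₂ _*_ (cong (λ d → d * d) d) (⇒disc {a} {b} {c} (proj₁ pf))))))) ,
  0<⇐*ˡ 0<n (pos-≈ {D} {a} {b} {c} 0<D (λ z → <-irrefl (sym z) 0<n) pf p)
  where
  lem : ∀ n a b c → n * n * (+ 4 * (a * c) - b * b) ≡ + 4 * (n * a * (n * c)) - n * b * (n * b)
  lem = ring

 -- A representative (a, bn, cn) with 2a prime to n. In this shape composition with the class of
 -- norm n is visible: it leads to (na, bn, c).
 record Adapted (n : ℤ) (f : Form) : Set where
  constructor adapted
  field
   a b c : ℤ
   equiv : f ≈ (a , b * n , c * n)
   cop   : Cop (+ 2 * a) n

 adapted-exists : ∀ {D f} N .{{_ : NonZero N}} → 0ℤ < D → PosForm D f → Cop (+ 2) (+ N) → Prim (+ N) f → + N ∣ D → Adapted (+ N) f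
 adapted-exists {D} {f} N 0<D pf c2 prim N∣D = from-adapt (adapt {D} {f} N 0<D pf c2 prim 0ℤ (subst (+ N ∣_) (sym (+-identityˡ D)) N∣D))
  where
  from-adapt : (∃ λ a → ∃ λ b → ∃ λ c → f ≈ (a , b , c * + N) × Cop (+ 2 * a) (+ N) × + N ∣ b - 0ℤ) → Adapted (+ N) f
  from-adapt (a , b , c , e , cop , divides k eb) = adapted a k c (subst (λ b → f ≈ (a , b , c * + N)) (i-j≡0⇒i≡j b (k * + N) (trans (lem b (k * + N)) (i≡j⇒i-j≡0 eb))) e) cop
   where
   lem : ∀ b x → b - x ≡ b - 0ℤ - x
   lem = ring

 T-adapted : ∀ {n f} (A : Adapted n f) → T n f (n * Adapted.a A , Adapted.b A * n , Adapted.c A)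
 T-adapted {n} {f} (adapted a b c e cop) = ≈-respˡ (≈-sym e) (by (mat n 0ℤ 0ℤ 1ℤ) (lem0 n) (form-≡ (lem1 n a b c) (lem2 n a b c) (lem3 n a b c)))
  where
  lem0 : ∀ n → n * 1ℤ - 0ℤ * 0ℤ ≡ n
  lem0 = ring
  lem1 : ∀ n a b c → a * (n * n) + b * n * (n * 0ℤ) + c * n * (0ℤ * 0ℤ) ≡ n * (n * a)
  lem1 = ring
  lem2 : ∀ n a b c → + 2 * a * (n * 0ℤ) + b * n * (n * 1ℤ + 0ℤ * 0ℤ) + + 2 * (c * n) * (0ℤ * 1ℤ) ≡ n * (b * n)
  lem2 = ring
  lem3 : ∀ n a b c → a * (0ℤ * 0ℤ) + b * n * (0ℤ * 1ℤ) + c * n * (1ℤ * 1ℤ) ≡ n * c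
  lem3 = ring

 -- Modulo n only a x² remains, and n is squarefree and prime to 2a.
 column-∣ : ∀ {n a b c x y k} → Cop (+ 2 * a) n → Radical n → a * (x * x) + b * n * (x * y) + c * n * (y * y) ≡ k * n → n ∣ x
 column-∣ {n} {a} {b} {c} {x} {y} {k} cop rad e = rad x (cop-∣ cop (divides (+ 2 * (k - b * (x * y) - c * (y * y))) (eq1 (+ 2) _ _ e (lem n a b c x y k))))
  where
  lem : ∀ n a b c x y k → + 2 * a * (x * x) - + 2 * (k - b * (x * y) - c * (y * y)) * n ≡ + 2 * (a * (x * x) + b * n * (x * y) + c * n * (y * y) - k * n)
  lem = ring

 -- By `column-∣` every matrix that realises `T n` on an adapted form has its first row divisible by
 -- n. It is therefore diag(n, 1) followed by an equivalence, and the resulting class is determined.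
 T-unique : ∀ {n f g h} → n ≢ 0ℤ → Radical n → Adapted n f → T n f g → T n f h → g ≈ h
 T-unique {n} {f} n≢0 rad A@(adapted a b c e cop) p q = ≈-trans (≈-sym (through p)) (through q)
  where
  f0 g0 : Form
  f0 = a , b * n , c * n
  g0 = n * a , b * n , c
  factored : ∀ {g} r s → n ≢ 0ℤ → ∀ {p q} → n ∣ p → n ∣ q → p * s - q * r ≡ n → act f0 (mat p q r s) ≡ n ⋆ g → g0 ≈ g
  factored {g1 , g2 , g3} r s n≢0 (divides x refl) (divides y refl) d e' = by (mat x y r s)
   (*-cancelˡ-≡ n _ _ {{≢-nonZero n≢0}} (trans (lem0 n x y r s) (trans d (sym (*-identityʳ n)))))
   (⋆-cancel n≢0 (trans (form-≡ (lem1 n a b c x r) (lem2 n a b c x y r s) (lem1 n a b c y s)) e'))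
   where
   lem0 : ∀ n x y r s → n * (x * s - y * r) ≡ x * n * s - y * n * r
   lem0 = ring
   lem1 : ∀ n a b c x r → n * (n * a * (x * x) + b * n * (x * r) + c * (r * r)) ≡ a * (x * n * (x * n)) + b * n * (x * n * r) + c * n * (r * r)
   lem1 = ring
   lem2 : ∀ n a b c x y r s → n * (+ 2 * (n * a) * (x * y) + b * n * (x * s + r * y) + + 2 * c * (r * s))
      ≡ + 2 * a * (x * n * (y * n)) + b * n * (x * n * s + r * (y * n)) + + 2 * (c * n) * (r * s)
   lem2 = ring
  from-matrix : ∀ {g} → f0 ≈⟨ n ⟩ n ⋆ g → g0 ≈ g
  from-matrix {g1 , g2 , g3} (by (mat x y r s) d e') = factored {g1 , g2 , g3} r s n≢0
      (column-∣ {n} {a} {b} {c} {x} {r} {g1} cop rad (trans (cong proj₁ e') (*-comm n g1)))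
      (column-∣ {n} {a} {b} {c} {y} {s} {g3} cop rad (trans (cong (λ z → proj₂ (proj₂ z)) e') (*-comm n g3))) d e'
  through : ∀ {g} → T n f g → g0 ≈ g
  through {g} p = from-matrix {g} (≈-respˡ e p)

-- Relations that induce free group actions

module Relational {A : Set} (_≟_ : DecidableEquality A) {P : A → Set} (P? : Decidable P) where

 open Counting
 open import Data.Nat.Divisibility using (_∣_)
 open Involution _≟_

 Total : (A → A → Set) → Set
 Total R = ∀ {x} → P x → ∃ λ y → P y × R x y

 private
  pick : ∀ {R} → Total R → ∀ x → Dec (P x) → A
  pick total x (yes px) = proj₁ (total px)
  -- Outside P the chosen function takes an arbitrary default value; its properties are stated on P.
  pick total x (no _)   = x

  pick-spec : ∀ {R} (total : Total R) {x} → P x → (d : Dec (P x)) → P (pick {R} total x d) × R x (pick {R} total x d)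
  pick-spec total px (yes px') = proj₂ (total px')
  pick-spec total px (no ¬px)  = ⊥-elim (¬px px)

 function : ∀ {R} → Total R → ∃ λ (f : A → A) → ∀ {x} → P x → P (f x) × R x (f x)
 function {R} total = (λ x → pick {R} total x (P? x)) , λ {x} px → pick-spec {R} total px (P? x)

 -- Commuting involutions T and S for which T, S and T S have no fixed point: `4∣-free` with σ² = 1.
 klein : ∀ {n T S} → Card P n → Total T → Total S →
  (∀ {x y z} → P x → P y → P z → T x y → T y z → z ≡ x) → (∀ {x y z} → P x → P y → P z → S x y → S y z → z ≡ x) →
  (∀ {x y z w v} → P x → P y → P z → P w → P v → T x y → S y z → S x w → T w v → z ≡ v) →
  (∀ {x} → P x → ¬ T x x) → (∀ {x} → P x → ¬ S x x) → (∀ {x y} → P x → P y → T x y → ¬ S x y) → 4 ∣ n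
 klein {T = T} {S} c totT totS TT SS comm freeT freeS freeTS with function {T} totT | function {S} totS
 ... | τ , τp | σ , σp = 4∣-free c record
  { τ-closed = pτ
  ; σ-closed = pσ
  ; τ-inv = λ px → TT px (pτ px) (pτ (pτ px)) (rτ px) (rτ (pτ px))
  ; commute = λ px → comm px (pτ px) (pσ (pτ px)) (pσ px) (pτ (pσ px)) (rτ px) (rσ (pτ px)) (rσ px) (rτ (pσ px))
  ; σ-square = λ px → inj₁ (SS px (pσ px) (pσ (pσ px)) (rσ px) (rσ (pσ px)))
  ; τ-free = λ {x} px e → freeT px (subst (T x) e (rτ px))
  ; σ-free = λ {x} px e → freeS px (subst (S x) e (rσ px))
  ; σ≢τ = λ {x} px e → freeTS px (pτ px) (rτ px) (subst (S x) e (rσ px)) }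
  where
  pτ : ∀ {x} → P x → P (τ x)
  pτ px = proj₁ (τp px)
  pσ : ∀ {x} → P x → P (σ x)
  pσ px = proj₁ (σp px)
  rτ : ∀ {x} → P x → T x (τ x)
  rτ px = proj₂ (τp px)
  rσ : ∀ {x} → P x → S x (σ x)
  rσ px = proj₂ (σp px)

 -- A map of order 4 whose square has no fixed point: `4∣-free` with τ = σ².
 cyclic : ∀ {n S} → Card P n → Total S → (∀ {x y z u v} → P x → P y → P z → P u → P v → S x y → S y z → S z u → S u v → v ≡ x) →
  (∀ {x y} → P x → P y → S x y → ¬ S y x) → 4 ∣ n
 cyclic {S = S} c tot order free with function {S} tot
 ... | σ , σp = 4∣-free c record
  { τ-closed = λ px → pσ (pσ px)
  ; σ-closed = pσ
  ; τ-inv = λ px → order px (pσ px) (pσ (pσ px)) (pσ (pσ (pσ px))) (pσ (pσ (pσ (pσ px)))) (rσ px) (rσ (pσ px)) (rσ (pσ (pσ px))) (rσ (pσ (pσ (pσ px))))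
  ; commute = λ _ → refl
  ; σ-square = λ _ → inj₂ refl
  ; τ-free = τ-free
  ; σ-free = λ px e → τ-free px (trans (cong σ e) e)
  ; σ≢τ = λ px e → τ-free (pσ px) (trans (cong σ (sym e)) (sym e)) }
  where
  pσ : ∀ {x} → P x → P (σ x)
  pσ px = proj₁ (σp px)
  rσ : ∀ {x} → P x → S x (σ x)
  rσ px = proj₂ (σp px)
  τ-free : ∀ {x} → P x → σ (σ x) ≢ x
  τ-free {x} px e = free px (pσ px) (rσ px) (subst (S (σ x)) e (rσ (pσ px)))

-- When composition with an ambiguous class fixes a class

module Freeness where

 open Forms
 open Reduction
 open Commuting
 open IntegerCoprime
 open Twist
 open import Data.Nat.Base as ℕ using ()
 open IntegerPrelude

 -- Says that D is not the square of a nonzero rational number.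
 NonSquare : ℤ → Set
 NonSquare D = ∀ x y → D * (x * x) ≡ y * y → y ≡ 0ℤ

 nonSquare-scale : ∀ {D} s → NonSquare D → NonSquare (s * s * D)
 nonSquare-scale {D} s ns x y e = ns (s * x) y (trans (lem D s x) e)
  where
  lem : ∀ D s x → D * (s * x * (s * x)) ≡ s * s * D * (x * x)
  lem = ring

 prime≢0 : ∀ {p} → Prime p → + p ≢ 0ℤ
 prime≢0 {zero} pr _ with prime⇒nonZero pr
 ... | ()
 prime≢0 {suc p} pr ()

 abs-< : ∀ {p} y → Prime p → y ≢ 0ℤ → abs y ℕ.< abs (y * + p)
 abs-< {p} y pr y≢0 = subst (abs y ℕ.<_) (sym (abs-* y (+ p)))
  (ℕP.m<m*n (abs y) p {{≢-nonZero y≢0}} (ℕ.nonTrivial⇒n>1 p {{prime⇒nonTrivial pr}}))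

 -- Infinite descent on |y|: p divides y, then x, and division of both by p gives a smaller
 -- solution.
 nonSquare-prime : ∀ {p N} → Prime p → ¬ + p ∣ N → NonSquare (N * + p)
 nonSquare-prime {p} {N} pr p∤N x y e = go x y e (<-wellFounded (abs y))
  where
  half : ∀ x y → N * + p * (x * x) ≡ y * + p * (y * + p) → N * (x * x) ≡ y * y * + p
  half x y e = *-cancelˡ-≡ (+ p) _ _ {{≢-nonZero (prime≢0 pr)}} (trans (lem N (+ p) x) (trans e (lem2 (+ p) y)))
   where
   lem : ∀ N p x → p * (N * (x * x)) ≡ N * p * (x * x)
   lem = ring
   lem2 : ∀ p y → y * p * (y * p) ≡ p * (y * y * p)
   lem2 = ring
  p∣x : ∀ {x z} → N * (x * x) ≡ z * + p → + p ∣ x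
  p∣x {x} {z} e = prime-radical pr x (cop-∣ (prime-Cop pr p∤N) (divides z e))
  p∣y : ∀ {x y} → N * + p * (x * x) ≡ y * y → + p ∣ y
  p∣y {x} {y} e = prime-radical pr y (divides (N * (x * x)) (trans (sym e) (lem N (+ p) x)))
   where
   lem : ∀ N p x → N * p * (x * x) ≡ N * (x * x) * p
   lem = ring
  quarter : ∀ x y → N * (x * + p * (x * + p)) ≡ y * y * + p → N * + p * (x * x) ≡ y * y
  quarter x y e = *-cancelʳ-≡ _ _ (+ p) {{≢-nonZero (prime≢0 pr)}} (trans (lem N (+ p) x) e)
   where
   lem : ∀ N p x → N * p * (x * x) * p ≡ N * (x * p * (x * p))
   lem = ring
  go : ∀ x y → N * + p * (x * x) ≡ y * y → Acc ℕ._<_ (abs y) → y ≡ 0ℤ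
  descend : ∀ {x y z w} → y ≡ z * + p → N * (x * x) ≡ z * z * + p → x ≡ w * + p → Acc ℕ._<_ (abs y) → Dec (z ≡ 0ℤ) → y ≡ 0ℤ
  descend y≡ _ _ _ (yes refl) = y≡
  descend {z = z} {w} refl e refl (acc rs) (no z≢0) = ⊥-elim (z≢0 (go w z (quarter w z e) (rs (abs-< z pr z≢0))))
  split-x : ∀ {x y z} → y ≡ z * + p → N * (x * x) ≡ z * z * + p → + p ∣ x → Acc ℕ._<_ (abs y) → y ≡ 0ℤ
  split-x {x} {y} {z} y≡ e (divides w x≡) ac = descend {x} {y} {z} {w} y≡ e x≡ ac (z ≟ 0ℤ)
  split-y : ∀ {x y} → N * + p * (x * x) ≡ y * y → + p ∣ y → Acc ℕ._<_ (abs y) → y ≡ 0ℤ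
  split-y {x} {y} e (divides z y≡) ac = split-x {x} {y} {z} y≡ e' (p∣x {x} {z * z} e') ac
   where
   e' : N * (x * x) ≡ z * z * + p
   e' = half x z (trans e (cong (λ y → y * y) y≡))
  go x y e ac = split-y {x} {y} e (p∣y {x} {y} e) ac

 -- A class fixed by T n has a multiplier of trace 0.
 module Fixed {D D' n a b c p q r s : ℤ} (0<D : 0ℤ < D) (5≤n : + 5 ≤ n) (D≡ : D ≡ D' * n) (rad : Radical n) (cop : Cop (+ 2 * a) n) (0<a : 0ℤ < a)
  (e : + 4 * (a * c) ≡ b * b + D) (d : p * s - q * r ≡ n) (act≡ : act (a , b , c) (mat p q r s) ≡ n ⋆ (a , b , c)) where

  private
   0<n : 0ℤ < n
   0<n = <-≤-trans (+<+ (ℕ.s≤s ℕ.z≤n)) 5≤n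

  n≢0 : n ≢ 0ℤ
  n≢0 e = <-irrefl (sym e) 0<n

  open Automorph {a} {b} {c} {D} {p} {q} {r} {s} {n} n≢0 e d act≡

  private
   n∣t : n ∣ p + s
   n∣t = rad (p + s) (cop-∣ cop (cop-∣ cop (divides (+ 4 * (+ 4 * (a * a)) + - (+ 4 * (D' * (r * r))))
    (eq2 (+ 4) (- (+ 4 * (r * r))) _ _ trace≡ D≡ (lem a D D' n r (p + s))))))
    where
    lem : ∀ a D D' n r t → + 2 * a * (+ 2 * a * (t * t)) - (+ 4 * (+ 4 * (a * a)) + - (+ 4 * (D' * (r * r)))) * n
      ≡ + 4 * (a * a * (t * t - + 4 * n) - - (D * (r * r))) + (- (+ 4 * (r * r))) * (D - D' * n)
    lem = ring
   -- The left side must be at most 0. A nonzero multiple t of n would have t² ≥ n² ≥ 5n > 4n.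
   trace-zero : ∀ {t} → a * a * (t * t - + 4 * n) ≡ - (D * (r * r)) → n ∣ t → t ≡ 0ℤ
   trace-zero {t} e (divides k t≡) = go (k ≟ 0ℤ)
    where
    lem : ∀ n k → (k * k - 1ℤ) * (n * n) + (n * (n - + 5) + n) ≡ k * n * (k * n) - + 4 * n
    lem = ring
    positive' : k ≢ 0ℤ → 0ℤ < t * t - + 4 * n
    positive' k≢0 = subst (λ t → 0ℤ < t * t - + 4 * n) (sym t≡) (subst (0ℤ <_) (lem n k)
     (0<sum (0≤* (0≤- (i<j⇒suc[i]≤j (square-pos k≢0))) (0≤square n)) (0<sum (0≤* (<⇒≤ 0<n) (0≤- 5≤n)) 0<n)))
    go : Dec (k ≡ 0ℤ) → t ≡ 0ℤ
    go (yes k≡0) = trans t≡ (cong (λ k → k * n) k≡0)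
    go (no k≢0) = ⊥-elim (<-irrefl refl (<-≤-trans (0<* (0<* 0<a 0<a) (positive' k≢0)) (≤-trans (≤-reflexive e) (neg-mono-≤ (0≤* (<⇒≤ 0<D) (0≤square r))))))

  trace≡0 : p + s ≡ 0ℤ
  trace≡0 = trace-zero trace≡ n∣t

  -- With trace 0 the relation `trace≡` reads 4 a² n = D r², and n cancels.
  norm≡ : D' * (r * r) ≡ + 2 * a * (+ 2 * a)
  norm≡ = *-cancelʳ-≡ (D' * (r * r)) (+ 2 * a * (+ 2 * a)) n {{≢-nonZero n≢0}} (i-j≡0⇒i≡j _ _ (trans (lem a D D' n r (p + s))
    (cong₂ _+_ (cong₂ _+_ (vanish (- (r * r)) D≡) (vanish 1ℤ trace≡)) (vanish (- (a * a * (p + s))) trace≡0))))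
   where
   lem : ∀ a D D' n r t → D' * (r * r) * n - + 2 * a * (+ 2 * a) * n
     ≡ (- (r * r)) * (D - D' * n) + 1ℤ * (a * a * (t * t - + 4 * n) - - (D * (r * r))) + (- (a * a * t)) * (t - 0ℤ)
   lem = ring

  -- Here r divides 2a by hypothesis and m ∣ f follows from br = a (s - p), aq = -cr.
  module Proportional (m : ℤ) (c2 : Cop (+ 2) m) (mr≡ : m * r ≡ + 2 * a) where

   r≢0 : r ≢ 0ℤ
   r≢0 r≡0 = <-irrefl (trans (sym (*-zeroʳ m)) (trans (cong (λ r → m * r) (sym r≡0)) mr≡)) (0<* {+ 2} (+<+ (ℕ.s≤s ℕ.z≤n)) 0<a)

   content : m ∣ᶠ (a , b , c)
   content = cop-∣ c2 (divides r (trans (sym mr≡) (*-comm m r))) ,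
    divides (- p) (*-cancelˡ-≡ r b (- p * m) {{≢-nonZero r≢0}} (i-j≡0⇒i≡j _ _ (trans (lem1 a b m p r s)
     (cong₂ _+_ (cong₂ _+_ (vanish 1ℤ br≡) (vanish a trace≡0)) (vanish p mr≡))))) ,
    cop-∣ c2 (divides (- q) (*-cancelˡ-≡ r (+ 2 * c) (- q * m) {{≢-nonZero r≢0}} (eq2 (+ 2) q _ _ aq≡ mr≡ (lem2 a c m q r))))
    where
    lem1 : ∀ a b m p r s → r * b - r * (- p * m) ≡ 1ℤ * (b * r - a * (s - p)) + a * (p + s - 0ℤ) + p * (m * r - + 2 * a)
    lem1 = ring
    lem2 : ∀ a c m q r → r * (+ 2 * c) - r * (- q * m) ≡ + 2 * (a * q - - (c * r)) + q * (m * r - + 2 * a)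
    lem2 = ring

 T-fixed-form : ∀ {n f a b c} → f ≈ (a , b , c) → T n f f → T n (a , b , c) (a , b , c)
 T-fixed-form e p = T-respʳ (T-respˡ e p) e

 -- A fixed class gives D' r² = (2a)² with a > 0, which is impossible when D' is not a square.
 T-free : ∀ {D D' n f} → 0ℤ < D → PosForm D f → + 5 ≤ n → D ≡ D' * n → Radical n → Adapted n f → NonSquare D' → ¬ T n f f
 T-free {D} {D'} {n} {f} 0<D pf 5≤n D≡ rad (adapted a b c e cop) ns t = contra (T-fixed-form e t) (PosForm-≈ {D} {f} 0<D pf e)
  where
  contra : T n (a , b * n , c * n) (a , b * n , c * n) → PosForm D (a , b * n , c * n) → ⊥
  contra (by (mat p q r s) d act≡) (e , 0<a) = <-irrefl (sym (ns r (+ 2 * a) (Fixed.norm≡ {D} {D'} {n} {a} {b * n} {c * n} {p} {q} {r} {s} 0<D 5≤n D≡ rad cop 0<a e d act≡)))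
   (0<* {+ 2} (+<+ (ℕ.s≤s ℕ.z≤n)) 0<a)

 square-roots : ∀ x y → x * x ≡ y * y → x ≡ y ⊎ - x ≡ y
 square-roots x y e = from-zero (i*j≡0⇒i≡0∨j≡0 (x - y) (trans (lem x y) (trans (cong (λ z → z - y * y) e) (+-inverseʳ (y * y)))))
  where
  lem : ∀ x y → (x - y) * (x + y) ≡ x * x - y * y
  lem = ring
  lem2 : ∀ x y → - x - y ≡ (- 1ℤ) * (x + y - 0ℤ)
  lem2 = ring
  from-zero : x - y ≡ 0ℤ ⊎ x + y ≡ 0ℤ → x ≡ y ⊎ - x ≡ y
  from-zero (inj₁ x-y≡0) = inj₁ (i-j≡0⇒i≡j x y x-y≡0)
  from-zero (inj₂ x+y≡0) = inj₂ (eq1 (- 1ℤ) _ _ x+y≡0 (lem2 x y))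

 -∣ : ∀ {m x} → - m ∣ x → m ∣ x
 -∣ {m} {x} (divides k e) = divides (- k) (trans e (lem k m))
  where
  lem : ∀ k m → k * - m ≡ - k * m
  lem = ring

 -- When D = m² n, `norm≡` yields m r = ±2a, and the relations between the matrix entries then force
 -- m to divide all coefficients.
 T-fixed-content : ∀ {D n f} m → 0ℤ < D → PosForm D f → + 5 ≤ n → D ≡ m * m * n → Radical n → Adapted n f → Cop (+ 2) m → T n f f → m ∣ᶠ f
 T-fixed-content {D} {n} {f} m 0<D pf 5≤n D≡ rad (adapted a b c e cop) c2 t = ∣ᶠ-≈ (≈-sym e) (on (T-fixed-form e t) (PosForm-≈ {D} {f} 0<D pf e))
  where
  on : T n (a , b * n , c * n) (a , b * n , c * n) → PosForm D (a , b * n , c * n) → m ∣ᶠ (a , b * n , c * n)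
  on (by (mat p q r s) d act≡) (e , 0<a) = cases (square-roots (m * r) (+ 2 * a) (trans (lem m r) norm≡))
   where
   open Fixed {D} {m * m} {n} {a} {b * n} {c * n} {p} {q} {r} {s} 0<D 5≤n D≡ rad cop 0<a e d act≡
   lem : ∀ m r → m * r * (m * r) ≡ m * m * (r * r)
   lem = ring
   lem2 : ∀ m r → - m * r ≡ - (m * r)
   lem2 = ring
   cases : m * r ≡ + 2 * a ⊎ - (m * r) ≡ + 2 * a → m ∣ᶠ (a , b * n , c * n)
   cases (inj₁ e) = Proportional.content m c2 e
   cases (inj₂ e) = flip (Proportional.content (- m) (cop-sym (cop-∣ˡ (divides (- 1ℤ) (lem3 m)) (cop-sym c2))) (trans (lem2 m r) e))
    where
    lem3 : ∀ m → m ≡ - 1ℤ * - m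
    lem3 = ring
    flip : - m ∣ᶠ (a , b * n , c * n) → m ∣ᶠ (a , b * n , c * n)
    flip (da , db , dc) = -∣ da , -∣ db , -∣ dc

-- Four-group actions on classes

module Orbits where

 open Forms
 open Reduction
 open IntegerCoprime
 open Twist
 open Freeness
 open Counting using (Card)
 open IntegerPrelude

 pos≢0 : ∀ {n} → 0ℤ < n → n ≢ 0ℤ
 pos≢0 0<n e = <-irrefl (sym e) 0<n

 T-total : ∀ {D n f} → 0ℤ < D → 0ℤ < n → PosForm D f → Adapted n f → ∃ λ g → RedForm D g × T n f g
 T-total {D} {n} {f} 0<D 0<n pf A = finish (exists-reduced {D} 0<D g0 (T-PosForm {D} {n} {f} {g0} 0<D 0<n pf (T-adapted A)))
  where
  g0 : Form
  g0 = n * Adapted.a A , Adapted.b A * n , Adapted.c A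
  finish : (∃ λ g → g0 ≈ g × RedForm D g) → ∃ λ g → RedForm D g × T n f g
  finish (g , e , r) = g , r , T-respʳ (T-adapted A) e

 T-involutive : ∀ {D n f g h} → 0ℤ < n → Radical n → Adapted n g → RedForm D f → RedForm D h → T n f g → T n g h → h ≡ f
 T-involutive {D} {n} {f} {g} {h} 0<n rad A rf rh p q = reduced-unique {D} {h} {f} rh rf (T-unique (pos≢0 0<n) rad A q (T-sym (pos≢0 0<n) p))

 -- Composing `T m` and `T n` in either order gives `T (m n)`, and a twist determines the class, so
 -- the two commute. The product being fixed-point free is the freeness of `T (m n)`.
 klein-classes : ∀ {D m n N} {Q : Form → Set} → 0ℤ < D → 0ℤ < m → 0ℤ < n → Radical m → Radical n → Radical (m * n) → (∀ f → Dec (Q f)) →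
  Card (λ f → RedForm D f × Q f) N →
  (∀ {f} → RedForm D f → Q f → Adapted m f × Adapted n f × Adapted (m * n) f) →
  (∀ {f g} → T m f g → Q f → Q g) → (∀ {f g} → T n f g → Q f → Q g) →
  (∀ {f} → RedForm D f → Q f → ¬ T m f f × ¬ T n f f × ¬ T (m * n) f f) → 4 ℕD.∣ N
 klein-classes {D} {m} {n} {N} {Q} 0<D 0<m 0<n rm rn rmn Q? card ad closed-m closed-n free =
  klein {T = T m} {S = T n} card total-m total-n
   (λ (rf , _) (rg , qg) (rh , _) p q → T-involutive {D} 0<m rm (proj₁ (ad rg qg)) rf rh p q)
   (λ (rf , _) (rg , qg) (rh , _) p q → T-involutive {D} 0<n rn (proj₁ (proj₂ (ad rg qg))) rf rh p q)
   (λ {x} {y} {z} {w} {v} (rx , qx) _ (rz , _) _ (rv , _) txy syz sxw twv → reduced-unique {D} {z} {v} rz rv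
    (T-unique (pos≢0 (0<* 0<m 0<n)) rmn (proj₂ (proj₂ (ad rx qx))) (T-comp txy syz) (subst (λ k → T k x v) (*-comm n m) (T-comp sxw twv))))
   (λ (rf , qf) → proj₁ (free rf qf))
   (λ (rf , qf) → proj₁ (proj₂ (free rf qf)))
   (λ {x} {y} (rf , qf) _ txy sxy → proj₂ (proj₂ (free rf qf)) (T-comp txy (T-sym (pos≢0 0<n) sxy)))
  where
  open Relational _≟ᶠ_ {P = λ f → RedForm D f × Q f} (λ f → redForm? D f ×-dec Q? f)
  total-m : Total (T m)
  total-m {f} (rf , qf) = let g , rg , t = T-total {D} {m} {f} 0<D 0<m (proj₁ rf) (proj₁ (ad rf qf)) in g , (rg , closed-m t qf) , t
  total-n : Total (T n)
  total-n {f} (rf , qf) = let g , rg , t = T-total {D} {n} {f} 0<D 0<n (proj₁ rf) (proj₁ (proj₂ (ad rf qf))) in g , (rg , closed-n t qf) , t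

 inv : Form → Form
 inv (a , b , c) = a , - b , c

 inv-inv : ∀ f → inv (inv f) ≡ f
 inv-inv (a , b , c) = cong (λ b → a , b , c) (neg-involutive b)

 inv-≈⟨⟩ : ∀ {n f g} → f ≈⟨ n ⟩ g → inv f ≈⟨ n ⟩ inv g
 inv-≈⟨⟩ {n} {a , b , c} {g} (by (mat p q r s) d e) = by (mat p (- q) (- r) s) (trans (lem0 p q r s) d) (trans (form-≡ (lem1 a b c p r) (lem2 a b c p q r s) (lem3 a b c q s)) (cong inv e))
  where
  lem0 : ∀ p q r s → p * s - - q * - r ≡ p * s - q * r
  lem0 = ring
  lem1 : ∀ a b c p r → a * (p * p) + - b * (p * - r) + c * (- r * - r) ≡ a * (p * p) + b * (p * r) + c * (r * r)
  lem1 = ring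
  lem2 : ∀ a b c p q r s → + 2 * a * (p * - q) + - b * (p * s + - r * - q) + + 2 * c * (- r * s) ≡ - (+ 2 * a * (p * q) + b * (p * s + r * q) + + 2 * c * (r * s))
  lem2 = ring
  lem3 : ∀ a b c q s → a * (- q * - q) + - b * (- q * s) + c * (s * s) ≡ a * (q * q) + b * (q * s) + c * (s * s)
  lem3 = ring

 inv-⋆ : ∀ n f → inv (n ⋆ f) ≡ n ⋆ inv f
 inv-⋆ n (a , b , c) = cong (λ b → n * a , b , n * c) (neg-distribʳ-* n b)

 inv-T : ∀ {n f g} → T n f g → T n (inv f) (inv g)
 inv-T {n} {f} {g} p = subst (inv f ≈⟨ n ⟩_) (inv-⋆ n g) (inv-≈⟨⟩ p)

 reflect : ∀ f → inv f ≈⟨ - 1ℤ ⟩ f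
 reflect (a , b , c) = by (mat 1ℤ 0ℤ 0ℤ (- 1ℤ)) refl (form-≡ (lem1 a b c) (lem2 a b c) (lem3 a b c))
  where
  lem1 : ∀ a b c → a * (1ℤ * 1ℤ) + - b * (1ℤ * 0ℤ) + c * (0ℤ * 0ℤ) ≡ a
  lem1 = ring
  lem2 : ∀ a b c → + 2 * a * (1ℤ * 0ℤ) + - b * (1ℤ * - 1ℤ + 0ℤ * 0ℤ) + + 2 * c * (0ℤ * - 1ℤ) ≡ b
  lem2 = ring
  lem3 : ∀ a b c → a * (0ℤ * 0ℤ) + - b * (0ℤ * - 1ℤ) + c * (- 1ℤ * - 1ℤ) ≡ c
  lem3 = ring

 -- f and inv f lie in one genus, so T p f (inv f) makes p a square modulo the other primes dividing D.
 T-inv-residue : ∀ {p q f} → Adapted q f → T p f (inv f) → ∃ λ x → q ∣ x * x - p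
 T-inv-residue {p} {q} {f} (adapted a b c e cop) t = read (≈-respʳ (≈-respˡ e (≈-comp t (⋆-≈ p (reflect f)))) (⋆-≈ p e))
  where
  lem : ∀ a b c p q x r → + 2 * a * (x * x - p) - - (+ 2 * (b * (x * r) + c * (r * r))) * q ≡ + 2 * (a * (x * x) + b * q * (x * r) + c * q * (r * r) - p * a)
  lem = ring
  read : ∀ {k} → (a , b * q , c * q) ≈⟨ k ⟩ p ⋆ (a , b * q , c * q) → ∃ λ x → q ∣ x * x - p
  read (by (mat x _ r _) _ e') = x , cop-∣ cop (divides (- (+ 2 * (b * (x * r) + c * (r * r))))
   (eq1 (+ 2) _ _ (cong proj₁ e') (lem a b c p q x r)))

 -- The reduced forms equivalent to their inverse; the shape b = 0 does not occur when 4 does not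
 -- divide D.
 Ambiguous : Form → Set
 Ambiguous (a , b , c) = b ≡ a ⊎ a ≡ c

 ambiguous? : ∀ f → Dec (Ambiguous f)
 ambiguous? (a , b , c) = (b ≟ a) ⊎-dec (a ≟ c)

 ambiguous-≈ : ∀ {f} → Ambiguous f → f ≈ inv f
 ambiguous-≈ {a , .a , c} (inj₁ refl) = subst₂ (λ b c' → (a , a , c) ≈ (a , b , c')) (lem1 a) (lem2 a c) (translate a a c (- 1ℤ))
  where
  lem1 : ∀ a → a + + 2 * a * - 1ℤ ≡ - a
  lem1 = ring
  lem2 : ∀ a c → a * (- 1ℤ * - 1ℤ) + a * - 1ℤ + c ≡ c
  lem2 = ring
 ambiguous-≈ {a , b , .a} (inj₂ refl) = swap a b a

 inv-reduced : ∀ {D f} → RedForm D f → ¬ Ambiguous f → RedForm D (inv f)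
 inv-reduced {D} {a , b , c} ((e , 0<a) , lo , hi , a≤c , _) ¬amb = (trans e (lem b D) , 0<a) ,
  neg-mono-< (≤∧≢⇒< hi (λ b≡a → ¬amb (inj₁ b≡a))) , <⇒≤ (subst (- b <_) (neg-involutive a) (neg-mono-< lo)) , a≤c , λ a≡c → ⊥-elim (¬amb (inj₂ a≡c))
  where
  lem : ∀ b D → b * b + D ≡ - b * - b + D
  lem = ring

 inv-≢ : ∀ {D f} → ¬ + 4 ∣ D → RedForm D f → f ≢ inv f
 inv-≢ {D} {a , b , c} 4∤D ((e , _) , _) f≡ = 4∤D (divides (a * c) (trans (sym (trans e (trans (cong (λ b → b * b + D) b≡0) (+-identityˡ D)))) (*-comm (+ 4) (a * c))))
  where
  lem : ∀ b → + 2 * b - + 2 * 0ℤ ≡ 1ℤ * (b - - b)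
  lem = ring
  b≡0 : b ≡ 0ℤ
  b≡0 = *-cancelˡ-≡ (+ 2) b 0ℤ (eq1 1ℤ _ _ (cong (λ f → proj₁ (proj₂ f)) f≡) (lem b))

 -- A reduced form equivalent to its inverse is ambiguous.
 ≈-inv⇒ambiguous : ∀ {D f} → ¬ + 4 ∣ D → RedForm D f → f ≈ inv f → ¬ ¬ Ambiguous f
 ≈-inv⇒ambiguous {D} {f} 4∤D rf e ¬amb = inv-≢ {D} {f} 4∤D rf (reduced-unique {D} {f} {inv f} rf (inv-reduced {D} {f} rf ¬amb) e)

 -- The four-group generated by `T n` and inversion. Inversion is free because b ≠ 0, and the
 -- product of the two is free by the last hypothesis.
 inverse-classes : ∀ {D n N} → 0ℤ < D → 0ℤ < n → ¬ + 4 ∣ D → Radical n → Card (λ f → RedForm D f × ¬ Ambiguous f) N →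
  (∀ {f} → RedForm D f → Adapted n f) → (∀ {f} → RedForm D f → ¬ T n f f) → (∀ {f} → RedForm D f → ¬ T n f (inv f)) → 4 ℕD.∣ N
 inverse-classes {D} {n} {N} 0<D 0<n 4∤D rad card ad free improper =
  klein {T = T n} {S = S} card total-T total-S
   (λ (rf , _) (rg , _) (rh , _) p q → T-involutive {D} 0<n rad (ad rg) rf rh p q)
   (λ {x} _ _ _ p q → trans q (trans (cong inv p) (inv-inv x)))
   (λ {x} {y} {z} {w} {v} _ (ry , ay) (rz , _) (rw , _) (rv , _) txy z≡ w≡ twv → reduced-unique {D} {z} {v} rz rv
    (T-unique (pos≢0 0<n) rad (ad rw) (subst₂ (T n) (sym w≡) (sym z≡) (inv-T txy)) twv))
   (λ (rf , _) → free rf)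
   (λ {f} (rf , _) → inv-≢ {D} {f} 4∤D rf)
   (λ {x} (rf , _) _ t g≡ → improper rf (subst (T n x) g≡ t))
  where
  S : Form → Form → Set
  S f g = g ≡ inv f
  open Relational _≟ᶠ_ {P = λ f → RedForm D f × ¬ Ambiguous f} (λ f → redForm? D f ×-dec ¬? (ambiguous? f))
  total-T : Total (T n)
  total-T {f} (rf , ¬amb) = let g , rg , t = T-total {D} {n} {f} 0<D 0<n (proj₁ rf) (ad rf) in
   -- If the twist g were ambiguous, twisting g ≈ inv g back would give f ≈ inv f.
   g , (rg , λ amb → ≈-inv⇒ambiguous {D} {f} 4∤D rf
    (T-unique (pos≢0 0<n) rad (ad rg) (T-sym (pos≢0 0<n) t) (T-respˡ (≈-sym (ambiguous-≈ {g} amb)) (T-sym (pos≢0 0<n) (inv-T t)))) ¬amb) , t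
  total-S : Total S
  total-S {f} (rf , ¬amb) = inv f , (inv-reduced {D} {f} rf ¬amb , λ amb → ≈-inv⇒ambiguous {D} {f} 4∤D rf
   (≈-sym (subst (inv f ≈_) (inv-inv f) (ambiguous-≈ {inv f} amb))) ¬amb) , refl

-- A square root of the class of norm p

module SquareRoot where

 open Forms
 open Reduction
 open IntegerCoprime
 open Twist
 open Freeness
 open Orbits
 open Counting using (Card)
 open import Data.Nat.Base as ℕ using ()
 open IntegerPrelude

 -- Moving a factor w from the last to the first coefficient is compatible with equivalence.
 transfer : ∀ {a b c a' b' c' w} → w ≢ 0ℤ → Cop (+ 2) w → Cop b w → w ∣ b' - b → (a , b , c * w) ≈ (a' , b' , c' * w) → (a * w , b , c) ≈ (a' * w , b' , c')
 transfer {a} {b} {c} {a'} {b'} {c'} {w} w≢0 c2 cb w∣ (by (mat x1 x2 x3 x4) d e) = build w∣x2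
  where
  value1 : a * (x1 * x1) + b * (x1 * x3) + c * w * (x3 * x3) ≡ a'
  value1 = cong proj₁ e
  polar1 : + 2 * a * (x1 * x2) + b * (x1 * x4 + x3 * x2) + + 2 * (c * w) * (x3 * x4) ≡ b'
  polar1 = cong (λ z → proj₁ (proj₂ z)) e
  value2 : a * (x2 * x2) + b * (x2 * x4) + c * w * (x4 * x4) ≡ c' * w
  value2 = cong (λ z → proj₂ (proj₂ z)) e
  w∣1 : w ∣ x2 * (a * x2 + b * x4)
  w∣1 = divides (c' - c * (x4 * x4)) (eq1 1ℤ _ _ value2 (lem a b c c' w x2 x4))
   where
   lem : ∀ a b c c' w x2 x4 → x2 * (a * x2 + b * x4) - (c' - c * (x4 * x4)) * w ≡ 1ℤ * (a * (x2 * x2) + b * (x2 * x4) + c * w * (x4 * x4) - c' * w)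
   lem = ring
  w∣2 : w ∣ x2 * (a * x1 + b * x3)
  w∣2 = cop-∣ c2 (subst (w ∣_) (sym (eq2 1ℤ (- b) _ _ polar1 d (lem a b b' c w x1 x2 x3 x4)))
    (∣m∣n⇒∣m-n w∣ (divides (+ 2 * c * (x3 * x4)) refl)))
   where
   lem : ∀ a b b' c w x1 x2 x3 x4 → + 2 * (x2 * (a * x1 + b * x3)) - (b' - b - + 2 * c * (x3 * x4) * w)
     ≡ 1ℤ * (+ 2 * a * (x1 * x2) + b * (x1 * x4 + x3 * x2) + + 2 * (c * w) * (x3 * x4) - b') + (- b) * (x1 * x4 - x2 * x3 - 1ℤ)
   lem = ring
  w∣x2 : w ∣ x2
  w∣x2 = cop-∣ cb (subst (w ∣_) (sym (eq1 (- (b * x2)) _ _ d (lem a b x1 x2 x3 x4)))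
    (∣m∣n⇒∣m-n (∣n⇒∣m*n x1 w∣1) (∣n⇒∣m*n x2 w∣2)))
   where
   lem : ∀ a b x1 x2 x3 x4 → b * x2 - (x1 * (x2 * (a * x2 + b * x4)) - x2 * (x2 * (a * x1 + b * x3))) ≡ (- (b * x2)) * (x1 * x4 - x2 * x3 - 1ℤ)
   lem = ring
  build : w ∣ x2 → (a * w , b , c) ≈ (a' * w , b' , c')
  build (divides y x2≡) = by (mat x1 y (w * x3) x4)
   (eq2 1ℤ x3 _ _ d x2≡ (lem0 w x1 x2 x3 x4 y))
   (form-≡ (eq1 w _ _ value1 (lem1 a b c a' w x1 x3))
    (eq2 1ℤ (- (+ 2 * a * x1 + b * x3)) _ _ polar1 x2≡ (lem2 a b b' c w x1 x2 x3 x4 y))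
    (*-cancelʳ-≡ (a * w * (y * y) + b * (y * x4) + c * (x4 * x4)) c' w {{≢-nonZero w≢0}}
     (eq2 1ℤ (- (a * (x2 + y * w) + b * x4)) _ _ value2 x2≡ (lem3 a b c c' w x2 x4 y))))
   where
   lem0 : ∀ w x1 x2 x3 x4 y → x1 * x4 - y * (w * x3) - 1ℤ ≡ 1ℤ * (x1 * x4 - x2 * x3 - 1ℤ) + x3 * (x2 - y * w)
   lem0 = ring
   lem1 : ∀ a b c a' w x1 x3 → a * w * (x1 * x1) + b * (x1 * (w * x3)) + c * (w * x3 * (w * x3)) - a' * w ≡ w * (a * (x1 * x1) + b * (x1 * x3) + c * w * (x3 * x3) - a')
   lem1 = ring
   lem2 : ∀ a b b' c w x1 x2 x3 x4 y → + 2 * (a * w) * (x1 * y) + b * (x1 * x4 + w * x3 * y) + + 2 * c * (w * x3 * x4) - b'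
      ≡ 1ℤ * (+ 2 * a * (x1 * x2) + b * (x1 * x4 + x3 * x2) + + 2 * (c * w) * (x3 * x4) - b') + (- (+ 2 * a * x1 + b * x3)) * (x2 - y * w)
   lem2 = ring
   lem3 : ∀ a b c c' w x2 x4 y → (a * w * (y * y) + b * (y * x4) + c * (x4 * x4)) * w - c' * w
      ≡ 1ℤ * (a * (x2 * x2) + b * (x2 * x4) + c * w * (x4 * x4) - c' * w) + (- (a * (x2 + y * w) + b * x4)) * (x2 - y * w)
   lem3 = ring

 -- A point on p u² + q y² = w² yields a square root of the class of norm p.
 module Root {p q u y : ℤ} {w : ℕ} (0<p : 0ℤ < p) (0<q : 0ℤ < q) {{w≢0 : NonZero w}} (conic : p * (u * u) + q * (y * y) ≡ + w * + w)
  (c2 : Cop (+ 2) (+ w)) (cy : Cop y (+ w)) (cpu : Cop (p * u) (+ w)) where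

  private
   D W : ℤ
   D = p * q
   W = + w
   0<D : 0ℤ < D
   0<D = 0<* 0<p 0<q
   0<W : 0ℤ < W
   0<W = +<+ (ℕ.>-nonZero⁻¹ w)
   N : ℕ
   N = w ℕ.* w
   N≡ : + N ≡ W * W
   N≡ = pos-* w w
   instance
    N≢0 : NonZero N
    N≢0 = ℕP.m*n≢0 w w

  -- Composition with one fixed class of norm W: by the conic, pu/y is a square root of -D modulo
  -- W², and the congruence pins b to it. A factor W then moves from the last to the first
  -- coefficient.
  S : Form → Form → Set
  S f g = ∃ λ a → ∃ λ b → ∃ λ c → f ≈ (a , b , c * W * W) × W * W ∣ p * u - y * b × (a * W , b , c * W) ≈ g

  private
   cop-b : ∀ {b} → W * W ∣ p * u - y * b → Cop b W
   cop-b {b} d = cop-∣ˡ (divides y refl) (cop-≡ (∣-trans (divides W refl) (subst (W * W ∣_) (lem (p * u) (y * b)) (∣m⇒∣-m d))) cpu)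
    where
    lem : ∀ x z → - (x - z) ≡ z - x
    lem = ring
   same-residue : ∀ {b b'} → W * W ∣ p * u - y * b → W * W ∣ p * u - y * b' → W ∣ b' - b
   same-residue {b} {b'} d d' = cop-∣ cy (∣-trans (divides W refl) (subst (W * W ∣_) (lem (p * u) y b b') (∣m∣n⇒∣m-n d d')))
    where
    lem : ∀ x y b b' → x - y * b - (x - y * b') ≡ y * (b' - b)
    lem = ring

  S-exists : ∀ {f} → PosForm D f → Prim W f → ∃ λ g → RedForm D g × S f g
  S-exists {f} pf prim = start (cop-* {+ 2} {1ℤ} c2 (bezout 1ℤ 0ℤ (cong (λ z → 1ℤ + z) (*-zeroʳ W)))) (cop-*ʳ cy cy)
   where
   from-form : ∀ {a b c} → f ≈ (a , b , c * W * W) → W * W ∣ p * u - y * b → ∃ λ g → RedForm D g × S f g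
   from-form {a} {b} {c} e d = finish (exists-reduced {D} 0<D (a * W , b , c * W) (trans (lem a c W) (proj₁ pf') , 0<* (proj₂ pf') 0<W))
    where
    pf' : PosForm D (a , b , c * W * W)
    pf' = PosForm-≈ {D} {f} 0<D pf e
    lem : ∀ a c W → + 4 * (a * W * (c * W)) ≡ + 4 * (a * (c * W * W))
    lem = ring
    finish : (∃ λ g → (a * W , b , c * W) ≈ g × RedForm D g) → ∃ λ g → RedForm D g × S f g
    finish (g , e' , rg) = g , rg , a , b , c , e , d , e'
   start : Cop (+ 2 * 1ℤ) W → Cop y (W * W) → ∃ λ g → RedForm D g × S f g
   start _ cyN@(bezout y' v ey) = use (adapt {D} {f} N 0<D pf (subst (Cop (+ 2)) (sym N≡) (cop-*ʳ c2 c2)) prim' b0 (subst (_∣ b0 * b0 + D) (sym N≡) N∣))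
    where
    -- y' inverts y modulo W², so b0 is pu/y, and the conic shows that b0² + pq is divisible by W².
    b0 : ℤ
    b0 = p * u * y'
    prim' : Prim (+ N) f
    prim' {ℓ} pr ℓ∣N = prim pr (prime-radical pr W (subst (+ ℓ ∣_) N≡ ℓ∣N))
    b0-residue : W * W ∣ p * u - y * b0
    b0-residue = divides (p * u * v) (eq1 (- (p * u)) _ _ ey (lem (p * u) y y' v (W * W)))
     where
     lem : ∀ x y y' v N → x - y * (x * y') - x * v * N ≡ (- x) * (y * y' + N * v - 1ℤ)
     lem = ring
    N∣ : W * W ∣ b0 * b0 + D
    N∣ = cop-∣ cyN (cop-∣ cyN (subst (W * W ∣_) (sym (eq1 p _ _ conic (lem p q u y b0 (W * W))))
       (∣m∣n⇒∣m+n (∣n⇒∣m*n (- (p * u + y * b0)) b0-residue) (divides p refl))))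
     where
     lem : ∀ p q u y b N → y * (y * (b * b + p * q)) - (- (p * u + y * b) * (p * u - y * b) + p * N) ≡ p * (p * (u * u) + q * (y * y) - N)
     lem = ring
    use : (∃ λ a → ∃ λ b → ∃ λ c → f ≈ (a , b , c * + N) × Cop (+ 2 * a) (+ N) × + N ∣ b - b0) → ∃ λ g → RedForm D g × S f g
    use (a , b , c , e , _ , d) = from-form {a} {b} {c} (subst (λ z → f ≈ (a , b , z)) (trans (cong (λ N → c * N) N≡) (sym (*-assoc c W W))) e)
     (subst (W * W ∣_) (lem (p * u) y b b0) (∣m∣n⇒∣m-n b0-residue (∣n⇒∣m*n y (subst (_∣ b - b0) N≡ d))))
     where
     lem : ∀ x y b b0 → x - y * b0 - y * (b - b0) ≡ x - y * b
     lem = ring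

  -- Two steps carry (a, b, cW²) to (aW², b, c), with `transfer` reconciling the representatives
  -- chosen at the second step. The conic supplies an explicit matrix of determinant p between these
  -- two forms.
  S-S : ∀ {f g h} → PosForm D f → S f g → S g h → T p f h
  S-S {f} {g} {h} pf (a , b , c , e , d@(divides k d≡) , e') (a1 , b1 , c1 , e1 , d1 , e1') =
   T-respˡ (≈-sym e) (T-respʳ (T-sym (pos≢0 0<p) step) (≈-trans (transfer (pos≢0 0<W) c2 (cop-b d) (same-residue d d1) (≈-trans e' e1)) e1'))
   where
   -- Here k W² = pu - yb. Multiplied by W², the left side is (pu)² + pq y², which the conic equates
   -- with p W².
   norm : k * k * (W * W) + + 2 * (b * (k * y)) + + 4 * (a * c) * (y * y) ≡ p
   norm = *-cancelʳ-≡ _ p (W * W) {{≢-nonZero (pos≢0 (0<* 0<W 0<W))}} (i-j≡0⇒i≡j _ _ (trans (lem a b c k p q u y W)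
    (cong₂ _+_ (cong₂ _+_ (vanish (y * y) (proj₁ (PosForm-≈ {D} {f} 0<D pf e))) (vanish (- (k * (W * W) + p * u + y * b)) d≡)) (vanish p conic))))
    where
    lem : ∀ a b c k p q u y W → (k * k * (W * W) + + 2 * (b * (k * y)) + + 4 * (a * c) * (y * y)) * (W * W) - p * (W * W)
      ≡ y * y * (+ 4 * (a * (c * W * W)) - (b * b + p * q)) + (- (k * (W * W) + p * u + y * b)) * (p * u - y * b - k * (W * W)) + p * (p * (u * u) + q * (y * y) - W * W)
    lem = ring
   step : T p (a * W * W , b , c) (a , b , c * W * W)
   step = by (mat k (- (+ 2 * c * y)) (+ 2 * a * y) (k * (W * W) + + 2 * (y * b))) (trans (lem0 a b c k y W) norm)
    (form-≡ (trans (lem1 a b c k y W) (cong (λ p → p * a) norm)) (trans (lem2 a b c k y W) (cong (λ p → p * b) norm)) (trans (lem3 a b c k y W) (cong (λ p → p * (c * W * W)) norm)))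
    where
    lem0 : ∀ a b c k y W → k * (k * (W * W) + + 2 * (y * b)) - - (+ 2 * c * y) * (+ 2 * a * y) ≡ k * k * (W * W) + + 2 * (b * (k * y)) + + 4 * (a * c) * (y * y)
    lem0 = ring
    lem1 : ∀ a b c k y W → a * W * W * (k * k) + b * (k * (+ 2 * a * y)) + c * (+ 2 * a * y * (+ 2 * a * y)) ≡ (k * k * (W * W) + + 2 * (b * (k * y)) + + 4 * (a * c) * (y * y)) * a
    lem1 = ring
    lem2 : ∀ a b c k y W → let s = k * (W * W) + + 2 * (y * b) in
     + 2 * (a * W * W) * (k * - (+ 2 * c * y)) + b * (k * s + + 2 * a * y * - (+ 2 * c * y)) + + 2 * c * (+ 2 * a * y * s) ≡ (k * k * (W * W) + + 2 * (b * (k * y)) + + 4 * (a * c) * (y * y)) * b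
    lem2 = ring
    lem3 : ∀ a b c k y W → let s = k * (W * W) + + 2 * (y * b) in
     a * W * W * (- (+ 2 * c * y) * - (+ 2 * c * y)) + b * (- (+ 2 * c * y) * s) + c * (s * s) ≡ (k * k * (W * W) + + 2 * (b * (k * y)) + + 4 * (a * c) * (y * y)) * (c * W * W)
    lem3 = ring

  -- `S` has order 4 on classes, because its square is the fixed-point free involution `T p`.
  four-divides : ∀ {n} → Card (RedForm D) n → Radical p → (∀ {f} → RedForm D f → Prim W f × Adapted p f × ¬ T p f f) → 4 ℕD.∣ n
  four-divides card rad hyp = cyclic {S = S} card (λ {f} rf → S-exists {f} (proj₁ rf) (proj₁ (hyp rf)))
   (λ {x} {y} {z} {u} {v} rx ry rz ru rv s1 s2 s3 s4 → T-involutive {D} 0<p rad (proj₁ (proj₂ (hyp rz))) rx rv (S-S (proj₁ rx) s1 s2) (S-S (proj₁ rz) s3 s4))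
   (λ rf _ s s' → proj₂ (proj₂ (hyp rf)) (S-S (proj₁ rf) s s'))
   where
   open Relational _≟ᶠ_ {P = RedForm D} (redForm? D)

-- Legendre's theorem for p u² + q y² = w²

module Conic where

 open Forms
 open Reduction using (0≤-; vanish)
 open IntegerCoprime
 open Freeness using (abs-<; NonSquare; nonSquare-prime; prime≢0)
 open import Data.Nat.Base as ℕ using ()
 import Data.Nat.Coprimality as ℕC
 open import Data.Nat.GCD using (gcd; gcd[m,n]∣m; gcd[m,n]∣n)
 open import Data.Fin.Base using (fromℕ<; combine; remQuot)
 open IntegerPrelude
 open import Data.Product.Base using (uncurry)

 isqrt : ∀ n → ∃ λ r → r ℕ.* r ℕ.≤ n × n ℕ.< suc r ℕ.* suc r
 isqrt zero    = 0 , ℕ.z≤n , ℕ.s≤s ℕ.z≤n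
 isqrt (suc n) = next (isqrt n)
  where
  next : (∃ λ r → r ℕ.* r ℕ.≤ n × n ℕ.< suc r ℕ.* suc r) → ∃ λ r → r ℕ.* r ℕ.≤ suc n × suc n ℕ.< suc r ℕ.* suc r
  next (r , lo , hi) = decide (suc r ℕ.* suc r ℕP.≤? suc n)
   where
   decide : Dec (suc r ℕ.* suc r ℕ.≤ suc n) → ∃ λ r → r ℕ.* r ℕ.≤ suc n × suc n ℕ.< suc r ℕ.* suc r
   decide (no ≰)   = r , ℕP.m≤n⇒m≤1+n lo , ℕP.≰⇒> ≰
   decide (yes le) = suc r , le , ℕP.≤-<-trans hi (ℕP.*-mono-< (ℕP.n<1+n (suc r)) (ℕP.n<1+n (suc r)))

 private
  residue : ∀ n .{{_ : NonZero n}} → ℤ → Fin n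
  residue n x = fromℕ< (n%ℕd<d x n)

  residue-≡ : ∀ n .{{_ : NonZero n}} x y → residue n x ≡ residue n y → + n ∣ x - y
  residue-≡ n x y e = divides (x /ℕ n - y /ℕ n) (i-j≡0⇒i≡j _ _ (trans (lem x y (+ (x %ℕ n)) (+ (y %ℕ n)) (x /ℕ n) (y /ℕ n) (+ n))
   (cong₂ _+_ (cong₂ _+_ (vanish 1ℤ (a≡a%ℕn+[a/ℕn]*n x n)) (vanish (- 1ℤ) (a≡a%ℕn+[a/ℕn]*n y n))) (vanish 1ℤ (cong +_ %≡)))))
   where
   %≡ : x %ℕ n ≡ y %ℕ n
   %≡ = trans (sym (FinP.toℕ-fromℕ< (n%ℕd<d x n))) (trans (cong toℕ e) (FinP.toℕ-fromℕ< (n%ℕd<d y n)))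
   lem : ∀ x y a b k l n → x - y - (k - l) * n ≡ 1ℤ * (x - (a + k * n)) + (- 1ℤ) * (y - (b + l * n)) + 1ℤ * (a - b)
   lem = ring

  diff-bound : ∀ {n} (i j : Fin (suc n)) → (+ toℕ i - + toℕ j) * (+ toℕ i - + toℕ j) ≤ + n * + n
  diff-bound {n} i j = ≤-from-diff (subst (0ℤ ≤_) (lem (+ n) (+ toℕ i) (+ toℕ j)) (0≤* (+-mono-≤ (0≤- i≤n) (+≤+ {0} {toℕ j} ℕ.z≤n)) (+-mono-≤ (0≤- j≤n) (+≤+ {0} {toℕ i} ℕ.z≤n))))
   where
   i≤n : + toℕ i ≤ + n
   i≤n = +≤+ (ℕP.≤-pred (FinP.toℕ<n i))
   j≤n : + toℕ j ≤ + n
   j≤n = +≤+ (ℕP.≤-pred (FinP.toℕ<n j))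
   lem : ∀ n i j → (n - i + j) * (n - j + i) ≡ n * n - (i - j) * (i - j)
   lem = ring

  -- The square of the number of boxes exceeds q · p · pq, by multiplying the three strict bounds.
  box-size : ∀ {p q U V W} → q ℕ.< suc U ℕ.* suc U → p ℕ.< suc V ℕ.* suc V → p ℕ.* q ℕ.< suc W ℕ.* suc W → q ℕ.* p ℕ.< suc U ℕ.* (suc V ℕ.* suc W)
  box-size {p} {q} {U} {V} {W} hU hV hW = decide (suc U ℕ.* (suc V ℕ.* suc W) ℕP.≤? q ℕ.* p)
   where
   open import Data.Nat.Tactic.RingSolver renaming (solve-∀ to solveℕ)
   square : ∀ u v w → u ℕ.* (v ℕ.* w) ℕ.* (u ℕ.* (v ℕ.* w)) ≡ u ℕ.* u ℕ.* (v ℕ.* v) ℕ.* (w ℕ.* w)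
   square = solveℕ
   square' : ∀ p q → q ℕ.* p ℕ.* (q ℕ.* p) ≡ q ℕ.* p ℕ.* (p ℕ.* q)
   square' = solveℕ
   decide : Dec (suc U ℕ.* (suc V ℕ.* suc W) ℕ.≤ q ℕ.* p) → q ℕ.* p ℕ.< suc U ℕ.* (suc V ℕ.* suc W)
   decide (no ≰)   = ℕP.≰⇒> ≰
   decide (yes le) = ⊥-elim (ℕP.<-irrefl refl (ℕP.<-≤-trans (ℕP.*-mono-< (ℕP.*-mono-< hU hV) hW)
    (ℕP.≤-trans (ℕP.≤-reflexive (sym (square (suc U) (suc V) (suc W)))) (ℕP.≤-trans (ℕP.*-mono-≤ le le) (ℕP.≤-reflexive (square' p q))))))

 record Point (p q : ℤ) : Set where
  constructor point
  field
   u y w : ℤ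
   conic : p * (u * u) + q * (y * y) ≡ w * w
   w≢0   : w ≢ 0ℤ

 module _ {p q : ℕ} (pr : Prime p) (qr : Prime q) (p≢q : p ≢ q) where

  private
   P Q : ℤ
   P = + p
   Q = + q
   0<P : 0ℤ < P
   0<P = ≤∧≢⇒< (+≤+ ℕ.z≤n) (λ e → prime≢0 pr (sym e))
   0<Q : 0ℤ < Q
   0<Q = ≤∧≢⇒< (+≤+ ℕ.z≤n) (λ e → prime≢0 qr (sym e))
   q∤p : ¬ Q ∣ P
   q∤p d = p≢q (sym (prime-∣ qr pr d))

   not-square : ∀ {n} → 0ℤ < n → NonSquare n → ∀ x → x * x ≢ n
   not-square {n} 0<n ns x e = <-irrefl (trans (cong (λ x → x * x) (sym (ns 1ℤ x (trans (lem n) (sym e))))) e) 0<n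
    where
    lem : ∀ n → n * (1ℤ * 1ℤ) ≡ n
    lem = ring

   Q-nonsquare : NonSquare Q
   Q-nonsquare = subst NonSquare (*-identityˡ Q) (nonSquare-prime {q} {1ℤ} qr (prime∤1 qr))

   PQ-nonsquare : NonSquare (P * Q)
   PQ-nonsquare = nonSquare-prime {q} {P} qr q∤p

   -- The box argument leaves p u² + q y² - w² ∈ {0, pq}; the second value is composed away with the identity
   -- (p u² + q y²)(w² + pq) = p (uw - qy)² + q (yw + pu)².
   from-box : ∀ {u y w k} → u * u ≤ Q → y * y ≤ P → w * w ≤ P * Q → ¬ (u ≡ 0ℤ × y ≡ 0ℤ × w ≡ 0ℤ) → P * (u * u) + Q * (y * y) - w * w ≡ k * (P * Q) → Point P Q
   from-box {u} {y} {w} {+ zero} _ _ _ ≢0 e = point u y w conic w≢0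
    where
    conic : P * (u * u) + Q * (y * y) ≡ w * w
    conic = i-j≡0⇒i≡j _ _ e
    sum-zero : w ≡ 0ℤ → P * (u * u) + Q * (y * y) ≡ 0ℤ
    sum-zero w≡0 = trans conic (cong (λ w → w * w) w≡0)
    u≡0 : w ≡ 0ℤ → Dec (u ≡ 0ℤ) → u ≡ 0ℤ
    u≡0 _   (yes e)  = e
    u≡0 w≡0 (no u≢0) = ⊥-elim (<-irrefl (sym (trans (+-comm (Q * (y * y)) (P * (u * u))) (sum-zero w≡0))) (0<sum (0≤* (<⇒≤ 0<Q) (0≤square y)) (0<* 0<P (square-pos u≢0))))
    y≡0 : w ≡ 0ℤ → Dec (y ≡ 0ℤ) → y ≡ 0ℤ
    y≡0 _   (yes e)  = e
    y≡0 w≡0 (no y≢0) = ⊥-elim (<-irrefl (sym (sum-zero w≡0)) (0<sum (0≤* (<⇒≤ 0<P) (0≤square u)) (0<* 0<Q (square-pos y≢0))))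
    w≢0 : w ≢ 0ℤ
    w≢0 w≡0 = ≢0 (u≡0 w≡0 (u ≟ 0ℤ) , y≡0 w≡0 (y ≟ 0ℤ) , w≡0)
   from-box {u} {y} {w} {+ suc zero} _ _ _ _ e = point (u * w - Q * y) (y * w + P * u) (w * w + P * Q)
    (eq1 (w * w + P * Q) _ _ e (lem P Q u y w))
    (λ z → <-irrefl (sym z) (0<sum (0≤square w) (0<* 0<P 0<Q)))
    where
    lem : ∀ p q u y w → p * ((u * w - q * y) * (u * w - q * y)) + q * ((y * w + p * u) * (y * w + p * u)) - (w * w + p * q) * (w * w + p * q)
      ≡ (w * w + p * q) * (p * (u * u) + q * (y * y) - w * w - 1ℤ * (p * q))
    lem = ring
   -- Multiples k ≥ 2 and, in the next clause, k < 0 are excluded by u² < q, y² ≤ p and w² < pq; two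
   -- of the bounds are strict because q and pq are not squares.
   from-box {u} {y} {w} {+ suc (suc k)} hu hy hw _ e = ⊥-elim (<-irrefl (sym zero-sum) (0<sum {K * (P * Q) + w * w + Q * (P - y * y)}
     (+-mono-≤ (+-mono-≤ (0≤* {K} (+≤+ ℕ.z≤n) (<⇒≤ (0<* 0<P 0<Q))) (0≤square w)) (0≤* (<⇒≤ 0<Q) (0≤- hy)))
     (0<* 0<P (<⇒0<- (≤∧≢⇒< hu (not-square 0<Q Q-nonsquare u))))))
    where
    K : ℤ
    K = + k
    lem : ∀ p q u y w k → k * (p * q) + w * w + q * (p - y * y) + p * (q - u * u) ≡ (+ 2 + k) * (p * q) - (p * (u * u) + q * (y * y) - w * w)
    lem = ring
    zero-sum : K * (P * Q) + w * w + Q * (P - y * y) + P * (Q - u * u) ≡ 0ℤ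
    zero-sum = trans (lem P Q u y w K) (i≡j⇒i-j≡0 (sym e))
   from-box {u} {y} {w} { -[1+ k ]} hu hy hw _ e = ⊥-elim (<-irrefl (sym zero-sum) (0<sum {K * (P * Q) + P * (u * u) + Q * (y * y)}
     (+-mono-≤ (+-mono-≤ (0≤* {K} (+≤+ ℕ.z≤n) (<⇒≤ (0<* 0<P 0<Q))) (0≤* (<⇒≤ 0<P) (0≤square u))) (0≤* (<⇒≤ 0<Q) (0≤square y)))
     (<⇒0<- (≤∧≢⇒< hw (not-square (0<* 0<P 0<Q) PQ-nonsquare w)))))
    where
    K : ℤ
    K = + k
    lem : ∀ p q u y w k → k * (p * q) + p * (u * u) + q * (y * y) + (p * q - w * w) ≡ p * (u * u) + q * (y * y) - w * w - - (1ℤ + k) * (p * q)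
    lem = ring
    zero-sum : K * (P * Q) + P * (u * u) + Q * (y * y) + (P * Q - w * w) ≡ 0ℤ
    zero-sum = trans (lem P Q u y w K) (i≡j⇒i-j≡0 e)

  -- Pigeonhole on triples (u, y, w) in a box with more than pq points, by the residues of w - r u
  -- modulo q and w - s y modulo p. The difference of two colliding triples makes p u² + q y² - w²
  -- divisible by pq.
  point-exists : ∀ r s → Q ∣ r * r - P → P ∣ s * s - Q → Point P Q
  point-exists r s r² s² = boxes (isqrt q) (isqrt p) (isqrt (p ℕ.* q))
   where
   Isqrt : ℕ → Set
   Isqrt n = ∃ λ r → r ℕ.* r ℕ.≤ n × n ℕ.< suc r ℕ.* suc r
   instance
    p≢0 : NonZero p
    p≢0 = ℕ.≢-nonZero (λ e → prime≢0 pr (cong +_ e))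
    q≢0 : NonZero q
    q≢0 = ℕ.≢-nonZero (λ e → prime≢0 qr (cong +_ e))
   boxes : Isqrt q → Isqrt p → Isqrt (p ℕ.* q) → Point P Q
   boxes (U , U≤ , U<) (V , V≤ , V<) (W , W≤ , W<) = collide (FinP.pigeonhole (box-size {p} {q} {U} {V} {W} U< V< W<) key)
    where
    Index : Set
    Index = Fin (suc U ℕ.* (suc V ℕ.* suc W))
    uOf : Index → Fin (suc U)
    uOf i = proj₁ (remQuot {suc U} (suc V ℕ.* suc W) i)
    yOf : Index → Fin (suc V)
    yOf i = proj₁ (remQuot {suc V} (suc W) (proj₂ (remQuot {suc U} (suc V ℕ.* suc W) i)))
    wOf : Index → Fin (suc W)
    wOf i = proj₂ (remQuot {suc V} (suc W) (proj₂ (remQuot {suc U} (suc V ℕ.* suc W) i)))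
    rebuild : ∀ i → combine (uOf i) (combine (yOf i) (wOf i)) ≡ i
    rebuild i = trans (cong (combine (uOf i)) (FinP.combine-remQuot {suc V} (suc W) (proj₂ (remQuot {suc U} (suc V ℕ.* suc W) i)))) (FinP.combine-remQuot {suc U} (suc V ℕ.* suc W) i)
    keyQ : Index → ℤ
    keyQ i = + toℕ (wOf i) - r * + toℕ (uOf i)
    keyP : Index → ℤ
    keyP i = + toℕ (wOf i) - s * + toℕ (yOf i)
    key : Index → Fin (q ℕ.* p)
    key i = combine (residue q (keyQ i)) (residue p (keyP i))
    bound : ∀ {n R} → R ℕ.* R ℕ.≤ n → ∀ {x} → x ≤ + R * + R → x ≤ + n
    bound {n} {R} le h = ≤-trans h (≤-trans (≤-reflexive (sym (pos-* R R))) (+≤+ le))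
    collide : (∃ λ i → ∃ λ j → i Fin.< j × key i ≡ key j) → Point P Q
    collide (i , j , i<j , e) = build (cop-*-∣ (prime-Cop qr q∤p) F∣P F∣Q)
     where
     u y w F : ℤ
     u = + toℕ (uOf i) - + toℕ (uOf j)
     y = + toℕ (yOf i) - + toℕ (yOf j)
     w = + toℕ (wOf i) - + toℕ (wOf j)
     F = P * (u * u) + Q * (y * y) - w * w
     lem-key : ∀ w w' u u' r → w - r * u - (w' - r * u') ≡ w - w' - r * (u - u')
     lem-key = ring
     q∣ : Q ∣ w - r * u
     q∣ = subst (Q ∣_) (lem-key (+ toℕ (wOf i)) (+ toℕ (wOf j)) (+ toℕ (uOf i)) (+ toℕ (uOf j)) r)
      (residue-≡ q (keyQ i) (keyQ j) (proj₁ (FinP.combine-injective (residue q (keyQ i)) (residue p (keyP i)) (residue q (keyQ j)) (residue p (keyP j)) e)))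
     p∣ : P ∣ w - s * y
     p∣ = subst (P ∣_) (lem-key (+ toℕ (wOf i)) (+ toℕ (wOf j)) (+ toℕ (yOf i)) (+ toℕ (yOf j)) s)
      (residue-≡ p (keyP i) (keyP j) (proj₂ (FinP.combine-injective (residue q (keyQ i)) (residue p (keyP i)) (residue q (keyQ j)) (residue p (keyP j)) e)))
     lem1 : ∀ p q u y w r → q * (y * y) - (w - r * u) * (w + r * u) - u * u * (r * r - p) ≡ p * (u * u) + q * (y * y) - w * w
     lem1 = ring
     lem2 : ∀ p q u y w s → p * (u * u) - (w - s * y) * (w + s * y) - y * y * (s * s - q) ≡ p * (u * u) + q * (y * y) - w * w
     lem2 = ring
     F∣Q : Q ∣ F
     F∣Q = subst (Q ∣_) (lem1 P Q u y w r) (∣m∣n⇒∣m-n (∣m∣n⇒∣m-n (∣m⇒∣m*n (y * y) ∣-refl) (∣m⇒∣m*n (w + r * u) q∣)) (∣n⇒∣m*n (u * u) r²))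
     F∣P : P ∣ F
     F∣P = subst (P ∣_) (lem2 P Q u y w s) (∣m∣n⇒∣m-n (∣m∣n⇒∣m-n (∣m⇒∣m*n (u * u) ∣-refl) (∣m⇒∣m*n (w + s * y) p∣)) (∣n⇒∣m*n (y * y) s²))
     same : ∀ {n} {a b : Fin n} → + toℕ a - + toℕ b ≡ 0ℤ → a ≡ b
     same {a = a} {b} e = FinP.toℕ-injective (+-injective (i-j≡0⇒i≡j (+ toℕ a) (+ toℕ b) e))
     distinct : ¬ (u ≡ 0ℤ × y ≡ 0ℤ × w ≡ 0ℤ)
     distinct (u≡0 , y≡0 , w≡0) = FinP.<-irrefl (trans (sym (rebuild i))
      (trans (cong₂ combine (same {a = uOf i} {uOf j} u≡0) (cong₂ combine (same {a = yOf i} {yOf j} y≡0) (same {a = wOf i} {wOf j} w≡0))) (rebuild j))) i<j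
     build : P * Q ∣ F → Point P Q
     build (divides k e') = from-box {u} {y} {w} {k} (bound {q} {U} U≤ (diff-bound (uOf i) (uOf j))) (bound {p} {V} V≤ (diff-bound (yOf i) (yOf j)))
      (≤-trans (bound {p ℕ.* q} {W} W≤ (diff-bound (wOf i) (wOf j))) (≤-reflexive (pos-* p q))) distinct e'

 -- If ℓ divides w and u, it divides y, unless q is divisible by ℓ².
 common-factor : ∀ {p q ℓ u y w} → Prime ℓ → Prime q → p * (u * u) + + q * (y * y) ≡ w * w → + ℓ ∣ u → + ℓ ∣ w → + ℓ ∣ y
 common-factor {p} {q} {ℓ} {u} {y} {w} pr qr e (divides u' u≡) (divides w' w≡) = prime-radical pr y (decide (+ ℓ ∣? + q))
  where
  z L : ℤ
  L = + ℓ
  z = w' * w' - p * (u' * u')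
  lem : ∀ p q u y w u' w' L → q * (y * y) - L * ((w' * w' - p * (u' * u')) * L)
    ≡ 1ℤ * (p * (u * u) + q * (y * y) - w * w) + (- (p * (u + u' * L))) * (u - u' * L) + (w + w' * L) * (w - w' * L)
  lem = ring
  qy≡ : + q * (y * y) ≡ L * (z * L)
  qy≡ = i-j≡0⇒i≡j _ _ (trans (lem p (+ q) u y w u' w' L) (cong₂ _+_ (cong₂ _+_ (vanish 1ℤ e) (vanish (- (p * (u + u' * L))) u≡)) (vanish (w + w' * L) w≡)))
  decide : Dec (+ ℓ ∣ + q) → + ℓ ∣ y * y
  decide (yes ℓ∣q) = divides z (*-cancelˡ-≡ L (y * y) (z * L) {{≢-nonZero (prime≢0 pr)}} (trans (cong (λ k → + k * (y * y)) (prime-∣ pr qr ℓ∣q)) qy≡))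
  decide (no ℓ∤q)  = cop-∣ (prime-Cop pr ℓ∤q) (divides (L * z) (trans qy≡ (sym (*-assoc L z L))))

 record PrimitivePoint (p q : ℤ) : Set where
  constructor primitivePoint
  field
   u y w : ℤ
   conic : p * (u * u) + q * (y * y) ≡ w * w
   w≢0   : w ≢ 0ℤ
   c2    : Cop (+ 2) w
   cy    : Cop y w
   cpu   : Cop (p * u) w

 module _ {p q : ℕ} (pr : Prime p) (qr : Prime q) (p≢q : p ≢ q) (2∤p : Cop (+ 2) (+ p)) (2∤q : Cop (+ 2) (+ q)) where

  private
   P Q : ℤ
   P = + p
   Q = + q

   odd-w : ∀ {w} → ¬ + 2 ∣ w → Cop (+ 2) w
   odd-w 2∤w = cop-sym (prime-Cop prime[2] 2∤w)

   divide-conic : ∀ {u y w u' y' w' k} → k ≢ 0ℤ → u ≡ u' * k → y ≡ y' * k → w ≡ w' * k → P * (u * u) + Q * (y * y) ≡ w * w → P * (u' * u') + Q * (y' * y') ≡ w' * w'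
   divide-conic {u' = u'} {y'} {w'} {k} k≢0 refl refl refl e = *-cancelʳ-≡ _ _ (k * k) {{≢-nonZero (λ z → k≢0 (square-zero z))}} (trans (lem P Q u' y' k) (trans e (lem2 w' k)))
    where
    square-zero : k * k ≡ 0ℤ → k ≡ 0ℤ
    square-zero z with i*j≡0⇒i≡0∨j≡0 k z
    ... | inj₁ e = e
    ... | inj₂ e = e
    lem : ∀ p q u y k → (p * (u * u) + q * (y * y)) * (k * k) ≡ p * (u * k * (u * k)) + q * (y * k * (y * k))
    lem = ring
    lem2 : ∀ w k → w * k * (w * k) ≡ w * w * (k * k)
    lem2 = ring

   factor≢0 : ∀ {w w' k} → w ≢ 0ℤ → w ≡ w' * k → w' ≢ 0ℤ
   factor≢0 {k = k} w≢0 e z = w≢0 (trans e (cong (λ w → w * k) z))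

   -- A prime dividing y and w also divides u by `common-factor`, and a prime dividing p and w also
   -- divides y; both contradict a coprimality already known.
   coprime-triple : ∀ {u y w} → P * (u * u) + Q * (y * y) ≡ w * w → w ≢ 0ℤ → ¬ + 2 ∣ w → Cop u w → PrimitivePoint P Q
   coprime-triple {u} {y} {w} e w≢0 2∤w cu = primitivePoint u y w e w≢0 (odd-w 2∤w) cy (cop-* cp cu)
    where
    cy : Cop y w
    cy = no-common-prime-ℤ λ {ℓ} ℓr ℓ∣y ℓ∣w → prime∤1 ℓr (cop-common cu (common-factor {Q} {p} {ℓ} {y} {u} {w} ℓr pr (trans (+-comm (Q * (y * y)) (P * (u * u))) e) ℓ∣y ℓ∣w) ℓ∣w)
    cp : Cop P w
    cp = no-common-prime-ℤ λ {ℓ} ℓr ℓ∣p ℓ∣w → prime∤1 ℓr (cop-common cy (ℓ∣y ℓr ℓ∣p ℓ∣w) ℓ∣w)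
     where
     ℓ∣y : ∀ {ℓ} → Prime ℓ → + ℓ ∣ P → + ℓ ∣ w → + ℓ ∣ y
     ℓ∣y {ℓ} ℓr ℓ∣p ℓ∣w = prime-radical ℓr y (cop-∣ (prime-Cop ℓr (λ ℓ∣q → p≢q (trans (sym (prime-∣ ℓr pr ℓ∣p)) (prime-∣ ℓr qr ℓ∣q))))
      (subst (+ ℓ ∣_) (sym (eq1 1ℤ _ _ e (lem P Q u y w))) (∣m∣n⇒∣m-n (∣m⇒∣m*n w ℓ∣w) (∣m⇒∣m*n (u * u) ℓ∣p))))
      where
      lem : ∀ p q u y w → q * (y * y) - (w * w - p * (u * u)) ≡ 1ℤ * (p * (u * u) + q * (y * y) - w * w)
      lem = ring

   primitive-part : ∀ {u y w} → P * (u * u) + Q * (y * y) ≡ w * w → w ≢ 0ℤ → ¬ + 2 ∣ w → Acc ℕ._<_ (abs w) → PrimitivePoint P Q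
   primitive-part {u} {y} {w} e w≢0 2∤w (acc rs) = decide (gcd (abs u) (abs w) ℕP.≟ 1)
    where
    divide : ∀ {ℓ} → Prime ℓ → + ℓ ∣ u → + ℓ ∣ y → + ℓ ∣ w → PrimitivePoint P Q
    divide {ℓ} ℓr (divides u' u≡) (divides y' y≡) (divides w' w≡) = primitive-part {u'} {y'} {w'}
     (divide-conic {u} {y} {w} {u'} {y'} {w'} {+ ℓ} (prime≢0 ℓr) u≡ y≡ w≡ e) w'≢0
     (λ 2∣w' → 2∤w (subst (+ 2 ∣_) (sym w≡) (∣m⇒∣m*n (+ ℓ) 2∣w')))
     (rs (subst (λ w → abs w' ℕ.< abs w) (sym w≡) (abs-< w' ℓr w'≢0)))
     where
     w'≢0 : w' ≢ 0ℤ
     w'≢0 = factor≢0 {w} {w'} {+ ℓ} w≢0 w≡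
    reduce : (∃ λ ℓ → Prime ℓ × ℓ ℕD.∣ gcd (abs u) (abs w)) → PrimitivePoint P Q
    reduce (ℓ , ℓr , ℓ∣) = divide ℓr ℓ∣u (common-factor {P} {q} {ℓ} {u} {y} {w} ℓr qr e ℓ∣u ℓ∣w) ℓ∣w
     where
     ℓ∣u : + ℓ ∣ u
     ℓ∣u = ∣ᵤ⇒∣ (ℕD.∣-trans ℓ∣ (gcd[m,n]∣m (abs u) (abs w)))
     ℓ∣w : + ℓ ∣ w
     ℓ∣w = ∣ᵤ⇒∣ (ℕD.∣-trans ℓ∣ (gcd[m,n]∣n (abs u) (abs w)))
    decide : Dec (gcd (abs u) (abs w) ≡ 1) → PrimitivePoint P Q
    decide (yes g≡1) = coprime-triple {u} {y} {w} e w≢0 2∤w (cop-∣ˡ m∣∣m∣ (cop-∣ʳ m∣∣m∣ (coprime⇒Cop (ℕC.gcd≡1⇒coprime g≡1))))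
    decide (no g≢1)  = reduce (prime-divisor (gcd (abs u) (abs w)) g≢1)

   -- An even w is made odd by reflecting the point in (1 , 0 , 1).
   odd-part : ∀ {u y w} → P * (u * u) + Q * (y * y) ≡ w * w → w ≢ 0ℤ → Acc ℕ._<_ (abs w) → PrimitivePoint P Q
   odd-part {u} {y} {w} e w≢0 (acc rs) = decide (+ 2 ∣? w) (+ 2 ∣? u)
    where
    halve : + 2 ∣ u → + 2 ∣ y → + 2 ∣ w → PrimitivePoint P Q
    halve (divides u' u≡) (divides y' y≡) (divides w' w≡) = odd-part {u'} {y'} {w'}
     (divide-conic {u} {y} {w} {u'} {y'} {w'} {+ 2} (λ ()) u≡ y≡ w≡ e) w'≢0
     (rs (subst (λ w → abs w' ℕ.< abs w) (sym w≡) (abs-< w' prime[2] w'≢0)))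
     where
     w'≢0 : w' ≢ 0ℤ
     w'≢0 = factor≢0 {w} {w'} {+ 2} w≢0 w≡
    reflect : ∀ h → P ≡ + 2 * h + 1ℤ → + 2 ∣ w → ¬ + 2 ∣ u → PrimitivePoint P Q
    reflect h p≡ 2∣w 2∤u = primitive-part {h * u - (P * u - w)} {h * y} {h * w - (P * u - w)}
     (eq2 (h * h) ((P * u - w) * (P * u - w)) _ _
      e p≡ (lem P Q u y w h)) (λ z → 2∤w' (subst (+ 2 ∣_) (sym z) (divides 0ℤ refl))) 2∤w' (<-wellFounded _)
     where
     lem : ∀ p q u y w h → p * ((h * u - (p * u - w)) * (h * u - (p * u - w))) + q * (h * y * (h * y)) - (h * w - (p * u - w)) * (h * w - (p * u - w))
       ≡ h * h * (p * (u * u) + q * (y * y) - w * w) + (p * u - w) * (p * u - w) * (p - (+ 2 * h + 1ℤ))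
     lem = ring
     lem2 : ∀ p u w h → h * w + w - (h * w - (p * u - w)) ≡ p * u
     lem2 = ring
     2∤w' : ¬ + 2 ∣ h * w - (P * u - w)
     2∤w' d = 2∤u (cop-∣ (cop-sym 2∤p) (subst (+ 2 ∣_) (lem2 P u w h) (∣m∣n⇒∣m-n (∣m∣n⇒∣m+n (∣n⇒∣m*n h 2∣w) 2∣w) d)))
    odd-p : ∃ λ h → P ≡ + 2 * h + 1ℤ
    odd-p = shape (P %ℕ 2) (n%ℕd<d P 2) (a≡a%ℕn+[a/ℕn]*n P 2)
     where
     h : ℤ
     h = P /ℕ 2
     shape : ∀ r → r ℕ.< 2 → P ≡ + r + h * + 2 → ∃ λ h → P ≡ + 2 * h + 1ℤ
     shape zero _ e = ⊥-elim (prime∤1 prime[2] (cop-common 2∤p ∣-refl (divides h (trans e (+-identityˡ (h * + 2))))))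
     shape (suc zero) _ e = h , trans e (trans (+-comm 1ℤ (h * + 2)) (cong (λ z → z + 1ℤ) (*-comm h (+ 2))))
     shape (suc (suc r)) (ℕ.s≤s (ℕ.s≤s ())) _
    2∣y : + 2 ∣ w → + 2 ∣ u → + 2 ∣ y
    2∣y 2∣w 2∣u = common-factor {P} {q} {2} {u} {y} {w} prime[2] qr e 2∣u 2∣w
    decide : Dec (+ 2 ∣ w) → Dec (+ 2 ∣ u) → PrimitivePoint P Q
    decide (no 2∤w) _          = primitive-part {u} {y} {w} e w≢0 2∤w (acc rs)
    decide (yes 2∣w) (yes 2∣u) = halve 2∣u (2∣y 2∣w 2∣u) 2∣w
    decide (yes 2∣w) (no 2∤u)  = reflect (proj₁ odd-p) (proj₂ odd-p) 2∣w 2∤u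

  primitive-point : ∀ r s → Q ∣ r * r - P → P ∣ s * s - Q → PrimitivePoint P Q
  primitive-point r s r² s² = from-point (point-exists pr qr p≢q r s r² s²)
   where
   from-point : Point P Q → PrimitivePoint P Q
   from-point (point u y w e w≢0) = odd-part {u} {y} {w} e w≢0 (<-wellFounded (abs w))

-- Class numbers when D is multiplied by p²

module Multiplicity where

 open Counting
 open Forms
 open Reduction
 open Commuting
 open IntegerCoprime
 open Twist
 open Freeness
 open Orbits using (pos≢0)
 open import Data.Nat.Base as ℕ using ()
 open IntegerPrelude

 private
  pick : ∀ {A B : Set} {P : A → Set} {R : A → B → Set} → B → (∀ {x} → P x → ∃ λ y → R x y) → ∀ x → Dec (P x) → B
  pick _ total x (yes px) = proj₁ (total px)
  pick b _     x (no _)   = b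

 choice : ∀ {A B : Set} {P : A → Set} {R : A → B → Set} → B → Decidable P → (∀ {x} → P x → ∃ λ y → R x y) → ∃ λ (f : A → B) → ∀ {x} → P x → R x (f x)
 choice {A} {B} {P} {R} b P? total = (λ x → pick {R = R} b total x (P? x)) , λ {x} px → spec px (P? x)
  where
  spec : ∀ {x} → P x → (d : Dec (P x)) → R x (pick {R = R} b total x d)
  spec px (yes px') = proj₂ (total px')
  spec px (no ¬px)  = ⊥-elim (¬px px)

 private
  abs-square : ∀ t → t * t ≡ + (abs t ℕ.* abs t)
  abs-square (+ n)    = sym (pos-* n n)
  abs-square -[1+ n ] = refl

  small-square : ∀ t → t * t ≤ + 4 → t * t ≡ 0ℤ ⊎ t * t ≡ 1ℤ ⊎ t * t ≡ + 4
  small-square t h = cases (abs t) (abs-square t)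
   where
   cases : ∀ k → t * t ≡ + (k ℕ.* k) → t * t ≡ 0ℤ ⊎ t * t ≡ 1ℤ ⊎ t * t ≡ + 4
   cases 0 e = inj₁ e
   cases 1 e = inj₂ (inj₁ e)
   cases 2 e = inj₂ (inj₂ e)
   cases k@(suc (suc (suc k'))) e = ⊥-elim (contra (ℕP.≤-trans (ℕP.*-mono-≤ 3≤k 3≤k) (drop‿+≤+ (subst (_≤ + 4) e h))))
    where
    3≤k : 3 ℕ.≤ k
    3≤k = ℕ.s≤s (ℕ.s≤s (ℕ.s≤s ℕ.z≤n))
    contra : ¬ 9 ℕ.≤ 4
    contra (ℕ.s≤s (ℕ.s≤s (ℕ.s≤s (ℕ.s≤s ()))))

 -- Forms of discriminant other than -3 x² and -4 x² have no automorphs besides ± I.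
 automorph-trivial : ∀ {D a b c p q r s} → 0ℤ < D → NonSquare D → NonSquare (+ 3 * D) → PosForm D (a , b , c) →
  p * s - q * r ≡ 1ℤ → act (a , b , c) (mat p q r s) ≡ (a , b , c) → q ≡ 0ℤ × r ≡ 0ℤ × p ≡ s
 automorph-trivial {D} {a} {b} {c} {p} {q} {r} {s} 0<D ns ns3 (e , 0<a) d act≡ = finish (r ≟ 0ℤ)
  where
  open Automorph {a} {b} {c} {D} {p} {q} {r} {s} {1ℤ} (λ ()) e d (trans act≡ (sym (1⋆ (a , b , c))))
  t : ℤ
  t = p + s
  lem : ∀ a t D r → a * a * (t * t - + 4 * 1ℤ) - - (D * (r * r)) ≡ D * (r * r) - a * a * (+ 4 - t * t)
  lem = ring
  norm : D * (r * r) ≡ a * a * (+ 4 - t * t)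
  norm = i-j≡0⇒i≡j _ _ (trans (sym (lem a t D r)) (i≡j⇒i-j≡0 trace≡))
  a²>0 : 0ℤ < a * a
  a²>0 = 0<* 0<a 0<a
  t²≤4 : Dec (t * t ≤ + 4) → t * t ≤ + 4
  t²≤4 (yes h) = h
  t²≤4 (no h)  = ⊥-elim (<-irrefl refl (<-≤-trans (0<* a²>0 (<⇒0<- (≰⇒> h))) (≤-trans (≤-reflexive (lem2 a (t * t)))
   (≤-trans (neg-mono-≤ (≤-trans (0≤* (<⇒≤ 0<D) (0≤square r)) (≤-reflexive norm))) ≤-refl))))
   where
   lem2 : ∀ a t² → a * a * (t² - + 4) ≡ - (a * a * (+ 4 - t²))
   lem2 = ring
  r≡0 : r ≢ 0ℤ → t * t ≡ 0ℤ ⊎ t * t ≡ 1ℤ ⊎ t * t ≡ + 4 → ⊥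
  r≡0 r≢0 (inj₁ z) = <-irrefl (sym (ns r (+ 2 * a) (trans norm (trans (cong (λ z → a * a * (+ 4 - z)) z) (lem0 a))))) (0<* {+ 2} (+<+ (ℕ.s≤s ℕ.z≤n)) 0<a)
   where
   lem0 : ∀ a → a * a * (+ 4 - 0ℤ) ≡ + 2 * a * (+ 2 * a)
   lem0 = ring
  r≡0 r≢0 (inj₂ (inj₁ z)) = <-irrefl (sym (ns3 r (+ 3 * a) (trans (lem1 D r) (trans (cong (λ x → + 3 * x) (trans norm (cong (λ z → a * a * (+ 4 - z)) z))) (lem3 a))))) (0<* {+ 3} (+<+ (ℕ.s≤s ℕ.z≤n)) 0<a)
   where
   lem1 : ∀ D r → + 3 * D * (r * r) ≡ + 3 * (D * (r * r))
   lem1 = ring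
   lem3 : ∀ a → + 3 * (a * a * (+ 4 - 1ℤ)) ≡ + 3 * a * (+ 3 * a)
   lem3 = ring
  r≡0 r≢0 (inj₂ (inj₂ z)) = <-irrefl (sym (trans norm (trans (cong (λ z → a * a * (+ 4 - z)) z) (*-zeroʳ (a * a))))) (0<* 0<D (square-pos r≢0))
  a-cancel : ∀ {x} → a * x ≡ 0ℤ → x ≡ 0ℤ
  a-cancel {x} e = *-cancelˡ-pos 0<a (trans e (sym (*-zeroʳ a)))
  finish : Dec (r ≡ 0ℤ) → q ≡ 0ℤ × r ≡ 0ℤ × p ≡ s
  finish (no r≢0) = ⊥-elim (r≡0 r≢0 (small-square t (t²≤4 (t * t ≤? + 4))))
  finish (yes r0) = a-cancel (trans aq≡ (trans (cong (λ r → - (c * r)) r0) (cong -_ (*-zeroʳ c)))) , r0 ,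
   sym (i-j≡0⇒i≡j s p (a-cancel (trans (sym br≡) (trans (cong (λ r → b * r) r0) (*-zeroʳ b)))))

 act-scale : ∀ f k p q r s → act f (mat (k * p) (k * q) (k * r) (k * s)) ≡ (k * k) ⋆ act f (mat p q r s)
 act-scale (a , b , c) k p q r s = form-≡ (val a b c k p r) (pol a b c k p q r s) (val a b c k q s)
  where
  val : ∀ a b c k p r → a * (k * p * (k * p)) + b * (k * p * (k * r)) + c * (k * r * (k * r)) ≡ k * k * (a * (p * p) + b * (p * r) + c * (r * r))
  val = ring
  pol : ∀ a b c k p q r s → + 2 * a * (k * p * (k * q)) + b * (k * p * (k * s) + k * r * (k * q)) + + 2 * c * (k * r * (k * s)) ≡ k * k * (+ 2 * a * (p * q) + b * (p * s + r * q) + + 2 * c * (r * s))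
  pol = ring

 PosForm-act : ∀ {D f n} M → 0ℤ < D → n ≢ 0ℤ → det M ≡ n → PosForm D f → PosForm (n * n * D) (act f M)
 PosForm-act {D} {a , b , c} M@(mat p q r s) 0<D n≢0 refl pf =
  disc⇒ {value (a , b , c) p r} {polar (a , b , c) p r q s} {value (a , b , c) q s}
   (trans (disc-act (a , b , c) M) (cong (λ d → det M * det M * d) (⇒disc {a} {b} {c} (proj₁ pf)))) ,
  pos-≈ {D} {a} {b} {c} 0<D n≢0 pf (by M refl refl)

 mat-≡ : ∀ {a b c d a' b' c' d'} → a ≡ a' → b ≡ b' → c ≡ c' → d ≡ d' → mat a b c d ≡ mat a' b' c' d'
 mat-≡ refl refl refl refl = refl

 private
  index-congruent : ∀ J J' P v1 v3 v4 {z} → z ≡ 0ℤ → v1 * v4 - z * P * v3 ≡ 1ℤ → J * v1 + P * v3 - J' * (J * z + v4) ≡ 0ℤ → v1 - J' * z ≡ J * z + v4 → P ∣ J - J'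
  index-congruent J J' P v1 v3 v4 refl d u3 u1 = divides (- (v1 * v3)) (i-j≡0⇒i≡j _ _ (trans (lem J J' P v1 v3 v4)
   (cong₂ _+_ (cong₂ _+_ (vanish (- (J - J')) d) (vanish v1 u3)) (vanish (- (J * v1)) u1))))
   where
   lem : ∀ J J' P v1 v3 v4 → J - J' - - (v1 * v3) * P ≡ (- (J - J')) * (v1 * v4 - 0ℤ * P * v3 - 1ℤ) + v1 * (J * v1 + P * v3 - J' * (J * 0ℤ + v4) - 0ℤ)
     + (- (J * v1)) * (v1 - J' * 0ℤ - (J * 0ℤ + v4))
   lem = ring

 scaled-card : ∀ {P D n} → 0ℤ < P → Card (RedForm D) n → Card (λ f → RedForm (P * P * D) f × P ∣ᶠ f) n
 scaled-card {P} {D} 0<P c = card-image c (P ⋆_) (λ {f} → to {f}) (λ _ _ → ⋆-cancel (pos≢0 0<P)) (λ {f} → onto {f})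
  where
  lem : ∀ P a b c D → + 4 * (P * a * (P * c)) - (P * b * (P * b) + P * P * D) ≡ P * P * (+ 4 * (a * c) - (b * b + D))
  lem = ring
  instance
   posP : Positive P
   posP = positive 0<P
   nonNegP : NonNegative P
   nonNegP = nonNegative (<⇒≤ 0<P)
  to : ∀ {f} → RedForm D f → RedForm (P * P * D) (P ⋆ f) × P ∣ᶠ (P ⋆ f)
  to {a , b , c} ((e , 0<a) , lo , hi , a≤c , eq) = ((eq1 (P * P) _ _ e (lem P a b c D) , 0<* 0<P 0<a) ,
   subst (_< P * b) (sym (neg-distribʳ-* P a)) (*-monoˡ-<-pos P lo) , *-monoˡ-≤-nonNeg P hi , *-monoˡ-≤-nonNeg P a≤c ,
   λ e → 0≤* (<⇒≤ 0<P) (eq (*-cancelˡ-pos 0<P e))) , ∣m⇒∣m*n a ∣-refl , ∣m⇒∣m*n b ∣-refl , ∣m⇒∣m*n c ∣-refl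
  shrink : ∀ {a b c} → RedForm (P * P * D) (P ⋆ (a , b , c)) → RedForm D (a , b , c)
  shrink {a} {b} {c} ((e , 0<a) , lo , hi , a≤c , eq) = (*-cancelˡ-pos (0<* 0<P 0<P) (eq1 1ℤ _ _ e (lem2 P a b c D)) , 0<⇐*ˡ 0<P 0<a) ,
   *-cancelˡ-<-nonNeg P (subst (_< P * b) (neg-distribʳ-* P a) lo) , *-cancelˡ-≤-pos b a P hi , *-cancelˡ-≤-pos a c P a≤c ,
   λ e → *-cancelˡ-≤-pos 0ℤ b P (subst (_≤ P * b) (sym (*-zeroʳ P)) (eq (cong (λ z → P * z) e)))
   where
   lem2 : ∀ P a b c D → P * P * (+ 4 * (a * c)) - P * P * (b * b + D) ≡ 1ℤ * (+ 4 * (P * a * (P * c)) - (P * b * (P * b) + P * P * D))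
   lem2 = ring
  onto : ∀ {f} → RedForm (P * P * D) f × P ∣ᶠ f → ∃ λ g → RedForm D g × P ⋆ g ≡ f
  onto {f} (rf , divides a a≡ , divides b b≡ , divides c c≡) = (a , b , c) , shrink {a} {b} {c} (subst (RedForm (P * P * D)) (sym f≡) rf) , f≡
   where
   f≡ : P ⋆ (a , b , c) ≡ f
   f≡ = form-≡ (trans (*-comm P a) (sym a≡)) (trans (*-comm P b) (sym b≡)) (trans (*-comm P c) (sym c≡))

 -- Overforms of level p: h ∘ [[1 , 0] , [j , p]].
 module Level {p : ℕ} (pr : Prime p) (c2 : Cop (+ 2) (+ p)) {D : ℤ} (0<D : 0ℤ < D) (p∣D : + p ∣ D) (ns : NonSquare D) (ns3 : NonSquare (+ 3 * D)) where

  private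
   P : ℤ
   P = + p
   P≢0 : P ≢ 0ℤ
   P≢0 = prime≢0 pr
   0<P : 0ℤ < P
   0<P = ≤∧≢⇒< (+≤+ ℕ.z≤n) (λ e → P≢0 (sym e))
   instance
    p≢0 : NonZero p
    p≢0 = ℕ.≢-nonZero (λ e → P≢0 (cong +_ e))

  pD : ℤ
  pD = P * P * D

  0<pD : 0ℤ < pD
  0<pD = 0<* (0<* 0<P 0<P) 0<D

  Prim-p : ∀ {f} → ¬ P ∣ᶠ f → Prim P f
  Prim-p {f} ¬d ℓr ℓ∣p d = ¬d (subst (λ ℓ → + ℓ ∣ᶠ f) (prime-∣ ℓr pr ℓ∣p) d)

  Proper : ℤ → Form → Set
  Proper D f = RedForm D f × ¬ P ∣ᶠ f

  private
   proper? : ∀ D f → Dec (Proper D f)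
   proper? D f = redForm? D f ×-dec ¬? (P ∣ᶠ? f)

   W : ℕ → Matrix
   W j = mat 1ℤ 0ℤ (+ j) P

   det-W : ∀ j → det (W j) ≡ P
   det-W j = trans (+-identityʳ (1ℤ * P)) (*-identityˡ P)

   -- One adapted representative per class is fixed once and for all, since the labelling of the p
   -- overforms by j depends on the representative.
   Hat : Form → Form → Set
   Hat f h = f ≈ h × ∃ λ a → ∃ λ b → ∃ λ c → h ≡ (a , b * P , c * P) × Cop (+ 2 * a) P

   abstract
    hats : ∃ λ (hat : Form → Form) → ∀ {f} → Proper D f → Hat f (hat f)
    hats = choice {P = Proper D} {R = Hat} (0ℤ , 0ℤ , 0ℤ) (proper? D) λ {f} (rf , ¬d) → from-adapted (adapted-exists {D} {f} p 0<D (proj₁ rf) c2 (Prim-p ¬d) p∣D)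
     where
     from-adapted : ∀ {f} → Adapted P f → ∃ λ h → Hat f h
     from-adapted (adapted a b c e cop) = (a , b * P , c * P) , e , a , b , c , refl , cop

   hat : Form → Form
   hat = proj₁ hats
   hat-spec : ∀ {f} → Proper D f → Hat f (hat f)
   hat-spec = proj₂ hats

   Over : ℕ × Form → Form → Set
   Over (j , f) g = Proper pD g × act (hat f) (W j) ≈ g

   over-total : ∀ {x} → (proj₁ x ℕ.< p) × Proper D (proj₂ x) → ∃ λ g → Over x g
   over-total {j , f} (_ , rf , ¬d) = go (hat-spec (rf , ¬d))
    where
    go : Hat f (hat f) → ∃ λ g → Over (j , f) g
    go (e , a , b , c , h≡ , cop) = finish (exists-reduced {pD} 0<pD (act (hat f) (W j)) pf)
     where
     pfh : PosForm D (hat f)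
     pfh = PosForm-≈ {D} {f} 0<D (proj₁ rf) e
     pf : PosForm pD (act (hat f) (W j))
     pf = PosForm-act {D} {hat f} (W j) 0<D P≢0 (det-W j) pfh
     ¬div : ¬ P ∣ᶠ act (hat f) (W j)
     ¬div d = prime∤1 pr (cop-common cop (∣n⇒∣m*n (+ 2) (p∣a (proj₁ (subst (λ h → P ∣ᶠ act h (W j)) h≡ d)))) ∣-refl)
      where
      lem : ∀ a b c j P → a * (1ℤ * 1ℤ) + b * P * (1ℤ * j) + c * P * (j * j) - (b * j + c * (j * j)) * P ≡ a
      lem = ring
      p∣a : P ∣ a * (1ℤ * 1ℤ) + b * P * (1ℤ * + j) + c * P * (+ j * + j) → P ∣ a
      p∣a d = subst (P ∣_) (lem a b c (+ j) P) (∣m∣n⇒∣m-n d (divides (b * + j + c * (+ j * + j)) refl))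
     finish : (∃ λ g → act (hat f) (W j) ≈ g × RedForm pD g) → ∃ λ g → Over (j , f) g
     finish (g , e' , rg) = g , (rg , λ d → ¬div (∣ᶠ-≈ (≈-sym e') d)) , e'

   abstract
    overs : ∃ λ (over : ℕ × Form → Form) → ∀ {x} → (proj₁ x ℕ.< p) × Proper D (proj₂ x) → Over x (over x)
    overs = choice {P = λ x → (proj₁ x ℕ.< p) × Proper D (proj₂ x)} {R = Over} (0ℤ , 0ℤ , 0ℤ) (λ x → (proj₁ x ℕP.<? p) ×-dec proper? D (proj₂ x)) over-total

   -- An equivalence between overforms of h and h′ comes from an equivalence U of h and h′.
   descend : ∀ {h h' a b c a' b' c'} j j' → h ≡ (a , b * P , c * P) → Cop (+ 2 * a) P → h' ≡ (a' , b' * P , c' * P) → act h (W j) ≈ act h' (W j') →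
    ∃ λ U → det U ≡ 1ℤ × act h U ≡ h' × (Matrix.q U ≡ 0ℤ → Matrix.r U ≡ 0ℤ → Matrix.p U ≡ Matrix.s U → P ∣ + j - + j')
   descend {h} {h'} {a} {b} {c} {a'} {b'} {c'} j j' refl cop refl (by (mat v1 v2 v3 v4) d e) = build (column-∣ {P} {a} {b} {c} {v2} {J * v2 + P * v4} {P * P * c'} cop (prime-radical pr) third)
    where
    J J' : ℤ
    J = + j
    J' = + j'
    M : Matrix
    M = mat v1 v2 (J * v1 + P * v3) (J * v2 + P * v4)
    M≡ : W j ·ᵐ mat v1 v2 v3 v4 ≡ M
    M≡ = cong₂ (λ x y → mat x y (J * v1 + P * v3) (J * v2 + P * v4)) (lem v1 v3) (lem v2 v4)
     where
     lem : ∀ x y → 1ℤ * x + 0ℤ * y ≡ x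
     lem = ring
    eM : act h M ≡ act h' (W j')
    eM = trans (cong (act h) (sym M≡)) (trans (sym (act-· h (W j) (mat v1 v2 v3 v4))) e)
    third : a * (v2 * v2) + b * P * (v2 * (J * v2 + P * v4)) + c * P * ((J * v2 + P * v4) * (J * v2 + P * v4)) ≡ P * P * c' * P
    third = trans (cong (λ z → proj₂ (proj₂ z)) eM) (lem a' b' c' P)
     where
     lem : ∀ a b c P → a * (0ℤ * 0ℤ) + b * P * (0ℤ * P) + c * P * (P * P) ≡ P * P * c * P
     lem = ring
    build : P ∣ v2 → ∃ λ U → det U ≡ 1ℤ × act h U ≡ h' × (Matrix.q U ≡ 0ℤ → Matrix.r U ≡ 0ℤ → Matrix.p U ≡ Matrix.s U → P ∣ + j - + j')
    -- U is W_j V W_j'^(-1), which has integer entries because v2 = z P.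
    build (divides z refl) = mat u1 z u3 u4 , det≡ , ⋆-cancel (λ e → P²≢0 e) scaled , read
     where
     P²≢0 : P * P ≢ 0ℤ
     P²≢0 = pos≢0 (0<* 0<P 0<P)
     u1 u3 u4 : ℤ
     u1 = v1 - J' * z
     u3 = J * v1 + P * v3 - J' * (J * z + v4)
     u4 = J * z + v4
     det≡ : u1 * u4 - z * u3 ≡ 1ℤ
     det≡ = eq1 1ℤ _ _ d (lem J J' P v1 v3 v4 z)
      where
      lem : ∀ J J' P v1 v3 v4 z → (v1 - J' * z) * (J * z + v4) - z * (J * v1 + P * v3 - J' * (J * z + v4)) - 1ℤ ≡ 1ℤ * (v1 * v4 - z * P * v3 - 1ℤ)
      lem = ring
     PU : mat (P * u1) (P * z) (P * u3) (P * u4) ≡ M ·ᵐ adj (W j')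
     PU = mat-≡ (lem1 J' P v1 z) (lem2 P v1 z) (lem3 J J' P v1 v3 v4 z) (lem4 J P v1 v3 v4 z)
      where
      lem1 : ∀ J' P v1 z → P * (v1 - J' * z) ≡ v1 * P + z * P * - J'
      lem1 = ring
      lem2 : ∀ P v1 z → P * z ≡ v1 * - 0ℤ + z * P * 1ℤ
      lem2 = ring
      lem3 : ∀ J J' P v1 v3 v4 z → P * (J * v1 + P * v3 - J' * (J * z + v4)) ≡ (J * v1 + P * v3) * P + (J * (z * P) + P * v4) * - J'
      lem3 = ring
      lem4 : ∀ J P v1 v3 v4 z → P * (J * z + v4) ≡ (J * v1 + P * v3) * - 0ℤ + (J * (z * P) + P * v4) * 1ℤ
      lem4 = ring
     scaled : (P * P) ⋆ act h (mat u1 z u3 u4) ≡ (P * P) ⋆ h'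
     scaled = trans (sym (act-scale h P u1 z u3 u4)) (trans (cong (act h) PU) (trans (sym (act-· h M (adj (W j')))) (trans (cong (λ g → act g (adj (W j'))) eM)
      (trans (act-adj h' (W j')) (cong (λ d → (d * d) ⋆ h') (det-W j'))))))
     read : z ≡ 0ℤ → u3 ≡ 0ℤ → u1 ≡ u4 → P ∣ J - J'
     read z0 u30 u1≡ = index-congruent J J' P v1 v3 v4 z0 d u30 u1≡

   over-injective : ∀ {x y} → (proj₁ x ℕ.< p) × Proper D (proj₂ x) → (proj₁ y ℕ.< p) × Proper D (proj₂ y) → proj₁ overs x ≡ proj₁ overs y → x ≡ y
   over-injective {j , f} {j' , f'} (j<p , pf) (j'<p , pf') e = go (hat-spec pf) (hat-spec pf')
    where
    e≈ : act (hat f) (W j) ≈ act (hat f') (W j')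
    e≈ = ≈-trans (subst (act (hat f) (W j) ≈_) e (proj₂ (proj₂ overs {j , f} (j<p , pf)))) (≈-sym (proj₂ (proj₂ overs {j' , f'} (j'<p , pf'))))
    go : Hat f (hat f) → Hat f' (hat f') → (j , f) ≡ (j' , f')
    go (e1 , a , b , c , h≡ , cop) (e2 , a' , b' , c' , h'≡ , _) = finish (descend {hat f} {hat f'} {a} {b} {c} {a'} {b'} {c'} j j' h≡ cop h'≡ e≈)
     where
     finish : (∃ λ U → det U ≡ 1ℤ × act (hat f) U ≡ hat f' × (Matrix.q U ≡ 0ℤ → Matrix.r U ≡ 0ℤ → Matrix.p U ≡ Matrix.s U → P ∣ + j - + j')) → (j , f) ≡ (j' , f')
     finish (U@(mat _ _ _ _) , dU , eU , idx) = cong₂ _,_ (residue-unique j<p j'<p (idx (proj₁ triv) (proj₁ (proj₂ triv)) (proj₂ (proj₂ triv)))) f≡f'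
      where
      f≡f' : f ≡ f'
      f≡f' = reduced-unique {D} {f} {f'} (proj₁ pf) (proj₁ pf') (≈-trans e1 (≈-trans (by U dU eU) (≈-sym e2)))
      triv : Matrix.q U ≡ 0ℤ × Matrix.r U ≡ 0ℤ × Matrix.p U ≡ Matrix.s U
      triv = automorph-trivial {D} {proj₁ (hat f)} {proj₁ (proj₂ (hat f))} {proj₂ (proj₂ (hat f))} 0<D ns ns3 (PosForm-≈ {D} {f} 0<D (proj₁ (proj₁ pf)) e1) dU
       (trans eU (cong hat (sym f≡f')))

   -- The discriminant equation forces an adapted form of level p to be (a, bP, c'P²), the image of
   -- (a, b, c') under diag(1, P). Rewriting (a, b, c') as the chosen representative of its class
   -- turns diag(1, P) into some W_j.
   over-onto : ∀ {g} → Proper pD g → ∃ λ x → ((proj₁ x ℕ.< p) × Proper D (proj₂ x)) × proj₁ overs x ≡ g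
   over-onto {g} (rg , ¬d) = from-adapted (adapted-exists {pD} {g} p 0<pD (proj₁ rg) c2 (Prim-p ¬d) (∣m⇒∣m*n D (∣m⇒∣m*n P ∣-refl)))
    where
    Goal : Set
    Goal = ∃ λ x → ((proj₁ x ℕ.< p) × Proper D (proj₂ x)) × proj₁ overs x ≡ g
    from-adapted : Adapted P g → Goal
    from-adapted (adapted a b c e cop) = with-c p∣c
     where
     pfg : PosForm pD (a , b * P , c * P)
     pfg = PosForm-≈ {pD} {g} 0<pD (proj₁ rg) e
     lem : ∀ a b c P D → P * (+ 2 * (+ 2 * a * c)) - P * ((b * b + D) * P) ≡ 1ℤ * (+ 4 * (a * (c * P)) - (b * P * (b * P) + P * P * D))
     lem = ring
     p∣c : P ∣ c
     p∣c = cop-∣ cop (cop-∣ c2 (divides (b * b + D) (*-cancelˡ-≡ P (+ 2 * (+ 2 * a * c)) ((b * b + D) * P) {{≢-nonZero P≢0}}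
      (eq1 1ℤ _ _ (proj₁ pfg) (lem a b c P D)))))
     with-c : P ∣ c → Goal
     with-c (divides c' c≡) = reduce (exists-reduced {D} 0<D f0 pf0)
      where
      f0 : Form
      f0 = a , b , c'
      lem2 : ∀ a b c' P D → P * P * (+ 4 * (a * c')) - P * P * (b * b + D) ≡ 1ℤ * (+ 4 * (a * (c' * P * P)) - (b * P * (b * P) + P * P * D))
      lem2 = ring
      pf0 : PosForm D f0
      pf0 = *-cancelˡ-≡ (P * P) (+ 4 * (a * c')) (b * b + D) {{≢-nonZero (pos≢0 (0<* 0<P 0<P))}}
       (eq1 1ℤ _ _ (subst (λ c → + 4 * (a * (c * P)) ≡ b * P * (b * P) + P * P * D) c≡ (proj₁ pfg)) (lem2 a b c' P D)) , proj₂ pfg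
      ¬d0 : ¬ P ∣ᶠ f0
      ¬d0 (d , _) = prime∤1 pr (cop-common cop (∣n⇒∣m*n (+ 2) d) ∣-refl)
      reduce : (∃ λ f → f0 ≈ f × RedForm D f) → Goal
      reduce (f , e0 , rf) = place (hat-spec proper)
       where
       proper : Proper D f
       proper = rf , λ d → ¬d0 (∣ᶠ-≈ (≈-sym e0) d)
       place : Hat f (hat f) → Goal
       place (e1 , ah , bh , ch , h≡ , _) = solve-j (≈-trans (≈-sym e1) (≈-sym e0))
        where
        solve-j : hat f ≈ f0 → Goal
        solve-j (by (mat v1 v2 v3 v4) dV eV) = indexed (prime-Cop pr p∤v1)
         where
         p∤v1 : ¬ P ∣ v1
         p∤v1 d = prime∤1 pr (cop-common cop (∣n⇒∣m*n (+ 2) (subst (P ∣_) (cong proj₁ (trans (cong (λ h → act h (mat v1 v2 v3 v4)) (sym h≡)) eV))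
          (∣m∣n⇒∣m+n (∣m∣n⇒∣m+n (∣n⇒∣m*n ah (∣m⇒∣m*n v1 d)) (∣m⇒∣m*n (v1 * v3) (divides bh refl))) (∣m⇒∣m*n (v3 * v3) (divides ch refl))))) ∣-refl)
         indexed : Cop v1 P → Goal
         indexed (bezout x y exy) = (j , f) , (j<p , proper) , reduced-unique {pD} {proj₁ overs (j , f)} {g} (proj₁ (proj₁ ov)) rg
           (≈-trans (≈-sym (proj₂ ov)) (≈-trans (by (mat v1 (v2 * P) z (v4 - + j * v2)) det≡ acted) (≈-sym e)))
          where
          -- x inverts v1 modulo p, so j is the residue of v3/v1.
          j : ℕ
          j = (v3 * x) %ℕ p
          k z : ℤ
          k = (v3 * x) /ℕ p
          z = v3 * y + k * v1
          j<p : j ℕ.< p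
          j<p = n%ℕd<d (v3 * x) p
          ej : v3 * x ≡ + j + k * P
          ej = a≡a%ℕn+[a/ℕn]*n (v3 * x) p
          ov : Over (j , f) (proj₁ overs (j , f))
          ov = proj₂ overs {j , f} (j<p , proper)
          lower : + j * v1 + P * z ≡ v3
          lower = eq2 v3 (- v1) _ _ exy ej (lem3 (+ j) k v1 v3 x y P)
           where
           lem3 : ∀ j k v1 v3 x y P → j * v1 + P * (v3 * y + k * v1) - v3 ≡ v3 * (v1 * x + P * y - 1ℤ) + (- v1) * (v3 * x - (j + k * P))
           lem3 = ring
          det≡ : v1 * (v4 - + j * v2) - v2 * P * z ≡ 1ℤ
          det≡ = eq2 1ℤ (- v2) _ _ dV lower (lem4 (+ j) z v1 v2 v3 v4 P)
           where
           lem4 : ∀ j z v1 v2 v3 v4 P → v1 * (v4 - j * v2) - v2 * P * z - 1ℤ ≡ 1ℤ * (v1 * v4 - v2 * v3 - 1ℤ) + (- v2) * (j * v1 + P * z - v3)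
           lem4 = ring
          V1 : Matrix
          V1 = mat v1 (v2 * P) z (v4 - + j * v2)
          product≡ : W j ·ᵐ V1 ≡ mat v1 v2 v3 v4 ·ᵐ mat 1ℤ 0ℤ 0ℤ P
          product≡ = mat-≡ (l1 v1 v2 z) (l2 v1 v2 v4 (+ j) P) (trans lower (l3 v3 v4)) (l4 v2 v3 v4 (+ j) P)
           where
           l1 : ∀ v1 v2 z → 1ℤ * v1 + 0ℤ * z ≡ v1 * 1ℤ + v2 * 0ℤ
           l1 = ring
           l2 : ∀ v1 v2 v4 j P → 1ℤ * (v2 * P) + 0ℤ * (v4 - j * v2) ≡ v1 * 0ℤ + v2 * P
           l2 = ring
           l3 : ∀ v3 v4 → v3 ≡ v3 * 1ℤ + v4 * 0ℤ
           l3 = ring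
           l4 : ∀ v2 v3 v4 j P → j * (v2 * P) + P * (v4 - j * v2) ≡ v3 * 0ℤ + v4 * P
           l4 = ring
          acted : act (act (hat f) (W j)) V1 ≡ (a , b * P , c * P)
          acted = trans (act-· (hat f) (W j) V1) (trans (cong (act (hat f)) product≡) (trans (sym (act-· (hat f) (mat v1 v2 v3 v4) (mat 1ℤ 0ℤ 0ℤ P)))
           (trans (cong (λ h → act h (mat 1ℤ 0ℤ 0ℤ P)) eV) (form-≡ (l1 a b c') (l2 a b c' P) (trans (l3 a b c' P) (cong (λ c → c * P) (sym c≡)))))))
           where
           l1 : ∀ a b c → a * (1ℤ * 1ℤ) + b * (1ℤ * 0ℤ) + c * (0ℤ * 0ℤ) ≡ a
           l1 = ring
           l2 : ∀ a b c P → + 2 * a * (1ℤ * 0ℤ) + b * (1ℤ * P + 0ℤ * 0ℤ) + + 2 * c * (0ℤ * P) ≡ b * P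
           l2 = ring
           l3 : ∀ a b c P → a * (0ℤ * 0ℤ) + b * (0ℤ * P) + c * (P * P) ≡ c * P * P
           l3 = ring

  proper-card : ∀ {n} → Card (Proper D) n → Card (Proper pD) (p ℕ.* n)
  proper-card {n} c = subst (Card (Proper pD)) (sumℕ-const p n) (card-image (card-sum p {λ _ → Proper D} {λ _ → n} (λ _ _ → c)) (proj₁ overs)
   (λ {x} px → proj₁ (proj₂ overs {x} px)) over-injective over-onto)

  all-card : ∀ {n y} → Card (RedForm D) n → Card (Proper D) y → Card (RedForm pD) (n ℕ.+ p ℕ.* y)
  all-card c cy = card-⇔ (card-⊎ (scaled-card {P} {D} 0<P c) (proper-card cy) (λ (_ , d) (_ , ¬d) → ¬d d)) (λ { (inj₁ (r , _)) → r ; (inj₂ (r , _)) → r }) (λ {f} r → split r (P ∣ᶠ? f))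
   where
   split : ∀ {f} → RedForm pD f → Dec (P ∣ᶠ f) → (RedForm pD f × P ∣ᶠ f) ⊎ Proper pD f
   split r (yes d) = inj₁ (r , d)
   split r (no ¬d) = inj₂ (r , ¬d)

 geometric : ℕ → ℕ → ℕ
 geometric p zero    = 1
 geometric p (suc k) = geometric p k ℕ.+ p ℕ.^ suc k

 odd-power : ℤ → ℤ → ℕ → ℤ
 odd-power P D zero    = D
 odd-power P D (suc k) = P * P * odd-power P D k

 module _ {p : ℕ} (pr : Prime p) (c2 : Cop (+ 2) (+ p)) {D : ℤ} (0<D : 0ℤ < D) (p∣D : + p ∣ D) (p∥D : ∀ {f} → RedForm D f → ¬ + p ∣ᶠ f) (ns : NonSquare D) (ns3 : NonSquare (+ 3 * D)) where

  private
   P : ℤ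
   P = + p
   Dk : ℕ → ℤ
   Dk = odd-power P D
   positive-D : ∀ k → 0ℤ < Dk k
   positive-D zero    = 0<D
   positive-D (suc k) = 0<* (square-pos (prime≢0 pr)) (positive-D k)
   divides-D : ∀ k → P ∣ Dk k
   divides-D zero    = p∣D
   divides-D (suc k) = ∣n⇒∣m*n (P * P) (divides-D k)
   nonsquare-D : ∀ k → NonSquare (Dk k)
   nonsquare-D zero    = ns
   nonsquare-D (suc k) = nonSquare-scale P (nonsquare-D k)
   nonsquare-3D : ∀ k → NonSquare (+ 3 * Dk k)
   nonsquare-3D zero    = ns3
   nonsquare-3D (suc k) = subst NonSquare (lem P (Dk k)) (nonSquare-scale P (nonsquare-3D k))
    where
    lem : ∀ P D → P * P * (+ 3 * D) ≡ + 3 * (P * P * D)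
    lem = ring
   module L k = Level pr c2 (positive-D k) (divides-D k) (nonsquare-D k) (nonsquare-3D k)

   proper-all : ∀ k {n} → Card (RedForm D) n → Card (λ f → RedForm (Dk k) f × ¬ P ∣ᶠ f) (p ℕ.^ k ℕ.* n)
   proper-all zero {n} c = subst (Card _) (sym (ℕP.+-identityʳ n)) (card-⇔ c (λ r → r , p∥D r) proj₁)
   proper-all (suc k) {n} c = subst (Card _) (sym (ℕP.*-assoc p (p ℕ.^ k) n)) (L.proper-card k (proper-all k c))

  -- At level k + 1 the forms divisible by p are p times all forms of level k, and the others lie p
  -- to one over the p^k h forms of level k not divisible by p.
  odd-power-card : ∀ k {n} → Card (RedForm D) n → Card (RedForm (Dk k)) (geometric p k ℕ.* n)
  odd-power-card zero {n} c = subst (Card (RedForm D)) (sym (ℕP.+-identityʳ n)) c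
  odd-power-card (suc k) {n} c = subst (Card _) (trans (cong (geometric p k ℕ.* n ℕ.+_) (sym (ℕP.*-assoc p (p ℕ.^ k) n))) (sym (ℕP.*-distribʳ-+ n (geometric p k) (p ℕ.^ suc k))))
   (L.all-card k (odd-power-card k c) (proper-all k c))

-- The triples counted by `Nσ` compared with reduced forms

module ReducedTriples where

 open Counting
 open import Data.Nat.Base
 open import Data.Nat.Properties
 open import Data.Nat.Divisibility
 open import Data.Nat.DivMod using (_divMod_; result; [m+kn]%n≡m%n; _%_)
 open import Data.Nat.Tactic.RingSolver using () renaming (solve-∀ to ring)
 open import Data.List.Base using (List; []; _∷_; length; filter)
 open import Data.List.Membership.Propositional using (_∈_)
 open import Data.List.Relation.Unary.Any using (here; there)

 Triple : Set
 Triple = ℕ × ℕ × ℕ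

 Disc : ℕ → Triple → Set
 Disc D (a , b , c) = b * b + D ≡ 4 * (a * c)

 -- `Amb` holds the ambiguous reduced forms, each triple of `Gen` stands for the two reduced forms
 -- with middle coefficient b and -b, and `Rep'` is the set of counted triples with the last entry
 -- tripled.
 Amb Gen Rep' : ℕ → Triple → Set
 Amb D t@(a , b , c) = Disc D t × 0 < b × b ≤ a × a ≤ c × (b ≡ a ⊎ a ≡ c)
 Gen D t@(a , b , c) = Disc D t × 0 < b × b < a × a < c
 Rep' D t@(a , b , c) = Disc D t × b < 3 * a × b < c × 3 ∣ c

 private
  disc? : ∀ D → Decidable (Disc D)
  disc? D (a , b , c) = b * b + D ≟ 4 * (a * c)

  bounded : ∀ {D a b c} → Disc D (a , b , c) → 0 < b → b ≤ a → a ≤ c → a < suc D × b < suc D × c < suc D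
  bounded {D} {a} {b} {c} e 0<b b≤a a≤c = s≤s (≤-trans a≤c c≤D) , s≤s (≤-trans b≤a (≤-trans a≤c c≤D)) , s≤s c≤D
   where
   lem : ∀ x → 4 * x ≡ x + 3 * x
   lem = ring
   3ac≤D : 3 * (a * c) ≤ D
   3ac≤D = +-cancelˡ-≤ (a * c) _ _ (≤-trans (≤-reflexive (sym (lem (a * c)))) (≤-trans (≤-reflexive (sym e)) (+-monoˡ-≤ D (*-mono-≤ b≤a (≤-trans b≤a a≤c)))))
   c≤D : c ≤ D
   c≤D = ≤-trans (m≤n*m c a {{>-nonZero (<-≤-trans 0<b b≤a)}}) (≤-trans (m≤n*m (a * c) 3) 3ac≤D)

  box : ∀ {P : Triple → Set} L → Decidable P → (∀ {a b c} → P (a , b , c) → a < L × b < L × c < L) → ∃ (Card P)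
  box L P? bound with card-filter (card-sum L (λ _ _ → card-sum L (λ _ _ → card-< L))) P?
  ... | n , c = n , card-⇔ c proj₂ (λ p → bound p , p)

 amb-card : ∀ D → ∃ (Card (Amb D))
 amb-card D = box (suc D) (λ t@(a , b , c) → disc? D t ×-dec (0 <? b) ×-dec (b ≤? a) ×-dec (a ≤? c) ×-dec ((b ≟ a) ⊎-dec (a ≟ c)))
  (λ { (e , 0<b , b≤a , a≤c , _) → bounded e 0<b b≤a a≤c })

 gen-card : ∀ D → ∃ (Card (Gen D))
 gen-card D = box (suc D) (λ t@(a , b , c) → disc? D t ×-dec (0 <? b) ×-dec (b <? a) ×-dec (a <? c))
  (λ { (e , 0<b , b<a , a<c) → bounded e 0<b (<⇒≤ b<a) (<⇒≤ a<c) })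

 private
  ind : ∀ {A : Set} → Dec A → ℕ
  ind (yes _) = 1
  ind (no _)  = 0

  ind-cong : ∀ {A B : Set} (a? : Dec A) (b? : Dec B) → (A → B) → (B → A) → ind a? ≡ ind b?
  ind-cong (yes _) (yes _) _ _ = refl
  ind-cong (no _)  (no _)  _ _ = refl
  ind-cong (yes a) (no ¬b) f _ = ⊥-elim (¬b (f a))
  ind-cong (no ¬a) (yes b) _ g = ⊥-elim (¬a (g b))

  length-filter-∷ : ∀ {A : Set} {Q : A → Set} (Q? : Decidable Q) x xs → length (filter Q? (x ∷ xs)) ≡ ind (Q? x) + length (filter Q? xs)
  length-filter-∷ Q? x xs with Q? x
  ... | yes _ = refl
  ... | no _  = refl

  double-count : ∀ {A : Set} {Q1 Q2 Q3 Q4 : A → Set} (Q1? : Decidable Q1) (Q2? : Decidable Q2) (Q3? : Decidable Q3) (Q4? : Decidable Q4) xs →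
   (∀ {x} → x ∈ xs → ind (Q1? x) + ind (Q2? x) + ind (Q3? x) + ind (Q4? x) ≡ 2) →
   length (filter Q1? xs) + length (filter Q2? xs) + length (filter Q3? xs) + length (filter Q4? xs) ≡ length xs + length xs
  double-count Q1? Q2? Q3? Q4? [] _ = refl
  double-count Q1? Q2? Q3? Q4? (x ∷ xs) two = trans
   (cong₂ _+_ (cong₂ _+_ (cong₂ _+_ (length-filter-∷ Q1? x xs) (length-filter-∷ Q2? x xs)) (length-filter-∷ Q3? x xs)) (length-filter-∷ Q4? x xs))
   (trans (regroup (ind (Q1? x)) (ind (Q2? x)) (ind (Q3? x)) (ind (Q4? x)) (length (filter Q1? xs)) (length (filter Q2? xs)) (length (filter Q3? xs)) (length (filter Q4? xs)))
   (trans (cong₂ _+_ (two (here refl)) (double-count Q1? Q2? Q3? Q4? xs (two ∘ there))) (cong suc (sym (+-suc (length xs) (length xs))))))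
   where
   regroup : ∀ a b c d e f g h → (a + e) + (b + f) + (c + g) + (d + h) ≡ (a + b + c + d) + (e + f + g + h)
   regroup = ring

  -- A form of discriminant 1 modulo 3 splits over the field of three elements, so it vanishes at
  -- exactly two of the four projective points. With α = δ + β the four numbers are the values at
  -- (1,0), (0,1), (1,1), (1,-1).
  tags : ∀ (δ β γ : Fin 3) → (toℕ β * toℕ β) % 3 ≡ (4 * ((toℕ δ + toℕ β) * toℕ γ) + 1) % 3 →
   ind (3 ∣? (toℕ δ + toℕ β)) + ind (3 ∣? toℕ γ) + ind (3 ∣? (toℕ γ + (toℕ δ + toℕ β + toℕ β))) + ind (3 ∣? (toℕ γ + toℕ δ)) ≡ 2
  tags = from-yes (FinP.all? λ (δ : Fin 3) → FinP.all? λ (β : Fin 3) → FinP.all? λ (γ : Fin 3) → ((toℕ β * toℕ β) % 3 ≟ (4 * ((toℕ δ + toℕ β) * toℕ γ) + 1) % 3) →-dec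
   (ind (3 ∣? (toℕ δ + toℕ β)) + ind (3 ∣? toℕ γ) + ind (3 ∣? (toℕ γ + (toℕ δ + toℕ β + toℕ β))) + ind (3 ∣? (toℕ γ + toℕ δ)) ≟ 2))

  ind-mod : ∀ {x y} k → x ≡ y + k * 3 → ind (3 ∣? x) ≡ ind (3 ∣? y)
  ind-mod {x} {y} k e = ind-cong (3 ∣? x) (3 ∣? y) (λ d → ∣m+n∣m⇒∣n (subst (3 ∣_) (trans e (+-comm y (k * 3))) d) (divides k refl)) (λ d → subst (3 ∣_) (sym e) (∣m∣n⇒∣m+n d (divides k refl)))

  exactly-two : ∀ m δ β γ → β * β + 12 * m ≡ 4 * ((δ + β) * γ) + 1 →
   ind (3 ∣? (δ + β)) + ind (3 ∣? γ) + ind (3 ∣? (γ + (δ + β + β))) + ind (3 ∣? (γ + δ)) ≡ 2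
  exactly-two m δ β γ e with δ divMod 3 | β divMod 3 | γ divMod 3
  ... | result d δ0 refl | result b β0 refl | result c γ0 refl = trans
    (cong₂ _+_ (cong₂ _+_ (cong₂ _+_ (ind-mod (d + b) (l1 (toℕ δ0) (toℕ β0) d b)) (ind-mod c refl))
     (ind-mod (c + (d + b + b)) (l3 (toℕ δ0) (toℕ β0) (toℕ γ0) d b c))) (ind-mod (c + d) (l1 (toℕ γ0) (toℕ δ0) c d)))
    (tags δ0 β0 γ0 (residues (toℕ δ0) (toℕ β0) (toℕ γ0) e))
   where
   l1 : ∀ x y d b → x + d * 3 + (y + b * 3) ≡ x + y + (d + b) * 3
   l1 = ring
   l3 : ∀ x y z d b c → z + c * 3 + (x + d * 3 + (y + b * 3) + (y + b * 3)) ≡ z + (x + y + y) + (c + (d + b + b)) * 3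
   l3 = ring
   l4 : ∀ y b m → (y + b * 3) * (y + b * 3) + 12 * m ≡ y * y + (2 * y * b + 3 * b * b + 4 * m) * 3
   l4 = ring
   l5 : ∀ x y z d b c → 4 * ((x + d * 3 + (y + b * 3)) * (z + c * 3)) + 1 ≡ 4 * ((x + y) * z) + 1 + 4 * ((x + y) * c + (d + b) * (z + c * 3)) * 3
   l5 = ring
   residues : ∀ x y z → (y + b * 3) * (y + b * 3) + 12 * m ≡ 4 * ((x + d * 3 + (y + b * 3)) * (z + c * 3)) + 1 → (y * y) % 3 ≡ (4 * ((x + y) * z) + 1) % 3
   residues x y z e = trans (sym ([m+kn]%n≡m%n (y * y) (2 * y * b + 3 * b * b + 4 * m) 3))
    (trans (cong (_% 3) (trans (sym (l4 y b m)) (trans e (l5 x y z d b c)))) ([m+kn]%n≡m%n (4 * ((x + y) * z) + 1) (4 * ((x + y) * c + (d + b) * (z + c * 3))) 3))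

  residue-eq : ∀ m x y z a b c → (y + b * 3) * (y + b * 3) + 12 * m ≡ 4 * ((x + a * 3) * (z + c * 3)) + 1 → (y * y) % 3 ≡ (4 * (x * z) + 1) % 3
  residue-eq m x y z a b c e = trans (sym ([m+kn]%n≡m%n (y * y) (2 * y * b + 3 * b * b + 4 * m) 3))
    (trans (cong (_% 3) (trans (sym (l4 y b m)) (trans e (l5 x z a c)))) ([m+kn]%n≡m%n (4 * (x * z) + 1) (4 * (x * c + a * (z + c * 3))) 3))
   where
   l4 : ∀ y b m → (y + b * 3) * (y + b * 3) + 12 * m ≡ y * y + (2 * y * b + 3 * b * b + 4 * m) * 3
   l4 = ring
   l5 : ∀ x z a c → 4 * ((x + a * 3) * (z + c * 3)) + 1 ≡ 4 * (x * z) + 1 + 4 * (x * c + a * (z + c * 3)) * 3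
   l5 = ring

  ambiguous-table1 : ∀ (x z : Fin 3) → (toℕ x * toℕ x) % 3 ≡ (4 * (toℕ x * toℕ z) + 1) % 3 → toℕ z ≡ 0
  ambiguous-table1 = from-yes (FinP.all? λ (x : Fin 3) → FinP.all? λ (z : Fin 3) → ((toℕ x * toℕ x) % 3 ≟ (4 * (toℕ x * toℕ z) + 1) % 3) →-dec (toℕ z ≟ 0))

  ambiguous-table2 : ∀ (y z : Fin 3) → (toℕ y * toℕ y) % 3 ≡ (4 * (toℕ z * toℕ z) + 1) % 3 → toℕ z ≡ 0
  ambiguous-table2 = from-yes (FinP.all? λ (y : Fin 3) → FinP.all? λ (z : Fin 3) → ((toℕ y * toℕ y) % 3 ≟ (4 * (toℕ z * toℕ z) + 1) % 3) →-dec (toℕ z ≟ 0))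

  ambiguous-3∣ : ∀ m a b c → b ≡ a ⊎ a ≡ c → b * b + 12 * m ≡ 4 * (a * c) + 1 → 3 ∣ c
  ambiguous-3∣ m a .a c (inj₁ refl) e with a divMod 3 | c divMod 3
  ... | result a' a0 refl | result c' c0 refl = divides c' (cong (_+ c' * 3) (ambiguous-table1 a0 c0 (residue-eq m (toℕ a0) (toℕ a0) (toℕ c0) a' a' c' e)))
  ambiguous-3∣ m a b .a (inj₂ refl) e with b divMod 3 | a divMod 3
  ... | result b' b0 refl | result a' a0 refl = divides a' (cong (_+ a' * 3) (ambiguous-table2 b0 a0 (residue-eq m (toℕ a0) (toℕ b0) (toℕ a0) a' b' a' e)))

  not-equal : ∀ m a → a * a + 12 * m ≢ 4 * (a * a) + 1
  not-equal m a e = 3∤1 (∣m+n∣m⇒∣n (subst (3 ∣_) (sym (+-cancelˡ-≡ (a * a) (a * a * 3 + 1) (4 * m * 3) (trans (sym (lem a)) (trans (sym e) (cong (a * a +_) (lem2 m)))))) (divides (4 * m) refl)) (divides (a * a) refl))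
   where
   lem : ∀ a → 4 * (a * a) + 1 ≡ a * a + (a * a * 3 + 1)
   lem = ring
   lem2 : ∀ m → 12 * m ≡ 4 * m * 3
   lem2 = ring
   3∤1 : ¬ 3 ∣ 1
   3∤1 d with ∣1⇒≡1 d
   ... | ()

  third : Triple → ℕ
  third (a , b , c) = c

  -- Four forms equivalent to (α, β, γ) up to the sign of the middle coefficient, with last
  -- coefficient the value at (1,0), (0,1), (1,1) and (1,-1).
  g1 g2 g3 g4 : Triple → Triple
  g1 (α , β , γ) = γ , β , α
  g2 t = t
  g3 (α , β , γ) = α , α + α + β , γ + (α + β)
  g4 (α , β , γ) = α , α + (α ∸ β) , γ + (α ∸ β)

 module _ {D : ℕ} (m : ℕ) (12m : 12 * m ≡ D + 1) (4∤D : ¬ 4 ∣ D) where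

  private
   two-tags : ∀ {t} → Gen D t → ind (3 ∣? third (g1 t)) + ind (3 ∣? third (g2 t)) + ind (3 ∣? third (g3 t)) + ind (3 ∣? third (g4 t)) ≡ 2
   two-tags {α , β , γ} (e , 0<b , b<a , a<c) = go (α ∸ β) (sym (m∸n+n≡m (<⇒≤ b<a)))
    where
    go : ∀ δ → α ≡ δ + β → ind (3 ∣? α) + ind (3 ∣? γ) + ind (3 ∣? (γ + (α + β))) + ind (3 ∣? (γ + δ)) ≡ 2
    go δ refl = exactly-two m δ β γ (trans (cong (β * β +_) 12m) (trans (sym (+-assoc (β * β) D 1)) (cong (_+ 1) e)))

   E1 E2 E3 E4 : Triple → Set
   E1 t@(a , b , c) = Rep' D t × c < a
   E2 t@(a , b , c) = Rep' D t × b < a × a < c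
   E3 t@(a , b , c) = Rep' D t × a + a < b
   E4 t@(a , b , c) = Rep' D t × a < b × b < a + a

   0<mid : ∀ {a b c} → Disc D (a , b , c) → 0 < b
   0<mid {a} {zero} {c} e = ⊥-elim (4∤D (divides (a * c) (trans e (*-comm 4 (a * c)))))
   0<mid {a} {suc b} {c} e = s≤s z≤n

   triple-≡ : ∀ {a b c a' b' c' : ℕ} → a ≡ a' → b ≡ b' → c ≡ c' → _≡_ {A = Triple} (a , b , c) (a' , b' , c')
   triple-≡ refl refl refl = refl

   card1 : ∀ {k} → Card (λ t → Gen D t × 3 ∣ third (g1 t)) k → Card E1 k
   card1 c = card-image c g1 to (λ { _ _ refl → refl }) onto
    where
    to : ∀ {t} → Gen D t × 3 ∣ third (g1 t) → E1 (g1 t)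
    to {α , β , γ} ((e , 0<β , β<α , α<γ) , d) = (trans e (cong (4 *_) (*-comm α γ)) , <-≤-trans (<-trans β<α α<γ) (m≤n*m γ 3) , β<α , d) , α<γ
    onto : ∀ {t} → E1 t → ∃ λ s → (Gen D s × 3 ∣ third (g1 s)) × g1 s ≡ t
    onto {a , b , c} ((e , _ , b<c , d) , c<a) = (c , b , a) , ((trans e (cong (4 *_) (*-comm a c)) , 0<mid {a} {b} {c} e , b<c , c<a) , d) , refl

   card2 : ∀ {k} → Card (λ t → Gen D t × 3 ∣ third (g2 t)) k → Card E2 k
   card2 c = card-⇔ c to from
    where
    to : ∀ {t} → Gen D t × 3 ∣ third t → E2 t
    to {α , β , γ} ((e , 0<β , β<α , α<γ) , d) = (e , <-≤-trans β<α (m≤n*m α 3) , <-trans β<α α<γ , d) , β<α , α<γ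
    from : ∀ {t} → E2 t → Gen D t × 3 ∣ third t
    from {a , b , c} ((e , _ , _ , d) , b<a , a<c) = (e , 0<mid {a} {b} {c} e , b<a , a<c) , d

   card3 : ∀ {k} → Card (λ t → Gen D t × 3 ∣ third (g3 t)) k → Card E3 k
   card3 c = card-image c g3 to inj onto
    where
    lem : ∀ α β D → (α + α + β) * (α + α + β) + D ≡ 4 * (α * (α + β)) + (β * β + D)
    lem = ring
    lem2 : ∀ α β γ → 4 * (α * (α + β)) + 4 * (α * γ) ≡ 4 * (α * (γ + (α + β)))
    lem2 = ring
    lem3 : ∀ α → α + α + α ≡ 3 * α
    lem3 = ring
    lem4 : ∀ α β e → α + suc e + (α + β) ≡ α + α + β + suc e
    lem4 = ring
    lem5 : ∀ α β γ → α + (α + β) ≡ α + α + β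
    lem5 = ring
    to : ∀ {t} → Gen D t × 3 ∣ third (g3 t) → E3 (g3 t)
    to {α , β , γ} ((e , 0<β , β<α , α<γ) , d) = (trans (lem α β D) (trans (cong (4 * (α * (α + β)) +_) e) (lem2 α β γ)) ,
     <-≤-trans (+-monoʳ-< (α + α) β<α) (≤-reflexive (lem3 α)) , subst (_< γ + (α + β)) (lem5 α β γ) (+-monoˡ-< (α + β) α<γ) , d) , m<m+n (α + α) 0<β
    inj : ∀ {s t} → Gen D s × 3 ∣ third (g3 s) → Gen D t × 3 ∣ third (g3 t) → g3 s ≡ g3 t → s ≡ t
    inj {α , β , γ} {α' , β' , γ'} _ _ e with cong proj₁ e
    ... | refl with +-cancelˡ-≡ (α + α) β β' (cong (proj₁ ∘ proj₂) e)
    ... | refl with +-cancelʳ-≡ (α + β) γ γ' (cong (proj₂ ∘ proj₂) e)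
    ... | refl = refl
    onto : ∀ {t} → E3 t → ∃ λ s → (Gen D s × 3 ∣ third (g3 s)) × g3 s ≡ t
    onto {a , b , c} ((e , b<3a , b<c , d) , 2a<b) = build (b ∸ (a + a)) (c ∸ suc b) (sym (m+[n∸m]≡n (<⇒≤ 2a<b))) (trans (sym (m+[n∸m]≡n b<c)) (sym (+-suc b (c ∸ suc b))))
     where
     build : ∀ β k → b ≡ a + a + β → c ≡ b + suc k → ∃ λ s → (Gen D s × 3 ∣ third (g3 s)) × g3 s ≡ (a , b , c)
     build β k refl refl = (a , β , a + suc k) ,
      ((+-cancelˡ-≡ (4 * (a * (a + β))) _ _ (trans (sym (lem a β D)) (trans e (trans (cong (λ z → 4 * (a * z)) (sym (lem4 a β k))) (sym (lem2 a β (a + suc k)))))) ,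
       +-cancelˡ-< (a + a) 0 β (subst (_< a + a + β) (sym (+-identityʳ (a + a))) 2a<b) ,
       +-cancelˡ-< (a + a) β a (<-≤-trans b<3a (≤-reflexive (sym (lem3 a)))) , m<m+n a (s≤s z≤n)) ,
       subst (3 ∣_) (sym (lem4 a β k)) d) , triple-≡ refl refl (lem4 a β k)

   card4 : ∀ {k} → Card (λ t → Gen D t × 3 ∣ third (g4 t)) k → Card E4 k
   card4 c = card-image c g4 to inj onto
    where
    lem : ∀ δ β γ D → (δ + β + δ) * (δ + β + δ) + D + 4 * ((δ + β) * β) ≡ 4 * ((δ + β) * (δ + β)) + (β * β + D)
    lem = ring
    lem2 : ∀ δ β γ → 4 * ((δ + β) * (δ + β)) + 4 * ((δ + β) * γ) ≡ 4 * ((δ + β) * (γ + δ)) + 4 * ((δ + β) * β)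
    lem2 = ring
    to' : ∀ {α β γ} δ → α ≡ δ + β → Gen D (α , β , γ) → 3 ∣ γ + δ → E4 (α , α + δ , γ + δ)
    to' {α} {β} {γ} δ refl (e , 0<β , β<α , α<γ) d = (+-cancelʳ-≡ (4 * ((δ + β) * β)) _ _ (trans (lem δ β γ D) (trans (cong (4 * ((δ + β) * (δ + β)) +_) e) (lem2 δ β γ))) ,
     <-≤-trans hi (*-monoˡ-≤ α {2} {3} (s≤s (s≤s z≤n))) , +-monoˡ-< δ α<γ , d) , m<m+n α 0<δ , subst (α + δ <_) (cong (α +_) (+-identityʳ α)) hi
     where
     0<δ : 0 < δ
     0<δ = +-cancelʳ-< β 0 δ β<α
     hi : α + δ < 2 * α
     hi = subst (λ z → α + δ < α + z) (sym (+-identityʳ α)) (+-monoʳ-< α (m<m+n δ 0<β))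
    to : ∀ {t} → Gen D t × 3 ∣ third (g4 t) → E4 (g4 t)
    to {α , β , γ} (g@(_ , _ , β<α , _) , d) = to' (α ∸ β) (sym (m∸n+n≡m (<⇒≤ β<α))) g d
    inj : ∀ {s t} → Gen D s × 3 ∣ third (g4 s) → Gen D t × 3 ∣ third (g4 t) → g4 s ≡ g4 t → s ≡ t
    inj {α , β , γ} {α' , β' , γ'} ((_ , _ , β<α , _) , _) ((_ , _ , β'<α' , _) , _) e with cong proj₁ e
    ... | refl with ∸-cancelˡ-≡ (<⇒≤ β<α) (<⇒≤ β'<α') (+-cancelˡ-≡ α _ _ (cong (proj₁ ∘ proj₂) e))
    ... | refl with +-cancelʳ-≡ (α ∸ β) γ γ' (cong (proj₂ ∘ proj₂) e)
    ... | refl = refl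
    lem3 : ∀ δ β e → δ + β + suc e + δ ≡ δ + β + δ + suc e
    lem3 = ring
    onto : ∀ {t} → E4 t → ∃ λ s → (Gen D s × 3 ∣ third (g4 s)) × g4 s ≡ t
    onto {a , b , c} ((e , b<3a , b<c , d) , a<b , b<2a) = build (b ∸ a) (a ∸ (b ∸ a)) (c ∸ suc b) (sym (m+[n∸m]≡n (<⇒≤ a<b))) (sym (m+[n∸m]≡n δ≤a)) (trans (sym (m+[n∸m]≡n b<c)) (sym (+-suc b (c ∸ suc b))))
     where
     δ≤a : b ∸ a ≤ a
     δ≤a = ≤-trans (∸-monoˡ-≤ a (<⇒≤ b<2a)) (≤-reflexive (m+n∸m≡n a a))
     build : ∀ δ β k → b ≡ a + δ → a ≡ δ + β → c ≡ b + suc k → ∃ λ s → (Gen D s × 3 ∣ third (g4 s)) × g4 s ≡ (a , b , c)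
     build δ β k refl refl refl = (δ + β , β , δ + β + suc k) ,
      ((+-cancelˡ-≡ (4 * ((δ + β) * (δ + β))) _ _ (trans (sym (lem δ β (δ + β + suc k) D)) (trans (cong (_+ 4 * ((δ + β) * β)) e)
        (trans (cong (λ z → 4 * ((δ + β) * z) + 4 * ((δ + β) * β)) (sym (lem3 δ β k))) (sym (lem2 δ β (δ + β + suc k)))))) ,
       0<β , m<n+m β 0<δ , m<m+n (δ + β) (s≤s z≤n)) , subst (3 ∣_) (trans (sym (lem3 δ β k)) (cong (δ + β + suc k +_) (sym δ≡))) d) ,
      triple-≡ refl (cong (δ + β +_) δ≡) (trans (cong (δ + β + suc k +_) δ≡) (lem3 δ β k))
      where
      δ≡ : δ + β ∸ β ≡ δ
      δ≡ = m+n∸n≡m δ β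
      0<δ : 0 < δ
      0<δ = +-cancelˡ-< (δ + β) 0 δ (subst (_< δ + β + δ) (sym (+-identityʳ (δ + β))) a<b)
      0<β : 0 < β
      0<β = +-cancelˡ-< (δ + β + δ) 0 β (subst₂ _<_ (sym (+-identityʳ (δ + β + δ))) (sym (+-assoc (δ + β) δ β)) b<2a)

   amb⇒rep : ∀ {t} → Amb D t → Rep' D t
   amb⇒rep {a , b , c} (e , 0<b , b≤a , a≤c , eq) = e , <-≤-trans (m<m+n b 0<b) (≤-trans (+-mono-≤ b≤a b≤a) (subst (_≤ 3 * a) (cong (a +_) (+-identityʳ a)) (*-monoˡ-≤ a {2} {3} (s≤s (s≤s z≤n))))) , b<c , 3∣c
    where
    e' : b * b + 12 * m ≡ 4 * (a * c) + 1
    e' = trans (cong (b * b +_) 12m) (trans (sym (+-assoc (b * b) D 1)) (cong (_+ 1) e))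
    3∣c : 3 ∣ c
    3∣c = ambiguous-3∣ m a b c eq e'
    b<c : b < c
    b<c = ≤∧≢⇒< (≤-trans b≤a a≤c) λ { refl → contra (≤-antisym b≤a a≤c) refl }
     where
     contra : b ≡ a → b ≡ c → ⊥
     contra refl refl = not-equal m b e'

   -- The regions c < a, b < a < c, 2a < b and a < b < 2a are where g1, g2, g3, g4 land. The
   -- boundaries a = b and a = c are ambiguous, and b = 2a would make D divisible by 4.
   classify : ∀ {t} → Rep' D t → (((E1 t ⊎ E2 t) ⊎ E3 t) ⊎ E4 t) ⊎ Amb D t
   classify {a , b , c} r@(e , b<3a , b<c , _) with c <? a
   ... | yes c<a = inj₁ (inj₁ (inj₁ (inj₁ (r , c<a))))
   ... | no c≮a with <-cmp a b
   ...   | tri≈ _ refl _ = inj₂ (e , 0<mid {a} {b} {c} e , ≤-refl , ≮⇒≥ c≮a , inj₁ refl)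
   ...   | tri> _ _ b<a with m≤n⇒m<n∨m≡n (≮⇒≥ c≮a)
   ...     | inj₁ a<c = inj₁ (inj₁ (inj₁ (inj₂ (r , b<a , a<c))))
   ...     | inj₂ a≡c = inj₂ (e , 0<mid {a} {b} {c} e , <⇒≤ b<a , ≮⇒≥ c≮a , inj₂ a≡c)
   classify {a , b , c} r@(e , b<3a , b<c , _) | no c≮a | tri< a<b _ _ with <-cmp b (a + a)
   ...     | tri< b<2a _ _ = inj₁ (inj₂ (r , a<b , b<2a))
   ...     | tri> _ _ 2a<b = inj₁ (inj₁ (inj₂ (r , 2a<b)))
   ...     | tri≈ _ refl _ = ⊥-elim (4∤D (∣m+n∣m⇒∣n {4} {(a + a) * (a + a)} (subst (4 ∣_) (sym e) (divides (a * c) (*-comm 4 (a * c)))) (divides (a * a) (lem a))))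
    where
    lem : ∀ a → (a + a) * (a + a) ≡ a * a * 4
    lem = ring

   declassify : ∀ {t} → (((E1 t ⊎ E2 t) ⊎ E3 t) ⊎ E4 t) ⊎ Amb D t → Rep' D t
   declassify (inj₁ (inj₁ (inj₁ (inj₁ (r , _))))) = r
   declassify (inj₁ (inj₁ (inj₁ (inj₂ (r , _))))) = r
   declassify (inj₁ (inj₁ (inj₂ (r , _)))) = r
   declassify (inj₁ (inj₂ (r , _))) = r
   declassify (inj₂ amb) = amb⇒rep amb

  -- A generic triple yields exactly the two of its four images with last coefficient divisible by
  -- 3, as many as the reduced forms it stands for. An ambiguous triple already belongs to `Rep'`.
  rep'-card : ∀ {A G} → Card (Amb D) A → Card (Gen D) G → Card (Rep' D) (A + (G + G))
  rep'-card {A} {G} cA cG = subst (Card (Rep' D)) total (card-⇔ union declassify classify)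
   where
   k : (g : Triple → Triple) → ∃ λ k → Card (λ t → Gen D t × 3 ∣ third (g t)) k
   k g = card-filter cG (λ t → 3 ∣? third (g t))
   k1 k2 k3 k4 : ℕ
   k1 = proj₁ (k g1)
   k2 = proj₁ (k g2)
   k3 = proj₁ (k g3)
   k4 = proj₁ (k g4)
   union : Card (λ t → (((E1 t ⊎ E2 t) ⊎ E3 t) ⊎ E4 t) ⊎ Amb D t) (k1 + k2 + k3 + k4 + A)
   union = card-⊎ (card-⊎ (card-⊎ (card-⊎ (card1 (proj₂ (k g1))) (card2 (proj₂ (k g2))) d12) (card3 (proj₂ (k g3))) d3) (card4 (proj₂ (k g4))) d4) cA dA
    where
    d12 : ∀ {t} → E1 t → ¬ E2 t
    d12 (_ , c<a) (_ , _ , a<c) = <-asym c<a a<c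
    d3 : ∀ {t} → E1 t ⊎ E2 t → ¬ E3 t
    d3 {a , b , c} (inj₁ ((_ , _ , b<c , _) , c<a)) (_ , 2a<b) = <-asym (<-trans b<c c<a) (≤-<-trans (m≤m+n a a) 2a<b)
    d3 {a , b , c} (inj₂ (_ , b<a , _)) (_ , 2a<b) = <-asym b<a (≤-<-trans (m≤m+n a a) 2a<b)
    d4 : ∀ {t} → (E1 t ⊎ E2 t) ⊎ E3 t → ¬ E4 t
    d4 (inj₁ (inj₁ ((_ , _ , b<c , _) , c<a))) (_ , a<b , _) = <-asym (<-trans b<c c<a) a<b
    d4 (inj₁ (inj₂ (_ , b<a , _))) (_ , a<b , _) = <-asym b<a a<b
    d4 (inj₂ (_ , 2a<b)) (_ , _ , b<2a) = <-asym 2a<b b<2a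
    dA : ∀ {t} → ((E1 t ⊎ E2 t) ⊎ E3 t) ⊎ E4 t → ¬ Amb D t
    dA (inj₁ (inj₁ (inj₁ (_ , c<a)))) (_ , _ , _ , a≤c , _) = <⇒≱ c<a a≤c
    dA (inj₁ (inj₁ (inj₂ (_ , b<a , a<c)))) (_ , _ , _ , _ , inj₁ refl) = <-irrefl refl b<a
    dA (inj₁ (inj₁ (inj₂ (_ , b<a , a<c)))) (_ , _ , _ , _ , inj₂ refl) = <-irrefl refl a<c
    dA {a , b , c} (inj₁ (inj₂ (_ , 2a<b))) (_ , _ , b≤a , _) = <⇒≱ (≤-<-trans (m≤m+n a a) 2a<b) b≤a
    dA (inj₂ (_ , a<b , _)) (_ , _ , b≤a , _) = <⇒≱ a<b b≤a
   total : k1 + k2 + k3 + k4 + A ≡ A + (G + G)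
   total = trans (+-comm (k1 + k2 + k3 + k4) A) (cong (A +_) (trans
    (double-count (λ t → 3 ∣? third (g1 t)) (λ t → 3 ∣? third (g2 t)) (λ t → 3 ∣? third (g3 t)) (λ t → 3 ∣? third (g4 t)) (Card.elems cG) (λ t∈ → two-tags (Card.sound cG t∈)))
    (cong₂ _+_ (Card.size cG) (Card.size cG))))

-- Reduced integer forms and triples of natural numbers

module Classes where

 open Counting
 open Forms
 open Reduction
 open Orbits using (Ambiguous; ambiguous?)
 open ReducedTriples
 open import Data.Nat.Base as ℕ using (ℕ; zero; suc)
 open import Data.Nat.Tactic.RingSolver using () renaming (solve-∀ to ring)
 open import Data.Integer.Base hiding (suc; NonZero)
 open import Data.Integer.Properties

 private
  embed⁺ embed⁻ : Triple → Form
  embed⁺ (a , b , c) = + a , + b , + c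
  embed⁻ (a , b , c) = + a , - + b , + c

  embed-disc : ∀ a b c D → b ℕ.* b ℕ.+ D ≡ 4 ℕ.* (a ℕ.* c) → + 4 * (+ a * + c) ≡ + b * + b + + D
  embed-disc a b c D e = trans (cong (λ z → + 4 * z) (sym (pos-* a c))) (trans (sym (pos-* 4 (a ℕ.* c))) (trans (cong +_ (sym e)) (trans (pos-+ (b ℕ.* b) D) (cong (λ z → z + + D) (pos-* b b)))))

  extract-disc : ∀ a b c D → + 4 * (+ a * + c) ≡ + b * + b + + D → b ℕ.* b ℕ.+ D ≡ 4 ℕ.* (a ℕ.* c)
  extract-disc a b c D e = +-injective (trans (pos-+ (b ℕ.* b) D) (trans (cong (λ z → z + + D) (pos-* b b)) (trans (sym e) (trans (cong (λ z → + 4 * z) (sym (pos-* a c))) (sym (pos-* 4 (a ℕ.* c)))))))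

  -a<b : ∀ {a b} → 0 ℕ.< b → - + a < + b
  -a<b {a} {b} 0<b = ≤-<-trans (neg-≤-pos {a} {0}) (+<+ 0<b)

  neg-square : ∀ b → b * b ≡ - b * - b
  neg-square b = trans (sym (neg-involutive (b * b))) (trans (cong -_ (neg-distribʳ-* b b)) (neg-distribˡ-* b (- b)))

 module _ (D : ℕ) (4∤D : ¬ 4 ℕD.∣ D) where

  private
   F : Form → Set
   F = RedForm (+ D)

   nonzero-mid : ∀ {a c} → ¬ (+ 4 * (+ a * + c) ≡ + 0 * + 0 + + D)
   nonzero-mid {a} {c} e = 4∤D (ℕD.divides (a ℕ.* c) (trans (extract-disc a 0 c D e) (ℕP.*-comm 4 (a ℕ.* c))))

   embed⁺-injective : ∀ {s t} → embed⁺ s ≡ embed⁺ t → s ≡ t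
   embed⁺-injective refl = refl

   embed⁻-injective : ∀ {s t} → embed⁻ s ≡ embed⁻ t → s ≡ t
   embed⁻-injective {a , b , c} {a' , b' , c'} e with cong proj₁ e | neg-injective (cong (λ z → proj₁ (proj₂ z)) e) | cong (λ z → proj₂ (proj₂ z)) e
   ... | refl | refl | refl = refl

   red⁺ : ∀ {a b c} → Disc D (a , b , c) → 0 ℕ.< b → b ℕ.≤ a → a ℕ.≤ c → F (+ a , + b , + c)
   red⁺ {a} {b} {c} e 0<b b≤a a≤c = (embed-disc a b c D e , +<+ (ℕP.<-≤-trans 0<b b≤a)) , -a<b 0<b , +≤+ b≤a , +≤+ a≤c , λ _ → +≤+ ℕ.z≤n

   red⁻ : ∀ {a b c} → Disc D (a , b , c) → b ℕ.< a → a ℕ.< c → 0 ℕ.< b → F (+ a , - + b , + c)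
   red⁻ {a} {b} {c} e b<a a<c 0<b = (trans (embed-disc a b c D e) (cong (λ z → z + + D) (neg-square (+ b))) , +<+ (ℕP.<-trans 0<b b<a)) , neg-mono-< (+<+ b<a) , neg-≤-pos {b} {a} , +≤+ (ℕP.<⇒≤ a<c) ,
    λ { refl → ⊥-elim (ℕP.<-irrefl refl a<c) }

   PositiveAmb : Form → Set
   PositiveAmb f = F f × Ambiguous f

   amb-forms : ∀ {A} → Card (Amb D) A → Card PositiveAmb A
   amb-forms c = card-image c embed⁺ to (λ _ _ → embed⁺-injective) onto
    where
    to : ∀ {t} → Amb D t → PositiveAmb (embed⁺ t)
    to {a , b , c} (e , 0<b , b≤a , a≤c , inj₁ b≡a) = red⁺ e 0<b b≤a a≤c , inj₁ (cong +_ b≡a)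
    to {a , b , c} (e , 0<b , b≤a , a≤c , inj₂ a≡c) = red⁺ e 0<b b≤a a≤c , inj₂ (cong +_ a≡c)
    positive-mid : ∀ {a b c} → F (a , b , c) → Ambiguous (a , b , c) → 0ℤ ≤ b
    positive-mid ((_ , 0<a) , _) (inj₁ refl) = <⇒≤ 0<a
    positive-mid (_ , _ , _ , _ , 0≤b) (inj₂ a≡c) = 0≤b a≡c
    drop : ∀ {a b c} → + b ≡ + a ⊎ + a ≡ + c → b ≡ a ⊎ a ≡ c
    drop (inj₁ e) = inj₁ (+-injective e)
    drop (inj₂ e) = inj₂ (+-injective e)
    from : ∀ {a b c} → F (+ a , + b , + c) → Ambiguous (+ a , + b , + c) → Amb D (a , b , c)
    from {a} {zero} {c} ((e , _) , _) _ = ⊥-elim (nonzero-mid {a} {c} e)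
    from {a} {b@(suc _)} {c} ((e , _) , _ , +≤+ b≤a , +≤+ a≤c , _) amb = extract-disc a b c D e , ℕ.s≤s ℕ.z≤n , b≤a , a≤c , drop amb
    onto : ∀ {f} → PositiveAmb f → ∃ λ t → Amb D t × embed⁺ t ≡ f
    onto {+ a , + b , + c} (rf , amb) = (a , b , c) , from rf amb , refl
    onto {+ a , + b , -[1+ c ]} ((_ , _ , _ , () , _) , _)
    onto { -[1+ a ] , b , c} (((_ , ()) , _) , _)
    onto {+ a , -[1+ b ] , c} (rf , amb) with positive-mid rf amb
    ... | ()

   gen⁺ : ∀ {G} → Card (Gen D) G → Card (λ f → (F f × ¬ Ambiguous f) × 0ℤ < proj₁ (proj₂ f)) G
   gen⁺ c = card-image c embed⁺ to (λ _ _ → embed⁺-injective) onto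
    where
    to : ∀ {t} → Gen D t → (F (embed⁺ t) × ¬ Ambiguous (embed⁺ t)) × 0ℤ < proj₁ (proj₂ (embed⁺ t))
    to {a , b , c} (e , 0<b , b<a , a<c) = (red⁺ e 0<b (ℕP.<⇒≤ b<a) (ℕP.<⇒≤ a<c) , λ { (inj₁ refl) → ℕP.<-irrefl refl b<a ; (inj₂ refl) → ℕP.<-irrefl refl a<c }) , +<+ 0<b
    onto : ∀ {f} → (F f × ¬ Ambiguous f) × 0ℤ < proj₁ (proj₂ f) → ∃ λ t → Gen D t × embed⁺ t ≡ f
    onto {+ a , + b , + c} ((((e , _) , _ , +≤+ b≤a , +≤+ a≤c , _) , ¬amb) , +<+ 0<b) = (a , b , c) ,
     (extract-disc a b c D e , 0<b , ℕP.≤∧≢⇒< b≤a (λ e → ¬amb (inj₁ (cong +_ e))) , ℕP.≤∧≢⇒< a≤c (λ e → ¬amb (inj₂ (cong +_ e)))) , refl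
    onto {+ a , + b , -[1+ c ]} (((_ , _ , _ , () , _) , _) , _)
    onto { -[1+ a ] , b , c} ((((_ , ()) , _) , _) , _)
    onto {+ a , -[1+ b ] , c} (_ , ())

   gen⁻ : ∀ {G} → Card (Gen D) G → Card (λ f → (F f × ¬ Ambiguous f) × ¬ 0ℤ < proj₁ (proj₂ f)) G
   gen⁻ c = card-image c embed⁻ to (λ _ _ → embed⁻-injective) onto
    where
    neg<0 : ∀ {b} → 0 ℕ.< b → - + b < 0ℤ
    neg<0 {suc b} _ = -<+
    to : ∀ {t} → Gen D t → (F (embed⁻ t) × ¬ Ambiguous (embed⁻ t)) × ¬ 0ℤ < proj₁ (proj₂ (embed⁻ t))
    to {a , b , c} (e , 0<b , b<a , a<c) = (red⁻ e b<a a<c 0<b , λ { (inj₁ eq) → <-irrefl eq (<-≤-trans (neg<0 0<b) (+≤+ ℕ.z≤n)) ; (inj₂ refl) → ℕP.<-irrefl refl a<c }) ,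
     λ 0<-b → <-asym 0<-b (neg<0 0<b)
    onto : ∀ {f} → (F f × ¬ Ambiguous f) × ¬ 0ℤ < proj₁ (proj₂ f) → ∃ λ t → Gen D t × embed⁻ t ≡ f
    onto {+ a , -[1+ b ] , + c} ((((e , _) , lo , _ , +≤+ a≤c , _) , ¬amb) , _) = (a , suc b , c) ,
     (extract-disc a (suc b) c D (trans e (cong (λ z → z + + D) (sym (neg-square (+ suc b))))) , ℕ.s≤s ℕ.z≤n , drop‿+<+ (neg-cancel-< lo) , ℕP.≤∧≢⇒< a≤c (λ e → ¬amb (inj₂ (cong +_ e)))) , refl
    onto {+ a , + zero , + c} ((((e , _) , _) , _) , _) = ⊥-elim (nonzero-mid {a} {c} e)
    onto {+ a , + suc b , c} (_ , ¬0<b) = ⊥-elim (¬0<b (+<+ (ℕ.s≤s ℕ.z≤n)))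
    onto {+ a , b , -[1+ c ]} (((_ , _ , _ , () , _) , _) , _)
    onto { -[1+ a ] , b , c} ((((_ , ()) , _) , _) , _)

  nonambiguous-forms : ∀ {G} → Card (Gen D) G → Card (λ f → F f × ¬ Ambiguous f) (G ℕ.+ G)
  nonambiguous-forms c = card-⇔ (card-⊎ (gen⁺ c) (gen⁻ c) (λ (_ , p) (_ , ¬p) → ¬p p)) (λ { (inj₁ (p , _)) → p ; (inj₂ (p , _)) → p }) split
   where
   split : ∀ {f} → F f × ¬ Ambiguous f → ((F f × ¬ Ambiguous f) × 0ℤ < proj₁ (proj₂ f)) ⊎ ((F f × ¬ Ambiguous f) × ¬ 0ℤ < proj₁ (proj₂ f))
   split {f} p with 0ℤ <? proj₁ (proj₂ f)
   ... | yes q = inj₁ (p , q)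
   ... | no ¬q = inj₂ (p , ¬q)

  forms-card : ∀ {A G} → Card (Amb D) A → Card (Gen D) G → Card (RedForm (+ D)) (A ℕ.+ (G ℕ.+ G))
  forms-card cA cG = card-⇔ (card-⊎ (amb-forms cA) (nonambiguous-forms cG) (λ (_ , p) (_ , ¬p) → ¬p p)) (λ { (inj₁ (p , _)) → p ; (inj₂ (p , _)) → p }) split
   where
   split : ∀ {f} → F f → PositiveAmb f ⊎ (F f × ¬ Ambiguous f)
   split {f} p with ambiguous? f
   ... | yes q = inj₁ (p , q)
   ... | no ¬q = inj₂ (p , ¬q)

 rep⇒rep' : ∀ {D n} m → 12 ℕ.* m ≡ D ℕ.+ 1 →
  Card (λ ((a , b , c) : Triple) → 12 ℕ.* m ℕ.+ b ℕ.* b ≡ 12 ℕ.* (a ℕ.* c) ℕ.+ 1 × b ℕ.< 3 ℕ.* a × b ℕ.< 3 ℕ.* c) n → Card (Rep' D) n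
 rep⇒rep' {D} m 12m c = card-image c (λ (a , b , c) → a , b , c ℕ.* 3) (λ {t} → to {t}) (λ {s} {t} → inj {s} {t}) (λ {t} → onto {t})
  where
  Rep : Triple → Set
  Rep (a , b , c) = 12 ℕ.* m ℕ.+ b ℕ.* b ≡ 12 ℕ.* (a ℕ.* c) ℕ.+ 1 × b ℕ.< 3 ℕ.* a × b ℕ.< 3 ℕ.* c
  lem : ∀ D b → D ℕ.+ 1 ℕ.+ b ℕ.* b ≡ b ℕ.* b ℕ.+ D ℕ.+ 1
  lem = ring
  lem2 : ∀ a c → 12 ℕ.* (a ℕ.* c) ≡ 4 ℕ.* (a ℕ.* (c ℕ.* 3))
  lem2 = ring
  shift : ∀ b → 12 ℕ.* m ℕ.+ b ℕ.* b ≡ b ℕ.* b ℕ.+ D ℕ.+ 1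
  shift b = trans (cong (ℕ._+ b ℕ.* b) 12m) (lem D b)
  to : ∀ {t} → Rep t → Rep' D (proj₁ t , proj₁ (proj₂ t) , proj₂ (proj₂ t) ℕ.* 3)
  to {a , b , c} (e , b<3a , b<3c) = ℕP.+-cancelʳ-≡ 1 _ _ (trans (sym (shift b)) (trans e (cong (ℕ._+ 1) (lem2 a c)))) , b<3a , subst (b ℕ.<_) (ℕP.*-comm 3 c) b<3c , ℕD.divides c refl
  inj : ∀ {s t} → Rep s → Rep t → (proj₁ s , proj₁ (proj₂ s) , proj₂ (proj₂ s) ℕ.* 3) ≡ (proj₁ t , proj₁ (proj₂ t) , proj₂ (proj₂ t) ℕ.* 3) → s ≡ t
  inj {a , b , c} {a' , b' , c'} _ _ e with cong proj₁ e | cong (λ z → proj₁ (proj₂ z)) e | ℕP.*-cancelʳ-≡ c c' 3 (cong (λ z → proj₂ (proj₂ z)) e)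
  ... | refl | refl | refl = refl
  onto : ∀ {t} → Rep' D t → ∃ λ s → Rep s × (proj₁ s , proj₁ (proj₂ s) , proj₂ (proj₂ s) ℕ.* 3) ≡ t
  onto {a , b , .(c ℕ.* 3)} (e , b<3a , b<c , ℕD.divides c refl) = (a , b , c) ,
   (trans (shift b) (trans (cong (ℕ._+ 1) e) (cong (ℕ._+ 1) (sym (lem2 a c)))) , b<3a , subst (b ℕ.<_) (ℕP.*-comm c 3) b<c) , refl

-- Ambiguous forms and factorisations of D

module Divisors where

 open Counting
 open ReducedTriples using (Triple; Amb)
 open import Data.Nat.Base
 open import Data.Nat.Properties
 open import Data.Nat.Divisibility
 open import Data.Nat.DivMod using (_divMod_; result; [m+kn]%n≡m%n; _%_)
 open import Data.Nat.Tactic.RingSolver using () renaming (solve-∀ to ring)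
 open import Data.Product.Base using (swap)
 open import Data.Product.Properties using (≡-dec)

 Ordered Increasing : ℕ → ℕ × ℕ → Set
 Ordered N (x , y) = x * y ≡ N
 Increasing N (x , y) = x * y ≡ N × x < y

 private
  sum-table : ∀ (x y : Fin 4) → (toℕ x * toℕ y) % 4 ≡ 3 → 4 ∣ toℕ x + toℕ y
  sum-table = from-yes (FinP.all? λ (x : Fin 4) → FinP.all? λ (y : Fin 4) → ((toℕ x * toℕ y) % 4 ≟ 3) →-dec (4 ∣? (toℕ x + toℕ y)))

  square-table : ∀ (x : Fin 4) → (toℕ x * toℕ x) % 4 ≢ 3
  square-table = from-yes (FinP.all? λ (x : Fin 4) → ¬? ((toℕ x * toℕ x) % 4 ≟ 3))

  product-mod : ∀ x y a b → ((x + a * 4) * (y + b * 4)) % 4 ≡ (x * y) % 4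
  product-mod x y a b = trans (cong (_% 4) (lem x y a b)) ([m+kn]%n≡m%n (x * y) (x * b + a * (y + b * 4)) 4)
   where
   lem : ∀ x y a b → (x + a * 4) * (y + b * 4) ≡ x * y + (x * b + a * (y + b * 4)) * 4
   lem = ring

  4∣sum : ∀ x y → (x * y) % 4 ≡ 3 → 4 ∣ x + y
  4∣sum x y e with x divMod 4 | y divMod 4
  ... | result a x0 refl | result b y0 refl = subst (4 ∣_) (lem (toℕ x0) (toℕ y0) a b)
    (∣m∣n⇒∣m+n (sum-table x0 y0 (trans (sym (product-mod (toℕ x0) (toℕ y0) a b)) e)) (divides (a + b) refl))
   where
   lem : ∀ x y a b → x + y + (a + b) * 4 ≡ x + a * 4 + (y + b * 4)
   lem = ring

 square-mod-4 : ∀ x → (x * x) % 4 ≢ 3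
 square-mod-4 x e with x divMod 4
 ... | result a x0 refl = square-table x0 (trans (sym (product-mod (toℕ x0) (toℕ x0) a a)) e)

 -- An ambiguous form (a , a , c) corresponds to D = a (4c - a), and (a , b , a) to D = (2a - b)(2a + b).
 amb-factorisations : ∀ {D A} → D % 4 ≡ 3 → Card (Amb D) A → Card (Increasing D) A
 amb-factorisations {D} D%4 c = card-image c ψ (λ {t} → to {t}) (λ {s} {t} → inj {s} {t}) (λ {t} → onto {t})
  where
  ψ' : (a b c : ℕ) → Dec (b ≡ a) → ℕ × ℕ
  ψ' a b c (yes _) = a , 4 * c ∸ a
  ψ' a b c (no _)  = 2 * a ∸ b , 2 * a + b
  ψ : Triple → ℕ × ℕ
  ψ (a , b , c) = ψ' a b c (b ≟ a)
  to' : ∀ a b c (d : Dec (b ≡ a)) → Amb D (a , b , c) → Increasing D (ψ' a b c d)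
  to' a .a c (yes refl) (e , 0<a , _ , a≤c , _) = go (4 * c ∸ a) (sym (m+[n∸m]≡n a≤4c))
   where
   a≤4c : a ≤ 4 * c
   a≤4c = ≤-trans a≤c (m≤n*m c 4)
   lem : ∀ a c → 4 * (a * c) ≡ a * (4 * c)
   lem = ring
   go : ∀ y → 4 * c ≡ a + y → a * y ≡ D × a < y
   go y 4c≡ = +-cancelˡ-≡ (a * a) (a * y) D (trans (sym (*-distribˡ-+ a a y)) (trans (cong (a *_) (sym 4c≡)) (trans (sym (lem a c)) (sym e)))) ,
    +-cancelˡ-< a a y (<-≤-trans (<-≤-trans (+-monoˡ-< a (m<m+n a 0<a)) (≤-reflexive (lem2 a))) (≤-trans (*-monoˡ-≤ a (n≤1+n 3)) (≤-trans (*-monoʳ-≤ 4 a≤c) (≤-reflexive 4c≡))))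
    where
    lem2 : ∀ a → a + a + a ≡ 3 * a
    lem2 = ring
  to' a b c (no b≢a) (_ , _ , _ , _ , inj₁ b≡a) = ⊥-elim (b≢a b≡a)
  to' a b .a (no b≢a) (e , 0<b , b≤a , _ , inj₂ refl) = go (2 * a ∸ b) (sym (m∸n+n≡m (≤-trans b≤a (m≤n*m a 2))))
   where
   lem : ∀ x b → b * b + x * (x + b + b) ≡ (x + b) * (x + b)
   lem = ring
   lem2 : ∀ a → 4 * (a * a) ≡ 2 * a * (2 * a)
   lem2 = ring
   go : ∀ x → 2 * a ≡ x + b → x * (2 * a + b) ≡ D × x < 2 * a + b
   go x 2a≡ = +-cancelˡ-≡ (b * b) _ D (trans (cong (λ z → b * b + x * (z + b)) 2a≡) (trans (lem x b) (trans (cong (λ z → z * z) (sym 2a≡)) (trans (sym (lem2 a)) (sym e))))) ,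
    subst (λ z → x < z + b) (sym 2a≡) (<-≤-trans (m<m+n x 0<b) (m≤m+n (x + b) b))
  to : ∀ {t} → Amb D t → Increasing D (ψ t)
  to {a , b , c} p = to' a b c (b ≟ a) p
  ⊥-mixed : ∀ {a c a' b' c'} → Amb D (a , a , c) → Amb D (a' , b' , c') → b' ≢ a' → (a , 4 * c ∸ a) ≡ (2 * a' ∸ b' , 2 * a' + b') → ⊥
  ⊥-mixed {a} {c} {a'} {b'} (_ , _ , _ , a≤c , _) (_ , _ , b'≤a' , _ , _) b'≢a' e = go (2 * a' ∸ b') (4 * c ∸ a) (sym (m∸n+n≡m (≤-trans b'≤a' (m≤n*m a' 2)))) (sym (m+[n∸m]≡n (≤-trans a≤c (m≤n*m c 4)))) (cong proj₁ e) (cong proj₂ e)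
   where
   lem : ∀ x b → x + b + b + x ≡ x + b + (x + b)
   lem = ring
   lem2 : ∀ a → 2 * a + 2 * a ≡ 4 * a
   lem2 = ring
   go : ∀ x y → 2 * a' ≡ x + b' → 4 * c ≡ a + y → a ≡ x → y ≡ 2 * a' + b' → ⊥
   go x y 2a'≡ 4c≡ refl refl = <-irrefl refl (<-≤-trans x<2a x≥)
    where
    c≡a' : c ≡ a'
    c≡a' = *-cancelˡ-≡ c a' 4 (trans 4c≡ (trans (+-comm x (2 * a' + b')) (trans (cong (λ z → z + b' + x) 2a'≡) (trans (lem x b') (trans (cong₂ _+_ (sym 2a'≡) (sym 2a'≡)) (lem2 a'))))))
    x<2a : 2 * a' < 2 * a' + (a' ∸ b')
    x<2a = m<m+n (2 * a') (m<n⇒0<n∸m (≤∧≢⇒< b'≤a' b'≢a'))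
    x≤a' : x ≤ a'
    x≤a' = subst (x ≤_) c≡a' a≤c
    x≥ : 2 * a' + (a' ∸ b') ≤ 2 * a'
    x≥ = +-cancelʳ-≤ b' _ _ (≤-trans (≤-reflexive (trans (+-assoc (2 * a') (a' ∸ b') b') (cong (2 * a' +_) (m∸n+n≡m b'≤a'))))
     (+-monoʳ-≤ (2 * a') (+-cancelˡ-≤ a' a' b' (≤-trans (≤-reflexive (cong (a' +_) (sym (+-identityʳ a')))) (≤-trans (≤-reflexive 2a'≡) (+-monoˡ-≤ b' x≤a'))))))
  inj' : ∀ a b c a' b' c' (d : Dec (b ≡ a)) (d' : Dec (b' ≡ a')) → Amb D (a , b , c) → Amb D (a' , b' , c') → ψ' a b c d ≡ ψ' a' b' c' d' → _≡_ {A = Triple} (a , b , c) (a' , b' , c')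
  inj' a .a c a' .a' c' (yes refl) (yes refl) (_ , _ , _ , a≤c , _) (_ , _ , _ , a'≤c' , _) e with cong proj₁ e
  ... | refl = cong (λ c → a , a , c) (*-cancelˡ-≡ c c' 4 (∸-cancelʳ-≡ (≤-trans a≤c (m≤n*m c 4)) (≤-trans a'≤c' (m≤n*m c' 4)) (cong proj₂ e)))
  inj' a .a c a' b' c' (yes refl) (no b'≢a') p p' e = ⊥-elim (⊥-mixed p p' b'≢a' e)
  inj' a b c a' .a' c' (no b≢a) (yes refl) p p' e = ⊥-elim (⊥-mixed p' p b≢a (sym e))
  inj' a b c a' b' c' (no b≢a) (no b'≢a') (_ , _ , _ , _ , inj₁ b≡a) _ _ = ⊥-elim (b≢a b≡a)
  inj' a b c a' b' c' (no b≢a) (no b'≢a') (_ , _ , _ , _ , inj₂ _) (_ , _ , _ , _ , inj₁ b'≡a') _ = ⊥-elim (b'≢a' b'≡a')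
  inj' a b .a a' b' .a' (no b≢a) (no b'≢a') (_ , _ , b≤a , _ , inj₂ refl) (_ , _ , b'≤a' , _ , inj₂ refl) e =
   go (2 * a ∸ b) (2 * a' ∸ b') (sym (m∸n+n≡m (≤-trans b≤a (m≤n*m a 2)))) (sym (m∸n+n≡m (≤-trans b'≤a' (m≤n*m a' 2)))) (cong proj₁ e) (cong proj₂ e)
   where
   lem : ∀ a → 4 * a ≡ 2 * a + 2 * a
   lem = ring
   lem2 : ∀ x b y → y + (x + b) ≡ y + b + x
   lem2 = ring
   go : ∀ x x' → 2 * a ≡ x + b → 2 * a' ≡ x' + b' → x ≡ x' → 2 * a + b ≡ 2 * a' + b' → _≡_ {A = Triple} (a , b , a) (a' , b' , a')
   go x .x 2a≡ 2a'≡ refl s≡ with *-cancelˡ-≡ a a' 4 (trans (lem a) (trans (cong (2 * a +_) 2a≡) (trans (lem2 x b (2 * a)) (trans (cong (_+ x) s≡) (trans (sym (lem2 x b' (2 * a'))) (trans (cong (2 * a' +_) (sym 2a'≡)) (sym (lem a'))))))))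
   ... | refl with +-cancelˡ-≡ (2 * a) b b' s≡
   ... | refl = refl
  inj : ∀ {s t} → Amb D s → Amb D t → ψ s ≡ ψ t → s ≡ t
  inj {a , b , c} {a' , b' , c'} = inj' a b c a' b' c' (b ≟ a) (b' ≟ a')
  onto : ∀ {z} → Increasing D z → ∃ λ t → Amb D t × ψ t ≡ z
  onto {x , y} (e , x<y) = with-c (4∣sum x y (trans (cong (_% 4) e) D%4))
   where
   0<x : 0 < x
   0<x = n≢0⇒n>0 λ { refl → case-zero (trans (cong (_% 4) e) D%4) }
    where
    case-zero : 0 ≡ 3 → ⊥
    case-zero ()
   with-c : 4 ∣ x + y → ∃ λ t → Amb D t × ψ t ≡ (x , y)
   -- As x + y = 4c, the factorisation comes from (x, x, c) when 3x ≤ y and from (c, 2c - x, c)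
   -- otherwise.
   with-c (divides c s≡) = decide (3 * x ≤? y)
    where
    4c≡ : 4 * c ≡ x + y
    4c≡ = trans (*-comm 4 c) (sym s≡)
    ψ-yes : ∀ a c (d : Dec (a ≡ a)) → ψ' a a c d ≡ (a , 4 * c ∸ a)
    ψ-yes a c (yes _) = refl
    ψ-yes a c (no ¬p) = ⊥-elim (¬p refl)
    ψ-no : ∀ a b (d : Dec (b ≡ a)) → b ≢ a → ψ' a b a d ≡ (2 * a ∸ b , 2 * a + b)
    ψ-no a b (yes p) ¬p = ⊥-elim (¬p p)
    ψ-no a b (no _) _ = refl
    lem : ∀ x → x + 3 * x ≡ 4 * x
    lem = ring
    lem2 : ∀ x c → x * (4 * c) ≡ 4 * (x * c)
    lem2 = ring
    decide : Dec (3 * x ≤ y) → ∃ λ t → Amb D t × ψ t ≡ (x , y)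
    decide (yes 3x≤y) = (x , x , c) , (trans (cong (x * x +_) (sym e)) (trans (sym (*-distribˡ-+ x x y)) (trans (cong (x *_) (sym 4c≡)) (lem2 x c))) , 0<x , ≤-refl ,
      *-cancelˡ-≤ 4 (≤-trans (≤-reflexive (sym (lem x))) (≤-trans (+-monoʳ-≤ x 3x≤y) (≤-reflexive (sym 4c≡)))) , inj₁ refl) ,
     trans (ψ-yes x c (x ≟ x)) (cong (x ,_) (trans (cong (_∸ x) 4c≡) (m+n∸m≡n x y)))
    decide (no 3x≰y) = middle (2 * c ∸ x) (sym (m+[n∸m]≡n x≤2c))
     where
     lem3 : ∀ c → 4 * c ≡ 2 * (2 * c)
     lem3 = ring
     x<2c : x < 2 * c
     x<2c = *-cancelˡ-< 2 x (2 * c) (subst₂ _<_ (cong (x +_) (sym (+-identityʳ x))) (trans (sym 4c≡) (lem3 c)) (+-monoʳ-< x x<y))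
     x≤2c : x ≤ 2 * c
     x≤2c = <⇒≤ x<2c
     c<x : c < x
     c<x = *-cancelˡ-< 4 c x (≤-<-trans (≤-reflexive 4c≡) (<-≤-trans (+-monoʳ-< x (≰⇒> 3x≰y)) (≤-reflexive (lem x))))
     middle : ∀ b → 2 * c ≡ x + b → ∃ λ t → Amb D t × ψ t ≡ (x , y)
     middle b 2c≡ = (c , b , c) , (disc , 0<b , <⇒≤ b<c , ≤-refl , inj₂ refl) ,
       trans (ψ-no c b (b ≟ c) (<⇒≢ b<c)) (cong₂ _,_ (trans (cong (_∸ b) 2c≡) (m+n∸n≡m x b)) y≡)
      where
      y≡ : 2 * c + b ≡ y
      y≡ = +-cancelˡ-≡ x _ _ (trans (lem4 x b (2 * c)) (trans (cong (2 * c +_) (sym 2c≡)) (trans (lem5 c) 4c≡)))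
       where
       lem4 : ∀ x b z → x + (z + b) ≡ z + (x + b)
       lem4 = ring
       lem5 : ∀ c → 2 * c + 2 * c ≡ 4 * c
       lem5 = ring
      0<b : 0 < b
      0<b = +-cancelˡ-< x 0 b (subst₂ _<_ (sym (+-identityʳ x)) 2c≡ x<2c)
      b<c : b < c
      b<c = +-cancelˡ-< c b c (<-≤-trans (+-monoˡ-< b c<x) (≤-reflexive (trans (sym 2c≡) (cong (c +_) (+-identityʳ c)))))
      disc : b * b + D ≡ 4 * (c * c)
      disc = trans (cong (b * b +_) (trans (sym e) (cong (x *_) (sym y≡)))) (trans (cong (λ z → b * b + x * (z + b)) 2c≡) (trans (lem6 x b) (trans (cong (λ z → z * z) (sym 2c≡)) (lem7 c))))
       where
       lem6 : ∀ x b → b * b + x * (x + b + b) ≡ (x + b) * (x + b)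
       lem6 = ring
       lem7 : ∀ c → 2 * c * (2 * c) ≡ 4 * (c * c)
       lem7 = ring

 -- D is 3 modulo 4, hence not a square, and interchanging the factors is free.
 ordered-card : ∀ {D A} → D % 4 ≡ 3 → Card (Increasing D) A → Card (Ordered D) (A + A)
 ordered-card {D} D%4 c = card-⇔ (card-⊎ c (card-image {Q = λ (x , y) → x * y ≡ D × y < x} c swap (λ { {x , y} (e , lt) → trans (*-comm y x) e , lt }) (λ { {x , y} {x' , y'} _ _ e → cong swap e })
   (λ { {x , y} (e , lt) → (y , x) , (trans (*-comm y x) e , lt) , refl })) (λ (_ , x<y) (_ , y<x) → <-asym x<y y<x))
  (λ { (inj₁ (e , _)) → e ; (inj₂ (e , _)) → e }) (λ {z} → split {z})
  where
  split : ∀ {z} → Ordered D z → Increasing D z ⊎ (proj₁ z * proj₂ z ≡ D × proj₂ z < proj₁ z)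
  split {x , y} e with <-cmp x y
  ... | tri< lt _ _   = inj₁ (e , lt)
  ... | tri> _ _ gt   = inj₂ (e , gt)
  ... | tri≈ _ refl _ = ⊥-elim (square-mod-4 x (trans (cong (_% 4) e) D%4))

 -- p divides exactly one of the two factors.
 ordered-prime : ∀ {p N k} → Prime p → ¬ p ∣ N → Card (Ordered N) k → Card (Ordered (p * N)) (k + k)
 ordered-prime {p} {N} pr p∤N c = card-⇔ (card-⊎ (card-image {Q = λ (x , y) → x * y ≡ p * N × p ∣ x} c (λ (x , y) → p * x , y) (λ {z} → to1 {z}) (λ {s} {t} → inj1' {s} {t}) (λ {z} → onto1 {z}))
   (card-image {Q = λ (x , y) → x * y ≡ p * N × p ∣ y} c (λ (x , y) → x , p * y) (λ {z} → to2 {z}) (λ {s} {t} → inj2' {s} {t}) (λ {z} → onto2 {z})) (λ {z} → disjoint {z}))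
  (λ { (inj₁ (e , _)) → e ; (inj₂ (e , _)) → e }) (λ {z} → split {z})
  where
  instance
   p≢0 : NonZero p
   p≢0 = prime⇒nonZero pr
  to1 : ∀ {z} → Ordered N z → (p * proj₁ z) * proj₂ z ≡ p * N × p ∣ p * proj₁ z
  to1 {x , y} e = trans (*-assoc p x y) (cong (p *_) e) , m∣m*n x
  inj1' : ∀ {s t} → Ordered N s → Ordered N t → (p * proj₁ s , proj₂ s) ≡ (p * proj₁ t , proj₂ t) → s ≡ t
  inj1' {x , y} {x' , y'} _ _ e = cong₂ _,_ (*-cancelˡ-≡ x x' p (cong proj₁ e)) (cong proj₂ e)
  onto1 : ∀ {z} → proj₁ z * proj₂ z ≡ p * N × p ∣ proj₁ z → ∃ λ s → Ordered N s × (p * proj₁ s , proj₂ s) ≡ z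
  onto1 {.(q * p) , y} (e , divides q refl) = (q , y) , *-cancelˡ-≡ (q * y) N p (trans (lem p q y) e) , cong (_, y) (*-comm p q)
   where
   lem : ∀ p q y → p * (q * y) ≡ q * p * y
   lem = ring
  to2 : ∀ {z} → Ordered N z → proj₁ z * (p * proj₂ z) ≡ p * N × p ∣ p * proj₂ z
  to2 {x , y} e = trans (lem p x y) (cong (p *_) e) , m∣m*n y
   where
   lem : ∀ p x y → x * (p * y) ≡ p * (x * y)
   lem = ring
  inj2' : ∀ {s t} → Ordered N s → Ordered N t → (proj₁ s , p * proj₂ s) ≡ (proj₁ t , p * proj₂ t) → s ≡ t
  inj2' {x , y} {x' , y'} _ _ e = cong₂ _,_ (cong proj₁ e) (*-cancelˡ-≡ y y' p (cong proj₂ e))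
  onto2 : ∀ {z} → proj₁ z * proj₂ z ≡ p * N × p ∣ proj₂ z → ∃ λ s → Ordered N s × (proj₁ s , p * proj₂ s) ≡ z
  onto2 {x , .(q * p)} (e , divides q refl) = (x , q) , *-cancelˡ-≡ (x * q) N p (trans (lem p x q) e) , cong (x ,_) (*-comm p q)
   where
   lem : ∀ p x q → p * (x * q) ≡ x * (q * p)
   lem = ring
  disjoint : ∀ {z} → proj₁ z * proj₂ z ≡ p * N × p ∣ proj₁ z → ¬ (proj₁ z * proj₂ z ≡ p * N × p ∣ proj₂ z)
  disjoint {.(x * p) , .(y * p)} (e , divides x refl) (_ , divides y refl) = p∤N (divides (x * y) (*-cancelˡ-≡ N (x * y * p) p (trans (sym e) (lem p x y))))
   where
   lem : ∀ p x y → x * p * (y * p) ≡ p * (x * y * p)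
   lem = ring
  split : ∀ {z} → Ordered (p * N) z → (proj₁ z * proj₂ z ≡ p * N × p ∣ proj₁ z) ⊎ (proj₁ z * proj₂ z ≡ p * N × p ∣ proj₂ z)
  split {x , y} e with euclidsLemma x y pr (subst (p ∣_) (sym e) (m∣m*n N))
  ... | inj₁ d = inj₁ (e , d)
  ... | inj₂ d = inj₂ (e , d)

 private
  square-injective : ∀ {x m} → x * x ≡ m * m → x ≡ m
  square-injective {x} {m} e with <-cmp x m
  ... | tri≈ _ x≡m _ = x≡m
  ... | tri< lt _ _  = ⊥-elim (<-irrefl e (*-mono-< lt lt))
  ... | tri> _ _ gt  = ⊥-elim (<-irrefl (sym e) (*-mono-< gt gt))

 -- Only (m , m) is fixed by swapping the factors of m².
 ordered-square : ∀ m → 0 < m → ∃ λ k → Card (Ordered (m * m)) k × k % 2 ≡ 1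
 ordered-square m 0<m = from-box (card-filter (card-sum (suc (m * m)) (λ _ _ → card-< (suc (m * m)))) (λ (x , y) → x * y ≟ m * m))
  where
  _≟²_ : DecidableEquality (ℕ × ℕ)
  _≟²_ = ≡-dec _≟_ _≟_
  open Involution _≟²_
  0<m² : 0 < m * m
  0<m² = *-mono-< 0<m 0<m
  bound : ∀ {x y} → x * y ≡ m * m → x < suc (m * m) × y < suc (m * m)
  bound {zero} e = ⊥-elim (<-irrefl e 0<m²)
  bound {suc x} {zero} e = ⊥-elim (<-irrefl (trans (sym (*-zeroʳ x)) e) 0<m²)
  bound {suc x} {suc y} e = s≤s (≤-trans (m≤m*n (suc x) (suc y)) (≤-reflexive e)) , s≤s (≤-trans (m≤n*m (suc y) (suc x)) (≤-reflexive e))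
  odd : ∀ {n} → 2 ∣ n → suc n % 2 ≡ 1
  odd (divides q refl) = [m+kn]%n≡m%n 1 q 2
  count : ∀ {k} → Card (Ordered (m * m)) k → k % 2 ≡ 1
  count {zero} c with remove-many _≟²_ c {m , m} refl
  ... | _ , () , _
  count {suc k} c = odd (2∣-free (card-remove _≟²_ c {m , m} refl) swap
   (λ { {x , y} (e , ≢m) → trans (*-comm y x) e , λ { refl → ≢m refl } }) (λ _ → refl)
   (λ { {x , y} (e , ≢m) s → ≢m (diagonal (cong proj₁ s) e) }))
   where
   diagonal : ∀ {x y} → y ≡ x → x * y ≡ m * m → (x , y) ≡ (m , m)
   diagonal {x} refl e = cong (λ x → x , x) (square-injective {x} {m} e)
  from-box : (∃ λ k → Card (λ ((x , y) : ℕ × ℕ) → (x < suc (m * m) × y < suc (m * m)) × x * y ≡ m * m) k) → ∃ λ k → Card (Ordered (m * m)) k × k % 2 ≡ 1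
  from-box (k , c) = k , c' , count c'
   where
   c' : Card (Ordered (m * m)) k
   c' = card-⇔ c proj₂ (λ {z} e → bound {proj₁ z} {proj₂ z} e , e)

-- Classification by primes of odd exponent

module Shapes where

 open import Data.Nat.Base
 open import Data.Nat.Properties
 open import Data.Nat.Divisibility
 open IntegerCoprime using (prime-divisor)
 open import Data.Nat.Tactic.RingSolver using () renaming (solve-∀ to ring)

 -- p^(2k+1) N
 oddPower : ℕ → ℕ → ℕ → ℕ
 oddPower p k N = p ^ k * p ^ k * (p * N)

 -- No, one, two, or at least three primes of odd exponent. In `many` the cofactor M only has to
 -- avoid the three named primes.
 data Shape : ℕ → Set where
  square : ∀ m → Shape (m * m)
  one    : ∀ {p} k m → Prime p → ¬ p ∣ m → Shape (oddPower p k (m * m))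
  two    : ∀ {p q} k l m → Prime p → Prime q → p ≢ q → ¬ p ∣ m → ¬ q ∣ m → Shape (oddPower p k (oddPower q l (m * m)))
  many   : ∀ {p q r} k l j M → Prime p → Prime q → Prime r → p ≢ q → p ≢ r → q ≢ r → ¬ p ∣ M → ¬ q ∣ M → ¬ r ∣ M →
       Shape (oddPower p k (oddPower q l (oddPower r j M)))

 ∤* : ∀ {p x y} → Prime p → ¬ p ∣ x → ¬ p ∣ y → ¬ p ∣ x * y
 ∤* {p} {x} {y} pr p∤x p∤y d with euclidsLemma x y pr d
 ... | inj₁ e = p∤x e
 ... | inj₂ e = p∤y e

 prime-≢⇒∤ : ∀ {p q} → Prime p → Prime q → p ≢ q → ¬ p ∣ q
 prime-≢⇒∤ pr qr p≢q d with prime⇒irreducible qr d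
 ... | inj₁ refl = ¬prime[1] pr
 ... | inj₂ p≡q  = p≢q p≡q

 ∤^ : ∀ {p q} → Prime p → Prime q → p ≢ q → ∀ k → ¬ p ∣ q ^ k
 ∤^ pr qr p≢q zero    d = ¬prime[1] (subst Prime (∣1⇒≡1 d) pr)
 ∤^ pr qr p≢q (suc k) d = ∤* pr (prime-≢⇒∤ pr qr p≢q) (∤^ pr qr p≢q k) d

 ∤oddPower : ∀ {p q N} k → Prime p → Prime q → p ≢ q → ¬ p ∣ N → ¬ p ∣ oddPower q k N
 ∤oddPower {p} {q} {N} k pr qr p≢q p∤N = ∤* pr (∤* pr (∤^ pr qr p≢q k) (∤^ pr qr p≢q k)) (∤* pr (prime-≢⇒∤ pr qr p≢q) p∤N)

 ∣oddPower : ∀ q k N → q ∣ oddPower q k N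
 ∣oddPower q k N = ∣n⇒∣m*n (q ^ k * q ^ k) (m∣m*n N)

 private
  ∣-inside : ∀ q k {d N} → d ∣ N → d ∣ oddPower q k N
  ∣-inside q k d = ∣n⇒∣m*n (q ^ k * q ^ k) (∣n⇒∣m*n q d)

  ≢-from-∤ : ∀ {p q N} → ¬ p ∣ N → q ∣ N → p ≢ q
  ≢-from-∤ p∤N d refl = p∤N d

  ∤square : ∀ {p m} → ¬ p ∣ m * m → ¬ p ∣ m
  ∤square {p} {m} p∤m² d = p∤m² (∣m⇒∣m*n m d)

  shift-square : ∀ s q k N → s * s * oddPower q k N ≡ oddPower q k (s * s * N)
  shift-square s q k N = lem s (q ^ k) q N
   where
   lem : ∀ s t q N → s * s * (t * t * (q * N)) ≡ t * t * (q * (s * s * N))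
   lem = ring

  square-square : ∀ s m → s * s * (m * m) ≡ s * m * (s * m)
  square-square = ring

  absorb : ∀ {p N} k → Prime p → ¬ p ∣ N → Shape N → Shape (p ^ k * p ^ k * N)
  absorb {p} k pr p∤N (square m) = subst Shape (sym (square-square (p ^ k) m)) (square (p ^ k * m))
  absorb {p} k pr p∤N (one {q} j m qr q∤m) = subst Shape (sym (trans (shift-square (p ^ k) q j (m * m)) (cong (oddPower q j) (square-square (p ^ k) m))))
   (one j (p ^ k * m) qr (∤* qr (∤^ qr pr (λ e → p∤N (subst (_∣ oddPower q j (m * m)) e (∣oddPower q j (m * m)))) k) q∤m))
  absorb {p} k pr p∤N (two {q} {r} j l m qr rr q≢r q∤m r∤m) = subst Shape
   (sym (trans (shift-square (p ^ k) q j _) (cong (oddPower q j) (trans (shift-square (p ^ k) r l (m * m)) (cong (oddPower r l) (square-square (p ^ k) m))))))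
   (two j l (p ^ k * m) qr rr q≢r
    (∤* qr (∤^ qr pr (λ e → ≢-from-∤ p∤N (∣oddPower q j _) (sym e)) k) q∤m)
    (∤* rr (∤^ rr pr (λ e → ≢-from-∤ p∤N (∣-inside q j (∣oddPower r l (m * m))) (sym e)) k) r∤m))
  absorb {p} k pr p∤N (many {q} {r} {s} j l i M qr rr sr q≢r q≢s r≢s q∤ r∤ s∤) = subst Shape
   (sym (trans (shift-square (p ^ k) q j _) (cong (oddPower q j) (trans (shift-square (p ^ k) r l _) (cong (oddPower r l) (shift-square (p ^ k) s i M))))))
   (many j l i (p ^ k * p ^ k * M) qr rr sr q≢r q≢s r≢s (inside qr (λ e → ≢-from-∤ p∤N (∣oddPower q j _) (sym e)) q∤)
    (inside rr (λ e → ≢-from-∤ p∤N (∣-inside q j (∣oddPower r l _)) (sym e)) r∤)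
    (inside sr (λ e → ≢-from-∤ p∤N (∣-inside q j (∣-inside r l (∣oddPower s i M))) (sym e)) s∤))
   where
   inside : ∀ {q} → Prime q → q ≢ p → ¬ q ∣ M → ¬ q ∣ p ^ k * p ^ k * M
   inside qr q≢p q∤M = ∤* qr (∤* qr (∤^ qr pr q≢p k) (∤^ qr pr q≢p k)) q∤M

  extend : ∀ {p N} k → Prime p → ¬ p ∣ N → Shape N → Shape (oddPower p k N)
  extend k pr p∤N (square m) = one k m pr (∤square p∤N)
  extend {p} k pr p∤N (one {q} j m qr q∤m) = two k j m pr qr (≢-from-∤ p∤N (∣oddPower q j _)) (λ d → p∤N (∣-inside q j (∣m⇒∣m*n m d))) q∤m
  extend {p} k pr p∤N (two {q} {r} j l m qr rr q≢r q∤m r∤m) = many k j l (m * m) pr qr rr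
   (≢-from-∤ p∤N (∣oddPower q j _)) (≢-from-∤ p∤N (∣-inside q j (∣oddPower r l (m * m)))) q≢r
   (λ d → p∤N (∣-inside q j (∣-inside r l d))) (∤* qr q∤m q∤m) (∤* rr r∤m r∤m)
  extend {p} k pr p∤N (many {q} {r} {s} j l i M qr rr sr q≢r q≢s r≢s q∤ r∤ s∤) = many k j l (oddPower s i M) pr qr rr
   (≢-from-∤ p∤N (∣oddPower q j _)) (≢-from-∤ p∤N (∣-inside q j (∣oddPower r l _))) q≢r
   (λ d → p∤N (∣-inside q j (∣-inside r l d))) (∤oddPower i qr sr q≢s q∤) (∤oddPower i rr sr r≢s r∤)

  data Strip (p N : ℕ) : Set where
   even : ∀ k N' → N ≡ p ^ k * p ^ k * N' → ¬ p ∣ N' → N' ≤ N → Strip p N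
   odd  : ∀ k N' → N ≡ oddPower p k N' → ¬ p ∣ N' → N' < N → Strip p N

  cofactor-< : ∀ {p q N} → Prime p → 0 < N → N ≡ q * p → q < N × 0 < q
  cofactor-< {p} {zero} pr 0<N refl = ⊥-elim (<-irrefl refl 0<N)
  cofactor-< {p} {suc q} pr 0<N refl = m<m*n (suc q) p (nonTrivial⇒n>1 p {{prime⇒nonTrivial pr}}) , s≤s z≤n

  strip : ∀ {p} N → Prime p → 0 < N → Acc _<_ N → Strip p N
  strip {p} N pr 0<N (acc rs) with p ∣? N
  ... | no p∤N = even 0 N (sym (+-identityʳ N)) p∤N ≤-refl
  ... | yes (divides q N≡) = step (cofactor-< pr 0<N N≡)
   where
   lem : ∀ t p N → t * t * N * p ≡ t * t * (p * N)
   lem = ring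
   lem2 : ∀ t p N → t * t * (p * N) * p ≡ p * t * (p * t) * N
   lem2 = ring
   step : q < N × 0 < q → Strip p N
   step (q<N , 0<q) with strip q pr 0<q (rs q<N)
   ... | even k N' q≡ p∤ le = odd k N' (trans N≡ (trans (cong (_* p) q≡) (lem (p ^ k) p N'))) p∤ (≤-<-trans le q<N)
   ... | odd k N' q≡ p∤ lt  = even (suc k) N' (trans N≡ (trans (cong (_* p) q≡) (lem2 (p ^ k) p N'))) p∤ (<⇒≤ (<-trans lt q<N))

 shape : ∀ N → 0 < N → Shape N
 shape N 0<N = go N 0<N (<-wellFounded N)
  where
  go : ∀ N → 0 < N → Acc _<_ N → Shape N
  go N 0<N (acc rs) with N ≟ 1
  ... | yes refl = square 1
  ... | no N≢1 with prime-divisor N N≢1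
  ...   | p , pr , p∣N = finish (strip N pr 0<N (<-wellFounded N))
   where
   positive : ∀ {x N'} → N ≡ x * N' → 0 < N'
   positive {x} {zero} refl = ⊥-elim (<-irrefl (sym (*-zeroʳ x)) 0<N)
   positive {x} {suc _} _ = s≤s z≤n
   finish : Strip p N → Shape N
   finish (odd k N' e p∤ lt) = subst Shape (sym e) (extend k pr p∤ (go N' (positive {p ^ k * p ^ k * p} (trans e (sym (*-assoc (p ^ k * p ^ k) p N')))) (rs lt)))
   finish (even k N' e p∤ le) = subst Shape (sym e) (absorb k pr p∤ (go N' (positive {p ^ k * p ^ k} e) (rs (≤∧≢⇒< le λ N'≡N → p∤ (subst (p ∣_) (sym N'≡N) p∣N)))))

-- Quadratic residues and the Kronecker symbol

module Residues where

 open import Defs using (isSquareMod; kroneckerPrime)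
 open Forms using (eq1)
 open IntegerCoprime using (residue-unique)
 open import Data.Bool.Base using (Bool; true; false; T; if_then_else_)
 open import Data.Nat.Base as ℕ using (_%_; _/_; _≡ᵇ_)
 open import Data.Nat.DivMod using (m≡m%n+[m/n]*n; m%n<n)
 open import Data.List.Base using (upTo)
 open import Data.List.Membership.Propositional.Properties using (∈-upTo⁺)
 open import Data.List.Membership.Propositional using (lose; find)
 open import Data.List.Relation.Unary.Any.Properties using (any⁺; any⁻)
 open IntegerPrelude hiding (_/_; _%_)
 open import Data.Unit.Base using (tt)

 Residue : ℕ → ℕ → Set
 Residue a q = ∃ λ x → + q ∣ x * x - + a

 private
  congruent⇒∣ : ∀ {x y} n .{{_ : NonZero n}} → x % n ≡ y % n → + n ∣ + x - + y
  congruent⇒∣ {x} {y} n e = divides (+ (x / n) - + (y / n)) (trans (cong₂ _-_ (expand x) (trans (expand y) (cong (λ r → + r + + (y / n) * + n) (sym e)))) (lem (+ (x % n)) (+ (x / n)) (+ (y / n)) (+ n)))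
   where
   expand : ∀ x → + x ≡ + (x % n) + + (x / n) * + n
   expand x = trans (cong +_ (m≡m%n+[m/n]*n x n)) (trans (pos-+ (x % n) (x / n ℕ.* n)) (cong (λ z → + (x % n) + z) (pos-* (x / n) n)))
   lem : ∀ r k l n → r + k * n - (r + l * n) ≡ (k - l) * n
   lem = ring

  ∣⇒congruent : ∀ {x y} n .{{_ : NonZero n}} → + n ∣ + x - + y → x % n ≡ y % n
  ∣⇒congruent {x} {y} n d = residue-unique (m%n<n x n) (m%n<n y n) (subst (+ n ∣_) (lem (+ x) (+ y) (+ (x % n)) (+ (y % n)))
    (∣m∣n⇒∣m+n (∣m∣n⇒∣m+n (∣m⇒∣-m (remainder x)) d) (remainder y)))
   where
   lem : ∀ x y r s → - (x - r) + (x - y) + (y - s) ≡ r - s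
   lem = ring
   remainder : ∀ x → + n ∣ + x - + (x % n)
   remainder x = divides (+ (x / n)) (eq1 1ℤ _ _
    (trans (cong +_ (m≡m%n+[m/n]*n x n)) (trans (pos-+ (x % n) (x / n ℕ.* n)) (cong (λ z → + (x % n) + z) (pos-* (x / n) n)))) (lem2 (+ x) (+ (x % n)) (+ (x / n) * + n)))
    where
    lem2 : ∀ x r z → x - r - z ≡ 1ℤ * (x - (r + z))
    lem2 = ring

  T-≡ : ∀ {b} → b ≡ true → T b
  T-≡ refl = tt

  ¬T-≡ : ∀ {b} → b ≡ false → ¬ T b
  ¬T-≡ refl ()

  is-square⇒residue : ∀ a q → isSquareMod a (suc q) ≡ true → Residue a (suc q)
  is-square⇒residue a q e with find (any⁻ (λ x → (x ℕ.* x) % suc q ≡ᵇ a % suc q) (upTo (suc q)) (T-≡ e))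
  ... | x , _ , t = + x , subst (λ z → + suc q ∣ z - + a) (pos-* x x) (congruent⇒∣ {x ℕ.* x} {a} (suc q) (ℕP.≡ᵇ⇒≡ ((x ℕ.* x) % suc q) (a % suc q) t))

  not-square⇒¬residue : ∀ a q → isSquareMod a (suc q) ≡ false → ¬ Residue a (suc q)
  not-square⇒¬residue a q e (x , d) = ¬T-≡ e (any⁺ (λ x → (x ℕ.* x) % suc q ≡ᵇ a % suc q)
    (lose {x = r} (∈-upTo⁺ (n%ℕd<d x (suc q))) (ℕP.≡⇒≡ᵇ ((r ℕ.* r) % suc q) (a % suc q) (∣⇒congruent {r ℕ.* r} {a} (suc q) (subst (λ z → + suc q ∣ z - + a) (sym (pos-* r r)) reduced)))))
   where
   r : ℕ
   r = x %ℕ suc q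
   k : ℤ
   k = x /ℕ suc q
   lem : ∀ x r k q a → (x * x - a) - (x + r) * k * q - (r * r - a) ≡ (x + r) * (x - (r + k * q))
   lem = ring
   reduced : + suc q ∣ + r * + r - + a
   reduced = subst (+ suc q ∣_) (eq1 (x + + r) _ _ (a≡a%ℕn+[a/ℕn]*n x (suc q)) (lem x (+ r) k (+ suc q) (+ a)))
    (∣m∣n⇒∣m-n d (divides ((x + + r) * k) refl))

  symbol-cases : ∀ {b1 b2 b3 X} → b1 ≡ false → (if b1 then X else (if b2 then + 0 else if b3 then + 1 else -[1+ 0 ])) ≡ -[1+ 0 ] → b2 ≡ false × b3 ≡ false
  symbol-cases {b2 = false} {false} refl _ = refl , refl
  symbol-cases {b2 = false} {true} refl ()
  symbol-cases {b2 = true} refl ()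

  symbol-value : ∀ {b1 b2 b3 X} → b1 ≡ false → b2 ≡ false → b3 ≡ false → (if b1 then X else (if b2 then + 0 else if b3 then + 1 else -[1+ 0 ])) ≡ -[1+ 0 ]
  symbol-value refl refl refl = refl

  ≢⇒≡ᵇ-false : ∀ m n → m ≢ n → (m ≡ᵇ n) ≡ false
  ≢⇒≡ᵇ-false m n m≢n with m ≡ᵇ n in e
  ... | false = refl
  ... | true  = ⊥-elim (m≢n (ℕP.≡ᵇ⇒≡ m n (T-≡ e)))

 kronecker⁻ : ∀ {a q} → Prime q → q ≢ 2 → kroneckerPrime a q ≡ -[1+ 0 ] → ¬ Residue a q × ¬ q ℕD.∣ a
 kronecker⁻ {a} {zero} pr = ⊥-elim (¬prime[0] pr)
 kronecker⁻ {a} {suc q} pr q≢2 e with symbol-cases (≢⇒≡ᵇ-false (suc q) 2 q≢2) e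
 ... | e2 , e3 = not-square⇒¬residue a q e3 , λ d → ¬T-≡ e2 (ℕP.≡⇒≡ᵇ (a % suc q) 0 (ℕD.n∣m⇒m%n≡0 a (suc q) d))

 kronecker⁺ : ∀ {a q} → Prime q → q ≢ 2 → ¬ q ℕD.∣ a → Residue a q ⊎ kroneckerPrime a q ≡ -[1+ 0 ]
 kronecker⁺ {a} {zero} pr = ⊥-elim (¬prime[0] pr)
 kronecker⁺ {a} {suc q} pr q≢2 q∤a = decide (isSquareMod a (suc q)) refl
  where
  decide : ∀ b → isSquareMod a (suc q) ≡ b → Residue a (suc q) ⊎ kroneckerPrime a (suc q) ≡ -[1+ 0 ]
  decide true e  = inj₁ (is-square⇒residue a q e)
  decide false e = inj₂ (symbol-value (≢⇒≡ᵇ-false (suc q) 2 q≢2) (≢⇒≡ᵇ-false (a % suc q) 0 (λ z → q∤a (ℕD.m%n≡0⇒n∣m a (suc q) z))) e)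

-- The class number modulo 4

module ClassParity where

 open Counting
 open Forms
 open Reduction
 open IntegerCoprime
 open Twist
 open Freeness
 open Orbits
 open SquareRoot
 open Conic
 open Multiplicity
 open ReducedTriples using (Amb; amb-card; gen-card)
 open Classes using (nonambiguous-forms; forms-card)
 open Divisors
 open Shapes
 open Residues using (Residue)
 open import Data.Nat.Base as ℕ using (_%_; _/_)
 open import Data.Nat.DivMod using (_divMod_; result; [m+kn]%n≡m%n; m≡m%n+[m/n]*n)
 open import Data.Nat.Tactic.RingSolver using () renaming (solve-∀ to solveℕ)
 open IntegerPrelude hiding (_/_; _%_)

 -- The property of 12n - 1 that is kept when a square factor is removed; it makes D prime to 6 and
 -- 3 modulo 4.
 Good : ℕ → Set
 Good D = D % 12 ≡ 11

 private
  good-form : ∀ {D} → Good D → ∃ λ k → D ≡ 11 ℕ.+ k ℕ.* 12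
  good-form {D} g = D / 12 , trans (m≡m%n+[m/n]*n D 12) (cong (ℕ._+ D / 12 ℕ.* 12) g)

  good-∤ : ∀ {D d} → d ℕD.∣ 12 → ¬ d ℕD.∣ 11 → Good D → ¬ d ℕD.∣ D
  good-∤ {D} {d} d∣12 d∤11 g d∣D with good-form {D} g
  ... | k , e = d∤11 (ℕD.∣m+n∣m⇒∣n (subst (d ℕD.∣_) (trans e (ℕP.+-comm 11 (k ℕ.* 12))) d∣D) (ℕD.∣n⇒∣m*n k d∣12))

  2∤ : ∀ {D} → Good D → ¬ 2 ℕD.∣ D
  2∤ {D} = good-∤ {D} (ℕD.divides 6 refl) (from-no (2 ℕD.∣? 11))

  3∤ : ∀ {D} → Good D → ¬ 3 ℕD.∣ D
  3∤ {D} = good-∤ {D} (ℕD.divides 4 refl) (from-no (3 ℕD.∣? 11))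

 good-4∤ : ∀ {D} → Good D → ¬ 4 ℕD.∣ D
 good-4∤ {D} = good-∤ {D} (ℕD.divides 3 refl) (from-no (4 ℕD.∣? 11))

 good-%4 : ∀ {D} → Good D → D % 4 ≡ 3
 good-%4 {D} g with good-form {D} g
 ... | k , refl = trans (cong (_% 4) (lem k)) ([m+kn]%n≡m%n 3 (2 ℕ.+ 3 ℕ.* k) 4)
  where
  lem : ∀ k → 11 ℕ.+ k ℕ.* 12 ≡ 3 ℕ.+ (2 ℕ.+ 3 ℕ.* k) ℕ.* 4
  lem = solveℕ

 private
  5≤-or-small : ∀ {p D} → Good D → Prime p → p ℕD.∣ D → 5 ℕ.≤ p
  5≤-or-small {0} g pr d = ⊥-elim (¬prime[0] pr)
  5≤-or-small {1} g pr d = ⊥-elim (¬prime[1] pr)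
  5≤-or-small {2} {D} g pr d = ⊥-elim (2∤ {D} g d)
  5≤-or-small {3} {D} g pr d = ⊥-elim (3∤ {D} g d)
  5≤-or-small {4} {D} g pr d = ⊥-elim (good-4∤ {D} g d)
  5≤-or-small {suc (suc (suc (suc (suc p))))} g pr d = ℕ.s≤s (ℕ.s≤s (ℕ.s≤s (ℕ.s≤s (ℕ.s≤s ℕ.z≤n))))

  strip-table : ∀ (x d : Fin 12) → (toℕ x ℕ.* toℕ x ℕ.* toℕ d) % 12 ≡ 11 → toℕ d ≡ 11
  strip-table = from-yes (FinP.all? λ (x : Fin 12) → FinP.all? λ (d : Fin 12) → ((toℕ x ℕ.* toℕ x ℕ.* toℕ d) % 12 ℕP.≟ 11) →-dec (toℕ d ℕP.≟ 11))

  square-table4 : ∀ (x d : Fin 4) → (toℕ d ℕ.* (toℕ x ℕ.* toℕ x)) % 4 ≡ 3 → toℕ d ≡ 3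
  square-table4 = from-yes (FinP.all? λ (x : Fin 4) → FinP.all? λ (d : Fin 4) → ((toℕ d ℕ.* (toℕ x ℕ.* toℕ x)) % 4 ℕP.≟ 3) →-dec (toℕ d ℕP.≟ 3))

 good-strip : ∀ {D} t → Good (t ℕ.* t ℕ.* D) → Good D
 good-strip {D} t g with t divMod 12 | D divMod 12
 ... | result a x refl | result b d refl = trans ([m+kn]%n≡m%n (toℕ d) b 12) (trans (small d) (strip-table x d
   (trans (sym ([m+kn]%n≡m%n (toℕ x ℕ.* toℕ x ℕ.* toℕ d) ((2 ℕ.* toℕ x ℕ.* a ℕ.+ 12 ℕ.* a ℕ.* a) ℕ.* (toℕ d ℕ.+ b ℕ.* 12) ℕ.+ toℕ x ℕ.* toℕ x ℕ.* b) 12)) (trans (cong (_% 12) (sym (lem (toℕ x) (toℕ d) a b))) g))))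
  where
  small : ∀ (d : Fin 12) → toℕ d % 12 ≡ toℕ d
  small = from-yes (FinP.all? λ (d : Fin 12) → toℕ d % 12 ℕP.≟ toℕ d)
  lem : ∀ x d a b → (x ℕ.+ a ℕ.* 12) ℕ.* (x ℕ.+ a ℕ.* 12) ℕ.* (d ℕ.+ b ℕ.* 12) ≡ x ℕ.* x ℕ.* d ℕ.+ ((2 ℕ.* x ℕ.* a ℕ.+ 12 ℕ.* a ℕ.* a) ℕ.* (d ℕ.+ b ℕ.* 12) ℕ.+ x ℕ.* x ℕ.* b) ℕ.* 12
  lem = solveℕ

 -- An odd square is 1 modulo 4, so p itself is 3 modulo 4.
 suc-mod-4 : ∀ p m → (p ℕ.* (m ℕ.* m)) % 4 ≡ 3 → 4 ℕD.∣ suc p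
 suc-mod-4 p m e with p divMod 4 | m divMod 4
 ... | result a d refl | result b x refl = ℕD.divides (suc a) (cong (λ d → suc (d ℕ.+ a ℕ.* 4)) (square-table4 x d
   (trans (sym ([m+kn]%n≡m%n (toℕ d ℕ.* (toℕ x ℕ.* toℕ x)) (a ℕ.* ((toℕ x ℕ.+ b ℕ.* 4) ℕ.* (toℕ x ℕ.+ b ℕ.* 4)) ℕ.+ toℕ d ℕ.* (2 ℕ.* toℕ x ℕ.* b ℕ.+ 4 ℕ.* b ℕ.* b)) 4)) (trans (cong (_% 4) (sym (lem (toℕ x) (toℕ d) a b))) e))))
  where
  lem : ∀ x d a b → (d ℕ.+ a ℕ.* 4) ℕ.* ((x ℕ.+ b ℕ.* 4) ℕ.* (x ℕ.+ b ℕ.* 4)) ≡ d ℕ.* (x ℕ.* x) ℕ.+ (a ℕ.* ((x ℕ.+ b ℕ.* 4) ℕ.* (x ℕ.+ b ℕ.* 4)) ℕ.+ d ℕ.* (2 ℕ.* x ℕ.* b ℕ.+ 4 ℕ.* b ℕ.* b)) ℕ.* 4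
  lem = solveℕ

 good-prime : ∀ {p D} → Good D → Prime p → p ℕD.∣ D → + 5 ≤ + p × Cop (+ 2) (+ p) × ¬ 2 ℕD.∣ p
 good-prime {p} {D} g pr p∣D = +≤+ (5≤-or-small {p} {D} g pr p∣D) , cop-sym (prime-Cop prime[2] (λ d → 2∤p (∣⇒∣ᵤ d))) , 2∤p
  where
  2∤p : ¬ 2 ℕD.∣ p
  2∤p d = 2∤ {D} g (ℕD.∣-trans d p∣D)

 -- A form divisible by p has discriminant divisible by p².
 content-free : ∀ {p N f} → Prime p → ¬ + p ∣ N → PosForm (N * + p) f → ¬ + p ∣ᶠ f
 content-free {p} {N} {a , b , c} pr p∤N (e , _) (divides a' a≡ , divides b' b≡ , divides c' c≡) = p∤N (divides (+ 4 * (a' * c') - b' * b')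
  (*-cancelʳ-≡ N ((+ 4 * (a' * c') - b' * b') * + p) (+ p) {{≢-nonZero (prime≢0 pr)}} (i-j≡0⇒i≡j _ _ (trans (lem a b c a' b' c' N (+ p))
   (cong₂ _+_ (cong₂ _+_ (cong₂ _+_ (vanish (- 1ℤ) e) (vanish (+ 4 * c) a≡)) (vanish (+ 4 * (a' * + p)) c≡)) (vanish (- (b + b' * + p)) b≡))))))
  where
  lem : ∀ a b c a' b' c' N P → N * P - (+ 4 * (a' * c') - b' * b') * P * P
    ≡ (- 1ℤ) * (+ 4 * (a * c) - (b * b + N * P)) + + 4 * c * (a - a' * P) + + 4 * (a' * P) * (c - c' * P) + (- (b + b' * P)) * (b - b' * P)
  lem = ring

 prime-part : ∀ {p f} → Prime p → ¬ + p ∣ᶠ f → Prim (+ p) f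
 prime-part {p} {f} pr ¬d ℓr ℓ∣p d = ¬d (subst (λ ℓ → + ℓ ∣ᶠ f) (prime-∣ ℓr pr ℓ∣p) d)

 ∤⇒ℤ∤ : ∀ {p N} → ¬ p ℕD.∣ N → ¬ + p ∣ + N
 ∤⇒ℤ∤ p∤N d = p∤N (∣⇒∣ᵤ d)

 class-count : ∀ {D h} → ¬ 4 ℕD.∣ D → Card (RedForm (+ D)) h → ∃ λ A → ∃ λ G → Card (Amb D) A × Card (λ f → RedForm (+ D) f × ¬ Ambiguous f) (G ℕ.+ G) × h ≡ A ℕ.+ (G ℕ.+ G)
 class-count {D} {h} 4∤D c with amb-card D | gen-card D
 ... | A , cA | G , cG = A , G , cA , nonambiguous-forms D 4∤D cG , card-unique c (forms-card D 4∤D cA cG)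

 class-exists : ∀ {D} → ¬ 4 ℕD.∣ D → ∃ λ h → Card (RedForm (+ D)) h
 class-exists {D} 4∤D with amb-card D | gen-card D
 ... | A , cA | G , cG = A ℕ.+ (G ℕ.+ G) , forms-card D 4∤D cA cG

 private
  double-injective : ∀ {a b} → a ℕ.+ a ≡ b ℕ.+ b → a ≡ b
  double-injective {a} {b} e = ℕP.*-cancelˡ-≡ a b 2 (trans (cong (a ℕ.+_) (ℕP.+-identityʳ a)) (trans e (cong (b ℕ.+_) (sym (ℕP.+-identityʳ b)))))

  odd+even : ∀ {k} G → k % 2 ≡ 1 → (k ℕ.+ (G ℕ.+ G)) % 2 ≡ 1
  odd+even {k} G e = trans (cong (λ z → (k ℕ.+ z) % 2) (lem G)) (trans ([m+kn]%n≡m%n k G 2) e)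
   where
   lem : ∀ G → G ℕ.+ G ≡ G ℕ.* 2
   lem = solveℕ

  twice-odd : ∀ {k z} → k % 2 ≡ 1 → 4 ℕD.∣ z → (k ℕ.+ k ℕ.+ z) % 4 ≡ 2
  twice-odd {k} e (ℕD.divides q refl) = trans (cong (λ k → (k ℕ.+ k ℕ.+ q ℕ.* 4) % 4) k≡) (trans (cong (_% 4) (lem (k / 2) q)) ([m+kn]%n≡m%n 2 (k / 2 ℕ.+ q) 4))
   where
   k≡ : k ≡ 1 ℕ.+ k / 2 ℕ.* 2
   k≡ = trans (m≡m%n+[m/n]*n k 2) (cong (ℕ._+ k / 2 ℕ.* 2) e)
   lem : ∀ j q → (1 ℕ.+ j ℕ.* 2) ℕ.+ (1 ℕ.+ j ℕ.* 2) ℕ.+ q ℕ.* 4 ≡ 2 ℕ.+ (j ℕ.+ q) ℕ.* 4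
   lem = solveℕ

  positive-square : ∀ {p m} → Good (p ℕ.* (m ℕ.* m)) → 0 ℕ.< m
  positive-square {p} {zero} g = ⊥-elim (zero-case (trans (sym (cong (_% 12) (ℕP.*-zeroʳ p))) g))
   where
   zero-case : 0 ≡ 11 → ⊥
   zero-case ()
  positive-square {p} {suc m} g = ℕ.s≤s ℕ.z≤n

 -- The ambiguous forms are as many as the ordered factorisations of m², an odd number, and the
 -- other reduced forms pair off by the sign of b.
 one-prime : ∀ {p m h} → Prime p → ¬ p ℕD.∣ m → Good (p ℕ.* (m ℕ.* m)) → Card (RedForm (+ (p ℕ.* (m ℕ.* m)))) h → h % 2 ≡ 1
 one-prime {p} {m} {h} pr p∤m g c = from (class-count (good-4∤ {p ℕ.* (m ℕ.* m)} g) c) (ordered-square m (positive-square {p} g))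
  where
  D : ℕ
  D = p ℕ.* (m ℕ.* m)
  from : (∃ λ A → ∃ λ G → Card (Amb D) A × Card (λ f → RedForm (+ D) f × ¬ Ambiguous f) (G ℕ.+ G) × h ≡ A ℕ.+ (G ℕ.+ G)) → (∃ λ k → Card (Ordered (m ℕ.* m)) k × k % 2 ≡ 1) → h % 2 ≡ 1
  from (A , G , cA , _ , h≡) (k , ck , odd) = trans (cong (_% 2) (trans h≡ (cong (ℕ._+ (G ℕ.+ G)) A≡k))) (odd+even {k} G odd)
   where
   A≡k : A ≡ k
   A≡k = double-injective (card-unique (ordered-card (good-%4 {D} g) (amb-factorisations (good-%4 {D} g) cA)) (ordered-prime pr (∤* pr p∤m p∤m) ck))

 -- D = p q R with p, q exactly dividing D.
 module TwoPrimes {p q R : ℕ} (pr : Prime p) (qr : Prime q) (p≢q : p ≢ q) (p∤R : ¬ p ℕD.∣ R) (q∤R : ¬ q ℕD.∣ R) (g : Good (p ℕ.* (q ℕ.* R))) where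

  D : ℕ
  D = p ℕ.* (q ℕ.* R)

  P Q Rz Dz : ℤ
  P = + p
  Q = + q
  Rz = + R
  Dz = + D

  p-facts : + 5 ≤ P × Cop (+ 2) P × ¬ 2 ℕD.∣ p
  p-facts = good-prime {p} {D} g pr (ℕD.m∣m*n (q ℕ.* R))

  q-facts : + 5 ≤ Q × Cop (+ 2) Q × ¬ 2 ℕD.∣ q
  q-facts = good-prime {q} {D} g qr (ℕD.∣n⇒∣m*n p (ℕD.m∣m*n R))

  positive-5 : ∀ {x} → + 5 ≤ x → 0ℤ < x
  positive-5 h = <-≤-trans (+<+ (ℕ.s≤s ℕ.z≤n)) h

  0<P : 0ℤ < P
  0<P = positive-5 (proj₁ p-facts)
  0<Q : 0ℤ < Q
  0<Q = positive-5 (proj₁ q-facts)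

  0<D : 0ℤ < Dz
  0<D = +<+ (ℕP.n≢0⇒n>0 λ z → good-4∤ {D} g (subst (4 ℕD.∣_) (sym z) (4 ℕD.∣0)))

  Dz≡ : Dz ≡ P * (Q * Rz)
  Dz≡ = trans (pos-* p (q ℕ.* R)) (cong (λ z → P * z) (pos-* q R))
  Dz≡1 : Dz ≡ Rz * Q * P
  Dz≡1 = trans Dz≡ (lem P Q Rz)
   where
   lem : ∀ P Q R → P * (Q * R) ≡ R * Q * P
   lem = ring
  Dz≡2 : Dz ≡ Rz * P * Q
  Dz≡2 = trans Dz≡ (lem P Q Rz)
   where
   lem : ∀ P Q R → P * (Q * R) ≡ R * P * Q
   lem = ring
  Dz≡3 : Dz ≡ Rz * (P * Q)
  Dz≡3 = trans Dz≡ (lem P Q Rz)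
   where
   lem : ∀ P Q R → P * (Q * R) ≡ R * (P * Q)
   lem = ring

  content-p : ∀ {f} → RedForm Dz f → ¬ P ∣ᶠ f
  content-p {f} (pf , _) = content-free {p} {Rz * Q} {f} pr p∤ (subst (λ D → PosForm D f) Dz≡1 pf)
   where
   p∤ : ¬ P ∣ Rz * Q
   p∤ d = ∤* pr p∤R (prime-≢⇒∤ pr qr p≢q) (∣⇒∣ᵤ (subst (P ∣_) (sym (pos-* R q)) d))

  content-q : ∀ {f} → RedForm Dz f → ¬ Q ∣ᶠ f
  content-q {f} (pf , _) = content-free {q} {Rz * P} {f} qr q∤ (subst (λ D → PosForm D f) Dz≡2 pf)
   where
   q∤ : ¬ Q ∣ Rz * P
   q∤ d = ∤* qr q∤R (prime-≢⇒∤ qr pr (λ e → p≢q (sym e))) (∣⇒∣ᵤ (subst (Q ∣_) (sym (pos-* R p)) d))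

  private
   instance
    p≢0 : NonZero p
    p≢0 = ℕ.≢-nonZero (λ e → prime≢0 pr (cong +_ e))
    q≢0 : NonZero q
    q≢0 = ℕ.≢-nonZero (λ e → prime≢0 qr (cong +_ e))
    pq≢0 : NonZero (p ℕ.* q)
    pq≢0 = ℕP.m*n≢0 p q

  adapted-p : ∀ {f} → RedForm Dz f → Adapted P f
  adapted-p {f} rf = adapted-exists {Dz} {f} p 0<D (proj₁ rf) (proj₁ (proj₂ p-facts)) (prime-part pr (content-p rf)) (divides (Rz * Q) Dz≡1)

  adapted-q : ∀ {f} → RedForm Dz f → Adapted Q f
  adapted-q {f} rf = adapted-exists {Dz} {f} q 0<D (proj₁ rf) (proj₁ (proj₂ q-facts)) (prime-part qr (content-q rf)) (divides (Rz * P) Dz≡2)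

  adapted-pq : ∀ {f} → RedForm Dz f → Adapted (P * Q) f
  adapted-pq {f} rf = subst (λ n → Adapted n f) (pos-* p q) (adapted-exists {Dz} {f} (p ℕ.* q) 0<D (proj₁ rf)
    (subst (Cop (+ 2)) (sym (pos-* p q)) (cop-*ʳ (proj₁ (proj₂ p-facts)) (proj₁ (proj₂ q-facts)))) prim (divides Rz (trans Dz≡3 (cong (λ z → Rz * z) (sym (pos-* p q))))))
   where
   prim : Prim (+ (p ℕ.* q)) f
   prim {ℓ} ℓr ℓ∣ = cases (prime-∣* P Q ℓr (subst (+ ℓ ∣_) (pos-* p q) ℓ∣))
    where
    cases : + ℓ ∣ P ⊎ + ℓ ∣ Q → ¬ + ℓ ∣ᶠ f
    cases (inj₁ d) = prime-part pr (content-p rf) ℓr d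
    cases (inj₂ d) = prime-part qr (content-q rf) ℓr d

  nonSquare-RQ : NonSquare (Rz * Q)
  nonSquare-RQ = nonSquare-prime qr (∤⇒ℤ∤ q∤R)
  nonSquare-RP : NonSquare (Rz * P)
  nonSquare-RP = nonSquare-prime pr (∤⇒ℤ∤ p∤R)

  free-p : ∀ {f} → RedForm Dz f → ¬ T P f f
  free-p {f} rf = T-free {Dz} {Rz * Q} {P} {f} 0<D (proj₁ rf) (proj₁ p-facts) Dz≡1 (prime-radical pr) (adapted-p rf) nonSquare-RQ

  free-q : ∀ {f} → RedForm Dz f → ¬ T Q f f
  free-q {f} rf = T-free {Dz} {Rz * P} {Q} {f} 0<D (proj₁ rf) (proj₁ q-facts) Dz≡2 (prime-radical qr) (adapted-q rf) nonSquare-RP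

  radical-pq : Radical (P * Q)
  radical-pq = radical-* (prime-Cop qr (∤⇒ℤ∤ (prime-≢⇒∤ qr pr (λ e → p≢q (sym e))))) (prime-radical pr) (prime-radical qr)

  5≤PQ : + 5 ≤ P * Q
  5≤PQ = ≤-trans (proj₁ p-facts) (≤-trans (+≤+ (ℕP.m≤m*n p q)) (≤-reflexive (pos-* p q)))

  free-pq : NonSquare Rz → ∀ {f} → RedForm Dz f → ¬ T (P * Q) f f
  free-pq ns {f} rf = T-free {Dz} {Rz} {P * Q} {f} 0<D (proj₁ rf) 5≤PQ Dz≡3 radical-pq (adapted-pq rf) ns

  klein-four : ∀ {N} {X : Form → Set} → (∀ f → Dec (X f)) → Card (λ f → RedForm Dz f × X f) N → (∀ {f g} → T P f g → X f → X g) → (∀ {f g} → T Q f g → X f → X g) →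
   (∀ {f} → RedForm Dz f → X f → ¬ T (P * Q) f f) → 4 ℕD.∣ N
  klein-four X? c closed-p closed-q free = klein-classes {Dz} {P} {Q} 0<D 0<P 0<Q (prime-radical pr) (prime-radical qr) radical-pq X? c
   (λ rf _ → adapted-p rf , adapted-q rf , adapted-pq rf) closed-p closed-q (λ rf x → free-p rf , free-q rf , free rf x)

  -- A form taken to its inverse by `T p` would make p a square modulo q.
  nonresidue-four : ∀ {N} → ¬ Residue p q → Card (λ f → RedForm Dz f × ¬ Ambiguous f) N → 4 ℕD.∣ N
  nonresidue-four nr c = inverse-classes {Dz} {P} 0<D 0<P (λ d → good-4∤ {D} g (∣⇒∣ᵤ d)) (prime-radical pr) c adapted-p free-p
   (λ {f} rf t → nr (T-inv-residue (adapted-q rf) t))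

 -- `T p` and `T q` are free, and `T (pq)` is free because the cofactor R is not a square.
 three-primes : ∀ {p q R h} → Prime p → Prime q → p ≢ q → ¬ p ℕD.∣ R → ¬ q ℕD.∣ R → NonSquare (+ R) → Good (p ℕ.* (q ℕ.* R)) → Card (RedForm (+ (p ℕ.* (q ℕ.* R)))) h → 4 ℕD.∣ h
 three-primes {p} {q} {R} pr qr p≢q p∤R q∤R ns g c = klein-four {X = λ _ → 0 ≡ 0} (λ _ → yes refl) (card-⇔ c (λ r → r , refl) proj₁) (λ _ x → x) (λ _ x → x) (λ rf _ → free-pq ns rf)
  where
  open TwoPrimes {p} {q} {R} pr qr p≢q p∤R q∤R g

 module TwoPrimesSquare {p q m : ℕ} (pr : Prime p) (qr : Prime q) (p≢q : p ≢ q) (p∤m : ¬ p ℕD.∣ m) (q∤m : ¬ q ℕD.∣ m) (g : Good (p ℕ.* (q ℕ.* (m ℕ.* m)))) where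

  open TwoPrimes {p} {q} {m ℕ.* m} pr qr p≢q (∤* pr p∤m p∤m) (∤* qr q∤m q∤m) g

  0<m : 0 ℕ.< m
  0<m = positive-square {p ℕ.* q} {m} (subst Good (sym (ℕP.*-assoc p q (m ℕ.* m))) g)

  count-shape : ∀ {h} → Card (RedForm Dz) h → ∃ λ k → ∃ λ G → k % 2 ≡ 1 × Card (λ f → RedForm Dz f × ¬ Ambiguous f) (G ℕ.+ G) × h ≡ k ℕ.+ k ℕ.+ (G ℕ.+ G)
  count-shape {h} c = from (class-count (good-4∤ {D} g) c) (ordered-square m 0<m)
   where
   from : (∃ λ A → ∃ λ G → Card (Amb D) A × Card (λ f → RedForm (+ D) f × ¬ Ambiguous f) (G ℕ.+ G) × h ≡ A ℕ.+ (G ℕ.+ G)) → (∃ λ k → Card (Ordered (m ℕ.* m)) k × k % 2 ≡ 1) →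
    ∃ λ k → ∃ λ G → k % 2 ≡ 1 × Card (λ f → RedForm Dz f × ¬ Ambiguous f) (G ℕ.+ G) × h ≡ k ℕ.+ k ℕ.+ (G ℕ.+ G)
   from (A , G , cA , cN , h≡) (k , ck , odd) = k , G , odd , cN , trans h≡ (cong (ℕ._+ (G ℕ.+ G)) A≡)
    where
    A≡ : A ≡ k ℕ.+ k
    A≡ = double-injective (card-unique (ordered-card (good-%4 {D} g) (amb-factorisations (good-%4 {D} g) cA))
     (ordered-prime pr (∤* pr (prime-≢⇒∤ pr qr p≢q) (∤* pr p∤m p∤m)) (ordered-prime qr (∤* qr q∤m q∤m) ck)))

  even-count : ∀ {h} → Card (RedForm Dz) h → 2 ℕD.∣ h
  even-count {h} c = read (count-shape c)
   where
   lem : ∀ k G → k ℕ.+ k ℕ.+ (G ℕ.+ G) ≡ (k ℕ.+ G) ℕ.* 2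
   lem = solveℕ
   read : (∃ λ k → ∃ λ G → k % 2 ≡ 1 × Card (λ f → RedForm Dz f × ¬ Ambiguous f) (G ℕ.+ G) × h ≡ k ℕ.+ k ℕ.+ (G ℕ.+ G)) → 2 ℕD.∣ h
   read (k , G , _ , _ , h≡) = ℕD.divides (k ℕ.+ G) (trans h≡ (lem k G))

  nonresidue-count : ∀ {h} → ¬ Residue p q → Card (RedForm Dz) h → h % 4 ≡ 2
  nonresidue-count {h} nr c = read (count-shape c)
   where
   read : (∃ λ k → ∃ λ G → k % 2 ≡ 1 × Card (λ f → RedForm Dz f × ¬ Ambiguous f) (G ℕ.+ G) × h ≡ k ℕ.+ k ℕ.+ (G ℕ.+ G)) → h % 4 ≡ 2
   read (k , G , odd , cN , h≡) = trans (cong (_% 4) h≡) (twice-odd {k} odd (nonresidue-four nr cN))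

  -- The forms divisible by m are m times the forms of discriminant -pq, on which the square root of
  -- `T p` acts freely with order 4. On the others `T p` and `T q` generate a free four-group, since
  -- a class fixed by `T (pq)` is divisible by m.
  residue-count : ∀ {h} → Residue p q → Residue q p → Card (RedForm Dz) h → 4 ℕD.∣ h
  residue-count {h} (r , r²) (s , s²) c = combine (card-split {P = RedForm Dz} {Q = λ f → M ∣ᶠ f} c (λ f → M ∣ᶠ? f)) (class-exists {D1} 4∤D1)
   where
   M : ℤ
   M = + m
   0<M : 0ℤ < M
   0<M = +<+ 0<m
   D1 : ℕ
   D1 = p ℕ.* (q ℕ.* 1)
   D≡ : m ℕ.* m ℕ.* D1 ≡ D
   D≡ = lem m p q
    where
    lem : ∀ m p q → m ℕ.* m ℕ.* (p ℕ.* (q ℕ.* 1)) ≡ p ℕ.* (q ℕ.* (m ℕ.* m))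
    lem = solveℕ
   g1 : Good D1
   g1 = good-strip {D1} m (subst Good (sym D≡) g)
   4∤D1 : ¬ 4 ℕD.∣ D1
   4∤D1 = good-4∤ {D1} g1
   prime∤ℕ1 : ∀ {p} → Prime p → ¬ p ℕD.∣ 1
   prime∤ℕ1 pr d = prime∤1 pr (∣ᵤ⇒∣ d)
   module One = TwoPrimes {p} {q} {1} pr qr p≢q (prime∤ℕ1 pr) (prime∤ℕ1 qr) g1
   PQ≡ : + D1 ≡ P * Q
   PQ≡ = trans One.Dz≡ (cong (λ z → P * z) (*-identityʳ Q))
   Dz-scaled : M * M * + D1 ≡ Dz
   Dz-scaled = trans (cong (λ z → z * + D1) (sym (pos-* m m))) (trans (sym (pos-* (m ℕ.* m) D1)) (cong +_ D≡))
   c2m : Cop (+ 2) M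
   c2m = cop-sym (prime-Cop prime[2] (λ d → 2∤ {D} g (ℕD.∣n⇒∣m*n p (ℕD.∣n⇒∣m*n q (ℕD.∣m⇒∣m*n m (∣⇒∣ᵤ d))))))
   primitive-four : ∀ {n} → Card (RedForm (+ D1)) n → 4 ℕD.∣ n
   primitive-four {n} c1 = from-point (primitive-point pr qr p≢q (proj₁ (proj₂ p-facts)) (proj₁ (proj₂ q-facts)) r s r² s²)
    where
    from-point : PrimitivePoint P Q → 4 ℕD.∣ n
    from-point (primitivePoint u y w conic w≢0 c2 cy cpu) = Root.four-divides {P} {Q} {u} {y} {abs w} 0<P 0<Q {{≢-nonZero w≢0}} (trans conic (abs-square w))
      (cop-∣ʳ ∣m∣∣m c2) (cop-∣ʳ ∣m∣∣m cy) (cop-∣ʳ ∣m∣∣m cpu) (subst (λ D → Card (RedForm D) n) PQ≡ c1) (prime-radical pr)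
      (λ {f} rf → (λ {ℓ} ℓr _ d → prim {f} (back rf) ℓr d) , One.adapted-p (back rf) , One.free-p (back rf))
     where
     abs-square : ∀ w → w * w ≡ + abs w * + abs w
     abs-square (+ n)    = refl
     abs-square -[1+ n ] = refl
     back : ∀ {f} → RedForm (P * Q) f → RedForm (+ D1) f
     back {f} = subst (λ D → RedForm D f) (sym PQ≡)
     prim : ∀ {f} → RedForm (+ D1) f → ∀ {ℓ} → Prime ℓ → ¬ + ℓ ∣ᶠ f
     prim {a , b , c} rf@((e , _) , _) {ℓ} ℓr d@(da , db , dc) = cases (prime-∣* P Q ℓr (subst (+ ℓ ∣_) PQ≡ ℓ∣D))
      where
      lem : ∀ x y z → x ≡ y + z → z ≡ x - y
      lem x y z e = eq1 (- 1ℤ) _ _ e (expand x y z)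
       where
       expand : ∀ x y z → z - (x - y) ≡ (- 1ℤ) * (x - (y + z))
       expand = ring
      ℓ∣D : + ℓ ∣ + D1
      ℓ∣D = subst (+ ℓ ∣_) (sym (lem (+ 4 * (a * c)) (b * b) (+ D1) e)) (∣m∣n⇒∣m-n (∣n⇒∣m*n (+ 4) (∣m⇒∣m*n c da)) (∣m⇒∣m*n b db))
      cases : + ℓ ∣ P ⊎ + ℓ ∣ Q → ⊥
      cases (inj₁ ℓ∣p) = prime-part pr (One.content-p rf) ℓr ℓ∣p d
      cases (inj₂ ℓ∣q) = prime-part qr (One.content-q rf) ℓr ℓ∣q d
   closed : ∀ {ℓ} → Prime ℓ → ¬ ℓ ℕD.∣ m → ∀ {f g} → T (+ ℓ) f g → ¬ M ∣ᶠ f → ¬ M ∣ᶠ g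
   closed ℓr ℓ∤m t ¬d d = ¬d (T-∣ᶠ (cop-sym (prime-Cop ℓr (∤⇒ℤ∤ ℓ∤m))) (prime≢0 ℓr) (T-sym (prime≢0 ℓr) t) d)
   free : ∀ {f} → RedForm Dz f → ¬ M ∣ᶠ f → ¬ T (P * Q) f f
   free {f} rf ¬d t = ¬d (T-fixed-content {Dz} {P * Q} {f} M 0<D (proj₁ rf) 5≤PQ (trans Dz≡3 (cong (λ z → z * (P * Q)) (pos-* m m))) radical-pq (adapted-pq rf) c2m t)
   multiples-four : ∀ {n a} → Card (RedForm (+ D1)) n → Card (λ f → RedForm Dz f × M ∣ᶠ f) a → 4 ℕD.∣ a
   multiples-four {n} {a} c1 ca = subst (4 ℕD.∣_) (card-unique scaled ca) (primitive-four c1)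
    where
    scaled : Card (λ f → RedForm Dz f × M ∣ᶠ f) n
    scaled = subst (λ D → Card (λ f → RedForm D f × M ∣ᶠ f) n) Dz-scaled (scaled-card {M} {+ D1} 0<M c1)
   others-four : ∀ {b} → Card (λ f → RedForm Dz f × ¬ M ∣ᶠ f) b → 4 ℕD.∣ b
   others-four cb = klein-four {X = λ f → ¬ M ∣ᶠ f} (λ f → ¬? (M ∣ᶠ? f)) cb (λ {f} {g} → closed pr p∤m {f} {g}) (λ {f} {g} → closed qr q∤m {f} {g}) (λ {f} → free {f})
   combine : (∃ λ a → ∃ λ b → Card (λ f → RedForm Dz f × M ∣ᶠ f) a × Card (λ f → RedForm Dz f × ¬ M ∣ᶠ f) b × a ℕ.+ b ≡ h) → (∃ λ n → Card (RedForm (+ D1)) n) → 4 ℕD.∣ h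
   combine (a , b , ca , cb , h≡) (n , c1) = subst (4 ℕD.∣_) h≡ (ℕD.∣m∣n⇒∣m+n (multiples-four c1 ca) (others-four cb))

-- From class numbers to the factorisation of 12n - 1

module Final where

 open import Defs
 open Counting
 open Forms using (RedForm)
 open IntegerCoprime using (Cop; no-common-prime)
 open Freeness
 open Multiplicity
 open Shapes
 open Residues
 open ClassParity
 open Representations using (Nσ-class-number)
 open ReducedTriples using (amb-card; gen-card; rep'-card)
 open Divisors using (square-mod-4)
 open Classes using (forms-card; rep⇒rep')
 open import Data.Nat.Base using (ℕ; zero; suc; _%_; _/_; _∸_; _^_; _*_; _+_; _<_; z≤n; s≤s)
 open import Data.Nat.Properties
 open import Data.Nat.Divisibility
 open import Data.Nat.DivMod using ([m+kn]%n≡m%n; %-distribˡ-*; m≡m%n+[m/n]*n)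
 open import Data.Nat.Coprimality using (Coprime)
 open import Data.Nat.Tactic.RingSolver using () renaming (solve-∀ to ring)
 open import Data.Integer.Base using (ℤ; -[1+_]; +_)
 import Data.Integer.Base as ℤ
 import Data.Integer.Divisibility.Signed as ℤD

 private
  oddPower-suc : ∀ p k N → p * p * oddPower p k N ≡ oddPower p (suc k) N
  oddPower-suc p k N = lem p (p ^ k) (p * N)
   where
   lem : ∀ p t x → p * p * (t * t * x) ≡ p * t * (p * t) * x
   lem = ring

  odd-power≡ : ∀ p k N → odd-power (+ p) (+ (p * N)) k ≡ + oddPower p k N
  odd-power≡ p zero N = cong +_ (sym (+-identityʳ (p * N)))
  odd-power≡ p (suc k) N = trans (cong₂ ℤ._*_ (sym (ℤP.pos-* p p)) (odd-power≡ p k N)) (trans (sym (ℤP.pos-* (p * p) (oddPower p k N))) (cong +_ (oddPower-suc p k N)))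

  prime[3] : Prime 3
  prime[3] = from-yes (prime? 3)

  good⇒positive : ∀ {D} → Good D → 0 < D
  good⇒positive {zero} ()
  good⇒positive {suc D} _ = s≤s z≤n

  good⇒3∤ : ∀ {D} → Good D → ¬ 3 ∣ D
  good⇒3∤ {D} g (divides q refl) = contra (q * 3 / 12) (trans (m≡m%n+[m/n]*n (q * 3) 12) (cong (_+ q * 3 / 12 * 12) g))
   where
   contra : ∀ k → q * 3 ≡ 11 + k * 12 → ⊥
   contra k e = 3∤2 (∣m+n∣m⇒∣n (subst (3 ∣_) (trans e (lem k)) (divides q refl)) (divides (3 + k * 4) refl))
    where
    lem : ∀ k → 11 + k * 12 ≡ (3 + k * 4) * 3 + 2
    lem = ring
    3∤2 : ¬ 3 ∣ 2
    3∤2 d with ∣⇒≤ d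
    ... | s≤s (s≤s ())

 power-card : ∀ {p k N h} → Prime p → ¬ p ∣ N → Good (oddPower p k N) → Card (RedForm (+ (p * N))) h → Card (RedForm (+ oddPower p k N)) (geometric p k * h)
 power-card {p} {k} {N} {h} pr p∤N g c = subst (λ D → Card (RedForm D) (geometric p k * h)) (odd-power≡ p k N)
   (odd-power-card pr c2 {+ (p * N)} (ℤ.+<+ (good⇒positive {p * N} g0)) (ℤD.∣ᵤ⇒∣ (m∣m*n N)) content ns ns3 k c)
  where
  g0 : Good (p * N)
  g0 = good-strip {p * N} (p ^ k) g
  c2 : Cop (+ 2) (+ p)
  c2 = proj₁ (proj₂ (good-prime {p} {p * N} g0 pr (m∣m*n N)))
  D≡ : + (p * N) ≡ + N ℤ.* + p
  D≡ = trans (cong +_ (*-comm p N)) (ℤP.pos-* N p)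
  content : ∀ {f} → RedForm (+ (p * N)) f → ¬ + p Twist.∣ᶠ f
  content {f} (pf , _) = content-free {p} {+ N} {f} pr (∤⇒ℤ∤ p∤N) (subst (λ D → Forms.PosForm D f) D≡ pf)
  ns : NonSquare (+ (p * N))
  ns = subst NonSquare (sym D≡) (nonSquare-prime pr (∤⇒ℤ∤ p∤N))
  ns3 : NonSquare (+ 3 ℤ.* + (p * N))
  ns3 = subst NonSquare (ℤP.*-comm (+ (p * N)) (+ 3)) (nonSquare-prime prime[3] (∤⇒ℤ∤ (good⇒3∤ {p * N} g0)))

 private
  geometric-step : ∀ p k → geometric p (suc (suc k)) ≡ geometric p k + p ^ suc k * suc p
  geometric-step p k = lem (geometric p k) (p ^ suc k) p
   where
   lem : ∀ x t p → x + t + p * t ≡ x + t * suc p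
   lem = ring

  -- Consecutive terms combine to multiples of p + 1, so 1 + p + ... + p^k is 1 modulo p + 1 for
  -- even k and 0 for odd k.
  geometric-even : ∀ p a → ∃ λ z → geometric p (a + a) ≡ 1 + z * suc p
  geometric-even p zero = 0 , refl
  geometric-even p (suc a) with geometric-even p a
  ... | z , e = z + p ^ suc (a + a) , trans (cong (λ k → geometric p (suc k)) (+-suc a a)) (trans (geometric-step p (a + a))
    (trans (cong (_+ p ^ suc (a + a) * suc p) e) (lem z (p ^ suc (a + a)) (suc p))))
   where
   lem : ∀ z t s → 1 + z * s + t * s ≡ 1 + (z + t) * s
   lem = ring

  geometric-odd : ∀ p a → suc p ∣ geometric p (suc (a + a))
  geometric-odd p zero = divides 1 (lem p)
   where
   lem : ∀ p → 1 + p * 1 ≡ 1 * suc p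
   lem = ring
  geometric-odd p (suc a) = subst (suc p ∣_) (sym (trans (cong (λ k → geometric p (suc (suc k))) (+-suc a a)) (geometric-step p (suc (a + a)))))
   (∣m∣n⇒∣m+n (geometric-odd p a) (divides (p ^ suc (suc (a + a))) refl))

  data Parity : ℕ → Set where
   even : ∀ a → Parity (a + a)
   odd  : ∀ a → Parity (suc (a + a))

  parity : ∀ k → Parity k
  parity zero = even 0
  parity (suc k) with parity k
  ... | even a = odd a
  ... | odd a  = subst Parity (cong suc (+-suc a a)) (even (suc a))

  odd-suc-even : ∀ p → ¬ 2 ∣ p → 2 ∣ suc p
  odd-suc-even p 2∤p with parity p
  ... | even a = ⊥-elim (2∤p (divides a (lem a)))
   where
   lem : ∀ a → a + a ≡ a * 2
   lem = ring
  ... | odd a  = divides (suc a) (lem a)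
   where
   lem : ∀ a → suc (suc (a + a)) ≡ suc a * 2
   lem = ring

  geometric-even-odd : ∀ {p} a → 2 ∣ suc p → geometric p (a + a) % 2 ≡ 1
  geometric-even-odd {p} a (divides q s≡) with geometric-even p a
  ... | z , e = trans (cong (_% 2) (trans e (trans (cong (λ s → 1 + z * s) s≡) (cong suc (sym (*-assoc z q 2)))))) ([m+kn]%n≡m%n 1 (z * q) 2)

  odd*odd : ∀ x y → x % 2 ≡ 1 → y % 2 ≡ 1 → (x * y) % 2 ≡ 1
  odd*odd x y ex ey = trans (%-distribˡ-* x y 2) (cong₂ (λ a b → (a * b) % 2) ex ey)

  odd*two : ∀ x y → x % 2 ≡ 1 → y % 4 ≡ 2 → (x * y) % 4 ≡ 2
  odd*two x y ex ey = trans (cong₂ (λ a b → (a * b) % 4) x≡ y≡) (trans (cong (_% 4) (lem (x / 2) (y / 4))) ([m+kn]%n≡m%n 2 (x / 2 + y / 4 + x / 2 * 2 * (y / 4)) 4))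
   where
   x≡ : x ≡ 1 + x / 2 * 2
   x≡ = trans (m≡m%n+[m/n]*n x 2) (cong (_+ x / 2 * 2) ex)
   y≡ : y ≡ 2 + y / 4 * 4
   y≡ = trans (m≡m%n+[m/n]*n y 4) (cong (_+ y / 4 * 4) ey)
   lem : ∀ a b → (1 + a * 2) * (2 + b * 4) ≡ 2 + (a + b + a * 2 * b) * 4
   lem = ring

  2∣*2∣ : ∀ {x y} → 2 ∣ x → 2 ∣ y → 4 ∣ x * y
  2∣*2∣ (divides q refl) (divides r refl) = divides (q * r) (lem q r)
   where
   lem : ∀ q r → q * 2 * (r * 2) ≡ q * r * 4
   lem = ring

 H : ℕ → ℕ → Set
 H D h = Card (RedForm (+ D)) h

 reduce-power : ∀ {p k N h} → Prime p → ¬ p ∣ N → Good (oddPower p k N) → H (oddPower p k N) h → ∃ λ h0 → H (p * N) h0 × h ≡ geometric p k * h0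
 reduce-power {p} {k} {N} {h} pr p∤N g c = finish (class-exists {p * N} (good-4∤ {p * N} (good-strip {p * N} (p ^ k) g)))
  where
  finish : (∃ λ h0 → H (p * N) h0) → ∃ λ h0 → H (p * N) h0 × h ≡ geometric p k * h0
  finish (h0 , c0) = h0 , c0 , card-unique c (power-card {p} {k} {N} pr p∤N g c0)

 reduce-powers : ∀ {p q k l N h} → Prime p → Prime q → p ≢ q → ¬ p ∣ N → ¬ q ∣ N → Good (oddPower p k (oddPower q l N)) → H (oddPower p k (oddPower q l N)) h →
  Good (p * (q * N)) × ∃ λ h0 → H (p * (q * N)) h0 × h ≡ geometric p k * (geometric q l * h0)
 reduce-powers {p} {q} {k} {l} {N} {h} pr qr p≢q p∤N q∤N g c = subst Good swap≡ g2 , outer (reduce-power {p} {k} pr (∤oddPower l pr qr p≢q p∤N) g c)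
  where
  inside≡ : p * oddPower q l N ≡ oddPower q l (p * N)
  inside≡ = lem p q (q ^ l) N
   where
   lem : ∀ p q t N → p * (t * t * (q * N)) ≡ t * t * (q * (p * N))
   lem = ring
  swap≡ : q * (p * N) ≡ p * (q * N)
  swap≡ = lem p q N
   where
   lem : ∀ p q N → q * (p * N) ≡ p * (q * N)
   lem = ring
  g1 : Good (oddPower q l (p * N))
  g1 = subst Good inside≡ (good-strip {p * oddPower q l N} (p ^ k) g)
  g2 : Good (q * (p * N))
  g2 = good-strip {q * (p * N)} (q ^ l) g1
  Goal : Set
  Goal = ∃ λ h0 → H (p * (q * N)) h0 × h ≡ geometric p k * (geometric q l * h0)
  outer : (∃ λ h1 → H (p * oddPower q l N) h1 × h ≡ geometric p k * h1) → Goal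
  outer (h1 , c1 , h≡) = inner (reduce-power {q} {l} {p * N} {h1} qr (∤* qr (prime-≢⇒∤ qr pr (λ e → p≢q (sym e))) q∤N) g1 (subst (λ D → H D h1) inside≡ c1))
   where
   inner : (∃ λ h0 → H (q * (p * N)) h0 × h1 ≡ geometric q l * h0) → Goal
   inner (h0 , c0 , h1≡) = h0 , subst (λ D → H D h0) swap≡ c0 , trans h≡ (cong (geometric p k *_) h1≡)

 OneForm TwoForm : ℕ → Set
 OneForm D = Σ ℕ λ p → Σ ℕ λ a → Σ ℕ λ m → Prime p × Coprime m p × D ≡ p ^ (4 * a + 1) * m ^ 2
 TwoForm D = Σ ℕ λ p1 → Σ ℕ λ p2 → Σ ℕ λ a → Σ ℕ λ b → Σ ℕ λ m →
  Prime p1 × Prime p2 × kroneckerPrime p1 p2 ≡ -[1+ 0 ] × Coprime m (p1 * p2) × D ≡ p1 ^ (4 * a + 1) * p2 ^ (4 * b + 1) * m ^ 2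

 private
  fourth-power : ∀ p a → p ^ (4 * a + 1) ≡ p ^ (a + a) * p ^ (a + a) * p
  fourth-power p a = trans (cong (p ^_) (lem a)) (trans (^-distribˡ-+-* p (a + a + (a + a)) 1) (cong₂ _*_ (^-distribˡ-+-* p (a + a) (a + a)) (*-identityʳ p)))
   where
   lem : ∀ a → 4 * a + 1 ≡ a + a + (a + a) + 1
   lem = ring

  one-form≡ : ∀ p a m → p ^ (4 * a + 1) * m ^ 2 ≡ oddPower p (a + a) (m * m)
  one-form≡ p a m = trans (cong (_* m ^ 2) (fourth-power p a)) (lem (p ^ (a + a)) p m)
   where
   lem : ∀ t p m → t * t * p * (m * (m * 1)) ≡ t * t * (p * (m * m))
   lem = ring

  two-form≡ : ∀ p q a b m → p ^ (4 * a + 1) * q ^ (4 * b + 1) * m ^ 2 ≡ oddPower p (a + a) (oddPower q (b + b) (m * m))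
  two-form≡ p q a b m = trans (cong₂ (λ x y → x * y * m ^ 2) (fourth-power p a) (fourth-power q b)) (lem (p ^ (a + a)) p (q ^ (b + b)) q m)
   where
   lem : ∀ t p s q m → t * t * p * (s * s * q) * (m * (m * 1)) ≡ t * t * (p * (s * s * (q * (m * m))))
   lem = ring

  ∤⇒coprime : ∀ {p m} → Prime p → ¬ p ∣ m → Coprime m p
  ∤⇒coprime {p} {m} pr p∤m = no-common-prime λ {ℓ} ℓr ℓ∣m ℓ∣p → divisor ℓr ℓ∣m (prime⇒irreducible pr ℓ∣p)
   where
   divisor : ∀ {ℓ} → Prime ℓ → ℓ ∣ m → ℓ ≡ 1 ⊎ ℓ ≡ p → ⊥
   divisor ℓr _ (inj₁ refl) = ¬prime[1] ℓr
   divisor _ ℓ∣m (inj₂ refl) = p∤m ℓ∣m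

  coprime⇒∤ : ∀ {p n m} → Prime p → p ∣ n → Coprime m n → ¬ p ∣ m
  coprime⇒∤ pr p∣n c p∣m = ¬prime[1] (subst Prime (c (p∣m , p∣n)) pr)

  coprime-product : ∀ {p q m} → Prime p → Prime q → ¬ p ∣ m → ¬ q ∣ m → Coprime m (p * q)
  coprime-product {p} {q} {m} pr qr p∤m q∤m = no-common-prime λ {ℓ} ℓr ℓ∣m ℓ∣pq → split ℓr ℓ∣m (euclidsLemma p q ℓr ℓ∣pq)
   where
   split : ∀ {ℓ} → Prime ℓ → ℓ ∣ m → ℓ ∣ p ⊎ ℓ ∣ q → ⊥
   split ℓr ℓ∣m (inj₁ ℓ∣p) = ¬prime[1] (subst Prime (∤⇒coprime pr p∤m (ℓ∣m , ℓ∣p)) ℓr)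
   split ℓr ℓ∣m (inj₂ ℓ∣q) = ¬prime[1] (subst Prime (∤⇒coprime qr q∤m (ℓ∣m , ℓ∣q)) ℓr)

 one-even : ∀ {p m h} a → Prime p → ¬ p ∣ m → Good (oddPower p (a + a) (m * m)) → H (oddPower p (a + a) (m * m)) h → h % 2 ≡ 1
 one-even {p} {m} {h} a pr p∤m g c = finish (reduce-power {p} {a + a} pr (∤* pr p∤m p∤m) g c)
  where
  g0 : Good (p * (m * m))
  g0 = good-strip {p * (m * m)} (p ^ (a + a)) g
  finish : (∃ λ h0 → H (p * (m * m)) h0 × h ≡ geometric p (a + a) * h0) → h % 2 ≡ 1
  finish (h0 , c0 , h≡) = trans (cong (_% 2) h≡) (odd*odd (geometric p (a + a)) h0
   (geometric-even-odd {p} a (odd-suc-even p (proj₂ (proj₂ (good-prime {p} {p * (m * m)} g0 pr (m∣m*n (m * m))))))) (one-prime pr p∤m g0 c0))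

 -- The geometric factor is divisible by p + 1, and p is 3 modulo 4.
 one-odd : ∀ {p m h} a → Prime p → ¬ p ∣ m → Good (oddPower p (suc (a + a)) (m * m)) → H (oddPower p (suc (a + a)) (m * m)) h → 4 ∣ h
 one-odd {p} {m} {h} a pr p∤m g c = finish (reduce-power {p} {suc (a + a)} pr (∤* pr p∤m p∤m) g c)
  where
  g0 : Good (p * (m * m))
  g0 = good-strip {p * (m * m)} (p ^ suc (a + a)) g
  finish : (∃ λ h0 → H (p * (m * m)) h0 × h ≡ geometric p (suc (a + a)) * h0) → 4 ∣ h
  finish (h0 , _ , h≡) = subst (4 ∣_) (sym h≡) (∣m⇒∣m*n h0 (∣-trans (suc-mod-4 p m (good-%4 {p * (m * m)} g0)) (geometric-odd p a)))

 module _ {p q m h : ℕ} (pr : Prime p) (qr : Prime q) (p≢q : p ≢ q) (p∤m : ¬ p ∣ m) (q∤m : ¬ q ∣ m) {k l : ℕ}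
  (g : Good (oddPower p k (oddPower q l (m * m)))) (c : H (oddPower p k (oddPower q l (m * m))) h) where

  private
   reduced : Good (p * (q * (m * m))) × ∃ λ h0 → H (p * (q * (m * m))) h0 × h ≡ geometric p k * (geometric q l * h0)
   reduced = reduce-powers {p} {q} {k} {l} {m * m} pr qr p≢q (∤* pr p∤m p∤m) (∤* qr q∤m q∤m) g c
   g0 : Good (p * (q * (m * m)))
   g0 = proj₁ reduced
   h0 : ℕ
   h0 = proj₁ (proj₂ reduced)
   c0 : H (p * (q * (m * m))) h0
   c0 = proj₁ (proj₂ (proj₂ reduced))
   h≡ : h ≡ geometric p k * (geometric q l * h0)
   h≡ = proj₂ (proj₂ (proj₂ reduced))
   open TwoPrimesSquare {p} {q} {m} pr qr p≢q p∤m q∤m g0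
   2∣1+p : 2 ∣ suc p
   2∣1+p = odd-suc-even p (proj₂ (proj₂ (good-prime {p} {p * (q * (m * m))} g0 pr (m∣m*n (q * (m * m))))))
   2∣1+q : 2 ∣ suc q
   2∣1+q = odd-suc-even q (proj₂ (proj₂ (good-prime {q} {p * (q * (m * m))} g0 qr (∣n⇒∣m*n p (m∣m*n (m * m))))))

  -- One factor 2 comes from p + 1 and another from the class number of p q m².
  two-odd-left : ∀ a → k ≡ suc (a + a) → 4 ∣ h
  two-odd-left a refl = subst (4 ∣_) (sym h≡) (2∣*2∣ (∣-trans 2∣1+p (geometric-odd p a)) (∣n⇒∣m*n (geometric q l) (even-count c0)))

  two-odd-right : ∀ b → l ≡ suc (b + b) → 4 ∣ h
  two-odd-right b refl = subst (4 ∣_) (sym h≡) (∣n⇒∣m*n (geometric p k) (2∣*2∣ (∣-trans 2∣1+q (geometric-odd q b)) (even-count c0)))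

  two-residues : Residue p q → Residue q p → 4 ∣ h
  two-residues r s = subst (4 ∣_) (sym h≡) (∣n⇒∣m*n (geometric p k) (∣n⇒∣m*n (geometric q l) (residue-count r s c0)))

  two-nonresidue : ∀ a b → k ≡ a + a → l ≡ b + b → ¬ Residue p q → h % 4 ≡ 2
  two-nonresidue a b refl refl nr = trans (cong (_% 4) h≡) (odd*two (geometric p k) (geometric q l * h0) (geometric-even-odd {p} a 2∣1+p)
   (odd*two (geometric q l) h0 (geometric-even-odd {q} b 2∣1+q) (nonresidue-count nr c0)))

  two-good : Good (p * (q * (m * m)))
  two-good = g0

 many-primes : ∀ {p q r M h} k l j → Prime p → Prime q → Prime r → p ≢ q → p ≢ r → q ≢ r → ¬ p ∣ M → ¬ q ∣ M → ¬ r ∣ M →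
  Good (oddPower p k (oddPower q l (oddPower r j M))) → H (oddPower p k (oddPower q l (oddPower r j M))) h → 4 ∣ h
 many-primes {p} {q} {r} {M} {h} k l j pr qr rr p≢q p≢r q≢r p∤M q∤M r∤M g c = finish (reduce-powers {p} {q} {k} {l} {R} pr qr p≢q p∤R q∤R g c)
  where
  R : ℕ
  R = oddPower r j M
  p∤R : ¬ p ∣ R
  p∤R = ∤oddPower j pr rr p≢r p∤M
  q∤R : ¬ q ∣ R
  q∤R = ∤oddPower j qr rr q≢r q∤M
  t : ℕ
  t = r ^ j
  R≡ : + t ℤ.* + t ℤ.* (+ M ℤ.* + r) ≡ + R
  R≡ = trans (cong₂ ℤ._*_ (sym (ℤP.pos-* t t)) (trans (sym (ℤP.pos-* M r)) (cong +_ (*-comm M r)))) (sym (ℤP.pos-* (t * t) (r * M)))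
  ns : NonSquare (+ R)
  ns = subst NonSquare R≡ (nonSquare-scale (+ t) (nonSquare-prime rr (∤⇒ℤ∤ r∤M)))
  finish : Good (p * (q * R)) × (∃ λ h0 → H (p * (q * R)) h0 × h ≡ geometric p k * (geometric q l * h0)) → 4 ∣ h
  finish (g0 , h0 , c0 , h≡) = subst (4 ∣_) (sym h≡) (∣n⇒∣m*n (geometric p k) (∣n⇒∣m*n (geometric q l) (three-primes pr qr p≢q p∤R q∤R ns g0 c0)))

 -- The three outcomes exclude one another modulo 4, which turns the case distinction on D into
 -- equivalences.
 data Outcome (D h : ℕ) : Set where
  odd-count : h % 2 ≡ 1 → OneForm D → Outcome D h
  two-count : h % 4 ≡ 2 → TwoForm D → Outcome D h
  four-count : 4 ∣ h → Outcome D h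

 private
  not-2 : ∀ {q D} → Good D → Prime q → q ∣ D → q ≢ 2
  not-2 {q} {D} g qr q∣D refl = proj₂ (proj₂ (good-prime {2} {D} g qr q∣D)) (divides 1 refl)

 -- With both exponents of the form 4a + 1, a nonresidue in either direction gives `TwoForm` with
 -- the primes in that order; residues in both directions give a class number divisible by 4.
 outcome-two : ∀ {p q m h} k l → Prime p → Prime q → p ≢ q → ¬ p ∣ m → ¬ q ∣ m →
  Good (oddPower p k (oddPower q l (m * m))) → H (oddPower p k (oddPower q l (m * m))) h → Parity k → Parity l → Outcome (oddPower p k (oddPower q l (m * m))) h
 outcome-two k l pr qr p≢q p∤m q∤m g c (odd a) _ = four-count (two-odd-left pr qr p≢q p∤m q∤m {k} {l} g c a refl)
 outcome-two k l pr qr p≢q p∤m q∤m g c (even a) (odd b) = four-count (two-odd-right pr qr p≢q p∤m q∤m {k} {l} g c b refl)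
 outcome-two {p} {q} {m} {h} k l pr qr p≢q p∤m q∤m g c (even a) (even b) =
  decide (kronecker⁺ {p} {q} qr (not-2 {q} {D0} g0 qr q∣D0) (prime-≢⇒∤ qr pr q≢p)) (kronecker⁺ {q} {p} pr (not-2 {p} {D0} g0 pr p∣D0) (prime-≢⇒∤ pr qr p≢q))
  where
  D D0 : ℕ
  D = oddPower p (a + a) (oddPower q (b + b) (m * m))
  D0 = p * (q * (m * m))
  g0 : Good D0
  g0 = two-good pr qr p≢q p∤m q∤m {a + a} {b + b} g c
  p∣D0 : p ∣ D0
  p∣D0 = m∣m*n (q * (m * m))
  q∣D0 : q ∣ D0
  q∣D0 = ∣n⇒∣m*n p (m∣m*n (m * m))
  q≢p : q ≢ p
  q≢p e = p≢q (sym e)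
  swapped≡ : D ≡ oddPower q (b + b) (oddPower p (a + a) (m * m))
  swapped≡ = lem (p ^ (a + a)) p (q ^ (b + b)) q (m * m)
   where
   lem : ∀ t p s q x → t * t * (p * (s * s * (q * x))) ≡ s * s * (q * (t * t * (p * x)))
   lem = ring
  decide : Residue p q ⊎ kroneckerPrime p q ≡ -[1+ 0 ] → Residue q p ⊎ kroneckerPrime q p ≡ -[1+ 0 ] → Outcome D h
  decide (inj₂ e) _ = two-count (two-nonresidue pr qr p≢q p∤m q∤m {a + a} {b + b} g c a b refl refl (proj₁ (kronecker⁻ {p} {q} qr (not-2 {q} {D0} g0 qr q∣D0) e)))
   (p , q , a , b , m , pr , qr , e , coprime-product pr qr p∤m q∤m , sym (two-form≡ p q a b m))
  decide (inj₁ r) (inj₁ s) = four-count (two-residues pr qr p≢q p∤m q∤m {a + a} {b + b} g c r s)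
  decide (inj₁ _) (inj₂ e) = two-count (two-nonresidue qr pr q≢p q∤m p∤m {b + b} {a + a} (subst Good swapped≡ g) (subst (λ D → H D h) swapped≡ c) b a refl refl
    (proj₁ (kronecker⁻ {q} {p} pr (not-2 {p} {D0} g0 pr p∣D0) e)))
   (q , p , b , a , m , qr , pr , e , coprime-product qr pr q∤m p∤m , trans swapped≡ (sym (two-form≡ q p b a m)))

 outcome : ∀ {D h} → Shape D → Good D → H D h → Outcome D h
 outcome (square m) g c = ⊥-elim (square-mod-4 m (good-%4 {m * m} g))
 outcome (one {p} k m pr p∤m) g c = by-parity (parity k) g c
  where
  by-parity : ∀ {k h} → Parity k → Good (oddPower p k (m * m)) → H (oddPower p k (m * m)) h → Outcome (oddPower p k (m * m)) h
  by-parity (even a) g c = odd-count (one-even a pr p∤m g c) (p , a , m , pr , ∤⇒coprime pr p∤m , sym (one-form≡ p a m))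
  by-parity (odd a)  g c = four-count (one-odd a pr p∤m g c)
 outcome (two {p} {q} k l m pr qr p≢q p∤m q∤m) g c = outcome-two k l pr qr p≢q p∤m q∤m g c (parity k) (parity l)
 outcome (many k l j M pr qr rr p≢q p≢r q≢r p∤M q∤M r∤M) g c = four-count (many-primes k l j pr qr rr p≢q p≢r q≢r p∤M q∤M r∤M g c)

 one-form-odd : ∀ {D h} → Good D → H D h → OneForm D → h % 2 ≡ 1
 one-form-odd {D} {h} g c (p , a , m , pr , cop , D≡) = one-even a pr (coprime⇒∤ pr ∣-refl cop) (subst Good D≡' g) (subst (λ D → H D h) D≡' c)
  where
  D≡' : D ≡ oddPower p (a + a) (m * m)
  D≡' = trans D≡ (one-form≡ p a m)

 two-form-two : ∀ {D h} → Good D → H D h → TwoForm D → h % 4 ≡ 2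
 two-form-two {D} {h} g c (p , q , a , b , m , pr , qr , kr , cop , D≡) = finish (kronecker⁻ {p} {q} qr (not-2 {q} {D} g qr q∣D) kr)
  where
  D≡' : D ≡ oddPower p (a + a) (oddPower q (b + b) (m * m))
  D≡' = trans D≡ (two-form≡ p q a b m)
  q∣D : q ∣ D
  q∣D = subst (q ∣_) (sym D≡') (∣n⇒∣m*n (p ^ (a + a) * p ^ (a + a)) (∣n⇒∣m*n p (∣oddPower q (b + b) (m * m))))
  finish : ¬ Residue p q × ¬ q ∣ p → h % 4 ≡ 2
  finish (nr , q∤p) = two-nonresidue pr qr (λ e → q∤p (subst (_∣ p) e ∣-refl)) (coprime⇒∤ pr (m∣m*n q) cop) (coprime⇒∤ qr (divides p refl) cop) {a + a} {b + b}
   (subst Good D≡' g) (subst (λ D → H D h) D≡' c) a b refl refl nr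

 private
  Nσ-forms : ∀ n {D} → 12 * n ≡ D + 1 → Good D → ∃ λ h → H D h × (Nσ n % 2 ≡ h % 2) × (Nσ n % 4 ≡ 2 ⇔ h % 4 ≡ 2)
  Nσ-forms n {D} 12n g = finish (Nσ-class-number n) (amb-card D) (gen-card D)
   where
   finish : (∃ λ h → Card _ h × (Nσ n % 2 ≡ h % 2) × (Nσ n % 4 ≡ 2 ⇔ h % 4 ≡ 2)) → (∃ λ A → Card _ A) → (∃ λ G → Card _ G) → ∃ λ h → H D h × (Nσ n % 2 ≡ h % 2) × (Nσ n % 4 ≡ 2 ⇔ h % 4 ≡ 2)
   finish (h , c , e2 , e4) (A , cA) (G , cG) = h , subst (H D) (card-unique (rep'-card n 12n (good-4∤ {D} g) cA cG) (rep⇒rep' n 12n c)) (forms-card D (good-4∤ {D} g) cA cG) , e2 , e4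

  not-odd-even : ∀ {h} → h % 2 ≡ 1 → ¬ 2 ∣ h
  not-odd-even {h} e d = contra (trans (sym e) (n∣m⇒m%n≡0 h 2 d))
   where
   contra : 1 ≡ 0 → ⊥
   contra ()

  two⇒even : ∀ {h} → h % 4 ≡ 2 → 2 ∣ h
  two⇒even {h} e = divides (1 + h / 4 * 2) (trans (m≡m%n+[m/n]*n h 4) (trans (cong (_+ h / 4 * 4) e) (lem (h / 4))))
   where
   lem : ∀ q → 2 + q * 4 ≡ (1 + q * 2) * 2
   lem = ring

  not-two-four : ∀ {h} → h % 4 ≡ 2 → ¬ 4 ∣ h
  not-two-four {h} e d = contra (trans (sym e) (n∣m⇒m%n≡0 h 4 d))
   where
   contra : 2 ≡ 0 → ⊥
   contra ()

  odd⇒form : ∀ {D h} → Outcome D h → h % 2 ≡ 1 → OneForm D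
  odd⇒form (odd-count _ f) _  = f
  odd⇒form {h = h} (two-count e _) e2 = ⊥-elim (not-odd-even {h} e2 (two⇒even {h} e))
  odd⇒form {h = h} (four-count d) e2 = ⊥-elim (not-odd-even {h} e2 (∣-trans (divides 2 refl) d))

  two⇒form : ∀ {D h} → Outcome D h → h % 4 ≡ 2 → TwoForm D
  two⇒form {h = h} (odd-count e _) e4 = ⊥-elim (not-odd-even {h} e (two⇒even {h} e4))
  two⇒form (two-count _ f) _  = f
  two⇒form {h = h} (four-count d) e4 = ⊥-elim (not-two-four {h} e4 d)

 characterisation : ∀ n {D} → 12 * n ≡ D + 1 → Good D → ((Nσ n % 2 ≡ 1) ⇔ OneForm D) × ((Nσ n % 4 ≡ 2) ⇔ TwoForm D)
 characterisation n {D} 12n g = finish (Nσ-forms n 12n g)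
  where
  finish : (∃ λ h → H D h × (Nσ n % 2 ≡ h % 2) × (Nσ n % 4 ≡ 2 ⇔ h % 4 ≡ 2)) → ((Nσ n % 2 ≡ 1) ⇔ OneForm D) × ((Nσ n % 4 ≡ 2) ⇔ TwoForm D)
  finish (h , c , e2 , e4) =
   mk⇔ (λ odd → odd⇒form (outcome (shape D (good⇒positive {D} g)) g c) (trans (sym e2) odd)) (λ f → trans e2 (one-form-odd g c f)) ,
   mk⇔ (λ two → two⇒form (outcome (shape D (good⇒positive {D} g)) g c) (Equivalence.to e4 two)) (λ f → Equivalence.from e4 (two-form-two g c f))

 12n-1-good : ∀ n → 0 < n → 12 * n ≡ 12 * n ∸ 1 + 1 × Good (12 * n ∸ 1)
 12n-1-good (suc n) _ = e , trans (cong (_% 12) (+-cancelʳ-≡ 1 (12 * suc n ∸ 1) (11 + n * 12) (trans (sym e) (lem n)))) ([m+kn]%n≡m%n 11 n 12)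
  where
  e : 12 * suc n ≡ 12 * suc n ∸ 1 + 1
  e = sym (m∸n+n≡m (s≤s z≤n))
  lem : ∀ n → 12 * suc n ≡ 11 + n * 12 + 1
  lem = ring

 characterisation-12n-1 : ∀ n → 0 < n → ((Nσ n % 2 ≡ 1) ⇔ OneForm (12 * n ∸ 1)) × ((Nσ n % 4 ≡ 2) ⇔ TwoForm (12 * n ∸ 1))
 characterisation-12n-1 n 0<n = characterisation n (proj₁ (12n-1-good n 0<n)) (proj₂ (12n-1-good n 0<n))


open import Defs
open import Data.Nat using (ℕ; _+_; _*_; _∸_; _^_; _<_; _%_)
open import Data.Nat.Primality using (Prime)
open import Data.Nat.Coprimality using (Coprime)
open import Data.Integer using (-[1+_])
open import Data.Product using (Σ; _×_)
open import Function.Bundles using (_⇔_)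
open import Relation.Binary.PropositionalEquality using (_≡_)

theorem3p12 : (n : ℕ) → 0 < n →
    ((Nσ n % 2 ≡ 1) ⇔
      Σ ℕ (λ p → Σ ℕ (λ a → Σ ℕ (λ m →
        Prime p × Coprime m p × (12 * n ∸ 1 ≡ p ^ (4 * a + 1) * m ^ 2)))))
    ×
    ((Nσ n % 4 ≡ 2) ⇔
      Σ ℕ (λ p₁ → Σ ℕ (λ p₂ → Σ ℕ (λ a → Σ ℕ (λ b → Σ ℕ (λ m →
        Prime p₁ × Prime p₂ × kroneckerPrime p₁ p₂ ≡ -[1+ 0 ] ×
        Coprime m (p₁ * p₂) ×
        (12 * n ∸ 1 ≡ p₁ ^ (4 * a + 1) * p₂ ^ (4 * b + 1) * m ^ 2)))))))
theorem3p12 n 0<n = Final.characterisation-12n-1 n 0<n
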